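{- Let $r$ be a positive integer with $r\not\equiv 0\pmod 3$. Then there are infinitely many fields $K\in\mathfrak{F}$ (pairwise non-isomorphic) whose ideal class group contains an ideal class of order $r$.
   Context: For an integer $n$ let $f_n(X)=X^3+nX^2+nX-1$. For odd $n\ge5$, $f_n$ is irreducible over $\mathbb{Q}$ with three real roots and Galois group $S_3$; let $K_n=\mathbb{Q}(\rho)$ with $\rho$ a root of $f_n$ (a non-Galois real cubic field). Let $\mathfrak{F}=\{K_n: n \text{ an odd integer}\ge 5\}$. -}

module Defs where

open import Level using (0ℓ)
open import Data.Nat as ℕ using (ℕ; zero; suc)
open import Data.Integer as ℤ using (ℤ; +_)
open import Data.Rational as ℚ using (ℚ; 0ℚ; 1ℚ)
open import Data.List using (List; []; _∷_)
open import Data.Product using (Σ; ∃; _×_; _,_)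
open import Relation.Binary.PropositionalEquality using (_≡_; _≢_)
open import Relation.Nullary using (¬_)

-- The cubic field K_n = ℚ[X]/(f_n),  f_n(X) = X^3 + n X^2 + n X - 1.
-- An element (a₀ , a₁ , a₂) represents a₀ + a₁ ρ + a₂ ρ², ρ = class of X.
-- (ℚ is the normalised rationals, so _≡_ is the right equality.)

K : Set
K = ℚ × ℚ × ℚ

nℚ : ℕ → ℚ
nℚ n = + n ℚ./ 1

0K : K
0K = 0ℚ , 0ℚ , 0ℚ

1K : K
1K = 1ℚ , 0ℚ , 0ℚ

ρK : K
ρK = 0ℚ , 1ℚ , 0ℚ

ιℚ : ℚ → K
ιℚ q = q , 0ℚ , 0ℚ

_+K_ : K → K → K
(a₀ , a₁ , a₂) +K (b₀ , b₁ , b₂) = a₀ ℚ.+ b₀ , a₁ ℚ.+ b₁ , a₂ ℚ.+ b₂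

_·K_ : ℚ → K → K
q ·K (b₀ , b₁ , b₂) = q ℚ.* b₀ , q ℚ.* b₁ , q ℚ.* b₂

-- multiplication by ρ in K_n, using ρ³ = 1 - n ρ - n ρ²
mulρ : ℕ → K → K
mulρ n (x₀ , x₁ , x₂) = x₂ , x₀ ℚ.- nℚ n ℚ.* x₂ , x₁ ℚ.- nℚ n ℚ.* x₂

mulK : ℕ → K → K → K
mulK n (a₀ , a₁ , a₂) b =
  (a₀ ·K b) +K ((a₁ ·K mulρ n b) +K (a₂ ·K mulρ n (mulρ n b)))

powK : ℕ → K → ℕ → K
powK n α zero    = 1K
powK n α (suc k) = mulK n α (powK n α k)

-- Ring of integers O_{K_n}: elements that are roots of a monic
-- polynomial with integer coefficients.  A list cs = c₀ ∷ c₁ ∷ … ∷ c_{d-1}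
-- stands for the monic polynomial X^d + c_{d-1} X^{d-1} + … + c₀.

ℤtoℚ : ℤ → ℚ
ℤtoℚ z = z ℚ./ 1

evalFrom : ℕ → K → ℕ → List ℤ → K
evalFrom n α k []       = 0K
evalFrom n α k (c ∷ cs) = (ℤtoℚ c ·K powK n α k) +K evalFrom n α (suc k) cs

len : List ℤ → ℕ
len []       = zero
len (_ ∷ cs) = suc (len cs)

evalMonic : ℕ → List ℤ → K → K
evalMonic n cs α = powK n α (len cs) +K evalFrom n α 0 cs

IsIntegral : ℕ → K → Set
IsIntegral n α = ∃ λ (cs : List ℤ) → evalMonic n cs α ≡ 0K

record IsIdeal (n : ℕ) (I : K → Set) : Set where
  field
    ⊆O       : ∀ {x} → I x → IsIntegral n x
    zero∈    : I 0K
    +-closed : ∀ {x y} → I x → I y → I (x +K y)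
    O-absorb : ∀ {a x} → IsIntegral n a → I x → I (mulK n a x)
    nonzero  : ∃ λ x → I x × x ≢ 0K

data Prod (n : ℕ) (I J : K → Set) : K → Set where
  pzero : Prod n I J 0K
  pstep : ∀ {a b x} → I a → J b → Prod n I J x → Prod n I J (mulK n a b +K x)

IdealPow : ℕ → (K → Set) → ℕ → (K → Set)
IdealPow n I zero    = IsIntegral n
IdealPow n I (suc k) = Prod n I (IdealPow n I k)

IsPrincipal : ℕ → (K → Set) → Set
IsPrincipal n I =
  ∃ λ α → IsIntegral n α ×
    (∀ x → (I x → ∃ λ β → IsIntegral n β × x ≡ mulK n α β)
         × ((∃ λ β → IsIntegral n β × x ≡ mulK n α β) → I x))

HasClassOfOrder : ℕ → ℕ → Set₁
HasClassOfOrder n r =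
  ∃ λ (I : K → Set) → IsIdeal n I
    × IsPrincipal n (IdealPow n I r)
    × (∀ k → 1 ℕ.≤ k → k ℕ.< r → ¬ IsPrincipal n (IdealPow n I k))

record FieldIso (n m : ℕ) : Set where
  field
    to      : K → K
    from    : K → K
    from∘to : ∀ x → from (to x) ≡ x
    to∘from : ∀ y → to (from y) ≡ y
    to-1    : to 1K ≡ 1K
    to-+    : ∀ x y → to (x +K y) ≡ to x +K to y
    to-*    : ∀ x y → to (mulK n x y) ≡ mulK m (to x) (to y)

InFamily : ℕ → Set
InFamily n = (n ℕ.% 2 ≡ 1) × (5 ℕ.≤ n)

{-# OPTIONS --safe #-}
-- Let α = z + (z + 1) ρ with N α = z³ + (z + 1)³ + n z (z + 1) = tʳ. When α and its cofactor α ♯ are comaximal, the ideal (t , α) has r-th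
-- power (α). If a smaller power were principal, some relation α^k = β^r u with a unit u and 0 < k < r would hold. Any unit is multiplicatively
-- dependent on ρ and η = (1 + ρ)³ / 2 (pigeonhole, after a descent on tr (x²) by units), so for some prime p ∣ r one gets α^d ρ^i η^j = ± v^p with
-- d, i, j not all divisible by p. This is excluded by reducing at degree one primes: modulo a prime divisor of z, α becomes ρ, and modulo a prime
-- divisor of z + 1 it becomes -1, and n can be prescribed so that ρ^i η^j reduces there to a p-th power non-residue.
-- Fields are told apart by D n = n⁴ - 18 n² - 27: an isomorphism makes D n · D n′ a square, but congruences on n force D n to have as a unitary
-- divisor a non-square prime to D n′.
module Submission where

open import Defs
open import Level using (0ℓ)
open import Data.Nat as ℕ using (ℕ; zero; suc; _≤_; _%_)
open import Data.Integer as ℤ using (ℤ; +_; -[1+_])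
open import Data.Rational as ℚ using (ℚ; 0ℚ; 1ℚ)
import Data.Rational.Unnormalised as ℚᵘ
import Data.Rational.Unnormalised.Properties as ℚᵘP
import Data.Nat.Properties as ℕP
import Data.Nat.Divisibility as ℕD
import Data.Nat.DivMod as ℕDM
import Data.Nat.Primality as Prim
import Data.Nat.Primality.Factorisation as Fact
import Data.List.Relation.Unary.All as All
import Data.Nat.Coprimality as Cop
import Data.Nat.GCD as GCD
import Data.Integer.Properties as ℤP
import Data.Integer.DivMod as ℤM
import Data.Integer.Divisibility.Signed as ℤD
import Data.Rational.Properties as ℚP
import Data.Sign as Sign
import Data.Fin as Fin
open import Data.Fin using (Fin; #_)
import Data.Fin.Properties as FinP
open import Data.Vec using (Vec; []; _∷_)
open import Data.List as List using (List)
open import Data.Maybe using (Maybe; just; nothing)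
open import Data.Sum using (_⊎_; inj₁; inj₂; [_,_]′)
open import Data.Product using (Σ; ∃; ∃₂; _×_; _,_; proj₁; proj₂)
open import Data.Empty using (⊥; ⊥-elim)
open import Data.Unit using (tt)
open import Function using (_∘_; id)
open import Relation.Nullary using (¬_; Dec; yes; no)
open import Relation.Nullary.Decidable using (True; toWitness; ¬?; _×-dec_)
open import Relation.Binary.PropositionalEquality hiding (J)
open import Algebra.Bundles using (CommutativeRing)
open import Algebra.Structures using (IsCommutativeRing)
import Algebra.Solver.Ring
import Algebra.Solver.Ring.AlmostCommutativeRing as ACR
open import Relation.Binary.Definitions using (Tri; tri<; tri≈; tri>)

-- Ring solver with integer coefficients

-- Real embeddings, the maximal order and the unit group are each replaced by something weaker.
-- Conjugates become evaluations at rational points near the real roots of f_n, with errors bounded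
-- by a multiple of |f_n|. Integrality is tested by bounded denominators of powers. Of a unit it is
-- only shown that some power lies in the group generated by ρ and η; common factors p of the
-- exponents then cancel, since a totally real field has no roots of unity but ± 1. The norm
-- equation is linear in n, so z and t are at our disposal. Modulo z + 1 it reads tʳ ≡ - 1 ≡ z,
-- which is why z is taken to be an r-th power Zʳ. Primes dividing z + 1 see only the exponents i
-- and j, and those dividing z then see d. The condition 3 ∤ r comes from the cube in η: passing to
-- another root modulo q changes ρ^b η^c by a power of g with exponent 2 b + 3 c or b - 3 c up to
-- sign, and p divides both only if it divides b and c, provided p ≠ 3. It also lets every D n be
-- kept prime to 3, the only prime that x and D (x²) can share.

module IntCoeff {R : Set} {_+_ _*_ : R → R → R} { -_ : R → R} {0# 1# : R}
  (isCR : IsCommutativeRing _≡_ _+_ _*_ -_ 0# 1#) where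

  private
    infixl 6 _⊕_
    infixl 7 _⊗_
    _⊕_ = _+_
    _⊗_ = _*_
    bundle : CommutativeRing 0ℓ 0ℓ
    bundle = record { isCommutativeRing = isCR }
  open IsCommutativeRing isCR hiding (refl; sym; trans; reflexive; setoid)
  open import Algebra.Properties.Ring (CommutativeRing.ring bundle)
  open import Algebra.Properties.AbelianGroup (CommutativeRing.+-abelianGroup bundle) using (⁻¹-∙-comm)
  open ≡-Reasoning

  -- The separate clause for 1 makes `con (+ 1)` denote `1#` itself, and 2 and 3 denote 1 + 1 and 1
  -- + (1 + 1), the very forms of `2#` and `3#` in `RawCubic`.
  fromℕ : ℕ → R
  fromℕ zero = 0#
  fromℕ (suc zero) = 1#
  fromℕ (suc (suc n)) = 1# ⊕ fromℕ (suc n)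

  fromℤ : ℤ → R
  fromℤ (+ n) = fromℕ n
  fromℤ -[1+ n ] = - fromℕ (suc n)

  fromℕ-suc : ∀ n → fromℕ (suc n) ≡ 1# ⊕ fromℕ n
  fromℕ-suc zero = sym (+-identityʳ 1#)
  fromℕ-suc (suc n) = refl

  fromℕ-+ : ∀ m n → fromℕ (m ℕ.+ n) ≡ fromℕ m ⊕ fromℕ n
  fromℕ-+ zero n = sym (+-identityˡ _)
  fromℕ-+ (suc m) n = begin
    fromℕ (suc (m ℕ.+ n))      ≡⟨ fromℕ-suc (m ℕ.+ n) ⟩
    1# ⊕ fromℕ (m ℕ.+ n)       ≡⟨ cong (1# ⊕_) (fromℕ-+ m n) ⟩
    1# ⊕ (fromℕ m ⊕ fromℕ n)   ≡⟨ sym (+-assoc _ _ _) ⟩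
    1# ⊕ fromℕ m ⊕ fromℕ n     ≡⟨ cong (_⊕ fromℕ n) (sym (fromℕ-suc m)) ⟩
    fromℕ (suc m) ⊕ fromℕ n ∎

  fromℕ-* : ∀ m n → fromℕ (m ℕ.* n) ≡ fromℕ m ⊗ fromℕ n
  fromℕ-* zero n = sym (zeroˡ _)
  fromℕ-* (suc m) n = begin
    fromℕ (n ℕ.+ m ℕ.* n)            ≡⟨ fromℕ-+ n (m ℕ.* n) ⟩
    fromℕ n ⊕ fromℕ (m ℕ.* n)        ≡⟨ cong₂ _⊕_ (sym (*-identityˡ _)) (fromℕ-* m n) ⟩
    1# ⊗ fromℕ n ⊕ fromℕ m ⊗ fromℕ n ≡⟨ sym (distribʳ _ _ _) ⟩
    (1# ⊕ fromℕ m) ⊗ fromℕ n         ≡⟨ cong (_⊗ fromℕ n) (sym (fromℕ-suc m)) ⟩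
    fromℕ (suc m) ⊗ fromℕ n ∎

  fromℤ-⊖ : ∀ m n → fromℤ (m ℤ.⊖ n) ≡ fromℕ m ⊕ - fromℕ n
  fromℤ-⊖ m zero = sym (trans (cong (fromℕ m ⊕_) -0#≈0#) (+-identityʳ _))
  fromℤ-⊖ zero (suc n) = sym (+-identityˡ _)
  fromℤ-⊖ (suc m) (suc n) = begin
    fromℤ (suc m ℤ.⊖ suc n)          ≡⟨ cong fromℤ (ℤP.[1+m]⊖[1+n]≡m⊖n m n) ⟩
    fromℤ (m ℤ.⊖ n)                  ≡⟨ fromℤ-⊖ m n ⟩
    a ⊕ - b                          ≡⟨ cong (_⊕ - b) (sym (trans (cong (_⊕ a) (-‿inverseʳ 1#)) (+-identityˡ a))) ⟩
    1# ⊕ - 1# ⊕ a ⊕ - b              ≡⟨ cong (_⊕ - b) (trans (+-assoc _ _ _) (trans (cong (1# ⊕_) (+-comm _ _)) (sym (+-assoc _ _ _)))) ⟩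
    1# ⊕ a ⊕ - 1# ⊕ - b              ≡⟨ +-assoc _ _ _ ⟩
    1# ⊕ a ⊕ (- 1# ⊕ - b)            ≡⟨ cong (1# ⊕ a ⊕_) (⁻¹-∙-comm 1# b) ⟩
    1# ⊕ a ⊕ - (1# ⊕ b)              ≡⟨ cong₂ (λ u v → u ⊕ - v) (sym (fromℕ-suc m)) (sym (fromℕ-suc n)) ⟩
    fromℕ (suc m) ⊕ - fromℕ (suc n) ∎
    where a = fromℕ m
          b = fromℕ n

  fromℤ-+ : ∀ i j → fromℤ (i ℤ.+ j) ≡ fromℤ i ⊕ fromℤ j
  fromℤ-+ (+ m) (+ n) = fromℕ-+ m n
  fromℤ-+ (+ m) -[1+ n ] = fromℤ-⊖ m (suc n)
  fromℤ-+ -[1+ m ] (+ n) = trans (fromℤ-⊖ n (suc m)) (+-comm _ _)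
  fromℤ-+ -[1+ m ] -[1+ n ] = trans (cong -_ (trans (cong fromℕ (cong suc (sym (ℕP.+-suc m n)))) (fromℕ-+ (suc m) (suc n)))) (sym (⁻¹-∙-comm _ _))

  fromℤ-neg : ∀ i → fromℤ (ℤ.- i) ≡ - fromℤ i
  fromℤ-neg (+ zero) = sym -0#≈0#
  fromℤ-neg (+ suc n) = refl
  fromℤ-neg -[1+ n ] = sym (-‿involutive _)

  fromℤ-◃- : ∀ n → fromℤ (Sign.- ℤ.◃ n) ≡ - fromℕ n
  fromℤ-◃- zero = sym -0#≈0#
  fromℤ-◃- (suc n) = refl

  fromℤ-* : ∀ i j → fromℤ (i ℤ.* j) ≡ fromℤ i ⊗ fromℤ j
  fromℤ-* (+ m) (+ n) = trans (cong fromℤ (ℤP.+◃n≡+n (m ℕ.* n))) (fromℕ-* m n)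
  fromℤ-* (+ m) -[1+ n ] = trans (fromℤ-◃- (m ℕ.* suc n)) (trans (cong -_ (fromℕ-* m (suc n))) (-‿distribʳ-* _ _))
  fromℤ-* -[1+ m ] (+ n) = trans (fromℤ-◃- (suc m ℕ.* n)) (trans (cong -_ (fromℕ-* (suc m) n)) (-‿distribˡ-* _ _))
  fromℤ-* -[1+ m ] -[1+ n ] = begin
    fromℕ (suc m ℕ.* suc n)     ≡⟨ fromℕ-* (suc m) (suc n) ⟩
    a ⊗ b                       ≡⟨ sym (-‿involutive _) ⟩
    - (- (a ⊗ b))               ≡⟨ cong -_ (-‿distribʳ-* a b) ⟩
    - (a ⊗ - b)                 ≡⟨ -‿distribˡ-* a (- b) ⟩
    - a ⊗ - b ∎
    where a = fromℕ (suc m)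
          b = fromℕ (suc n)

  private
    decℤ : ∀ x y → Maybe (fromℤ x ≡ fromℤ y)
    decℤ x y with x ℤ.≟ y
    ... | yes p = just (cong fromℤ p)
    ... | no _ = nothing

    coefficients : ℤ.+-*-rawRing ACR.-Raw-AlmostCommutative⟶ ACR.fromCommutativeRing bundle
    coefficients = record { ⟦_⟧ = fromℤ ; +-homo = fromℤ-+ ; *-homo = fromℤ-* ; -‿homo = fromℤ-neg ; 0-homo = refl ; 1-homo = refl }

  module Solver = Algebra.Solver.Ring ℤ.+-*-rawRing (ACR.fromCommutativeRing bundle) coefficients decℤ

  open import Algebra.Properties.CommutativeSemiring.Exp (CommutativeRing.commutativeSemiring bundle) public
    using (_^_; ^-homo-*; ^-assocʳ; ^-distrib-*)

  1^ : ∀ k → 1# ^ k ≡ 1#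
  1^ zero = refl
  1^ (suc k) = trans (*-identityˡ _) (1^ k)

-- The cubic algebra of X³ + n X² + n X - 1

module RawCubic {R : Set} (_+_ _*_ : R → R → R) (-_ : R → R) (0# 1# : R) where

  infixl 6 _⊕_ _⊖_
  infixl 7 _⊗_
  _⊕_ _⊗_ _⊖_ : R → R → R
  _⊕_ = _+_
  _⊗_ = _*_
  x ⊖ y = x + (- y)

  2# 3# : R
  2# = 1# ⊕ 1#
  3# = 1# ⊕ 2#

  A : Set
  A = R × R × R

  0A 1A ρ : A
  0A = 0# , 0# , 0#
  1A = 1# , 0# , 0#
  ρ  = 0# , 1# , 0#

  ι : R → A
  ι a = a , 0# , 0#

  add : A → A → A
  add (a₀ , a₁ , a₂) (b₀ , b₁ , b₂) = a₀ ⊕ b₀ , a₁ ⊕ b₁ , a₂ ⊕ b₂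

  neg : A → A
  neg (a₀ , a₁ , a₂) = - a₀ , - a₁ , - a₂

  scale : R → A → A
  scale q (b₀ , b₁ , b₂) = q ⊗ b₀ , q ⊗ b₁ , q ⊗ b₂

  module _ (n : R) where

    shift : A → A
    shift (x₀ , x₁ , x₂) = x₂ , x₀ ⊖ n ⊗ x₂ , x₁ ⊖ n ⊗ x₂

    mul : A → A → A
    mul (a₀ , a₁ , a₂) b =
      add (scale a₀ b) (add (scale a₁ (shift b)) (scale a₂ (shift (shift b))))

    f f′ : R → R
    f t = t ⊗ t ⊗ t ⊕ n ⊗ t ⊗ t ⊕ n ⊗ t ⊖ 1#
    f′ t = 3# ⊗ t ⊗ t ⊕ 2# ⊗ n ⊗ t ⊕ n

    ev : R → A → R
    ev t (x₀ , x₁ , x₂) = x₀ ⊕ x₁ ⊗ t ⊕ x₂ ⊗ (t ⊗ t)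

    tr : A → R
    tr (x₀ , x₁ , x₂) = 3# ⊗ x₀ ⊖ n ⊗ x₁ ⊕ (n ⊗ n ⊖ 2# ⊗ n) ⊗ x₂

    -- The product of the other two conjugates: x · (x ♯) is the norm.
    _♯ : A → A
    (x₀ , x₁ , x₂) ♯ =
        x₀ ⊗ x₀ ⊖ n ⊗ x₀ ⊗ x₁ ⊕ (n ⊗ n ⊖ 2# ⊗ n) ⊗ x₀ ⊗ x₂ ⊕ n ⊗ x₁ ⊗ x₁ ⊕ (- 1# ⊖ n ⊗ n) ⊗ x₁ ⊗ x₂ ⊕ (n ⊗ n ⊕ n) ⊗ x₂ ⊗ x₂
      , - (x₀ ⊗ x₁) ⊕ n ⊗ x₁ ⊗ x₁ ⊖ n ⊗ n ⊗ x₁ ⊗ x₂ ⊕ (n ⊗ n ⊕ 1#) ⊗ x₂ ⊗ x₂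
      , x₁ ⊗ x₁ ⊖ x₀ ⊗ x₂ ⊖ n ⊗ x₁ ⊗ x₂ ⊕ n ⊗ x₂ ⊗ x₂

    N e₂ : A → R
    N x = proj₁ (mul x (x ♯))
    e₂ x = tr (x ♯)

    -- The quotient of a(X) b(X) - (a · b)(X) by f, evaluated at t: it measures how far `ev t` is
    -- from being multiplicative when t is not a root.
    quot : R → A → A → R
    quot t (a₀ , a₁ , a₂) (b₀ , b₁ , b₂) = a₂ ⊗ b₂ ⊗ (t ⊖ n) ⊕ (a₁ ⊗ b₂ ⊕ a₂ ⊗ b₁)

    -- f = (X - t) · (cofactor of t) + f t
    cofactor : R → A
    cofactor t = t ⊗ t ⊕ n ⊗ t ⊕ n , n ⊕ t , 1#

    -- D is the discriminant of f. The other two come from completing the square in 3 tr (x²) - (tr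
    -- x)², a binary quadratic form in x₁ and x₂ with leading coefficient α; see `tr-form`.
    α β D : R
    α = 2# ⊗ n ⊗ n ⊖ 2# ⊗ 3# ⊗ n
    β = - (2# ⊗ n ⊗ n ⊗ n) ⊕ (1# ⊕ 2# ⊗ 3#) ⊗ n ⊗ n ⊕ 3# ⊗ 3#
    D = n ⊗ n ⊗ n ⊗ n ⊖ 2# ⊗ 3# ⊗ 3# ⊗ n ⊗ n ⊖ 3# ⊗ 3# ⊗ 3#

    κ : A
    κ = 1# , 1# , 0#

    -- The index form: the determinant of 1, x, x² in the basis 1, ρ, ρ², so that the discriminant
    -- of x is its square times D.
    index : A → R
    index x@(_ , x₁ , x₂) with mul x x
    ... | (_ , y₁ , y₂) = x₁ ⊗ y₂ ⊖ x₂ ⊗ y₁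

  -- Discriminant of X³ - T X² + S X - M.
  disc : R → R → R → R
  disc T S M = T ⊗ T ⊗ S ⊗ S ⊖ 2# ⊗ 2# ⊗ S ⊗ S ⊗ S ⊖ 2# ⊗ 2# ⊗ T ⊗ T ⊗ T ⊗ M ⊖ 3# ⊗ 3# ⊗ 3# ⊗ M ⊗ M ⊕ 2# ⊗ 3# ⊗ 3# ⊗ T ⊗ S ⊗ M

module Cubic {R : Set} {_+_ _*_ : R → R → R} { -_ : R → R} {0# 1# : R}
  (isCR : IsCommutativeRing _≡_ _+_ _*_ -_ 0# 1#) (n : R) where

  open IntCoeff isCR using (module Solver)
  open Solver using (Polynomial; _:+_; _:*_; :-_; con; var; ⟦_⟧; ⟦_⟧↓; prove)
  private
    module R = RawCubic _+_ _*_ -_ 0# 1#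
    -- The same formulas read over the solver's syntax, in the twelve variables of `env`: n, two
    -- scalars and the coordinates of three elements. Each identity is then proved by normalising
    -- its two syntactic sides.
    module S = RawCubic {Polynomial 12} _:+_ _:*_ :-_ (con (+ 0)) (con (+ 1))
  open R public using (A; 0A; 1A; ρ; ι; add; neg; scale; _⊕_; _⊗_; _⊖_; 2#; 3#)

  infixl 7 _·_
  _·_ : A → A → A
  _·_ = R.mul n

  f f′ : R → R
  f = R.f n
  f′ = R.f′ n

  ev : R → A → R
  ev = R.ev n

  tr N e₂ : A → R
  tr = R.tr n
  N = R.N n
  e₂ = R.e₂ n

  _♯ : A → A
  _♯ = R._♯ n

  ≡A : {a b : A} → proj₁ a ≡ proj₁ b → proj₁ (proj₂ a) ≡ proj₁ (proj₂ b) → proj₂ (proj₂ a) ≡ proj₂ (proj₂ b) → a ≡ b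
  ≡A refl refl refl = refl

  private
    νn νs νt : Polynomial 12
    νn = var (# 0)
    νs = var (# 1)
    νt = var (# 2)
    νa νb νc : S.A
    νa = var (# 3) , var (# 4) , var (# 5)
    νb = var (# 6) , var (# 7) , var (# 8)
    νc = var (# 9) , var (# 10) , var (# 11)

    env : (s t : R) (a b c : A) → Vec R 12
    env s t (a₀ , a₁ , a₂) (b₀ , b₁ , b₂) (c₀ , c₁ , c₂) = n ∷ s ∷ t ∷ a₀ ∷ a₁ ∷ a₂ ∷ b₀ ∷ b₁ ∷ b₂ ∷ c₀ ∷ c₁ ∷ c₂ ∷ []

    ⟦_⟧A ⟦_⟧A↓ : S.A → Vec R 12 → A
    ⟦ x , y , z ⟧A e = ⟦ x ⟧ e , ⟦ y ⟧ e , ⟦ z ⟧ e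
    ⟦ x , y , z ⟧A↓ e = ⟦ x ⟧↓ e , ⟦ y ⟧↓ e , ⟦ z ⟧↓ e

    proveA : ∀ e (l r : S.A) → ⟦ l ⟧A↓ e ≡ ⟦ r ⟧A↓ e → ⟦ l ⟧A e ≡ ⟦ r ⟧A e
    proveA e (x , y , z) (x′ , y′ , z′) p =
      ≡A (prove e x x′ (cong proj₁ p)) (prove e y y′ (cong (λ q → proj₁ (proj₂ q)) p)) (prove e z z′ (cong (λ q → proj₂ (proj₂ q)) p))

    infixl 7 _*ₛ_
    _*ₛ_ = S.mul νn

  mul-comm : ∀ a b → a · b ≡ b · a
  mul-comm a b = proveA (env n n a b b) (νa *ₛ νb) (νb *ₛ νa) refl

  mul-assoc : ∀ a b c → (a · b) · c ≡ a · (b · c)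
  mul-assoc a b c = proveA (env n n a b c) (νa *ₛ νb *ₛ νc) (νa *ₛ (νb *ₛ νc)) refl

  mul-identityˡ : ∀ a → 1A · a ≡ a
  mul-identityˡ a = proveA (env n n a a a) (S.1A *ₛ νa) νa refl

  mul-distribˡ : ∀ a b c → a · add b c ≡ add (a · b) (a · c)
  mul-distribˡ a b c = proveA (env n n a b c) (νa *ₛ S.add νb νc) (S.add (νa *ₛ νb) (νa *ₛ νc)) refl

  add-assoc : ∀ a b c → add (add a b) c ≡ add a (add b c)
  add-assoc a b c = proveA (env n n a b c) (S.add (S.add νa νb) νc) (S.add νa (S.add νb νc)) refl

  add-comm : ∀ a b → add a b ≡ add b a
  add-comm a b = proveA (env n n a b b) (S.add νa νb) (S.add νb νa) refl

  add-identityˡ : ∀ a → add 0A a ≡ a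
  add-identityˡ a = proveA (env n n a a a) (S.add S.0A νa) νa refl

  add-inverseˡ : ∀ a → add (neg a) a ≡ 0A
  add-inverseˡ a = proveA (env n n a a a) (S.add (S.neg νa) νa) S.0A refl

  isCommutativeRing : IsCommutativeRing _≡_ add _·_ neg 0A 1A
  isCommutativeRing = record
    { isRing = record
      { +-isAbelianGroup = record
        { isGroup = record
          { isMonoid = record
            { isSemigroup = record { isMagma = record { isEquivalence = isEquivalence ; ∙-cong = cong₂ add } ; assoc = add-assoc }
            ; identity = add-identityˡ , λ a → trans (add-comm a 0A) (add-identityˡ a)
            }
          ; inverse = add-inverseˡ , λ a → trans (add-comm a (neg a)) (add-inverseˡ a)
          ; ⁻¹-cong = cong neg
          }
        ; comm = add-comm
        }
      ; *-cong = cong₂ _·_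
      ; *-assoc = mul-assoc
      ; *-identity = mul-identityˡ , λ a → trans (mul-comm a 1A) (mul-identityˡ a)
      ; distrib = mul-distribˡ , λ a b c → trans (mul-comm (add b c) a) (trans (mul-distribˡ a b c) (cong₂ add (mul-comm a b) (mul-comm a c)))
      }
    ; *-comm = mul-comm
    }

  ι-mul : ∀ s t → ι (s ⊗ t) ≡ ι s · ι t
  ι-mul s t = proveA (env s t 0A 0A 0A) (S.ι (νs :* νt)) (S.ι νs *ₛ S.ι νt) refl

  ι-add : ∀ s t → ι (s ⊕ t) ≡ add (ι s) (ι t)
  ι-add s t = proveA (env s t 0A 0A 0A) (S.ι (νs :+ νt)) (S.add (S.ι νs) (S.ι νt)) refl

  scale-ι : ∀ s a → scale s a ≡ ι s · a
  scale-ι s a = proveA (env s n a a a) (S.scale νs νa) (S.ι νs *ₛ νa) refl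

  mul-♯ : ∀ a → a · (a ♯) ≡ ι (N a)
  mul-♯ a = proveA (env n n a a a) (νa *ₛ S._♯ νn νa) (S.ι (S.N νn νa)) refl

  ♯-mul : ∀ a b → (a · b) ♯ ≡ (a ♯) · (b ♯)
  ♯-mul a b = proveA (env n n a b b) (S._♯ νn (νa *ₛ νb)) (S._♯ νn νa *ₛ S._♯ νn νb) refl

  N-ι : ∀ s → N (ι s) ≡ s ⊗ s ⊗ s
  N-ι s = prove (env s s 0A 0A 0A) (S.N νn (S.ι νs)) (νs :* νs :* νs) refl

  N-add-ι : ∀ a s → N (add a (ι s)) ≡ N a ⊕ e₂ a ⊗ s ⊕ tr a ⊗ s ⊗ s ⊕ s ⊗ s ⊗ s
  N-add-ι a s = prove (env s s a a a) (S.N νn (S.add νa (S.ι νs))) (S.N νn νa :+ S.e₂ νn νa :* νs :+ S.tr νn νa :* νs :* νs :+ νs :* νs :* νs) refl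

  tr-square : ∀ a → tr (a · a) ⊕ 2# ⊗ e₂ a ≡ tr a ⊗ tr a
  tr-square a = prove (env n n a a a) (S.tr νn (νa *ₛ νa) :+ S.2# :* S.e₂ νn νa) (S.tr νn νa :* S.tr νn νa) refl

  cayley-hamilton : ∀ a → add (a · a · a) (scale (e₂ a) a) ≡ add (scale (tr a) (a · a)) (ι (N a))
  cayley-hamilton a = proveA (env n n a a a) (S.add (νa *ₛ νa *ₛ νa) (S.scale (S.e₂ νn νa) νa)) (S.add (S.scale (S.tr νn νa) (νa *ₛ νa)) (S.ι (S.N νn νa))) refl

  newton : ∀ a → 2# ⊗ 3# ⊗ N a ⊕ 3# ⊗ tr a ⊗ tr (a · a) ≡ tr a ⊗ tr a ⊗ tr a ⊕ 2# ⊗ tr (a · a · a)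
  newton a = prove (env n n a a a) (S.2# :* S.3# :* S.N νn νa :+ S.3# :* S.tr νn νa :* S.tr νn (νa *ₛ νa))
     (S.tr νn νa :* S.tr νn νa :* S.tr νn νa :+ S.2# :* S.tr νn (νa *ₛ νa *ₛ νa)) refl

  tr-add : ∀ a b → tr (add a b) ≡ tr a ⊕ tr b
  tr-add a b = prove (env n n a b b) (S.tr νn (S.add νa νb)) (S.tr νn νa :+ S.tr νn νb) refl

  tr-scale : ∀ s a → tr (scale s a) ≡ s ⊗ tr a
  tr-scale s a = prove (env s n a a a) (S.tr νn (S.scale νs νa)) (νs :* S.tr νn νa) refl

  ev-add : ∀ t a b → ev t (add a b) ≡ ev t a ⊕ ev t b
  ev-add t a b = prove (env t t a b b) (S.ev νn νt (S.add νa νb)) (S.ev νn νt νa :+ S.ev νn νt νb) refl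

  quot : R → A → A → R
  quot = R.quot n

  ev-mul : ∀ t a b → ev t a ⊗ ev t b ≡ ev t (a · b) ⊕ f t ⊗ quot t a b
  ev-mul t a b = prove (env t t a b b) (S.ev νn νt νa :* S.ev νn νt νb) (S.ev νn νt (νa *ₛ νb) :+ S.f νn νt :* S.quot νn νt νa νb) refl

  tr-form : ∀ a → let (_ , a₁ , a₂) = a in
    R.α n ⊗ (3# ⊗ tr (a · a)) ≡ R.α n ⊗ (tr a ⊗ tr a) ⊕ (R.α n ⊗ a₁ ⊕ R.β n ⊗ a₂) ⊗ (R.α n ⊗ a₁ ⊕ R.β n ⊗ a₂) ⊕ 3# ⊗ R.D n ⊗ (a₂ ⊗ a₂)
  tr-form a = prove (env n n a a a) (S.α νn :* (S.3# :* S.tr νn (νa *ₛ νa))) (S.α νn :* (S.tr νn νa :* S.tr νn νa) :+ (S.α νn :* var (# 4) :+ S.β νn :* var (# 5)) :* (S.α νn :* var (# 4) :+ S.β νn :* var (# 5)) :+ S.3# :* S.D νn :* (var (# 5) :* var (# 5))) refl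

  disc : ∀ a → R.disc (tr a) (e₂ a) (N a) ≡ R.index n a ⊗ R.index n a ⊗ R.D n
  disc a = prove (env n n a a a) (S.disc (S.tr νn νa) (S.e₂ νn νa) (S.N νn νa)) (S.index νn νa :* S.index νn νa :* S.D νn) refl

  κ : A
  κ = R.κ n

  -- For odd n all coordinates are even, so κ³ = 2 η with η a unit: the prime 2 is totally ramified.
  -- This yields both the second unit and the descent showing that the norm is anisotropic.
  κ-cube : κ · κ · κ ≡ (2# , 3# ⊖ n , 3# ⊖ n)
  κ-cube = proveA (env n n 0A 0A 0A) (S.κ νn *ₛ S.κ νn *ₛ S.κ νn) (S.2# , (S.3# S.⊖ νn) , (S.3# S.⊖ νn)) refl

  N-κ : N κ ≡ 2#
  N-κ = prove (env n n 0A 0A 0A) (S.N νn (S.κ νn)) S.2# refl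

  N-ρ : N ρ ≡ 1#
  N-ρ = prove (env n n 0A 0A 0A) (S.N νn S.ρ) (con (+ 1)) refl

  κ-cofactor : κ · (1# , n ⊖ 1# , 1#) ≡ ι 2#
  κ-cofactor = proveA (env n n 0A 0A 0A) (S.κ νn *ₛ (con (+ 1) , νn S.⊖ con (+ 1) , con (+ 1))) (S.ι S.2#) refl

  κ-division : ∀ a → let (a₀ , a₁ , a₂) = a in a ≡ add (κ · (a₁ ⊖ a₂ , a₂ , 0#)) (ι (a₀ ⊖ a₁ ⊕ a₂))
  κ-division a = proveA (env n n a a a) νa (S.add (S.κ νn *ₛ (var (# 4) S.⊖ var (# 5) , var (# 5) , con (+ 0))) (S.ι ((var (# 3) S.⊖ var (# 4)) :+ var (# 5)))) refl

  -- Written in powers of 3 - n, which is even for odd n, so that the trace of a multiple of κ is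
  -- visibly even; the same holds for `e₂-κ`.
  tr-κ : ∀ s t → tr (κ · (s ⊕ t , t , 0#)) ≡ (3# ⊖ n) ⊗ s ⊕ ((3# ⊖ n) ⊗ (3# ⊖ n) ⊖ 2# ⊗ (3# ⊖ n)) ⊗ t
  tr-κ s t = prove (env s t 0A 0A 0A) (S.tr νn (S.κ νn *ₛ (νs :+ νt , νt , con (+ 0)))) ((S.3# S.⊖ νn) :* νs :+ ((S.3# S.⊖ νn) :* (S.3# S.⊖ νn) S.⊖ S.2# :* (S.3# S.⊖ νn)) :* νt) refl

  e₂-κ : ∀ s t → e₂ (κ · (s ⊕ t , t , 0#)) ≡ (3# ⊖ n) ⊗ s ⊗ s ⊕ ((3# ⊖ n) ⊗ (3# ⊖ n) ⊖ 2# ⊗ 3#) ⊗ s ⊗ t ⊕ ((3# ⊖ n) ⊗ (3# ⊖ n) ⊖ 2# ⊗ 2# ⊗ (3# ⊖ n)) ⊗ t ⊗ t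
  e₂-κ s t = prove (env s t 0A 0A 0A) (S.e₂ νn (S.κ νn *ₛ (νs :+ νt , νt , con (+ 0))))
    ((S.3# S.⊖ νn) :* νs :* νs :+ ((S.3# S.⊖ νn) :* (S.3# S.⊖ νn) S.⊖ S.2# :* S.3#) :* νs :* νt :+ ((S.3# S.⊖ νn) :* (S.3# S.⊖ νn) S.⊖ S.2# :* S.2# :* (S.3# S.⊖ νn)) :* νt :* νt) refl

  -- Modulo f t, the cofactor is an eigenvector of multiplication by a, with eigenvalue `ev t a`.
  -- When q divides f t this removes factors q from denominators at the prime (q , ρ - t).
  cofactor-mul : ∀ t a → let (_ , a₁ , a₂) = a in R.cofactor n t · a ≡ add (ι (ev t a) · R.cofactor n t) (neg (ι (f t) · (a₁ ⊕ a₂ ⊗ t , a₂ , 0#)))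
  cofactor-mul t a = proveA (env t t a a a) (S.cofactor νn νt *ₛ νa) (S.add (S.ι (S.ev νn νt νa) *ₛ S.cofactor νn νt) (S.neg (S.ι (S.f νn νt) *ₛ (var (# 4) :+ var (# 5) :* νt , var (# 5) , con (+ 0))))) refl

  ev-cofactor : ∀ t → ev t (R.cofactor n t) ≡ f′ t
  ev-cofactor t = prove (env t t 0A 0A 0A) (S.ev νn νt (S.cofactor νn νt)) (S.f′ νn νt) refl

  -- With g = n w - 2z + w ρ one has z α♯ - z α g = Δ - (z - 1) N α for α = z + w ρ, w = 1 + z.
  linear-resultant : ∀ z → let w = 1# ⊕ z; a = (z , w , 0#) in
    add (ι (2# ⊗ (z ⊗ w) ⊗ (z ⊗ w) ⊖ 2# ⊗ (z ⊗ w) ⊖ 1#)) (ι z · (a · (n ⊗ w ⊖ 2# ⊗ z , w , 0#))) ≡ add (ι z · a ♯) (ι (z ⊖ 1#) · (a · a ♯))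
  linear-resultant z = proveA (env z z 0A 0A 0A)
    (S.add (S.ι (S.2# :* (νs :* w) :* (νs :* w) S.⊖ S.2# :* (νs :* w) S.⊖ con (+ 1))) (S.ι νs *ₛ (a *ₛ (νn :* w S.⊖ S.2# :* νs , w , con (+ 0)))))
    (S.add (S.ι νs *ₛ S._♯ νn a) (S.ι (νs S.⊖ con (+ 1)) *ₛ (a *ₛ S._♯ νn a))) refl
    where
    w : Polynomial 12
    w = con (+ 1) :+ νs
    a : S.A
    a = νs , w , con (+ 0)

  N-linear : ∀ s t → N (s , t , 0#) ≡ s ⊗ s ⊗ s ⊕ t ⊗ t ⊗ t ⊕ n ⊗ s ⊗ (t ⊗ t) ⊖ n ⊗ (s ⊗ s) ⊗ t
  N-linear s t = prove (env s t 0A 0A 0A) (S.N νn (νs , νt , con (+ 0))) (νs :* νs :* νs :+ νt :* νt :* νt :+ νn :* νs :* (νt :* νt) S.⊖ νn :* (νs :* νs) :* νt) refl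

  ρ-root : add (ρ · ρ · ρ) (add (ι n · (ρ · ρ)) (ι n · ρ)) ≡ 1A
  ρ-root = proveA (env n n 0A 0A 0A) (S.add (S.ρ *ₛ S.ρ *ₛ S.ρ) (S.add (S.ι νn *ₛ (S.ρ *ₛ S.ρ)) (S.ι νn *ₛ S.ρ))) S.1A refl

  basis-expansion : ∀ a → let (a₀ , a₁ , a₂) = a in a ≡ add (ι a₀) (add (ι a₁ · ρ) (ι a₂ · (ρ · ρ)))
  basis-expansion a = proveA (env n n a a a) νa (S.add (S.ι (var (# 3))) (S.add (S.ι (var (# 4)) *ₛ S.ρ) (S.ι (var (# 5)) *ₛ (S.ρ *ₛ S.ρ)))) refl

-- Integers in ℚ

module ℚS = IntCoeff ℚP.+-*-isCommutativeRing
module ℤS = IntCoeff ℤP.+-*-isCommutativeRing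

-- Opaque: z / 1 would otherwise unfold into gcd computations.
opaque
  int : ℤ → ℚ
  int = ℤtoℚ

  int≡ℤtoℚ : ∀ i → int i ≡ ℤtoℚ i
  int≡ℤtoℚ i = refl

  int-0 : int (+ 0) ≡ 0ℚ
  int-0 = refl

  int-1 : int (+ 1) ≡ 1ℚ
  int-1 = refl

  toℚᵘ-int : ∀ i → ℚ.toℚᵘ (int i) ℚᵘ.≃ ℚᵘ.mkℚᵘ i 0
  toℚᵘ-int i = ℚP.toℚᵘ-fromℚᵘ (ℚᵘ.mkℚᵘ i 0)

int-+ : ∀ i j → int (i ℤ.+ j) ≡ int i ℚ.+ int j
int-+ i j = ℚP.toℚᵘ-injective (begin
  ℚ.toℚᵘ (int (i ℤ.+ j))                     ≈⟨ toℚᵘ-int (i ℤ.+ j) ⟩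
  ℚᵘ.mkℚᵘ (i ℤ.+ j) 0                         ≈⟨ ℚᵘ.*≡* (cong (ℤ._* + 1) (sym (cong₂ ℤ._+_ (ℤP.*-identityʳ i) (ℤP.*-identityʳ j)))) ⟩
  ℚᵘ.mkℚᵘ i 0 ℚᵘ.+ ℚᵘ.mkℚᵘ j 0                ≈⟨ ℚᵘP.+-cong (ℚᵘP.≃-sym (toℚᵘ-int i)) (ℚᵘP.≃-sym (toℚᵘ-int j)) ⟩
  ℚ.toℚᵘ (int i) ℚᵘ.+ ℚ.toℚᵘ (int j)        ≈⟨ ℚᵘP.≃-sym (ℚP.toℚᵘ-homo-+ (int i) (int j)) ⟩
  ℚ.toℚᵘ (int i ℚ.+ int j) ∎)
  where open ℚᵘP.≃-Reasoning

int-* : ∀ i j → int (i ℤ.* j) ≡ int i ℚ.* int j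
int-* i j = ℚP.toℚᵘ-injective (begin
  ℚ.toℚᵘ (int (i ℤ.* j))                     ≈⟨ toℚᵘ-int (i ℤ.* j) ⟩
  ℚᵘ.mkℚᵘ i 0 ℚᵘ.* ℚᵘ.mkℚᵘ j 0                ≈⟨ ℚᵘP.*-cong (ℚᵘP.≃-sym (toℚᵘ-int i)) (ℚᵘP.≃-sym (toℚᵘ-int j)) ⟩
  ℚ.toℚᵘ (int i) ℚᵘ.* ℚ.toℚᵘ (int j)        ≈⟨ ℚᵘP.≃-sym (ℚP.toℚᵘ-homo-* (int i) (int j)) ⟩
  ℚ.toℚᵘ (int i ℚ.* int j) ∎)
  where open ℚᵘP.≃-Reasoning

int-injective : ∀ {i j} → int i ≡ int j → i ≡ j
int-injective {i} {j} eq with ℚᵘP.≃-trans (ℚᵘP.≃-sym (toℚᵘ-int i)) (ℚᵘP.≃-trans (ℚᵘP.≃-reflexive (cong ℚ.toℚᵘ eq)) (toℚᵘ-int j))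
... | ℚᵘ.*≡* e = trans (sym (ℤP.*-identityʳ i)) (trans e (ℤP.*-identityʳ j))

int-neg : ∀ i → int (ℤ.- i) ≡ ℚ.- int i
int-neg i = trans (sym (ℚP.+-identityˡ _)) (trans (cong (ℚ._+ int (ℤ.- i)) (sym (ℚP.+-inverseˡ (int i))))
  (trans (ℚP.+-assoc (ℚ.- int i) (int i) (int (ℤ.- i))) (trans (cong (ℚ.- int i ℚ.+_) (trans (sym (int-+ i (ℤ.- i))) (trans (cong int (ℤP.+-inverseʳ i)) int-0))) (ℚP.+-identityʳ _))))

int-mono-≤ : ∀ {i j} → i ℤ.≤ j → int i ℚ.≤ int j
int-mono-≤ {i} {j} le = ℚP.toℚᵘ-cancel-≤ (ℚᵘP.≤-respˡ-≃ (ℚᵘP.≃-sym (toℚᵘ-int i)) (ℚᵘP.≤-respʳ-≃ (ℚᵘP.≃-sym (toℚᵘ-int j))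
  (ℚᵘ.*≤* (subst₂ ℤ._≤_ (sym (ℤP.*-identityʳ i)) (sym (ℤP.*-identityʳ j)) le))))

int-cancel-≤ : ∀ {i j} → int i ℚ.≤ int j → i ℤ.≤ j
int-cancel-≤ {i} {j} le with ℚᵘP.≤-respˡ-≃ (toℚᵘ-int i) (ℚᵘP.≤-respʳ-≃ (toℚᵘ-int j) (ℚP.toℚᵘ-mono-≤ le))
... | ℚᵘ.*≤* e = subst₂ ℤ._≤_ (ℤP.*-identityʳ i) (ℤP.*-identityʳ j) e

fromℕ≡ : ∀ k → ℚS.fromℕ k ≡ int (+ k)
fromℕ≡ zero = sym int-0
fromℕ≡ (suc k) = trans (ℚS.fromℕ-suc k) (trans (cong₂ ℚ._+_ (sym int-1) (fromℕ≡ k)) (sym (int-+ (+ 1) (+ k))))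

int≢0 : ∀ {i} → i ≢ + 0 → int i ≢ 0ℚ
int≢0 i≢0 e = i≢0 (int-injective (trans e (sym int-0)))

IsInt : ℚ → Set
IsInt q = ∃ λ z → q ≡ int z

isInt-+ : ∀ {p q} → IsInt p → IsInt q → IsInt (p ℚ.+ q)
isInt-+ (i , refl) (j , refl) = i ℤ.+ j , sym (int-+ i j)

isInt-* : ∀ {p q} → IsInt p → IsInt q → IsInt (p ℚ.* q)
isInt-* (i , refl) (j , refl) = i ℤ.* j , sym (int-* i j)

isInt-neg : ∀ {p} → IsInt p → IsInt (ℚ.- p)
isInt-neg (i , refl) = ℤ.- i , sym (int-neg i)

isInt-int : ∀ i → IsInt (int i)
isInt-int i = i , refl

isInt-ℤtoℚ : ∀ i → IsInt (ℤtoℚ i)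
isInt-ℤtoℚ i = i , sym (int≡ℤtoℚ i)

isInt-0 : IsInt 0ℚ
isInt-0 = + 0 , sym int-0

isInt-1 : IsInt 1ℚ
isInt-1 = + 1 , sym int-1

denominator : ∀ q → Σ ℕ λ d → int (+ suc d) ℚ.* q ≡ int (ℚ.numerator q)
denominator q@(ℚ.mkℚ z d c) = d , ℚP.toℚᵘ-injective (begin
  ℚ.toℚᵘ (int (+ suc d) ℚ.* q)               ≈⟨ ℚP.toℚᵘ-homo-* (int (+ suc d)) q ⟩
  ℚ.toℚᵘ (int (+ suc d)) ℚᵘ.* ℚᵘ.mkℚᵘ z d    ≈⟨ ℚᵘP.*-congʳ {ℚᵘ.mkℚᵘ z d} (toℚᵘ-int (+ suc d)) ⟩
  ℚᵘ.mkℚᵘ (+ suc d) 0 ℚᵘ.* ℚᵘ.mkℚᵘ z d       ≈⟨ ℚᵘ.*≡* (trans (ℤP.*-identityʳ _) (trans (ℤP.*-comm (+ suc d) z) (cong (λ u → z ℤ.* + suc u) (sym (ℕP.+-identityʳ d))))) ⟩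
  ℚᵘ.mkℚᵘ z 0                                ≈⟨ ℚᵘP.≃-sym (toℚᵘ-int z) ⟩
  ℚ.toℚᵘ (int z) ∎)
  where open ℚᵘP.≃-Reasoning

clearDenominator : ∀ q → ∃ λ m → m ≢ 0ℚ × IsInt m × IsInt (m ℚ.* q)
clearDenominator q with denominator q
... | d , e = int (+ suc d) , int≢0 (λ ()) , isInt-int _ , _ , e

≤-byDiff : ∀ {a b} e → 0ℚ ℚ.≤ e → a ℚ.+ e ≡ b → a ℚ.≤ b
≤-byDiff {a} e 0≤e refl = subst (ℚ._≤ a ℚ.+ e) (ℚP.+-identityʳ a) (ℚP.+-monoʳ-≤ a 0≤e)

≤⇒0≤- : ∀ {a b} → a ℚ.≤ b → 0ℚ ℚ.≤ b ℚ.- a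
≤⇒0≤- {a} {b} le = subst (ℚ._≤ b ℚ.- a) (ℚP.+-inverseʳ a) (ℚP.+-monoˡ-≤ (ℚ.- a) le)

0≤-+ : ∀ {a b} → 0ℚ ℚ.≤ a → 0ℚ ℚ.≤ b → 0ℚ ℚ.≤ a ℚ.+ b
0≤-+ = ℚP.+-mono-≤ {0ℚ} {_} {0ℚ}

0≤-* : ∀ {a b} → 0ℚ ℚ.≤ a → 0ℚ ℚ.≤ b → 0ℚ ℚ.≤ a ℚ.* b
0≤-* {a} {b} p q = subst (ℚ._≤ a ℚ.* b) (ℚP.*-zeroʳ a) (ℚP.*-monoˡ-≤-nonNeg a {{ℚ.nonNegative p}} q)

*-mono-≤ : ∀ {a b c d} → 0ℚ ℚ.≤ a → a ℚ.≤ b → 0ℚ ℚ.≤ c → c ℚ.≤ d → a ℚ.* c ℚ.≤ b ℚ.* d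
*-mono-≤ {a} {b} {c} {d} 0≤a a≤b 0≤c c≤d = ℚP.≤-trans (ℚP.*-monoˡ-≤-nonNeg a {{ℚ.nonNegative 0≤a}} c≤d)
  (ℚP.*-monoʳ-≤-nonNeg d {{ℚ.nonNegative (ℚP.≤-trans 0≤c c≤d)}} a≤b)

0≤-neg : ∀ {a} → a ℚ.≤ 0ℚ → 0ℚ ℚ.≤ ℚ.- a
0≤-neg = ℚP.neg-antimono-≤

0≤-square : ∀ a → 0ℚ ℚ.≤ a ℚ.* a
0≤-square a with ℚP.≤-total 0ℚ a
... | inj₁ p = 0≤-* p p
... | inj₂ p = subst (0ℚ ℚ.≤_) (solve 1 (λ a → (:- a) :* (:- a) := a :* a) refl a) (0≤-* (0≤-neg p) (0≤-neg p))
  where open ℚS.Solver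

inverse : ∀ {a} → a ≢ 0ℚ → ∃ λ b → a ℚ.* b ≡ 1ℚ
inverse {a} a≢0 = ℚ.1/_ a {{ℚ.≢-nonZero a≢0}} , ℚP.*-inverseʳ a {{ℚ.≢-nonZero a≢0}}

*-cancelˡ : ∀ {a b c} → a ≢ 0ℚ → a ℚ.* b ≡ a ℚ.* c → b ≡ c
*-cancelˡ {a} {b} {c} a≢0 eq with inverse a≢0
... | i , ai≡1 = begin
  b                ≡⟨ sym (ℚP.*-identityˡ b) ⟩
  1ℚ ℚ.* b         ≡⟨ cong (ℚ._* b) (sym ai≡1) ⟩
  a ℚ.* i ℚ.* b    ≡⟨ solve 3 (λ a i b → a :* i :* b := i :* (a :* b)) refl a i b ⟩
  i ℚ.* (a ℚ.* b)  ≡⟨ cong (i ℚ.*_) eq ⟩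
  i ℚ.* (a ℚ.* c)  ≡⟨ solve 3 (λ a i b → i :* (a :* b) := a :* i :* b) refl a i c ⟩
  a ℚ.* i ℚ.* c    ≡⟨ cong (ℚ._* c) ai≡1 ⟩
  1ℚ ℚ.* c         ≡⟨ ℚP.*-identityˡ c ⟩
  c ∎
  where open ≡-Reasoning
        open ℚS.Solver using (solve; _:*_; _:=_)

-≡0⇒≡ : ∀ {a b} → a ℚ.- b ≡ 0ℚ → a ≡ b
-≡0⇒≡ {a} {b} eq = trans (solve 2 (λ a b → a := a :- b :+ b) refl a b) (trans (cong (ℚ._+ b) eq) (ℚP.+-identityˡ b))
  where open ℚS.Solver

*≢0 : ∀ {p q} → p ≢ 0ℚ → q ≢ 0ℚ → p ℚ.* q ≢ 0ℚ
*≢0 {p} {q} p≢0 q≢0 e = q≢0 (*-cancelˡ p≢0 (trans e (sym (ℚP.*-zeroʳ p))))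

ℚ<⇒≱ : ∀ {p q} → p ℚ.< q → ¬ (q ℚ.≤ p)
ℚ<⇒≱ lt le = ℚP.<-irrefl refl (ℚP.<-≤-trans lt le)

-- Criteria for a rational number to be an integer

∣-even-square : ∀ u → 2 ℕD.∣ u ℕ.* u → 2 ℕD.∣ u
∣-even-square u d = [ id , id ]′ (Prim.euclidsLemma u u Prim.prime[2] d)

coprime-^ : ∀ {m n} k → Cop.Coprime m n → Cop.Coprime (m ℕ.^ k) n
coprime-^ zero c (d∣1 , _) = ℕD.∣1⇒≡1 d∣1
coprime-^ {m} {n} (suc k) c {d} (d∣m^ , d∣n) = coprime-^ k c (Cop.coprime-divisor {d} {m} (λ (e∣d , e∣m) → c (e∣m , ℕD.∣-trans e∣d d∣n)) d∣m^ , d∣n)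

k<2+n^k : ∀ n k → k ℕ.< suc (suc n) ℕ.^ k
k<2+n^k n zero = ℕ.s≤s ℕ.z≤n
k<2+n^k n (suc k) = ℕP.≤-trans (ℕP.+-mono-≤ (ℕP.≤-trans (ℕ.s≤s ℕ.z≤n) (k<2+n^k n k)) (k<2+n^k n k))
  (ℕP.+-monoʳ-≤ p (ℕP.m≤m+n p (n ℕ.* p)))
  where p = suc (suc n) ℕ.^ k

abs-^ : ∀ z k → ℤ.∣ z ℤS.^ k ∣ ≡ ℤ.∣ z ∣ ℕ.^ k
abs-^ z zero = refl
abs-^ z (suc k) = trans (ℤP.abs-* z (z ℤS.^ k)) (cong (ℤ.∣ z ∣ ℕ.*_) (abs-^ z k))

int-^ : ∀ i k → int (i ℤS.^ k) ≡ int i ℚS.^ k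
int-^ i zero = int-1
int-^ i (suc k) = trans (int-* i (i ℤS.^ k)) (cong (int i ℚ.*_) (int-^ i k))

-- The denominator d of q satisfies dᵏ ∣ M for every k.
boundedPowers⇒int : ∀ q M → M ≢ 0ℚ → IsInt M → (∀ k → IsInt (M ℚ.* q ℚS.^ k)) → IsInt q
boundedPowers⇒int q@(ℚ.mkℚ z zero c) M M≢0 _ _ = z , ℚP.toℚᵘ-injective (ℚᵘP.≃-sym (toℚᵘ-int z))
boundedPowers⇒int q@(ℚ.mkℚ z d@(suc d′) c) M M≢0 (m , refl) h = ⊥-elim (ℕP.<⇒≱ (k<2+n^k d′ ℤ.∣ m ∣) (ℕD.∣⇒≤ {{ℕ.≢-nonZero ∣m∣≢0}} divides))
  where
  k = ℤ.∣ m ∣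
  ∣m∣≢0 : k ≢ 0
  ∣m∣≢0 e = M≢0 (trans (cong int (ℤP.∣i∣≡0⇒i≡0 {m} e)) int-0)
  dq : int (+ suc d) ℚ.* q ≡ int z
  dq = proj₂ (denominator q)
  w = proj₁ (h k)
  open ≡-Reasoning
  eq : m ℤ.* z ℤS.^ k ≡ w ℤ.* (+ suc d) ℤS.^ k
  eq = int-injective (begin
    int (m ℤ.* z ℤS.^ k)                              ≡⟨ trans (int-* m (z ℤS.^ k)) (cong (M ℚ.*_) (trans (int-^ z k) (cong (ℚS._^ k) (sym dq)))) ⟩
    M ℚ.* (int (+ suc d) ℚ.* q) ℚS.^ k               ≡⟨ cong (M ℚ.*_) (ℚS.^-distrib-* (int (+ suc d)) q k) ⟩
    M ℚ.* (int (+ suc d) ℚS.^ k ℚ.* q ℚS.^ k)        ≡⟨ solve 3 (λ M a b → M :* (a :* b) := M :* b :* a) refl M (int (+ suc d) ℚS.^ k) (q ℚS.^ k) ⟩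
    M ℚ.* q ℚS.^ k ℚ.* int (+ suc d) ℚS.^ k          ≡⟨ cong₂ ℚ._*_ (proj₂ (h k)) (sym (int-^ (+ suc d) k)) ⟩
    int w ℚ.* int ((+ suc d) ℤS.^ k)                 ≡⟨ sym (int-* w ((+ suc d) ℤS.^ k)) ⟩
    int (w ℤ.* (+ suc d) ℤS.^ k) ∎)
    where open ℚS.Solver using (solve; _:*_; _:=_)
  eqℕ : k ℕ.* ℤ.∣ z ∣ ℕ.^ k ≡ ℤ.∣ w ∣ ℕ.* suc d ℕ.^ k
  eqℕ = trans (cong (k ℕ.*_) (sym (abs-^ z k))) (trans (sym (ℤP.abs-* m (z ℤS.^ k))) (trans (cong ℤ.∣_∣ eq)
    (trans (ℤP.abs-* w ((+ suc d) ℤS.^ k)) (cong (ℤ.∣ w ∣ ℕ.*_) (abs-^ (+ suc d) k)))))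
  cop : Cop.Coprime (suc d ℕ.^ k) (ℤ.∣ z ∣ ℕ.^ k)
  cop = coprime-^ k (Cop.sym (coprime-^ k (Cop.recompute c)))
  divides : suc d ℕ.^ k ℕD.∣ k
  divides = Cop.coprime-divisor cop (ℕD.divides ℤ.∣ w ∣ (trans (ℕP.*-comm (ℤ.∣ z ∣ ℕ.^ k) k) eqℕ))

-- For u = 2 q the second hypothesis reads u² = 2 (2 q²), so u is even. It serves for traces, which
-- the norms of x ± 1 determine only up to a half.
half-isInt : ∀ q → IsInt (q ℚ.+ q) → IsInt (q ℚ.* q ℚ.+ q ℚ.* q) → IsInt q
half-isInt q (u , 2q≡u) (v , 2qq≡v) = halve even
  where
  open ℚS.Solver using (solve; _:*_; _:=_; _:+_; con)
  uu≡2v : u ℤ.* u ≡ + 2 ℤ.* v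
  uu≡2v = int-injective (trans (int-* u u) (trans (cong₂ ℚ._*_ (sym 2q≡u) (sym 2q≡u))
    (trans (solve 1 (λ q → (q :+ q) :* (q :+ q) := con (+ 2) :* (q :* q :+ q :* q)) refl q)
    (trans (cong₂ ℚ._*_ (fromℕ≡ 2) 2qq≡v) (sym (int-* (+ 2) v))))))
  even : 2 ℕD.∣ ℤ.∣ u ∣
  even = ∣-even-square ℤ.∣ u ∣ (ℕD.divides ℤ.∣ v ∣ (trans (sym (ℤP.abs-* u u)) (trans (cong ℤ.∣_∣ uu≡2v) (trans (ℤP.abs-* (+ 2) v) (ℕP.*-comm 2 ℤ.∣ v ∣)))))
  halve : 2 ℕD.∣ ℤ.∣ u ∣ → IsInt q
  halve e with ℤD.∣ᵤ⇒∣ {+ 2} {u} e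
  ... | ℤD.divides k refl = k , *-cancelˡ {ℚS.fromℤ (+ 2)} (λ ()) (trans (solve 1 (λ q → con (+ 2) :* q := q :+ q) refl q)
    (trans 2q≡u (trans (cong int (ℤP.*-comm k (+ 2))) (trans (int-* (+ 2) k) (cong (ℚ._* int k) (sym (fromℕ≡ 2)))))))

-- The cubic field and its integers

module CubicField (n : ℕ) where

  private module C = Cubic ℚP.+-*-isCommutativeRing (nℚ n)

  ι : ℚ → K
  ι = C.ι

  ρ : K
  ρ = C.ρ

  f : ℚ → ℚ
  f = C.f

  κ : K
  κ = C.κ

  private module RQ = RawCubic ℚ._+_ ℚ._*_ ℚ.-_ 0ℚ 1ℚ

  f′ : ℚ → ℚ
  f′ = C.f′

  cofactor : ℚ → K
  cofactor = RQ.cofactor (nℚ n)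

  α β D : ℚ
  α = RQ.α (nℚ n)
  β = RQ.β (nℚ n)
  D = RQ.D (nℚ n)

  -- Opaque, since pairs have η and the ring solver would otherwise expand every product into coordinates.
  opaque
    infixl 7 _·_
    infixl 6 _⊕_
    infixl 8 _♯
    _·_ _⊕_ : K → K → K
    _·_ = C._·_
    _⊕_ = C.add

    neg _♯ : K → K
    neg = C.neg
    _♯ = C._♯

    N tr e₂ : K → ℚ
    N = C.N
    tr = C.tr
    e₂ = C.e₂

    ev : ℚ → K → ℚ
    ev = C.ev

    quot : ℚ → K → K → ℚ
    quot = C.quot

    isCommutativeRing : IsCommutativeRing _≡_ _⊕_ _·_ neg 0K 1K
    isCommutativeRing = C.isCommutativeRing

    mulK≡· : ∀ x y → mulK n x y ≡ x · y
    mulK≡· x y = refl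

    +K≡⊕ : ∀ x y → x +K y ≡ x ⊕ y
    +K≡⊕ x y = refl

    ·K≡ι· : ∀ q x → q ·K x ≡ ι q · x
    ·K≡ι· = C.scale-ι

    ι-mul : ∀ s t → ι (s ℚ.* t) ≡ ι s · ι t
    ι-mul = C.ι-mul

    ι-add : ∀ s t → ι (s ℚ.+ t) ≡ ι s ⊕ ι t
    ι-add = C.ι-add

    ι-neg : ∀ s → ι (ℚ.- s) ≡ neg (ι s)
    ι-neg s = refl

    mul-♯ : ∀ x → x · x ♯ ≡ ι (N x)
    mul-♯ = C.mul-♯

    ♯-mul : ∀ x y → (x · y) ♯ ≡ x ♯ · y ♯
    ♯-mul = C.♯-mul

    N-ι : ∀ s → N (ι s) ≡ s ℚ.* s ℚ.* s
    N-ι = C.N-ι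

    N-add-ι : ∀ x s → N (x ⊕ ι s) ≡ N x ℚ.+ e₂ x ℚ.* s ℚ.+ tr x ℚ.* s ℚ.* s ℚ.+ s ℚ.* s ℚ.* s
    N-add-ι = C.N-add-ι

    tr-square : ∀ x → tr (x · x) ℚ.+ ℚS.fromℤ (+ 2) ℚ.* e₂ x ≡ tr x ℚ.* tr x
    tr-square = C.tr-square

    cayley-hamilton : ∀ x → x · x · x ⊕ ι (e₂ x) · x ≡ ι (tr x) · (x · x) ⊕ ι (N x)
    cayley-hamilton x = trans (cong (x · x · x ⊕_) (sym (C.scale-ι (e₂ x) x))) (trans (C.cayley-hamilton x) (cong (_⊕ ι (N x)) (C.scale-ι (tr x) (x · x))))

    newton : ∀ x → ℚS.fromℤ (+ 6) ℚ.* N x ℚ.+ ℚS.fromℤ (+ 3) ℚ.* tr x ℚ.* tr (x · x) ≡ tr x ℚ.* tr x ℚ.* tr x ℚ.+ ℚS.fromℤ (+ 2) ℚ.* tr (x · x · x)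
    newton = C.newton

    tr-add : ∀ x y → tr (x ⊕ y) ≡ tr x ℚ.+ tr y
    tr-add = C.tr-add

    tr-ι· : ∀ s x → tr (ι s · x) ≡ s ℚ.* tr x
    tr-ι· s x = trans (cong tr (sym (C.scale-ι s x))) (C.tr-scale s x)

    tr-ι : ∀ s → tr (ι s) ≡ ℚS.fromℤ (+ 3) ℚ.* s
    tr-ι s = ℚS.Solver.solve 2 (λ n s → con (+ 3) :* s :- n :* con (+ 0) :+ (n :* n :- con (+ 2) :* n) :* con (+ 0) := con (+ 3) :* s) refl (nℚ n) s
      where open ℚS.Solver

    ev-add : ∀ t x y → ev t (x ⊕ y) ≡ ev t x ℚ.+ ev t y
    ev-add = C.ev-add

    ev-mul : ∀ t x y → ev t x ℚ.* ev t y ≡ ev t (x · y) ℚ.+ f t ℚ.* quot t x y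
    ev-mul = C.ev-mul

    ev-ι : ∀ t s → ev t (ι s) ≡ s
    ev-ι t s = ℚS.Solver.solve 2 (λ t s → s :+ con (+ 0) :* t :+ con (+ 0) :* (t :* t) := s) refl t s
      where open ℚS.Solver

    ev-ρ : ∀ t → ev t ρ ≡ t
    ev-ρ t = ℚS.Solver.solve 1 (λ t → con (+ 0) :+ con (+ 1) :* t :+ con (+ 0) :* (t :* t) := t) refl t
      where open ℚS.Solver

    κ³≡ : ∀ h → ℚS.fromℤ (+ 2) ℚ.* h ≡ ℚS.fromℤ (+ 3) ℚ.- nℚ n → ι (ℚS.fromℤ (+ 2)) · (1ℚ , h , h) ≡ κ · κ · κ
    κ³≡ h eq = trans (sym (C.scale-ι (ℚS.fromℤ (+ 2)) (1ℚ , h , h))) (trans (C.≡A refl eq eq) (sym C.κ-cube))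

    κ≡1+ρ : κ ≡ 1K ⊕ ρ
    κ≡1+ρ = refl

    N-κ : N κ ≡ ℚS.fromℤ (+ 2)
    N-κ = C.N-κ

    N-ρ : N ρ ≡ 1ℚ
    N-ρ = C.N-ρ

    κ-cofactor : κ · (1ℚ , nℚ n ℚ.- 1ℚ , 1ℚ) ≡ ι (ℚS.fromℤ (+ 2))
    κ-cofactor = C.κ-cofactor

    κ-division : ∀ x₀ x₁ x₂ → (x₀ , x₁ , x₂) ≡ κ · (x₁ ℚ.- x₂ , x₂ , 0ℚ) ⊕ ι (x₀ ℚ.- x₁ ℚ.+ x₂)
    κ-division x₀ x₁ x₂ = C.κ-division (x₀ , x₁ , x₂)

    tr-κ : ∀ s t → tr (κ · (s ℚ.+ t , t , 0ℚ)) ≡ (ℚS.fromℤ (+ 3) ℚ.- nℚ n) ℚ.* s ℚ.+ ((ℚS.fromℤ (+ 3) ℚ.- nℚ n) ℚ.* (ℚS.fromℤ (+ 3) ℚ.- nℚ n) ℚ.- ℚS.fromℤ (+ 2) ℚ.* (ℚS.fromℤ (+ 3) ℚ.- nℚ n)) ℚ.* t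
    tr-κ = C.tr-κ

    e₂-κ : ∀ s t → e₂ (κ · (s ℚ.+ t , t , 0ℚ)) ≡ (ℚS.fromℤ (+ 3) ℚ.- nℚ n) ℚ.* s ℚ.* s ℚ.+ ((ℚS.fromℤ (+ 3) ℚ.- nℚ n) ℚ.* (ℚS.fromℤ (+ 3) ℚ.- nℚ n) ℚ.- ℚS.fromℤ (+ 6)) ℚ.* s ℚ.* t
      ℚ.+ ((ℚS.fromℤ (+ 3) ℚ.- nℚ n) ℚ.* (ℚS.fromℤ (+ 3) ℚ.- nℚ n) ℚ.- ℚS.fromℤ (+ 4) ℚ.* (ℚS.fromℤ (+ 3) ℚ.- nℚ n)) ℚ.* t ℚ.* t
    e₂-κ = C.e₂-κ

    tr-form : ∀ x₀ x₁ x₂ → let x = (x₀ , x₁ , x₂) in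
      α ℚ.* (ℚS.fromℤ (+ 3) ℚ.* tr (x · x)) ≡ α ℚ.* (tr x ℚ.* tr x) ℚ.+ (α ℚ.* x₁ ℚ.+ β ℚ.* x₂) ℚ.* (α ℚ.* x₁ ℚ.+ β ℚ.* x₂) ℚ.+ ℚS.fromℤ (+ 3) ℚ.* D ℚ.* (x₂ ℚ.* x₂)
    tr-form x₀ x₁ x₂ = C.tr-form (x₀ , x₁ , x₂)

    cofactor-mul : ∀ t x₀ x₁ x₂ → let x = (x₀ , x₁ , x₂) in cofactor t · x ≡ ι (ev t x) · cofactor t ⊕ neg (ι (f t) · (x₁ ℚ.+ x₂ ℚ.* t , x₂ , 0ℚ))
    cofactor-mul t x₀ x₁ x₂ = C.cofactor-mul t (x₀ , x₁ , x₂)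

    ev-cofactor : ∀ t → ev t (cofactor t) ≡ f′ t
    ev-cofactor = C.ev-cofactor

    ev-coords : ∀ t x₀ x₁ x₂ → ev t (x₀ , x₁ , x₂) ≡ x₀ ℚ.+ x₁ ℚ.* t ℚ.+ x₂ ℚ.* (t ℚ.* t)
    ev-coords t x₀ x₁ x₂ = refl

    quot-coords : ∀ t x₀ x₁ x₂ y₀ y₁ y₂ → quot t (x₀ , x₁ , x₂) (y₀ , y₁ , y₂) ≡ x₂ ℚ.* y₂ ℚ.* (t ℚ.- nℚ n) ℚ.+ (x₁ ℚ.* y₂ ℚ.+ x₂ ℚ.* y₁)
    quot-coords t x₀ x₁ x₂ y₀ y₁ y₂ = refl

    tr-coords : ∀ x₀ x₁ x₂ → tr (x₀ , x₁ , x₂) ≡ ℚS.fromℤ (+ 3) ℚ.* x₀ ℚ.- nℚ n ℚ.* x₁ ℚ.+ (nℚ n ℚ.* nℚ n ℚ.- ℚS.fromℤ (+ 2) ℚ.* nℚ n) ℚ.* x₂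
    tr-coords x₀ x₁ x₂ = refl

    linear-resultant : ∀ z → let w = 1ℚ ℚ.+ z; a = (z , w , 0ℚ) in
      ι (ℚS.fromℤ (+ 2) ℚ.* (z ℚ.* w) ℚ.* (z ℚ.* w) ℚ.- ℚS.fromℤ (+ 2) ℚ.* (z ℚ.* w) ℚ.- 1ℚ) ⊕ ι z · (a · (nℚ n ℚ.* w ℚ.- ℚS.fromℤ (+ 2) ℚ.* z , w , 0ℚ)) ≡ ι z · a ♯ ⊕ ι (z ℚ.- 1ℚ) · (a · a ♯)
    linear-resultant = C.linear-resultant

    N-linear : ∀ s t → N (s , t , 0ℚ) ≡ s ℚ.* s ℚ.* s ℚ.+ t ℚ.* t ℚ.* t ℚ.+ nℚ n ℚ.* s ℚ.* (t ℚ.* t) ℚ.- nℚ n ℚ.* (s ℚ.* s) ℚ.* t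
    N-linear = C.N-linear

    ρ-root : ρ · ρ · ρ ⊕ (ι (nℚ n) · (ρ · ρ) ⊕ ι (nℚ n) · ρ) ≡ 1K
    ρ-root = C.ρ-root

    basis-expansion : ∀ x₀ x₁ x₂ → (x₀ , x₁ , x₂) ≡ ι x₀ ⊕ (ι x₁ · ρ ⊕ ι x₂ · (ρ · ρ))
    basis-expansion x₀ x₁ x₂ = C.basis-expansion (x₀ , x₁ , x₂)

    disc : ∀ x → ∃ λ k → RQ.disc (tr x) (e₂ x) (N x) ≡ k ℚ.* k ℚ.* D
    disc x = RQ.index (nℚ n) x , C.disc x

  module KS = IntCoeff isCommutativeRing
  open KS using (_^_; ^-homo-*; ^-assocʳ; ^-distrib-*; 1^) public
  open KS.Solver using (solve; _:+_; _:*_; :-_; _:-_; con; _:=_)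
  private module QR = ℚS.Solver

  powK≡^ : ∀ x k → powK n x k ≡ x ^ k
  powK≡^ x zero = refl
  powK≡^ x (suc k) = trans (mulK≡· x (powK n x k)) (cong (x ·_) (powK≡^ x k))

  -- The order ℤ[ρ]. It may be smaller than the ring of integers, which is never computed.
  Lat : K → Set
  Lat (x₀ , x₁ , x₂) = IsInt x₀ × IsInt x₁ × IsInt x₂

  private
    int-n : IsInt (nℚ n)
    int-n = isInt-ℤtoℚ (+ n)

    lat-shift : ∀ {x} → Lat x → Lat (mulρ n x)
    lat-shift (a , b , c) = c , isInt-+ a (isInt-neg (isInt-* int-n c)) , isInt-+ b (isInt-neg (isInt-* int-n c))

    lat-+K : ∀ {x y} → Lat x → Lat y → Lat (x +K y)
    lat-+K (a , b , c) (d , e , g) = isInt-+ a d , isInt-+ b e , isInt-+ c g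

    lat-·K : ∀ {q x} → IsInt q → Lat x → Lat (q ·K x)
    lat-·K i (a , b , c) = isInt-* i a , isInt-* i b , isInt-* i c

  opaque
    unfolding _·_

    lat-add : ∀ {x y} → Lat x → Lat y → Lat (x ⊕ y)
    lat-add {x} {y} = lat-+K {x} {y}

    lat-neg : ∀ {x} → Lat x → Lat (neg x)
    lat-neg (a , b , c) = isInt-neg a , isInt-neg b , isInt-neg c

    lat-mul : ∀ {x y} → Lat x → Lat y → Lat (x · y)
    lat-mul {x@(x₀ , x₁ , x₂)} {y} (a , b , c) ly = lat-+K {x₀ ·K y} {(x₁ ·K mulρ n y) +K (x₂ ·K mulρ n (mulρ n y))}
      (lat-·K {x = y} a ly)
      (lat-+K {x₁ ·K mulρ n y} {x₂ ·K mulρ n (mulρ n y)}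
        (lat-·K {x = mulρ n y} b (lat-shift {y} ly))
        (lat-·K {x = mulρ n (mulρ n y)} c (lat-shift {mulρ n y} (lat-shift {y} ly))))

    lat-♯ : ∀ {x} → Lat x → Lat (x ♯)
    lat-♯ (a , b , c) =
       (((((isInt-* a a ⊞ isInt-neg (isInt-* (isInt-* int-n a) b)) ⊞ isInt-* (isInt-* n²-2n a) c) ⊞ isInt-* (isInt-* int-n b) b) ⊞ isInt-* (isInt-* (isInt-neg isInt-1 ⊞ isInt-neg n²) b) c) ⊞ isInt-* (isInt-* (n² ⊞ int-n) c) c)
      , (((isInt-neg (isInt-* a b) ⊞ isInt-* (isInt-* int-n b) b) ⊞ isInt-neg (isInt-* (isInt-* n² b) c)) ⊞ isInt-* (isInt-* (n² ⊞ isInt-1) c) c)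
      , (((isInt-* b b ⊞ isInt-neg (isInt-* a c)) ⊞ isInt-neg (isInt-* (isInt-* int-n b) c)) ⊞ isInt-* (isInt-* int-n c) c)
      where
      infixl 6 _⊞_
      _⊞_ : ∀ {p q} → IsInt p → IsInt q → IsInt (p ℚ.+ q)
      _⊞_ = isInt-+
      n² : IsInt (nℚ n ℚ.* nℚ n)
      n² = isInt-* int-n int-n
      n²-2n : IsInt (nℚ n ℚ.* nℚ n ℚ.- ℚS.fromℤ (+ 2) ℚ.* nℚ n)
      n²-2n = n² ⊞ isInt-neg (isInt-* (+ 2 , fromℕ≡ 2) int-n)

    lat⇒intN : ∀ {x} → Lat x → IsInt (N x)
    lat⇒intN {x} l = proj₁ (lat-mul {x} {x ♯} l (lat-♯ {x} l))

  lat-ι : ∀ {q} → IsInt q → Lat (ι q)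
  lat-ι i = i , isInt-0 , isInt-0

  lat-0 : Lat 0K
  lat-0 = lat-ι (isInt-0)

  lat-1 : Lat 1K
  lat-1 = lat-ι (isInt-1)

  lat-ρ : Lat ρ
  lat-ρ = isInt-0 , isInt-1 , isInt-0

  lat-^ : ∀ {x} k → Lat x → Lat (x ^ k)
  lat-^ zero l = lat-1
  lat-^ {x} (suc k) l = lat-mul {x} {x ^ k} l (lat-^ k l)

  -- Integrality by bounded denominators

  HasDenominator : K → Set
  HasDenominator y = ∃ λ m → m ≢ 0ℚ × IsInt m × Lat (ι m · y)

  lat-denominator : ∀ x → HasDenominator x
  lat-denominator x@(x₀ , x₁ , x₂) with clearDenominator x₀ | clearDenominator x₁ | clearDenominator x₂
  ... | a , a≢0 , ia , ax | b , b≢0 , ib , bx | c , c≢0 , ic , cx =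
    a ℚ.* b ℚ.* c , *≢0 (*≢0 a≢0 b≢0) c≢0 , isInt-* (isInt-* ia ib) ic ,
    subst Lat (·K≡ι· (a ℚ.* b ℚ.* c) x)
      ( subst IsInt (QR.solve 4 (λ a b c x → b QR.:* c QR.:* (a QR.:* x) QR.:= a QR.:* b QR.:* c QR.:* x) refl a b c x₀) (isInt-* (isInt-* ib ic) ax)
      , subst IsInt (QR.solve 4 (λ a b c x → a QR.:* c QR.:* (b QR.:* x) QR.:= a QR.:* b QR.:* c QR.:* x) refl a b c x₁) (isInt-* (isInt-* ia ic) bx)
      , subst IsInt (QR.solve 4 (λ a b c x → a QR.:* b QR.:* (c QR.:* x) QR.:= a QR.:* b QR.:* c QR.:* x) refl a b c x₂) (isInt-* (isInt-* ia ib) cx))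

  -- Powers with a common denominator: a form of integrality that is visibly closed under sums and products.
  BD : K → Set
  BD x = ∃ λ m → m ≢ 0ℚ × IsInt m × (∀ k → Lat (ι m · x ^ k))

  bd-lat : ∀ {x} → Lat x → BD x
  bd-lat {x} l = 1ℚ , (λ ()) , isInt-1 , λ k → lat-mul {1K} {x ^ k} lat-1 (lat-^ {x} k l)

  bd-mul : ∀ {x y} → BD x → BD y → BD (x · y)
  bd-mul {x} {y} (m , m≢0 , im , lx) (m′ , m′≢0 , im′ , ly) = m ℚ.* m′ , *≢0 m≢0 m′≢0 , isInt-* im im′ , λ k →
    subst Lat (trans (solve 4 (λ a x b y → a :* x :* (b :* y) := a :* b :* (x :* y)) refl (ι m) (x ^ k) (ι m′) (y ^ k))
      (cong₂ _·_ (sym (ι-mul m m′)) (sym (^-distrib-* x y k)))) (lat-mul {ι m · x ^ k} {ι m′ · y ^ k} (lx k) (ly k))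

  bd-add : ∀ {x y} → BD x → BD y → BD (x ⊕ y)
  bd-add {x} {y} (m , m≢0 , im , lx) (m′ , m′≢0 , im′ , ly) = m ℚ.* m′ , *≢0 m≢0 m′≢0 , isInt-* im im′ , λ k →
    subst Lat (solve 2 (λ a b → a :* (b :* (con (+ 1) :* con (+ 1))) := a :* b) refl (ι (m ℚ.* m′)) ((x ⊕ y) ^ k)) (claim k 0 0)
    where
    M = ι (m ℚ.* m′)
    -- Generalised to extra factors xⁱ yʲ, so that induction on k can expand one factor x + y at a
    -- time.
    claim : ∀ k i j → Lat (M · ((x ⊕ y) ^ k · (x ^ i · y ^ j)))
    claim zero i j = subst Lat (trans (solve 4 (λ a x b y → a :* x :* (b :* y) := a :* b :* (con (+ 1) :* (x :* y))) refl (ι m) (x ^ i) (ι m′) (y ^ j))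
      (cong (_· (1K · (x ^ i · y ^ j))) (sym (ι-mul m m′)))) (lat-mul {ι m · x ^ i} {ι m′ · y ^ j} (lx i) (ly j))
    claim (suc k) i j = subst Lat (solve 6 (λ M x y s a b → M :* (s :* (x :* a :* b)) :+ M :* (s :* (a :* (y :* b))) := M :* ((x :+ y) :* s :* (a :* b))) refl M x y ((x ⊕ y) ^ k) (x ^ i) (y ^ j))
      (lat-add {M · ((x ⊕ y) ^ k · (x ^ suc i · y ^ j))} {M · ((x ⊕ y) ^ k · (x ^ i · y ^ suc j))} (claim k (suc i) j) (claim k i (suc j)))

  commonDenominator : ∀ x d → ∃ λ m → m ≢ 0ℚ × IsInt m × (∀ k → k ℕ.< d → Lat (ι m · x ^ k))
  commonDenominator x zero = 1ℚ , (λ ()) , isInt-1 , λ k ()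
  commonDenominator x (suc d) = extend (commonDenominator x d) (lat-denominator (x ^ d))
    where
    extend : (∃ λ m → m ≢ 0ℚ × IsInt m × (∀ k → k ℕ.< d → Lat (ι m · x ^ k))) → HasDenominator (x ^ d) →
             ∃ λ m → m ≢ 0ℚ × IsInt m × (∀ k → k ℕ.< suc d → Lat (ι m · x ^ k))
    extend (m , m≢0 , im , lm) (m′ , m′≢0 , im′ , lm′) = m ℚ.* m′ , *≢0 m≢0 m′≢0 , isInt-* im im′ , cases
      where
      rescale : ∀ {c c′ y} → IsInt c′ → c ℚ.* c′ ≡ m ℚ.* m′ → Lat (ι c · y) → Lat (ι (m ℚ.* m′) · y)
      rescale {c} {c′} {y} ic′ eq l = subst Lat (trans (solve 3 (λ a b x → b :* (a :* x) := a :* b :* x) refl (ι c) (ι c′) y)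
        (cong (_· y) (trans (sym (ι-mul c c′)) (cong ι eq)))) (lat-mul {ι c′} {ι c · y} (lat-ι ic′) l)
      cases : ∀ k → k ℕ.< suc d → Lat (ι (m ℚ.* m′) · x ^ k)
      cases k k<1+d = [ (λ k<d → rescale {m} {m′} {x ^ k} im′ refl (lm k k<d))
        , (λ k≡d → rescale {m′} {m} {x ^ k} im (ℚP.*-comm m′ m) (subst (λ k → Lat (ι m′ · x ^ k)) (sym k≡d) lm′)) ]′
        (ℕP.m≤n⇒m<n∨m≡n (ℕP.≤-pred k<1+d))

  -- Denominators of w are absorbed by those of w, w², …, w^{P-1} and of the powers of w^P.
  bd-root : ∀ {x} P → BD (x ^ suc P) → BD x
  bd-root {x} P (m , m≢0 , im , lm) = m ℚ.* m′ , *≢0 m≢0 m′≢0 , isInt-* im im′ , λ k →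
    subst Lat (trans (solve 4 (λ a x b y → a :* x :* (b :* y) := a :* b :* (x :* y)) refl (ι m) ((x ^ suc P) ^ (k ℕ./ suc P)) (ι m′) (x ^ (k ℕ.% suc P)))
      (cong₂ _·_ (sym (ι-mul m m′)) (split k)))
      (lat-mul {ι m · (x ^ suc P) ^ (k ℕ./ suc P)} {ι m′ · x ^ (k ℕ.% suc P)} (lm (k ℕ./ suc P)) (lm′ (k ℕ.% suc P) (ℕDM.m%n<n k (suc P))))
    where
    cd = commonDenominator x (suc P)
    m′ = proj₁ cd
    m′≢0 = proj₁ (proj₂ cd)
    im′ = proj₁ (proj₂ (proj₂ cd))
    lm′ = proj₂ (proj₂ (proj₂ cd))
    split : ∀ k → (x ^ suc P) ^ (k ℕ./ suc P) · x ^ (k ℕ.% suc P) ≡ x ^ k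
    split k = trans (cong (_· x ^ (k ℕ.% suc P)) (^-assocʳ x (suc P) (k ℕ./ suc P))) (trans (sym (^-homo-* x (suc P ℕ.* (k ℕ./ suc P)) (k ℕ.% suc P)))
      (cong (x ^_) (trans (ℕP.+-comm (suc P ℕ.* (k ℕ./ suc P)) (k ℕ.% suc P)) (trans (cong (k ℕ.% suc P ℕ.+_) (ℕP.*-comm (suc P) (k ℕ./ suc P))) (sym (ℕDM.m≡m%n+[m/n]*n k (suc P)))))))

  -- A common denominator of the first d powers serves for all of them, because the monic equation
  -- expresses each later power as an integral combination of the d preceding ones.
  integral⇒bd : ∀ {x} → IsIntegral n x → BD x
  integral⇒bd {x} (cs , root) with commonDenominator x (len cs)
  ... | m , m≢0 , im , lm = m , m≢0 , im , λ k → window (suc k) k ℕP.≤-refl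
    where
    d = len cs
    lower : ∀ cs k j → (∀ i → i ℕ.< len cs → Lat (ι m · x ^ (k ℕ.+ i ℕ.+ j))) → Lat (ι m · (evalFrom n x k cs · x ^ j))
    lower List.[] k j _ = subst Lat (solve 2 (λ a y → con (+ 0) := a :* (con (+ 0) :* y)) refl (ι m) (x ^ j)) lat-0
    lower (c List.∷ cs) k j h = subst Lat (solve 5 (λ a c y e z → c :* (a :* (y :* z)) :+ a :* (e :* z) := a :* ((c :* y :+ e) :* z)) refl (ι m) (ι (ℤtoℚ c)) (x ^ k) (evalFrom n x (suc k) cs) (x ^ j) ∙ cong (λ u → ι m · (u · x ^ j)) (sym (trans (+K≡⊕ _ _) (cong (_⊕ evalFrom n x (suc k) cs) (trans (cong (ℤtoℚ c ·K_) (powK≡^ x k)) (·K≡ι· (ℤtoℚ c) (x ^ k)))))))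
      (lat-add {ι (ℤtoℚ c) · (ι m · (x ^ k · x ^ j))} {ι m · (evalFrom n x (suc k) cs · x ^ j)}
        (lat-mul {ι (ℤtoℚ c)} {ι m · (x ^ k · x ^ j)} (lat-ι (isInt-ℤtoℚ c))
           (subst (λ u → Lat (ι m · u)) (trans (cong (λ u → x ^ (u ℕ.+ j)) (ℕP.+-identityʳ k)) (^-homo-* x k j)) (h 0 (ℕ.s≤s ℕ.z≤n))))
        (lower cs (suc k) j (λ i i< → subst (λ u → Lat (ι m · x ^ (u ℕ.+ j))) (ℕP.+-suc k i) (h (suc i) (ℕ.s≤s i<)))))
      where
      infixr 2 _∙_
      _∙_ : {x y z : K} → x ≡ y → y ≡ z → x ≡ z
      _∙_ = trans
    step : ∀ j → (∀ i → i ℕ.< d ℕ.+ j → Lat (ι m · x ^ i)) → Lat (ι m · x ^ (d ℕ.+ j))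
    step j h = subst Lat (begin
      neg (ι m · (evalFrom n x 0 cs · x ^ j))                              ≡⟨ solve 4 (λ a e p z → :- (a :* (e :* z)) := a :* (p :* z) :- a :* ((p :+ e) :* z)) refl (ι m) (evalFrom n x 0 cs) (x ^ d) (x ^ j) ⟩
      ι m · (x ^ d · x ^ j) ⊕ neg (ι m · ((x ^ d ⊕ evalFrom n x 0 cs) · x ^ j))
                                                                           ≡⟨ cong (λ u → ι m · (x ^ d · x ^ j) ⊕ neg (ι m · (u · x ^ j))) (trans (cong (_⊕ evalFrom n x 0 cs) (sym (powK≡^ x d))) (trans (sym (+K≡⊕ _ _)) root)) ⟩
      ι m · (x ^ d · x ^ j) ⊕ neg (ι m · (0K · x ^ j))               ≡⟨ solve 3 (λ a p z → a :* (p :* z) :- a :* (con (+ 0) :* z) := a :* (p :* z)) refl (ι m) (x ^ d) (x ^ j) ⟩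
      ι m · (x ^ d · x ^ j)                                                ≡⟨ cong (ι m ·_) (sym (^-homo-* x d j)) ⟩
      ι m · x ^ (d ℕ.+ j) ∎)
      (lat-neg {ι m · (evalFrom n x 0 cs · x ^ j)} (lower cs 0 j (λ i i<d → h (i ℕ.+ j) (ℕP.+-monoˡ-< j i<d))))
      where open ≡-Reasoning
    window : ∀ k i → i ℕ.< k → Lat (ι m · x ^ i)
    window (suc k) i i<1+k with ℕP.m≤n⇒m<n∨m≡n (ℕP.≤-pred i<1+k)
    ... | inj₁ i<k = window k i i<k
    ... | inj₂ refl with i ℕ.<? d
    ... | yes i<d = lm i i<d
    ... | no i≮d = subst (λ u → Lat (ι m · x ^ u)) i≡ (step (i ℕ.∸ d) (λ l l< → window k l (subst (l ℕ.<_) i≡ l<)))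
      where
      i≡ : d ℕ.+ (i ℕ.∸ d) ≡ i
      i≡ = ℕP.m+[n∸m]≡n (ℕP.≮⇒≥ i≮d)

  N-mul : ∀ x y → N (x · y) ≡ N x ℚ.* N y
  N-mul x y = cong proj₁ {ι (N (x · y))} {ι (N x ℚ.* N y)} (begin
    ι (N (x · y))                ≡⟨ sym (mul-♯ (x · y)) ⟩
    x · y · (x · y) ♯            ≡⟨ cong (x · y ·_) (♯-mul x y) ⟩
    x · y · (x ♯ · y ♯)      ≡⟨ solve 4 (λ x y u v → x :* y :* (u :* v) := x :* u :* (y :* v)) refl x y (x ♯) (y ♯) ⟩
    (x · x ♯) · (y · y ♯)    ≡⟨ cong₂ _·_ (mul-♯ x) (mul-♯ y) ⟩
    ι (N x) · ι (N y)            ≡⟨ sym (ι-mul (N x) (N y)) ⟩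
    ι (N x ℚ.* N y) ∎)
    where open ≡-Reasoning

  N-^ : ∀ x k → N (x ^ k) ≡ N x ℚS.^ k
  N-^ x zero = trans (N-ι 1ℚ) refl
  N-^ x (suc k) = trans (N-mul x (x ^ k)) (cong (N x ℚ.*_) (N-^ x k))

  -- N (m xᵏ) = m³ (N x)ᵏ is an integer for every k, so the powers of the rational number N x have a
  -- bounded denominator.
  bd⇒intN : ∀ {x} → BD x → IsInt (N x)
  bd⇒intN {x} (m , m≢0 , im , lm) = boundedPowers⇒int (N x) (m ℚ.* m ℚ.* m) (*≢0 (*≢0 m≢0 m≢0) m≢0) (isInt-* (isInt-* im im) im)
    (λ k → subst IsInt (trans (N-mul (ι m) (x ^ k)) (cong₂ ℚ._*_ (N-ι m) (N-^ x k))) (lat⇒intN {ι m · x ^ k} (lm k)))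

  private
    -- The elements x ± 1 again have bounded denominators, and their norms expand into N x, e₂ x and
    -- tr x. Only the sum and the difference of e₂ and tr are reached this way, hence 2 tr x but not
    -- yet tr x.
    shifted-norms : ∀ {x} → BD x → IsInt (e₂ x ℚ.+ tr x) × IsInt (tr x ℚ.- e₂ x)
    shifted-norms {x} b = subst IsInt (trans (cong₂ (λ u v → u ℚ.- v ℚ.- 1ℚ) (N-add-ι x 1ℚ) refl)
                           (QR.solve 3 (λ N e t → N QR.:+ e QR.:* QR.con (+ 1) QR.:+ t QR.:* QR.con (+ 1) QR.:* QR.con (+ 1) QR.:+ QR.con (+ 1) QR.:* QR.con (+ 1) QR.:* QR.con (+ 1) QR.:- N QR.:- QR.con (+ 1) QR.:= e QR.:+ t) refl (N x) (e₂ x) (tr x)))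
                         (isInt-+ (isInt-+ (bd⇒intN (bd-add {x} {ι 1ℚ} b (bd-lat (lat-ι isInt-1)))) (isInt-neg (bd⇒intN b))) (isInt-neg isInt-1))
                      , subst IsInt (trans (cong₂ (λ u v → u ℚ.- v ℚ.+ 1ℚ) (N-add-ι x (ℚ.- 1ℚ)) refl)
                           (QR.solve 3 (λ N e t → N QR.:+ e QR.:* QR.con (ℤ.- + 1) QR.:+ t QR.:* QR.con (ℤ.- + 1) QR.:* QR.con (ℤ.- + 1) QR.:+ QR.con (ℤ.- + 1) QR.:* QR.con (ℤ.- + 1) QR.:* QR.con (ℤ.- + 1) QR.:- N QR.:+ QR.con (+ 1) QR.:= t QR.:- e) refl (N x) (e₂ x) (tr x)))
                         (isInt-+ (isInt-+ (bd⇒intN (bd-add {x} {ι (ℚ.- 1ℚ)} b (bd-lat (lat-ι (isInt-neg isInt-1))))) (isInt-neg (bd⇒intN b))) isInt-1)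

    double-tr : ∀ {x} → BD x → IsInt (tr x ℚ.+ tr x)
    double-tr {x} b = subst IsInt (QR.solve 2 (λ e t → e QR.:+ t QR.:+ (t QR.:- e) QR.:= t QR.:+ t) refl (e₂ x) (tr x))
      (isInt-+ (proj₁ (shifted-norms b)) (proj₂ (shifted-norms b)))

  -- `tr-square` writes 2 (tr x)² as 2 tr (x²) + 4 e₂ x, an integer by `double-tr` at x² and the
  -- integrality of 2 e₂ x. Together with 2 tr x this removes the half.
  bd⇒int-tr : ∀ {x} → BD x → IsInt (tr x)
  bd⇒int-tr {x} b = half-isInt (tr x) (double-tr b) (subst IsInt
    (trans (QR.solve 3 (λ s e t → s QR.:+ s QR.:+ (e QR.:+ t QR.:- (t QR.:- e) QR.:+ (e QR.:+ t QR.:- (t QR.:- e))) QR.:= (s QR.:+ QR.con (+ 2) QR.:* e) QR.:+ (s QR.:+ QR.con (+ 2) QR.:* e)) refl (tr (x · x)) (e₂ x) (tr x))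
      (cong₂ ℚ._+_ (tr-square x) (tr-square x)))
    (isInt-+ (double-tr (bd-mul {x} {x} b b)) (isInt-+ 2e 2e)))
    where
    2e = isInt-+ (proj₁ (shifted-norms b)) (isInt-neg (proj₂ (shifted-norms b)))

  bd⇒int-e₂ : ∀ {x} → BD x → IsInt (e₂ x)
  bd⇒int-e₂ {x} b = subst IsInt (QR.solve 2 (λ e t → e QR.:+ t QR.:- t QR.:= e) refl (e₂ x) (tr x))
    (isInt-+ (proj₁ (shifted-norms b)) (isInt-neg (bd⇒int-tr b)))

  -- The characteristic polynomial is the required monic equation: its coefficients are integers by
  -- the preceding lemmas, and x is a root by `cayley-hamilton`.
  bd⇒integral : ∀ {x} → BD x → IsIntegral n x
  bd⇒integral {x} b = from (isInt-neg (bd⇒intN b)) (bd⇒int-e₂ b) (isInt-neg (bd⇒int-tr b))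
    where
    from : IsInt (ℚ.- N x) → IsInt (e₂ x) → IsInt (ℚ.- tr x) → IsIntegral n x
    from (c₀ , e₀) (c₁ , e₁) (c₂ , e₂′) = c₀ List.∷ c₁ List.∷ c₂ List.∷ List.[] , (begin
      evalMonic n (c₀ List.∷ c₁ List.∷ c₂ List.∷ List.[]) x
        ≡⟨ trans (+K≡⊕ _ _) (cong₂ _⊕_ (powK≡^ x 3) (trans (term c₀ 0 _) (cong (ι (ℤtoℚ c₀) · x ^ 0 ⊕_) (trans (term c₁ 1 _) (cong (ι (ℤtoℚ c₁) · x ^ 1 ⊕_) (term c₂ 2 _)))))) ⟩
      x ^ 3 ⊕ (ι (ℤtoℚ c₀) · x ^ 0 ⊕ (ι (ℤtoℚ c₁) · x ^ 1 ⊕ (ι (ℤtoℚ c₂) · x ^ 2 ⊕ 0K)))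
        ≡⟨ cong (x ^ 3 ⊕_) (cong₂ (λ u v → ι u · x ^ 0 ⊕ v) (coeff e₀) (cong₂ (λ u v → ι u · x ^ 1 ⊕ (ι v · x ^ 2 ⊕ 0K)) (coeff e₁) (coeff e₂′))) ⟩
      x ^ 3 ⊕ (ι (ℚ.- N x) · x ^ 0 ⊕ (ι (e₂ x) · x ^ 1 ⊕ (ι (ℚ.- tr x) · x ^ 2 ⊕ 0K)))
        ≡⟨ cong₂ (λ u v → x ^ 3 ⊕ (u · x ^ 0 ⊕ (ι (e₂ x) · x ^ 1 ⊕ (v · x ^ 2 ⊕ 0K)))) (ι-neg (N x)) (ι-neg (tr x)) ⟩
      x ^ 3 ⊕ (neg (ι (N x)) · x ^ 0 ⊕ (ι (e₂ x) · x ^ 1 ⊕ (neg (ι (tr x)) · x ^ 2 ⊕ 0K)))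
        ≡⟨ solve 4 (λ x N e t → x :* (x :* (x :* con (+ 1))) :+ (:- N :* con (+ 1) :+ (e :* (x :* con (+ 1)) :+ (:- t :* (x :* (x :* con (+ 1))) :+ con (+ 0)))) := x :* x :* x :+ e :* x :- (t :* (x :* x) :+ N)) refl x (ι (N x)) (ι (e₂ x)) (ι (tr x)) ⟩
      x · x · x ⊕ ι (e₂ x) · x ⊕ neg (ι (tr x) · (x · x) ⊕ ι (N x))
        ≡⟨ cong (_⊕ neg (ι (tr x) · (x · x) ⊕ ι (N x))) (cayley-hamilton x) ⟩
      ι (tr x) · (x · x) ⊕ ι (N x) ⊕ neg (ι (tr x) · (x · x) ⊕ ι (N x))
        ≡⟨ solve 1 (λ u → u :- u := con (+ 0)) refl (ι (tr x) · (x · x) ⊕ ι (N x)) ⟩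
      0K ∎)
      where
      open ≡-Reasoning
      coeff : ∀ {q c} → q ≡ int c → ℤtoℚ c ≡ q
      coeff {c = c} e = trans (sym (int≡ℤtoℚ c)) (sym e)
      term : ∀ c k y → (ℤtoℚ c ·K powK n x k) +K y ≡ ι (ℤtoℚ c) · x ^ k ⊕ y
      term c k y = trans (+K≡⊕ _ _) (cong (_⊕ y) (trans (·K≡ι· (ℤtoℚ c) (powK n x k)) (cong (ι (ℤtoℚ c) ·_) (powK≡^ x k))))

  unit-norm : ∀ {u v} → BD u → BD v → u · v ≡ 1K → N u ≡ 1ℚ ⊎ N u ≡ ℚ.- 1ℚ
  unit-norm {u} {v} bu bv uv≡1 = signs (bd⇒intN bu) (bd⇒intN bv)
    where
    signs : IsInt (N u) → IsInt (N v) → N u ≡ 1ℚ ⊎ N u ≡ ℚ.- 1ℚ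
    signs (i , Nu≡i) (j , Nv≡j) = case i (ℕP.m*n≡1⇒m≡1 ℤ.∣ i ∣ ℤ.∣ j ∣ (trans (sym (ℤP.abs-* i j)) (cong ℤ.∣_∣ ij≡1))) Nu≡i
      where
      ij≡1 : i ℤ.* j ≡ + 1
      ij≡1 = int-injective (trans (int-* i j) (trans (cong₂ ℚ._*_ (sym Nu≡i) (sym Nv≡j)) (trans (sym (N-mul u v)) (trans (cong N uv≡1) (trans (N-ι 1ℚ) (sym int-1))))))
      case : ∀ i → ℤ.∣ i ∣ ≡ 1 → N u ≡ int i → N u ≡ 1ℚ ⊎ N u ≡ ℚ.- 1ℚ
      case (+ .1) refl e = inj₁ (trans e int-1)
      case -[1+ .0 ] refl e = inj₂ (trans e (trans (int-neg (+ 1)) (cong ℚ.-_ int-1)))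

-- Ideals

module Ideals (n : ℕ) where

  open CubicField n
  open KS.Solver using (solve; _:+_; _:*_; :-_; _:-_; con; _:=_)

  integral-add : ∀ {x y} → IsIntegral n x → IsIntegral n y → IsIntegral n (x ⊕ y)
  integral-add {x} {y} p q = bd⇒integral (bd-add {x} {y} (integral⇒bd p) (integral⇒bd q))

  integral-mul : ∀ {x y} → IsIntegral n x → IsIntegral n y → IsIntegral n (x · y)
  integral-mul {x} {y} p q = bd⇒integral (bd-mul {x} {y} (integral⇒bd p) (integral⇒bd q))

  lat-integral : ∀ {x} → Lat x → IsIntegral n x
  lat-integral l = bd⇒integral (bd-lat l)

  record IsModule (I : K → Set) : Set where
    field
      zero∈ : I 0K
      +-closed : ∀ {x y} → I x → I y → I (x ⊕ y)
      absorb : ∀ {a x} → IsIntegral n a → I x → I (a · x)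

  open IsModule

  integral-isModule : IsModule (IsIntegral n)
  integral-isModule = record { zero∈ = lat-integral lat-0 ; +-closed = integral-add ; absorb = integral-mul }

  prod : ∀ {I J a b} → I a → J b → IsModule J → Prod n I J (a · b)
  prod {I} {J} {a} {b} ia jb mJ = subst (Prod n I J) (trans (+K≡⊕ _ _) (trans (cong (_⊕ 0K) (mulK≡· a b)) (solve 1 (λ x → x :+ con (+ 0) := x) refl (a · b)))) (pstep ia jb pzero)

  prod-elim : ∀ {I J} (S : K → Set) → S 0K → (∀ {a b x} → I a → J b → S x → S (a · b ⊕ x)) → ∀ {x} → Prod n I J x → S x
  prod-elim S s₀ s₁ pzero = s₀
  prod-elim S s₀ s₁ (pstep {a} {b} {x} ia jb p) = subst S (sym (trans (+K≡⊕ _ _) (cong (_⊕ x) (mulK≡· a b)))) (s₁ ia jb (prod-elim S s₀ s₁ p))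

  prod-step : ∀ {I J a b x} → I a → J b → Prod n I J x → Prod n I J (a · b ⊕ x)
  prod-step {I} {J} {a} {b} {x} ia jb p = subst (Prod n I J) (trans (+K≡⊕ _ _) (cong (_⊕ x) (mulK≡· a b))) (pstep ia jb p)

  prod-isModule : ∀ {I J} → IsModule I → IsModule (Prod n I J)
  prod-isModule {I} {J} mI = record
    { zero∈ = pzero
    ; +-closed = λ {x} {y} px py → prod-elim (λ x → Prod n I J (x ⊕ y))
        (subst (Prod n I J) (solve 1 (λ y → y := con (+ 0) :+ y) refl y) py)
        (λ {a} {b} {x} ia jb p → subst (Prod n I J) (solve 4 (λ a b x y → a :* b :+ (x :+ y) := a :* b :+ x :+ y) refl a b x y) (prod-step ia jb p))
        px
    ; absorb = λ {o} io p → prod-elim (λ x → Prod n I J (o · x))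
        (subst (Prod n I J) (solve 1 (λ o → con (+ 0) := o :* con (+ 0)) refl o) pzero)
        (λ {a} {b} {x} ia jb p → subst (Prod n I J) (solve 4 (λ o a b x → o :* a :* b :+ o :* x := o :* (a :* b :+ x)) refl o a b x) (prod-step (absorb mI io ia) jb p))
        p
    }

  module Powers {J : K → Set} (mJ : IsModule J) where

    private
      J^ : ℕ → K → Set
      J^ = IdealPow n J

    pow-isModule : ∀ k → IsModule (J^ k)
    pow-isModule zero = integral-isModule
    pow-isModule (suc k) = prod-isModule mJ

    pow-mul : ∀ a b {x y} → J^ a x → J^ b y → J^ (a ℕ.+ b) (x · y)
    pow-mul zero b ix jy = absorb (pow-isModule b) ix jy
    pow-mul (suc a) b {x} {y} px jy = prod-elim (λ x → J^ (suc a ℕ.+ b) (x · y))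
      (subst (J^ (suc a ℕ.+ b)) (solve 1 (λ y → con (+ 0) := con (+ 0) :* y) refl y) pzero)
      (λ {e} {c} {x} je jc p → subst (J^ (suc a ℕ.+ b)) (solve 4 (λ e c x y → e :* (c :* y) :+ x :* y := (e :* c :+ x) :* y) refl e c x y)
        (prod-step je (pow-mul a b jc jy) p))
      px

    pow-^ : ∀ k m {x} → J^ k x → J^ (m ℕ.* k) (x ^ m)
    pow-^ k zero jx = lat-integral lat-1
    pow-^ k (suc m) jx = pow-mul k (m ℕ.* k) jx (pow-^ k m jx)

    element^ : ∀ m {x} → J x → J^ m (x ^ m)
    element^ zero jx = lat-integral lat-1
    element^ (suc m) jx = prod jx (element^ m jx) (pow-isModule m)

    Divides : ℕ → K → Set
    Divides k β = ∀ {x} → J^ k x → ∃ λ o → IsIntegral n o × x ≡ β · o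

    private
      -- Products of ideals are nested to the right, so the first k factors are gathered one by one
      -- in the accumulator c ∈ Jʲ until they form an element of Jᵏ, which β divides.
      split : ∀ {k β} → Divides k β → ∀ a b j → a ℕ.+ j ≡ k → ∀ {c x} → J^ j c → J^ (a ℕ.+ b) x → ∃ λ y → J^ b y × c · x ≡ β · y
      split {k} {β} div zero b .k refl {c} {x} jc jx = from (div jc)
        where
        from : (∃ λ o → IsIntegral n o × c ≡ β · o) → ∃ λ y → J^ b y × c · x ≡ β · y
        from (o , io , eq) = o · x , absorb (pow-isModule b) io jx , trans (cong (_· x) eq) (solve 3 (λ β o x → β :* o :* x := β :* (o :* x)) refl β o x)
      split {k} {β} div (suc a) b j eq {c} jc jx = prod-elim (λ x → ∃ λ y → J^ b y × c · x ≡ β · y)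
        (0K , zero∈ (pow-isModule b) , solve 2 (λ c β → c :* con (+ 0) := β :* con (+ 0)) refl c β)
        (λ {e} {d} {x} je jd IH → combine {e} {d} {x} (split div a b (suc j) (trans (ℕP.+-suc a j) eq) (prod je jc (pow-isModule j)) jd) IH)
        jx
        where
        combine : ∀ {e d x} → (∃ λ y → J^ b y × (e · c) · d ≡ β · y) → (∃ λ y → J^ b y × c · x ≡ β · y) → ∃ λ y → J^ b y × c · (e · d ⊕ x) ≡ β · y
        combine {e} {d} {x} (y , jy , p) (y′ , jy′ , p′) = y ⊕ y′ , +-closed (pow-isModule b) jy jy′ ,
          trans (solve 4 (λ c e d x → c :* (e :* d :+ x) := e :* c :* d :+ c :* x) refl c e d x)
            (trans (cong₂ _⊕_ p p′) (solve 3 (λ β y y′ → β :* y :+ β :* y′ := β :* (y :+ y′)) refl β y y′))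

    divides-pow : ∀ {k β} → Divides k β → ∀ m → Divides (m ℕ.* k) (β ^ m)
    divides-pow div zero {x} ix = x , ix , solve 1 (λ x → x := con (+ 1) :* x) refl x
    divides-pow {k} {β} div (suc m) {x} jx = from (split div k (m ℕ.* k) 0 (ℕP.+-identityʳ k) (lat-integral lat-1) jx)
      where
      next : ∀ {y} → 1K · x ≡ β · y → (∃ λ o → IsIntegral n o × y ≡ β ^ m · o) → ∃ λ o → IsIntegral n o × x ≡ β ^ suc m · o
      next {y} eq (o , io , eq′) = o , io , trans (solve 1 (λ x → x := con (+ 1) :* x) refl x) (trans eq (trans (cong (β ·_) eq′) (solve 3 (λ b c o → b :* (c :* o) := b :* c :* o) refl β (β ^ m) o)))
      from : (∃ λ y → J^ (m ℕ.* k) y × 1K · x ≡ β · y) → ∃ λ o → IsIntegral n o × x ≡ β ^ suc m · o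
      from (y , jy , eq) = next eq (divides-pow div m jy)

    principal⇒generator : ∀ {k} ((β , _) : IsPrincipal n (J^ k)) → Divides k β × J^ k β
    principal⇒generator (β , iβ , iff) =
      (λ jx → let o , io , eq = proj₁ (iff _) jx in o , io , trans eq (mulK≡· β o)) ,
      proj₂ (iff β) (1K , lat-integral lat-1 , sym (trans (mulK≡· β 1K) (solve 1 (λ x → x :* con (+ 1) := x) refl β)))

    generator⇒principal : ∀ {k β} → IsIntegral n β → Divides k β → J^ k β → IsPrincipal n (J^ k)
    generator⇒principal {k} {β} iβ div jβ = β , iβ , λ x →
      (λ jx → let o , io , eq = div jx in o , io , trans eq (sym (mulK≡· β o))) ,
      (λ { (o , io , eq) → subst (J^ k) (trans (solve 2 (λ o β → o :* β := β :* o) refl o β) (sym (trans eq (mulK≡· β o)))) (absorb (pow-isModule k) io jβ) })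

    -- Both α^k and β^r generate J^(k r): each lies in it, and each divides all of it by
    -- `divides-pow`.
    associated : ∀ {k r α β} → Divides r α × J^ r α → Divides k β × J^ k β →
      ∃₂ λ u v → IsIntegral n u × IsIntegral n v × α ^ k ≡ β ^ r · u × β ^ r ≡ α ^ k · v
    associated {k} {r} {α} {β} (divα , jα) (divβ , jβ) = pair
      (divides-pow divβ r (subst (λ e → J^ e (α ^ k)) (ℕP.*-comm k r) (pow-^ r k jα)))
      (divides-pow divα k (subst (λ e → J^ e (β ^ r)) (ℕP.*-comm r k) (pow-^ k r jβ)))
      where
      pair : (∃ λ o → IsIntegral n o × α ^ k ≡ β ^ r · o) → (∃ λ o → IsIntegral n o × β ^ r ≡ α ^ k · o) →
        ∃₂ λ u v → IsIntegral n u × IsIntegral n v × α ^ k ≡ β ^ r · u × β ^ r ≡ α ^ k · v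
      pair (u , iu , eu) (v , iv , ev) = u , v , iu , iv , eu , ev

  -- The ideal (t , α) has r-th power (α) as soon as α and its cofactor α ♯ are comaximal and N α = tʳ.
  module RootIdeal (α : K) (t : ℚ) (r : ℕ) (lα : Lat α) (it : IsInt t) (Nα : N α ≡ t ℚS.^ r)
    (comax : ∃₂ λ u v → IsIntegral n u × IsIntegral n v × 1K ≡ u · α ⊕ v · α ♯) where

    J : K → Set
    J x = ∃₂ λ u v → IsIntegral n u × IsIntegral n v × x ≡ ι t · u ⊕ α · v

    J-isModule : IsModule J
    J-isModule = record
      { zero∈ = 0K , 0K , lat-integral lat-0 , lat-integral lat-0 , solve 2 (λ t a → con (+ 0) := t :* con (+ 0) :+ a :* con (+ 0)) refl (ι t) α
      ; +-closed = λ { (u , v , iu , iv , e) (u′ , v′ , iu′ , iv′ , e′) → u ⊕ u′ , v ⊕ v′ , integral-add iu iu′ , integral-add iv iv′ ,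
          trans (cong₂ _⊕_ e e′) (solve 6 (λ t a u v u′ v′ → t :* u :+ a :* v :+ (t :* u′ :+ a :* v′) := t :* (u :+ u′) :+ a :* (v :+ v′)) refl (ι t) α u v u′ v′) }
      ; absorb = λ { {o} io (u , v , iu , iv , e) → o · u , o · v , integral-mul io iu , integral-mul io iv ,
          trans (cong (o ·_) e) (solve 5 (λ o t a u v → o :* (t :* u :+ a :* v) := t :* (o :* u) :+ a :* (o :* v)) refl o (ι t) α u v) }
      }

    open Powers J-isModule

    private
      iα : IsIntegral n α
      iα = lat-integral lα

      t∈J : J (ι t)
      t∈J = 1K , 0K , lat-integral lat-1 , lat-integral lat-0 , solve 2 (λ t a → t := t :* con (+ 1) :+ a :* con (+ 0)) refl (ι t) α

      α∈J : J α
      α∈J = 0K , 1K , lat-integral lat-0 , lat-integral lat-1 , solve 2 (λ t a → a := t :* con (+ 0) :+ a :* con (+ 1)) refl (ι t) α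

    J-isIdeal : t ≢ 0ℚ → IsIdeal n J
    J-isIdeal t≢0 = record
      { ⊆O = λ { (u , v , iu , iv , e) → subst (IsIntegral n) (sym e) (integral-add (integral-mul (lat-integral (lat-ι it)) iu) (integral-mul iα iv)) }
      ; zero∈ = zero∈ J-isModule
      ; +-closed = λ {x} {y} jx jy → subst J (sym (+K≡⊕ x y)) (+-closed J-isModule jx jy)
      ; O-absorb = λ {a} {x} ia jx → subst J (sym (mulK≡· a x)) (absorb J-isModule ia jx)
      ; nonzero = ι t , t∈J , λ e → t≢0 (cong proj₁ e)
      }

    private
      form : ∀ k {x} → IdealPow n J k x → ∃₂ λ a b → IsIntegral n a × IsIntegral n b × x ≡ ι t ^ k · a ⊕ α · b
      form zero {x} ix = x , 0K , ix , lat-integral lat-0 , solve 2 (λ x a → x := con (+ 1) :* x :+ a :* con (+ 0)) refl x α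
      form (suc k) = prod-elim (λ x → ∃₂ λ a b → IsIntegral n a × IsIntegral n b × x ≡ ι t ^ suc k · a ⊕ α · b)
        (0K , 0K , lat-integral lat-0 , lat-integral lat-0 , solve 2 (λ t a → con (+ 0) := t :* con (+ 0) :+ a :* con (+ 0)) refl (ι t ^ suc k) α)
        (λ je jd IH → combine je (form k jd) IH)
        where
        combine : ∀ {e d x} → J e → (∃₂ λ a b → IsIntegral n a × IsIntegral n b × d ≡ ι t ^ k · a ⊕ α · b) →
          (∃₂ λ a b → IsIntegral n a × IsIntegral n b × x ≡ ι t ^ suc k · a ⊕ α · b) →
          ∃₂ λ a b → IsIntegral n a × IsIntegral n b × e · d ⊕ x ≡ ι t ^ suc k · a ⊕ α · b
        combine {e} {d} (u , v , iu , iv , refl) (a , b , ia , ib , refl) (a′ , b′ , ia′ , ib′ , refl) =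
          u · a ⊕ a′ , (ι t · u) · b ⊕ (v · d ⊕ b′) ,
          integral-add (integral-mul iu ia) ia′ ,
          integral-add (integral-mul (integral-mul (lat-integral (lat-ι it)) iu) ib) (integral-add (integral-mul iv (integral-add (integral-mul (lat-integral (lat-^ k (lat-ι it))) ia) (integral-mul iα ib))) ib′) ,
          solve 9 (λ t T α u v a b a′ b′ → (t :* u :+ α :* v) :* (T :* a :+ α :* b) :+ (t :* T :* a′ :+ α :* b′)
             := t :* T :* (u :* a :+ a′) :+ α :* (t :* u :* b :+ (v :* (T :* a :+ α :* b) :+ b′))) refl (ι t) (ι t ^ k) α u v a b a′ b′

      ι-^ : ∀ s k → ι (s ℚS.^ k) ≡ ι s ^ k
      ι-^ s zero = refl
      ι-^ s (suc k) = trans (ι-mul s (s ℚS.^ k)) (cong (ι s ·_) (ι-^ s k))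

      t^r≡ : ι t ^ r ≡ α · α ♯
      t^r≡ = trans (sym (ι-^ t r)) (trans (cong ι (sym Nα)) (sym (mul-♯ α)))

      comax^ : ∀ k → ∃₂ λ u v → IsIntegral n u × IsIntegral n v × 1K ≡ u · α ^ k ⊕ v · α ♯
      comax^ zero = 1K , 0K , lat-integral lat-1 , lat-integral lat-0 , solve 1 (λ a → con (+ 1) := con (+ 1) :* con (+ 1) :+ con (+ 0) :* a) refl (α ♯)
      comax^ (suc k) = step comax (comax^ k)
        where
        step : (∃₂ λ u v → IsIntegral n u × IsIntegral n v × 1K ≡ u · α ⊕ v · α ♯) → (∃₂ λ u v → IsIntegral n u × IsIntegral n v × 1K ≡ u · α ^ k ⊕ v · α ♯) →
          ∃₂ λ u v → IsIntegral n u × IsIntegral n v × 1K ≡ u · α ^ suc k ⊕ v · α ♯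
        step (u , v , iu , iv , e) (u′ , v′ , iu′ , iv′ , e′) =
          u′ · u , u′ · α ^ k · v ⊕ v′ , integral-mul iu′ iu ,
          integral-add (integral-mul (integral-mul iu′ (lat-integral (lat-^ k lα))) iv) iv′ ,
          trans e′ (trans (cong (λ w → w ⊕ v′ · α ♯) (trans (solve 1 (λ x → x := x :* con (+ 1)) refl (u′ · α ^ k)) (cong (u′ · α ^ k ·_) e)))
            (solve 7 (λ u v u′ v′ α a β → u′ :* a :* (u :* α :+ v :* β) :+ v′ :* β := u′ :* u :* (α :* a) :+ (u′ :* a :* v :+ v′) :* β) refl u v u′ v′ α (α ^ k) (α ♯)))

    -- By `form` the power Jʳ lies in (tʳ , α), and tʳ = N α = α · α ♯ is itself a multiple of α.
    J^r-divides : Divides r α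
    J^r-divides {x} jx = from (form r jx)
      where
      from : (∃₂ λ a b → IsIntegral n a × IsIntegral n b × x ≡ ι t ^ r · a ⊕ α · b) → ∃ λ o → IsIntegral n o × x ≡ α · o
      from (a , b , ia , ib , eq) = α ♯ · a ⊕ b , integral-add (integral-mul (lat-integral (lat-♯ lα)) ia) ib ,
        trans eq (trans (cong (λ u → u · a ⊕ α · b) t^r≡) (solve 4 (λ α s a b → α :* s :* a :+ α :* b := α :* (s :* a :+ b)) refl α (α ♯) a b))

    -- Multiplying 1 = u α^(r-1) + v α ♯ by α gives α = u αʳ + v tʳ, and both terms lie in Jʳ.
    α∈J^r : ∀ r′ → r ≡ suc r′ → IdealPow n J r α
    α∈J^r r′ refl = from (comax^ r′)
      where
      from : (∃₂ λ u v → IsIntegral n u × IsIntegral n v × 1K ≡ u · α ^ r′ ⊕ v · α ♯) → IdealPow n J r α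
      from (u , v , iu , iv , e) = subst (IdealPow n J r)
        (trans (cong (λ w → u · α ^ r ⊕ v · w) t^r≡)
          (trans (solve 5 (λ u v α a s → u :* (α :* a) :+ v :* (α :* s) := α :* (u :* a :+ v :* s)) refl u v α (α ^ r′) (α ♯))
            (trans (cong (α ·_) (sym e)) (solve 1 (λ a → a :* con (+ 1) := a) refl α))))
        (+-closed (pow-isModule r) (absorb (pow-isModule r) iu (element^ r α∈J)) (absorb (pow-isModule r) iv (element^ r t∈J)))

-- Real roots by bisection

2^ : ℕ → ℚ
2^ k = ℚS.fromℤ (+ 2) ℚS.^ k

int-mono-ℕ : ∀ {a b} → a ℕ.≤ b → int (+ a) ℚ.≤ int (+ b)
int-mono-ℕ le = int-mono-≤ (ℤ.+≤+ le)

2^≡ : ∀ k → 2^ k ≡ int (+ (2 ℕ.^ k))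
2^≡ zero = sym int-1
2^≡ (suc k) = trans (cong₂ ℚ._*_ (fromℕ≡ 2) (2^≡ k)) (trans (sym (int-* (+ 2) (+ (2 ℕ.^ k)))) (cong int (sym (ℤP.pos-* 2 (2 ℕ.^ k)))))

0≤int : ∀ k → 0ℚ ℚ.≤ int (+ k)
0≤int k = subst (ℚ._≤ int (+ k)) int-0 (int-mono-ℕ ℕ.z≤n)

0≤2^ : ∀ k → 0ℚ ℚ.≤ 2^ k
0≤2^ k = subst (0ℚ ℚ.≤_) (sym (2^≡ k)) (0≤int _)

upperInt : ∀ q → ∃ λ k → q ℚ.≤ int (+ k)
upperInt q = k , q≤
  where
  k = ℤ.∣ ℚ.numerator q ∣
  i≤∣i∣ : ∀ i → i ℤ.≤ + ℤ.∣ i ∣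
  i≤∣i∣ (+ n) = ℤP.≤-refl
  i≤∣i∣ -[1+ n ] = ℤ.-≤+
  d = proj₁ (denominator q)
  dq : int (+ suc d) ℚ.* q ≡ int (ℚ.numerator q)
  dq = proj₂ (denominator q)
  1≤d : 1ℚ ℚ.≤ int (+ suc d)
  1≤d = subst (ℚ._≤ int (+ suc d)) int-1 (int-mono-ℕ (ℕ.s≤s ℕ.z≤n))
  q≤ : q ℚ.≤ int (+ k)
  q≤ with ℚP.≤-total 0ℚ q
  ... | inj₁ 0≤q = ℚP.≤-trans (subst₂ ℚ._≤_ (ℚP.*-identityˡ q) dq (ℚP.*-monoʳ-≤-nonNeg q {{ℚ.nonNegative 0≤q}} 1≤d)) (int-mono-≤ (i≤∣i∣ (ℚ.numerator q)))
  ... | inj₂ q≤0 = ℚP.≤-trans q≤0 (0≤int k)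

archimedean : ∀ X ε → 0ℚ ℚ.< ε → ∃ λ k → X ℚ.≤ ε ℚ.* 2^ k
archimedean X ε 0<ε = k , (begin
  X                        ≡⟨ sym (ℚP.*-identityʳ X) ⟩
  X ℚ.* 1ℚ                 ≡⟨ cong (X ℚ.*_) (sym εi≡1) ⟩
  X ℚ.* (ε ℚ.* i)          ≡⟨ solve 3 (λ X e i → X :* (e :* i) := e :* (X :* i)) refl X ε i ⟩
  ε ℚ.* (X ℚ.* i)          ≤⟨ ℚP.*-monoˡ-≤-nonNeg ε {{ℚ.nonNegative (ℚP.<⇒≤ 0<ε)}} (ℚP.≤-trans Xi≤k (int-mono-ℕ (ℕP.<⇒≤ (k<2+n^k 0 k)))) ⟩
  ε ℚ.* int (+ (2 ℕ.^ k))  ≡⟨ cong (ε ℚ.*_) (sym (2^≡ k)) ⟩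
  ε ℚ.* 2^ k ∎)
  where
  open ℚP.≤-Reasoning
  open ℚS.Solver using (solve; _:*_; _:=_)
  ε⁻¹ : ∃ λ i → ε ℚ.* i ≡ 1ℚ
  ε⁻¹ = inverse (λ e → ℚP.<-irrefl (sym e) 0<ε)
  i = proj₁ ε⁻¹
  εi≡1 = proj₂ ε⁻¹
  k = proj₁ (upperInt (X ℚ.* i))
  Xi≤k = proj₂ (upperInt (X ℚ.* i))

record Bracket (g : ℚ → ℚ) (l u w : ℚ) : Set where
  field
    lo hi : ℚ
    l≤lo : l ℚ.≤ lo
    hi≤u : hi ℚ.≤ u
    width : hi ≡ lo ℚ.+ w
    g-lo : g lo ℚ.≤ 0ℚ
    g-hi : 0ℚ ℚ.≤ g hi

bisect : ∀ g l u w → 0ℚ ℚ.≤ w → Bracket g l u (w ℚ.+ w) → Bracket g l u w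
bisect g l u w 0≤w b with ℚP.≤-total (g (Bracket.lo b ℚ.+ w)) 0ℚ
... | inj₁ g≤0 = record { lo = Bracket.lo b ℚ.+ w ; hi = Bracket.hi b ; l≤lo = ℚP.≤-trans (Bracket.l≤lo b) (≤-byDiff w 0≤w refl)
  ; hi≤u = Bracket.hi≤u b ; width = trans (Bracket.width b) (sym (ℚP.+-assoc (Bracket.lo b) w w)) ; g-lo = g≤0 ; g-hi = Bracket.g-hi b }
... | inj₂ 0≤g = record { lo = Bracket.lo b ; hi = Bracket.lo b ℚ.+ w ; l≤lo = Bracket.l≤lo b
  ; hi≤u = ℚP.≤-trans (≤-byDiff w 0≤w (trans (ℚP.+-assoc (Bracket.lo b) w w) (sym (Bracket.width b)))) (Bracket.hi≤u b) ; width = refl ; g-lo = Bracket.g-lo b ; g-hi = 0≤g }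

bisect^ : ∀ g l u k w → 0ℚ ℚ.≤ w → Bracket g l u (2^ k ℚ.* w) → Bracket g l u w
bisect^ g l u zero w 0≤w b = subst (Bracket g l u) (ℚP.*-identityˡ w) b
bisect^ g l u (suc k) w 0≤w b = bisect^ g l u k w 0≤w (bisect g l u (2^ k ℚ.* w) (0≤-* (0≤2^ k) 0≤w)
  (subst (Bracket g l u) (solve 2 (λ p w → con (+ 2) :* p :* w := p :* w :+ p :* w) refl (2^ k) w) b))
  where open ℚS.Solver

-- The one-sided Lipschitz bound replaces continuity. Once the bracket has width w with L w ≤ ε, the
-- value at its left end is at most L w below a nonnegative one.
approximateRoot : ∀ (g : ℚ → ℚ) L l u → 0ℚ ℚ.≤ L → l ℚ.≤ u →
  (∀ x y → l ℚ.≤ x → x ℚ.≤ y → y ℚ.≤ u → g y ℚ.≤ g x ℚ.+ L ℚ.* (y ℚ.- x)) →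
  g l ℚ.≤ 0ℚ → 0ℚ ℚ.≤ g u → ∀ ε → 0ℚ ℚ.< ε →
  ∃ λ s → l ℚ.≤ s × s ℚ.≤ u × ℚ.- ε ℚ.≤ g s × g s ℚ.≤ 0ℚ
approximateRoot g L l u 0≤L l≤u lip gl gu ε 0<ε = refine (archimedean (L ℚ.* (u ℚ.- l)) ε 0<ε)
  where
  2^≢0 : ∀ k → 2^ k ≢ 0ℚ
  2^≢0 k e = ℕP.<⇒≢ (ℕP.≤-trans (ℕ.s≤s ℕ.z≤n) (k<2+n^k 0 k)) (sym (ℤP.+-injective (int-injective (trans (sym (2^≡ k)) (trans e (sym int-0))))))
  open ℚS.Solver using (solve; _:*_; _:+_; _:-_; :-_; con; _:=_)
  found : ∀ p → 0ℚ ℚ.≤ p → L ℚ.* (u ℚ.- l) ℚ.≤ ε ℚ.* p → (∃ λ i → p ℚ.* i ≡ 1ℚ) →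
    (∀ w → 0ℚ ℚ.≤ w → Bracket g l u (p ℚ.* w) → Bracket g l u w) →
    ∃ λ s → l ℚ.≤ s × s ℚ.≤ u × ℚ.- ε ℚ.≤ g s × g s ℚ.≤ 0ℚ
  found p 0≤p bound (i , pi≡1) bis = fromBracket (bis w 0≤w (record { lo = l ; hi = u ; l≤lo = ℚP.≤-refl ; hi≤u = ℚP.≤-refl
      ; width = trans (solve 2 (λ l u → u := l :+ (u :- l)) refl l u) (cong (l ℚ.+_) (sym pw)) ; g-lo = gl ; g-hi = gu }))
    where
    0≤i : 0ℚ ℚ.≤ i
    0≤i = [ id , (λ i≤0 → ⊥-elim (ℚ<⇒≱ (subst (λ v → ℚ.- v ℚ.< 0ℚ) (sym pi≡1) (ℚP.negative⁻¹ (ℚ.- 1ℚ)))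
      (subst (0ℚ ℚ.≤_) (solve 2 (λ p i → p :* (:- i) := :- (p :* i)) refl p i) (0≤-* 0≤p (0≤-neg i≤0))))) ]′ (ℚP.≤-total 0ℚ i)
    w = (u ℚ.- l) ℚ.* i
    0≤w : 0ℚ ℚ.≤ w
    0≤w = 0≤-* (≤⇒0≤- l≤u) 0≤i
    pw : p ℚ.* w ≡ u ℚ.- l
    pw = trans (solve 3 (λ p d i → p :* (d :* i) := p :* i :* d) refl p (u ℚ.- l) i) (trans (cong (ℚ._* (u ℚ.- l)) pi≡1) (ℚP.*-identityˡ _))
    Lw≤ε : L ℚ.* w ℚ.≤ ε
    Lw≤ε = begin
      L ℚ.* w                    ≡⟨ solve 3 (λ L d i → L :* (d :* i) := L :* d :* i) refl L (u ℚ.- l) i ⟩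
      L ℚ.* (u ℚ.- l) ℚ.* i      ≤⟨ ℚP.*-monoʳ-≤-nonNeg i {{ℚ.nonNegative 0≤i}} bound ⟩
      ε ℚ.* p ℚ.* i              ≡⟨ trans (ℚP.*-assoc ε p i) (trans (cong (ε ℚ.*_) pi≡1) (ℚP.*-identityʳ ε)) ⟩
      ε ∎
      where open ℚP.≤-Reasoning
    fromBracket : Bracket g l u w → ∃ λ s → l ℚ.≤ s × s ℚ.≤ u × ℚ.- ε ℚ.≤ g s × g s ℚ.≤ 0ℚ
    fromBracket record { lo = lo ; hi = hi ; l≤lo = l≤lo ; hi≤u = hi≤u ; width = width ; g-lo = g-lo ; g-hi = g-hi } =
      lo , l≤lo , ℚP.≤-trans lo≤hi hi≤u , -ε≤ , g-lo
      where
      lo≤hi : lo ℚ.≤ hi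
      lo≤hi = ≤-byDiff w 0≤w (sym width)
      cancel : g lo ℚ.+ L ℚ.* (hi ℚ.- lo) ℚ.- L ℚ.* w ≡ g lo
      cancel = trans (cong (λ h → g lo ℚ.+ L ℚ.* (h ℚ.- lo) ℚ.- L ℚ.* w) width) (solve 4 (λ G L a w → G :+ L :* (a :+ w :- a) :- L :* w := G) refl (g lo) L lo w)
      -ε≤ : ℚ.- ε ℚ.≤ g lo
      -ε≤ = ℚP.≤-trans (ℚP.neg-antimono-≤ Lw≤ε) (subst₂ ℚ._≤_ (ℚP.+-identityˡ (ℚ.- (L ℚ.* w))) cancel (ℚP.+-monoˡ-≤ (ℚ.- (L ℚ.* w)) (ℚP.≤-trans g-hi (lip lo hi l≤lo lo≤hi hi≤u))))
  refine : (∃ λ k → L ℚ.* (u ℚ.- l) ℚ.≤ ε ℚ.* 2^ k) → ∃ λ s → l ℚ.≤ s × s ℚ.≤ u × ℚ.- ε ℚ.≤ g s × g s ℚ.≤ 0ℚ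
  refine (k , bound) = found (2^ k) (0≤2^ k) bound (inverse {2^ k} (2^≢0 k)) (bisect^ g l u k)

abs-≤ : ∀ {a b} → ℚ.- b ℚ.≤ a → a ℚ.≤ b → ℚ.∣ a ∣ ℚ.≤ b
abs-≤ {a} {b} lo hi = [ (λ e → subst (ℚ._≤ b) (sym e) hi)
  , (λ e → subst₂ ℚ._≤_ (sym e) (⁻¹-involutive b) (ℚP.neg-antimono-≤ lo)) ]′ (ℚP.∣p∣≡p∨∣p∣≡-p a)
  where
  ⁻¹-involutive : ∀ b → ℚ.- (ℚ.- b) ≡ b
  ⁻¹-involutive = ℚS.Solver.solve 1 (λ b → :- (:- b) := b) refl
    where open ℚS.Solver

≤-abs : ∀ a → a ℚ.≤ ℚ.∣ a ∣
≤-abs a = [ (λ e → ℚP.≤-reflexive (sym e)) , (λ e → ℚP.≤-trans (p≤0 e) (ℚP.0≤∣p∣ a)) ]′ (ℚP.∣p∣≡p∨∣p∣≡-p a)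
  where
  p≤0 : ℚ.∣ a ∣ ≡ ℚ.- a → a ℚ.≤ 0ℚ
  p≤0 e = subst (ℚ._≤ 0ℚ) (ℚS.Solver.solve 1 (λ b → :- (:- b) := b) refl a) (ℚP.neg-antimono-≤ (subst (0ℚ ℚ.≤_) e (ℚP.0≤∣p∣ a)))
    where open ℚS.Solver

closed≤ : ∀ {a b} {w : True (a ℚP.≤? b)} → a ℚ.≤ b
closed≤ {w = w} = toWitness w

-- Estimates up to a multiple of an error function

module Approximation {P : Set} (ε : P → ℚ) (0≤ε : ∀ x → 0ℚ ℚ.≤ ε x) where

  open ℚS.Solver using (solve; _:*_; _:+_; _:-_; :-_; con; _:=_)

  infix 4 _≈_
  -- With constants uniform over all points: bounded, zero in the limit ε → 0, and nonpositive in
  -- the limit. Identities between conjugates, which fail at rational points, survive as `_≈_`.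
  Bdd Small Neg : (P → ℚ) → Set
  Bdd A = ∃ λ B → 0ℚ ℚ.≤ B × (∀ x → ℚ.∣ A x ∣ ℚ.≤ B)
  Small A = ∃ λ B → 0ℚ ℚ.≤ B × (∀ x → ℚ.∣ A x ∣ ℚ.≤ B ℚ.* ε x)
  Neg A = ∃ λ B → 0ℚ ℚ.≤ B × (∀ x → A x ℚ.≤ B ℚ.* ε x)

  record _≈_ (A B : P → ℚ) : Set where
    constructor approx
    field small : Small (λ x → A x ℚ.- B x)
  open _≈_ public

  bdd-const : ∀ q → Bdd (λ _ → q)
  bdd-const q = ℚ.∣ q ∣ , ℚP.0≤∣p∣ q , λ _ → ℚP.≤-refl

  bdd-+ : ∀ {A B} → Bdd A → Bdd B → Bdd (λ x → A x ℚ.+ B x)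
  bdd-+ {A} {B} (a , 0≤a , ha) (b , 0≤b , hb) = a ℚ.+ b , 0≤-+ 0≤a 0≤b , λ x → ℚP.≤-trans (ℚP.∣p+q∣≤∣p∣+∣q∣ (A x) (B x)) (ℚP.+-mono-≤ (ha x) (hb x))

  bdd-* : ∀ {A B} → Bdd A → Bdd B → Bdd (λ x → A x ℚ.* B x)
  bdd-* {A} {B} (a , 0≤a , ha) (b , 0≤b , hb) = a ℚ.* b , 0≤-* 0≤a 0≤b , λ x →
    subst (ℚ._≤ a ℚ.* b) (sym (ℚP.∣p*q∣≡∣p∣*∣q∣ (A x) (B x))) (*-mono-≤ (ℚP.0≤∣p∣ (A x)) (ha x) (ℚP.0≤∣p∣ (B x)) (hb x))

  bdd-neg : ∀ {A} → Bdd A → Bdd (λ x → ℚ.- A x)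
  bdd-neg {A} (a , 0≤a , ha) = a , 0≤a , λ x → subst (ℚ._≤ a) (sym (ℚP.∣-p∣≡∣p∣ (A x))) (ha x)

  bdd-resp : ∀ {A B} → (∀ x → A x ≡ B x) → Bdd A → Bdd B
  bdd-resp eq (a , 0≤a , ha) = a , 0≤a , λ x → subst (λ v → ℚ.∣ v ∣ ℚ.≤ a) (eq x) (ha x)

  small-resp : ∀ {A B} → (∀ x → A x ≡ B x) → Small A → Small B
  small-resp eq (a , 0≤a , ha) = a , 0≤a , λ x → subst (λ v → ℚ.∣ v ∣ ℚ.≤ a ℚ.* ε x) (eq x) (ha x)

  small-+ : ∀ {A B} → Small A → Small B → Small (λ x → A x ℚ.+ B x)
  small-+ {A} {B} (a , 0≤a , ha) (b , 0≤b , hb) = a ℚ.+ b , 0≤-+ 0≤a 0≤b , λ x →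
    ℚP.≤-trans (ℚP.∣p+q∣≤∣p∣+∣q∣ (A x) (B x)) (subst (ℚ.∣ A x ∣ ℚ.+ ℚ.∣ B x ∣ ℚ.≤_) (sym (ℚP.*-distribʳ-+ (ε x) a b)) (ℚP.+-mono-≤ (ha x) (hb x)))

  small-neg : ∀ {A} → Small A → Small (λ x → ℚ.- A x)
  small-neg {A} (a , 0≤a , ha) = a , 0≤a , λ x → subst (ℚ._≤ a ℚ.* ε x) (sym (ℚP.∣-p∣≡∣p∣ (A x))) (ha x)

  small-* : ∀ {A B} → Bdd A → Small B → Small (λ x → A x ℚ.* B x)
  small-* {A} {B} (a , 0≤a , ha) (b , 0≤b , hb) = a ℚ.* b , 0≤-* 0≤a 0≤b , λ x →
    subst₂ ℚ._≤_ (sym (ℚP.∣p*q∣≡∣p∣*∣q∣ (A x) (B x))) (sym (ℚP.*-assoc a b (ε x))) (*-mono-≤ (ℚP.0≤∣p∣ (A x)) (ha x) (ℚP.0≤∣p∣ (B x)) (hb x))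

  small-0 : Small (λ _ → 0ℚ)
  small-0 = 0ℚ , ℚP.≤-refl , λ x → ℚP.≤-reflexive (sym (ℚP.*-zeroˡ (ε x)))

  small-÷ : ∀ {W A : P → ℚ} → (∀ x → 1ℚ ℚ.≤ W x) → Small (λ x → W x ℚ.* A x) → Small A
  small-÷ {W} {A} 1≤W (a , 0≤a , ha) = a , 0≤a , λ x → ℚP.≤-trans
    (subst₂ ℚ._≤_ (ℚP.*-identityˡ ℚ.∣ A x ∣) (sym (ℚP.∣p*q∣≡∣p∣*∣q∣ (W x) (A x))) (*-mono-≤ {1ℚ} {ℚ.∣ W x ∣} {ℚ.∣ A x ∣} {ℚ.∣ A x ∣} (closed≤ {0ℚ} {1ℚ}) (ℚP.≤-trans (1≤W x) (≤-abs (W x))) (ℚP.0≤∣p∣ (A x)) ℚP.≤-refl)) (ha x)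

  ≡⇒≈ : ∀ {A B} → (∀ x → A x ≡ B x) → A ≈ B
  ≡⇒≈ {A} {B} eq = approx (small-resp (λ x → trans (sym (ℚP.+-inverseʳ (A x))) (cong (λ v → A x ℚ.- v) (eq x))) small-0)

  ≈-refl : ∀ {A} → A ≈ A
  ≈-refl = ≡⇒≈ (λ _ → refl)

  ≈-sym : ∀ {A B} → A ≈ B → B ≈ A
  ≈-sym {A} {B} (approx p) = approx (small-resp (λ x → solve 2 (λ a b → :- (a :- b) := b :- a) refl (A x) (B x)) (small-neg p))

  ≈-trans : ∀ {A B C} → A ≈ B → B ≈ C → A ≈ C
  ≈-trans {A} {B} {C} (approx p) (approx q) = approx (small-resp (λ x → solve 3 (λ a b c → a :- b :+ (b :- c) := a :- c) refl (A x) (B x) (C x)) (small-+ p q))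

  ≈-+ : ∀ {A B C D} → A ≈ B → C ≈ D → (λ x → A x ℚ.+ C x) ≈ (λ x → B x ℚ.+ D x)
  ≈-+ {A} {B} {C} {D} (approx p) (approx q) = approx (small-resp (λ x → solve 4 (λ a b c d → a :- b :+ (c :- d) := a :+ c :- (b :+ d)) refl (A x) (B x) (C x) (D x)) (small-+ p q))

  ≈-neg : ∀ {A B} → A ≈ B → (λ x → ℚ.- A x) ≈ (λ x → ℚ.- B x)
  ≈-neg {A} {B} (approx p) = approx (small-resp (λ x → solve 2 (λ a b → :- (a :- b) := :- a :- (:- b)) refl (A x) (B x)) (small-neg p))

  ≈-* : ∀ {A B C D} → Bdd A → Bdd D → A ≈ B → C ≈ D → (λ x → A x ℚ.* C x) ≈ (λ x → B x ℚ.* D x)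
  ≈-* {A} {B} {C} {D} ba bd (approx p) (approx q) = approx (small-resp (λ x → solve 4 (λ a b c d → a :* (c :- d) :+ d :* (a :- b) := a :* c :- b :* d) refl (A x) (B x) (C x) (D x))
    (small-+ (small-* ba q) (small-* bd p)))

  small⇒neg : ∀ {A} → Small A → Neg A
  small⇒neg {A} (a , 0≤a , ha) = a , 0≤a , λ x → ℚP.≤-trans (≤-abs (A x)) (ha x)

  neg-≤ : ∀ {A B} → (∀ x → A x ℚ.≤ B x) → Neg B → Neg A
  neg-≤ le (b , 0≤b , hb) = b , 0≤b , λ x → ℚP.≤-trans (le x) (hb x)

  neg-+ : ∀ {A B} → Neg A → Neg B → Neg (λ x → A x ℚ.+ B x)
  neg-+ {A} {B} (a , 0≤a , ha) (b , 0≤b , hb) = a ℚ.+ b , 0≤-+ 0≤a 0≤b , λ x →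
    subst (A x ℚ.+ B x ℚ.≤_) (sym (ℚP.*-distribʳ-+ (ε x) a b)) (ℚP.+-mono-≤ (ha x) (hb x))

  neg-* : ∀ {A B} → (∀ x → 0ℚ ℚ.≤ A x) → Bdd A → Neg B → Neg (λ x → A x ℚ.* B x)
  neg-* {A} {B} 0≤A (a , 0≤a , ha) (b , 0≤b , hb) = a ℚ.* b , 0≤-* 0≤a 0≤b , λ x → ℚP.≤-trans
    (ℚP.*-monoˡ-≤-nonNeg (A x) {{ℚ.nonNegative (0≤A x)}} (hb x))
    (subst (A x ℚ.* (b ℚ.* ε x) ℚ.≤_) (sym (ℚP.*-assoc a b (ε x))) (ℚP.*-monoʳ-≤-nonNeg (b ℚ.* ε x) {{ℚ.nonNegative (0≤-* 0≤b (0≤ε x))}} (ℚP.≤-trans (≤-abs (A x)) (ha x))))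

  neg-÷ : ∀ {W A : P → ℚ} → (∀ x → 1ℚ ℚ.≤ W x) → Neg (λ x → W x ℚ.* A x) → Neg A
  neg-÷ {W} {A} 1≤W (a , 0≤a , ha) = a , 0≤a , λ x → [ (λ 0≤A → ℚP.≤-trans (subst (ℚ._≤ W x ℚ.* A x) (ℚP.*-identityˡ (A x)) (ℚP.*-monoʳ-≤-nonNeg (A x) {{ℚ.nonNegative 0≤A}} {1ℚ} {W x} (1≤W x))) (ha x))
    , (λ A≤0 → ℚP.≤-trans A≤0 (0≤-* 0≤a (0≤ε x))) ]′ (ℚP.≤-total 0ℚ (A x))

-- Rational points near the three real roots

module RootBox (c ν : ℚ) (cν≡1 : c ℚ.* ν ≡ 1ℚ) (0≤ν : 0ℚ ℚ.≤ ν) (10≤c : ℚS.fromℤ (+ 10) ℚ.≤ c) where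

  open RawCubic ℚ._+_ ℚ._*_ ℚ.-_ 0ℚ 1ℚ using (f)
  open ℚS.Solver using (solve; _:*_; _:+_; _:-_; :-_; con; _:=_)

  private
    F : ℚ → ℚ
    F = f c

    q : ℕ → ℚ
    q k = ℚS.fromℤ (+ k)

    0≤c-10 : 0ℚ ℚ.≤ c ℚ.- q 10
    0≤c-10 = ≤⇒0≤- 10≤c

    0≤q : ∀ k → 0ℚ ℚ.≤ q k
    0≤q k = subst (0ℚ ℚ.≤_) (sym (fromℕ≡ k)) (0≤int k)

    0≤c : 0ℚ ℚ.≤ c
    0≤c = ≤-byDiff (c ℚ.- q 10 ℚ.+ q 10) (0≤-+ 0≤c-10 (0≤q 10)) (solve 1 (λ c → con (+ 0) :+ (c :- con (+ 10) :+ con (+ 10)) := c) refl c)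

    10ν≤1 : q 10 ℚ.* ν ℚ.≤ 1ℚ
    10ν≤1 = ≤-byDiff ((c ℚ.- q 10) ℚ.* ν) (0≤-* 0≤c-10 0≤ν) (trans (solve 2 (λ c v → con (+ 10) :* v :+ (c :- con (+ 10)) :* v := c :* v) refl c ν) cν≡1)

    ν≤1 : ν ℚ.≤ 1ℚ
    ν≤1 = ℚP.≤-trans (≤-byDiff (q 9 ℚ.* ν) (0≤-* (0≤q 9) 0≤ν) (solve 1 (λ v → v :+ con (+ 9) :* v := con (+ 10) :* v) refl ν)) 10ν≤1

  -- The intervals isolate the roots by signs: f (1 - c) = - c, f (2 - c) = c² - 6 c + 7, f (- 2) =
  -- 2 c - 9, f (- 1 - ν) < 0, f 0 = - 1 and f ν = ν³ + ν. Any two of them are at distance at least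
  -- 1. The bound - 1 - ν on r₂ matters because that root tends to - 1 as c grows, and 1 / ρ must
  -- still contract there.
  record Pt : Set where
    field
      r₁ r₂ r₃ : ℚ
      lo₁ : 1ℚ ℚ.- c ℚ.≤ r₁
      hi₁ : r₁ ℚ.≤ q 2 ℚ.- c
      lo₂ : ℚ.- q 2 ℚ.≤ r₂
      hi₂ : r₂ ℚ.≤ ℚ.- 1ℚ ℚ.- ν
      lo₃ : 0ℚ ℚ.≤ r₃
      hi₃ : r₃ ℚ.≤ ν

  open Pt public

  ε : Pt → ℚ
  ε p = ℚ.∣ F (r₁ p) ∣ ℚ.+ ℚ.∣ F (r₂ p) ∣ ℚ.+ ℚ.∣ F (r₃ p) ∣

  0≤ε : ∀ p → 0ℚ ℚ.≤ ε p
  0≤ε p = 0≤-+ (0≤-+ (ℚP.0≤∣p∣ (F (r₁ p))) (ℚP.0≤∣p∣ (F (r₂ p)))) (ℚP.0≤∣p∣ (F (r₃ p)))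

  open Approximation ε 0≤ε public

  private
    -- A bound for the derivative 3 t² + 2 c t + c on |t| ≤ c.
    L : ℚ
    L = q 3 ℚ.* (c ℚ.* c) ℚ.+ q 2 ℚ.* (c ℚ.* c) ℚ.+ c

    0≤L : 0ℚ ℚ.≤ L
    0≤L = 0≤-+ (0≤-+ (0≤-* (0≤q 3) (0≤-* 0≤c 0≤c)) (0≤-* (0≤q 2) (0≤-* 0≤c 0≤c))) 0≤c

    product-bound : ∀ {x y} → ℚ.∣ x ∣ ℚ.≤ c → ℚ.∣ y ∣ ℚ.≤ c → 0ℚ ℚ.≤ c ℚ.* c ℚ.- x ℚ.* y × 0ℚ ℚ.≤ c ℚ.* c ℚ.+ x ℚ.* y
    product-bound {x} {y} bx by = ≤⇒0≤- (ℚP.≤-trans (≤-abs (x ℚ.* y)) ∣xy∣≤) ,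
      subst (0ℚ ℚ.≤_) (solve 2 (λ c p → c :- (:- p) := c :+ p) refl (c ℚ.* c) (x ℚ.* y)) (≤⇒0≤- (ℚP.≤-trans (≤-abs (ℚ.- (x ℚ.* y))) (subst (ℚ._≤ c ℚ.* c) (sym (ℚP.∣-p∣≡∣p∣ (x ℚ.* y))) ∣xy∣≤)))
      where
      ∣xy∣≤ : ℚ.∣ x ℚ.* y ∣ ℚ.≤ c ℚ.* c
      ∣xy∣≤ = subst (ℚ._≤ c ℚ.* c) (sym (ℚP.∣p*q∣≡∣p∣*∣q∣ x y)) (*-mono-≤ (ℚP.0≤∣p∣ x) bx (ℚP.0≤∣p∣ y) by)

    single-bound : ∀ {x} → ℚ.∣ x ∣ ℚ.≤ c → 0ℚ ℚ.≤ c ℚ.- x × 0ℚ ℚ.≤ c ℚ.+ x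
    single-bound {x} bx = ≤⇒0≤- (ℚP.≤-trans (≤-abs x) bx) ,
      subst (0ℚ ℚ.≤_) (solve 2 (λ c p → c :- (:- p) := c :+ p) refl c x) (≤⇒0≤- (ℚP.≤-trans (≤-abs (ℚ.- x)) (subst (ℚ._≤ c) (sym (ℚP.∣-p∣≡∣p∣ x)) bx)))

    -- Both signs occur because f decreases through its middle root, where the bisection runs on -
    -- f.
    F-lipschitz : ∀ {x y} → ℚ.∣ x ∣ ℚ.≤ c → ℚ.∣ y ∣ ℚ.≤ c → x ℚ.≤ y →
      F y ℚ.≤ F x ℚ.+ L ℚ.* (y ℚ.- x) × ℚ.- F y ℚ.≤ ℚ.- F x ℚ.+ L ℚ.* (y ℚ.- x)
    F-lipschitz {x} {y} bx by x≤y =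
      ≤-byDiff _ (0≤-* (≤⇒0≤- x≤y) (0≤-+ (0≤-+ (0≤-+ (0≤-+ (proj₁ (product-bound bx bx)) (proj₁ (product-bound bx by))) (proj₁ (product-bound by by)))
         (0≤-* 0≤c (proj₁ (single-bound bx)))) (0≤-* 0≤c (proj₁ (single-bound by)))))
       (solve 3 (λ c x y → (y :* y :* y :+ c :* y :* y :+ c :* y :- con (+ 1)) :+ (y :- x) :* ((c :* c :- x :* x) :+ (c :* c :- x :* y) :+ (c :* c :- y :* y) :+ c :* (c :- x) :+ c :* (c :- y))
          := (x :* x :* x :+ c :* x :* x :+ c :* x :- con (+ 1)) :+ (con (+ 3) :* (c :* c) :+ con (+ 2) :* (c :* c) :+ c) :* (y :- x)) refl c x y) ,
      ≤-byDiff _ (0≤-* (≤⇒0≤- x≤y) (0≤-+ (0≤-+ (0≤-+ (0≤-+ (0≤-+ (proj₂ (product-bound bx bx)) (proj₂ (product-bound bx by))) (proj₂ (product-bound by by)))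
         (0≤-* 0≤c (proj₂ (single-bound bx)))) (0≤-* 0≤c (proj₂ (single-bound by)))) (0≤-+ 0≤c 0≤c)))
       (solve 3 (λ c x y → :- (y :* y :* y :+ c :* y :* y :+ c :* y :- con (+ 1)) :+ (y :- x) :* ((c :* c :+ x :* x) :+ (c :* c :+ x :* y) :+ (c :* c :+ y :* y) :+ c :* (c :+ x) :+ c :* (c :+ y) :+ (c :+ c))
          := :- (x :* x :* x :+ c :* x :* x :+ c :* x :- con (+ 1)) :+ (con (+ 3) :* (c :* c) :+ con (+ 2) :* (c :* c) :+ c) :* (y :- x)) refl c x y)

    bound₁ : ∀ {x} → 1ℚ ℚ.- c ℚ.≤ x → x ℚ.≤ q 2 ℚ.- c → ℚ.∣ x ∣ ℚ.≤ c
    bound₁ {x} l u = abs-≤ (ℚP.≤-trans (≤-byDiff 1ℚ closed≤ (ℚP.+-comm (ℚ.- c) 1ℚ)) l)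
      (ℚP.≤-trans u (≤-byDiff (c ℚ.- q 10 ℚ.+ (c ℚ.+ q 8)) (0≤-+ 0≤c-10 (0≤-+ 0≤c (0≤q 8))) (solve 1 (λ c → con (+ 2) :- c :+ (c :- con (+ 10) :+ (c :+ con (+ 8))) := c) refl c)))

    bound₂ : ∀ {x} → ℚ.- q 2 ℚ.≤ x → x ℚ.≤ ℚ.- 1ℚ ℚ.- ν → ℚ.∣ x ∣ ℚ.≤ c
    bound₂ {x} l u = abs-≤ (ℚP.≤-trans (≤-byDiff (c ℚ.- q 10 ℚ.+ q 8) (0≤-+ 0≤c-10 (0≤q 8)) (solve 1 (λ c → :- c :+ (c :- con (+ 10) :+ con (+ 8)) := :- con (+ 2)) refl c)) l)
      (ℚP.≤-trans u (≤-byDiff (1ℚ ℚ.+ ν ℚ.+ c) (0≤-+ (0≤-+ {1ℚ} closed≤ 0≤ν) 0≤c) (solve 2 (λ c v → :- con (+ 1) :- v :+ (con (+ 1) :+ v :+ c) := c) refl c ν)))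

    bound₃ : ∀ {x} → 0ℚ ℚ.≤ x → x ℚ.≤ ν → ℚ.∣ x ∣ ℚ.≤ c
    bound₃ {x} l u = abs-≤ (ℚP.≤-trans (subst (ℚ.- c ℚ.≤_) refl (ℚP.neg-antimono-≤ 0≤c)) l)
      (ℚP.≤-trans u (ℚP.≤-trans ν≤1 (≤-byDiff (c ℚ.- q 10 ℚ.+ q 9) (0≤-+ 0≤c-10 (0≤q 9)) (solve 1 (λ c → con (+ 1) :+ (c :- con (+ 10) :+ con (+ 9)) := c) refl c))))

    inside : ∀ {l u x y} → (∀ {x} → l ℚ.≤ x → x ℚ.≤ u → ℚ.∣ x ∣ ℚ.≤ c) → l ℚ.≤ x → x ℚ.≤ y → y ℚ.≤ u → ℚ.∣ x ∣ ℚ.≤ c × ℚ.∣ y ∣ ℚ.≤ c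
    inside b l≤x x≤y y≤u = b l≤x (ℚP.≤-trans x≤y y≤u) , b (ℚP.≤-trans l≤x x≤y) y≤u

    small-root : ∀ {δ s} → 0ℚ ℚ.< δ → ℚ.- δ ℚ.≤ s → s ℚ.≤ 0ℚ → ℚ.∣ s ∣ ℚ.≤ δ
    small-root 0<δ lo hi = abs-≤ lo (ℚP.≤-trans hi (ℚP.<⇒≤ 0<δ))

    cν : ∀ e → (c ℚ.* ν) ℚ.* e ≡ e
    cν e = trans (cong (ℚ._* e) cν≡1) (ℚP.*-identityˡ e)

    root₁ : ∀ δ → 0ℚ ℚ.< δ → ∃ λ s → 1ℚ ℚ.- c ℚ.≤ s × s ℚ.≤ q 2 ℚ.- c × ℚ.- δ ℚ.≤ F s × F s ℚ.≤ 0ℚ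
    root₁ = approximateRoot F L _ _ 0≤L (≤-byDiff 1ℚ closed≤ (solve 1 (λ c → con (+ 1) :- c :+ con (+ 1) := con (+ 2) :- c) refl c))
      (λ x y l xy u → let bx , by = inside bound₁ l xy u in proj₁ (F-lipschitz bx by xy))
      (subst (ℚ._≤ 0ℚ) (solve 1 (λ c → :- c := (con (+ 1) :- c) :* (con (+ 1) :- c) :* (con (+ 1) :- c) :+ c :* (con (+ 1) :- c) :* (con (+ 1) :- c) :+ c :* (con (+ 1) :- c) :- con (+ 1)) refl c) (ℚP.neg-antimono-≤ 0≤c))
      (subst (0ℚ ℚ.≤_) (solve 1 (λ c → c :* (c :- con (+ 10)) :+ con (+ 4) :* c :+ con (+ 7) := (con (+ 2) :- c) :* (con (+ 2) :- c) :* (con (+ 2) :- c) :+ c :* (con (+ 2) :- c) :* (con (+ 2) :- c) :+ c :* (con (+ 2) :- c) :- con (+ 1)) refl c)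
        (0≤-+ (0≤-+ (0≤-* 0≤c 0≤c-10) (0≤-* (0≤q 4) 0≤c)) (0≤q 7)))

    root₂ : ∀ δ → 0ℚ ℚ.< δ → ∃ λ s → ℚ.- q 2 ℚ.≤ s × s ℚ.≤ ℚ.- 1ℚ ℚ.- ν × ℚ.- δ ℚ.≤ ℚ.- F s × ℚ.- F s ℚ.≤ 0ℚ
    root₂ = approximateRoot (λ s → ℚ.- F s) L _ _ 0≤L (≤-byDiff (1ℚ ℚ.- ν) (≤⇒0≤- ν≤1) (solve 1 (λ v → :- con (+ 2) :+ (con (+ 1) :- v) := :- con (+ 1) :- v) refl ν))
      (λ x y l xy u → let bx , by = inside bound₂ l xy u in proj₂ (F-lipschitz bx by xy))
      (≤-byDiff (c ℚ.- q 10 ℚ.+ (c ℚ.- q 10) ℚ.+ q 11) (0≤-+ (0≤-+ 0≤c-10 0≤c-10) (0≤q 11))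
        (solve 1 (λ c → let t = :- con (+ 2) in :- (t :* t :* t :+ c :* t :* t :+ c :* t :- con (+ 1)) :+ (c :- con (+ 10) :+ (c :- con (+ 10)) :+ con (+ 11)) := con (+ 0)) refl c))
      (subst (0ℚ ℚ.≤_)
        (trans (trans (solve 2 (λ c v → con (+ 1) :+ con (+ 2) :* v :+ con (+ 3) :* (v :* v) :+ v :* v :* v
           := con (+ 2) :+ con (+ 3) :* v :+ con (+ 3) :* (v :* v) :+ v :* v :* v :- (con (+ 1) :+ v)) refl c ν)
           (cong (λ e → q 2 ℚ.+ q 3 ℚ.* ν ℚ.+ q 3 ℚ.* (ν ℚ.* ν) ℚ.+ ν ℚ.* ν ℚ.* ν ℚ.- e) (sym (cν (1ℚ ℚ.+ ν)))))
           (solve 2 (λ c v → let t = :- con (+ 1) :- v in con (+ 2) :+ con (+ 3) :* v :+ con (+ 3) :* (v :* v) :+ v :* v :* v :- c :* v :* (con (+ 1) :+ v)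
             := :- (t :* t :* t :+ c :* t :* t :+ c :* t :- con (+ 1))) refl c ν))
        (0≤-+ (0≤-+ (0≤-+ {1ℚ} closed≤ (0≤-* (0≤q 2) 0≤ν)) (0≤-* (0≤q 3) (0≤-* 0≤ν 0≤ν))) (0≤-* (0≤-* 0≤ν 0≤ν) 0≤ν)))

    root₃ : ∀ δ → 0ℚ ℚ.< δ → ∃ λ s → 0ℚ ℚ.≤ s × s ℚ.≤ ν × ℚ.- δ ℚ.≤ F s × F s ℚ.≤ 0ℚ
    root₃ = approximateRoot F L _ _ 0≤L 0≤ν
      (λ x y l xy u → let bx , by = inside bound₃ l xy u in proj₁ (F-lipschitz bx by xy))
      (≤-byDiff 1ℚ closed≤ (solve 1 (λ c → con (+ 0) :* con (+ 0) :* con (+ 0) :+ c :* con (+ 0) :* con (+ 0) :+ c :* con (+ 0) :- con (+ 1) :+ con (+ 1) := con (+ 0)) refl c))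
      (subst (0ℚ ℚ.≤_) (trans (cong₂ (λ a b → ν ℚ.* ν ℚ.* ν ℚ.+ a ℚ.+ b) (sym (cν ν)) (solve 0 (con (+ 0) := con (+ 1) :- con (+ 1)) refl))
          (trans (cong (λ e → ν ℚ.* ν ℚ.* ν ℚ.+ c ℚ.* ν ℚ.* ν ℚ.+ (e ℚ.- 1ℚ)) (sym cν≡1)) (sym (ℚP.+-assoc (ν ℚ.* ν ℚ.* ν ℚ.+ c ℚ.* ν ℚ.* ν) (c ℚ.* ν) (ℚ.- 1ℚ)))))
        (0≤-+ (0≤-+ (0≤-* (0≤-* 0≤ν 0≤ν) 0≤ν) 0≤ν) ℚP.≤-refl))

  near : ∀ δ → 0ℚ ℚ.< δ → ∃ λ p → ε p ℚ.≤ δ ℚ.+ δ ℚ.+ δ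
  near δ 0<δ = build (root₁ δ 0<δ) (root₂ δ 0<δ) (root₃ δ 0<δ)
    where
    build : (∃ λ s → 1ℚ ℚ.- c ℚ.≤ s × s ℚ.≤ q 2 ℚ.- c × ℚ.- δ ℚ.≤ F s × F s ℚ.≤ 0ℚ) →
            (∃ λ s → ℚ.- q 2 ℚ.≤ s × s ℚ.≤ ℚ.- 1ℚ ℚ.- ν × ℚ.- δ ℚ.≤ ℚ.- F s × ℚ.- F s ℚ.≤ 0ℚ) →
            (∃ λ s → 0ℚ ℚ.≤ s × s ℚ.≤ ν × ℚ.- δ ℚ.≤ F s × F s ℚ.≤ 0ℚ) → ∃ λ p → ε p ℚ.≤ δ ℚ.+ δ ℚ.+ δ
    build (s₁ , l₁ , u₁ , a₁ , b₁) (s₂ , l₂ , u₂ , a₂ , b₂) (s₃ , l₃ , u₃ , a₃ , b₃) =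
      record { r₁ = s₁ ; r₂ = s₂ ; r₃ = s₃ ; lo₁ = l₁ ; hi₁ = u₁ ; lo₂ = l₂ ; hi₂ = u₂ ; lo₃ = l₃ ; hi₃ = u₃ } ,
      ℚP.+-mono-≤ (ℚP.+-mono-≤ (small-root 0<δ a₁ b₁) (subst (ℚ._≤ δ) (ℚP.∣-p∣≡∣p∣ (F s₂)) (small-root 0<δ a₂ b₂))) (small-root 0<δ a₃ b₃)

  bdd-r₁ : Bdd r₁
  bdd-r₁ = c , 0≤c , λ p → bound₁ (lo₁ p) (hi₁ p)

  bdd-r₂ : Bdd r₂
  bdd-r₂ = c , 0≤c , λ p → bound₂ (lo₂ p) (hi₂ p)

  bdd-r₃ : Bdd r₃
  bdd-r₃ = c , 0≤c , λ p → bound₃ (lo₃ p) (hi₃ p)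

  small-F₁ : Small (λ p → F (r₁ p))
  small-F₁ = 1ℚ , closed≤ , λ p → ≤-byDiff (ℚ.∣ F (r₂ p) ∣ ℚ.+ ℚ.∣ F (r₃ p) ∣) (0≤-+ (ℚP.0≤∣p∣ (F (r₂ p))) (ℚP.0≤∣p∣ (F (r₃ p)))) (solve 3 (λ a b c → a :+ (b :+ c) := con (+ 1) :* (a :+ b :+ c)) refl ℚ.∣ F (r₁ p) ∣ ℚ.∣ F (r₂ p) ∣ ℚ.∣ F (r₃ p) ∣)

  small-F₂ : Small (λ p → F (r₂ p))
  small-F₂ = 1ℚ , closed≤ , λ p → ≤-byDiff (ℚ.∣ F (r₁ p) ∣ ℚ.+ ℚ.∣ F (r₃ p) ∣) (0≤-+ (ℚP.0≤∣p∣ (F (r₁ p))) (ℚP.0≤∣p∣ (F (r₃ p)))) (solve 3 (λ a b c → b :+ (a :+ c) := con (+ 1) :* (a :+ b :+ c)) refl ℚ.∣ F (r₁ p) ∣ ℚ.∣ F (r₂ p) ∣ ℚ.∣ F (r₃ p) ∣)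

  small-F₃ : Small (λ p → F (r₃ p))
  small-F₃ = 1ℚ , closed≤ , λ p → ≤-byDiff (ℚ.∣ F (r₁ p) ∣ ℚ.+ ℚ.∣ F (r₂ p) ∣) (0≤-+ (ℚP.0≤∣p∣ (F (r₁ p))) (ℚP.0≤∣p∣ (F (r₂ p)))) (solve 3 (λ a b c → c :+ (a :+ b) := con (+ 1) :* (a :+ b :+ c)) refl ℚ.∣ F (r₁ p) ∣ ℚ.∣ F (r₂ p) ∣ ℚ.∣ F (r₃ p) ∣)

  private
    1≤-* : ∀ {a b} → 1ℚ ℚ.≤ a → 1ℚ ℚ.≤ b → 1ℚ ℚ.≤ a ℚ.* b
    1≤-* {a} {b} p r = *-mono-≤ {1ℚ} {a} {1ℚ} {b} closed≤ p closed≤ r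

    gap₁₂ : ∀ p → 1ℚ ℚ.≤ r₂ p ℚ.- r₁ p
    gap₁₂ p = ≤-byDiff _ (0≤-+ (0≤-+ (≤⇒0≤- (lo₂ p)) (≤⇒0≤- (hi₁ p))) (0≤-+ 0≤c-10 (0≤q 5)))
      (solve 3 (λ c a b → con (+ 1) :+ (b :- (:- con (+ 2)) :+ (con (+ 2) :- c :- a) :+ (c :- con (+ 10) :+ con (+ 5))) := b :- a) refl c (r₁ p) (r₂ p))

    gap₂₃ : ∀ p → 1ℚ ℚ.≤ r₃ p ℚ.- r₂ p
    gap₂₃ p = ≤-byDiff _ (0≤-+ (0≤-+ (≤⇒0≤- (lo₃ p)) (≤⇒0≤- (hi₂ p))) 0≤ν)
      (solve 3 (λ v a b → con (+ 1) :+ (b :- con (+ 0) :+ (:- con (+ 1) :- v :- a) :+ v) := b :- a) refl ν (r₂ p) (r₃ p))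

    gap₁₃ : ∀ p → 1ℚ ℚ.≤ r₃ p ℚ.- r₁ p
    gap₁₃ p = ≤-byDiff _ (0≤-+ (≤⇒0≤- (gap₁₂ p)) (≤-trans0 (gap₂₃ p)))
      (solve 3 (λ a b d → con (+ 1) :+ (b :- a :- con (+ 1) :+ (d :- b)) := d :- a) refl (r₁ p) (r₂ p) (r₃ p))
      where
      ≤-trans0 : ∀ {a} → 1ℚ ℚ.≤ a → 0ℚ ℚ.≤ a
      ≤-trans0 = ℚP.≤-trans closed≤

  -- The combination of the values f (rᵢ) with the differences of the other two points as
  -- coefficients equals the Vandermonde product times c + r₁ + r₂ + r₃, and that product is at
  -- least 1.
  vieta₁ : Small (λ p → c ℚ.+ r₁ p ℚ.+ r₂ p ℚ.+ r₃ p)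
  vieta₁ = small-÷ {λ p → (r₂ p ℚ.- r₁ p) ℚ.* (r₃ p ℚ.- r₁ p) ℚ.* (r₃ p ℚ.- r₂ p)}
    (λ p → 1≤-* (1≤-* (gap₁₂ p) (gap₁₃ p)) (gap₂₃ p))
    (small-resp (λ p → solve 4 (λ c x y z → let F = λ t → t :* t :* t :+ c :* t :* t :+ c :* t :- con (+ 1) in
        (z :- y) :* F x :+ (x :- z) :* F y :+ (y :- x) :* F z := (y :- x) :* (z :- x) :* (z :- y) :* (c :+ x :+ y :+ z)) refl c (r₁ p) (r₂ p) (r₃ p))
      (small-+ (small-+ (small-* (bdd-+ bdd-r₃ (bdd-neg bdd-r₂)) small-F₁) (small-* (bdd-+ bdd-r₁ (bdd-neg bdd-r₃)) small-F₂)) (small-* (bdd-+ bdd-r₂ (bdd-neg bdd-r₁)) small-F₃)))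

  private
    divided-difference : Small (λ p → r₁ p ℚ.* r₁ p ℚ.+ r₁ p ℚ.* r₂ p ℚ.+ r₂ p ℚ.* r₂ p ℚ.+ c ℚ.* (r₁ p ℚ.+ r₂ p) ℚ.+ c)
    divided-difference = small-÷ {λ p → r₂ p ℚ.- r₁ p} gap₁₂
      (small-resp (λ p → solve 3 (λ c x y → let F = λ t → t :* t :* t :+ c :* t :* t :+ c :* t :- con (+ 1) in
        F y :- F x := (y :- x) :* (x :* x :+ x :* y :+ y :* y :+ c :* (x :+ y) :+ c)) refl c (r₁ p) (r₂ p))
        (small-+ small-F₂ (small-neg small-F₁)))

  -- With σ = c + r₁ + r₂ + r₃ and δ the divided difference of f at r₁ and r₂, the expression equals
  -- (σ - 2 c - 2 (r₁ + r₂)) σ + 2 δ, and both σ and δ are small.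
  vieta₂ : Small (λ p → r₁ p ℚ.* r₁ p ℚ.+ r₂ p ℚ.* r₂ p ℚ.+ r₃ p ℚ.* r₃ p ℚ.- (c ℚ.* c ℚ.- q 2 ℚ.* c))
  vieta₂ = small-resp (λ p → solve 4 (λ c x y z → (con -[1+ 1 ] :* c :+ con -[1+ 1 ] :* (x :+ y) :+ (c :+ x :+ y :+ z)) :* (c :+ x :+ y :+ z) :+ con (+ 2) :* (x :* x :+ x :* y :+ y :* y :+ c :* (x :+ y) :+ c)
        := x :* x :+ y :* y :+ z :* z :- (c :* c :- con (+ 2) :* c)) refl c (r₁ p) (r₂ p) (r₃ p))
    (small-+ (small-* (bdd-+ (bdd-+ (bdd-const (q′ ℚ.* c)) (bdd-* (bdd-const q′) (bdd-+ bdd-r₁ bdd-r₂))) (bdd-+ (bdd-+ (bdd-+ (bdd-const c) bdd-r₁) bdd-r₂) bdd-r₃)) vieta₁)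
      (small-* (bdd-const (q 2)) divided-difference))
    where
    q′ : ℚ
    q′ = ℚS.fromℤ -[1+ 1 ]

  r₁²≥2 : ∀ p → q 2 ℚ.≤ r₁ p ℚ.* r₁ p
  r₁²≥2 p = ≤-byDiff _ (0≤-+ (0≤-* pos (0≤-+ (0≤-+ pos (0≤q 2)) (0≤q 2))) (0≤q 2))
      (solve 1 (λ a → con (+ 2) :+ ((:- a :- con (+ 2)) :* (:- a :- con (+ 2) :+ con (+ 2) :+ con (+ 2)) :+ con (+ 2)) := a :* a) refl (r₁ p))
    where
    pos : 0ℚ ℚ.≤ ℚ.- r₁ p ℚ.- q 2
    pos = subst (0ℚ ℚ.≤_) (solve 2 (λ c a → con (+ 2) :- c :- a :+ (c :- con (+ 10) :+ con (+ 6)) := :- a :- con (+ 2)) refl c (r₁ p)) (0≤-+ (≤⇒0≤- (hi₁ p)) (0≤-+ 0≤c-10 (0≤q 6)))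

  r₂²≥1+ν : ∀ p → 1ℚ ℚ.+ ν ℚ.≤ r₂ p ℚ.* r₂ p
  r₂²≥1+ν p = ≤-byDiff _ (0≤-+ (0≤-* h (0≤-+ h (0≤-+ (0≤-+ {1ℚ} closed≤ 0≤ν) (0≤-+ {1ℚ} closed≤ 0≤ν)))) (0≤-+ 0≤ν (0≤-* 0≤ν 0≤ν)))
      (solve 2 (λ v a → let h = :- con (+ 1) :- v :- a in con (+ 1) :+ v :+ (h :* (h :+ (con (+ 1) :+ v :+ (con (+ 1) :+ v))) :+ (v :+ v :* v)) := a :* a) refl ν (r₂ p))
    where
    h = ≤⇒0≤- (hi₂ p)

  -- From c ≥ 10 one has r₁ ≤ 2 - c ≤ - 8, so 1 + r₁ ≤ - 7.
  κ₁²≥49 : ∀ p → q 49 ℚ.≤ (1ℚ ℚ.+ r₁ p) ℚ.* (1ℚ ℚ.+ r₁ p)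
  κ₁²≥49 p = ≤-byDiff _ (0≤-+ (0≤-* h (0≤-+ h (0≤q 14))) (0≤q 0))
      (solve 2 (λ c a → let h = con (+ 2) :- c :- a :+ (c :- con (+ 10)) in con (+ 49) :+ (h :* (h :+ con (+ 14)) :+ con (+ 0)) := (con (+ 1) :+ a) :* (con (+ 1) :+ a)) refl c (r₁ p))
    where
    h = 0≤-+ (≤⇒0≤- (hi₁ p)) 0≤c-10

  r₁²≤4κ₁² : ∀ p → r₁ p ℚ.* r₁ p ℚ.≤ q 4 ℚ.* ((1ℚ ℚ.+ r₁ p) ℚ.* (1ℚ ℚ.+ r₁ p))
  r₁²≤4κ₁² p = ≤-byDiff _ (0≤-+ (0≤-* h (0≤-+ (0≤-* (0≤q 3) h) (0≤q 40))) (0≤q 132))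
      (solve 2 (λ c a → let h = con (+ 2) :- c :- a :+ (c :- con (+ 10)) in a :* a :+ (h :* (con (+ 3) :* h :+ con (+ 40)) :+ con (+ 132)) := con (+ 4) :* ((con (+ 1) :+ a) :* (con (+ 1) :+ a))) refl c (r₁ p))
    where
    h = 0≤-+ (≤⇒0≤- (hi₁ p)) 0≤c-10

  κ₂²≤1 : ∀ p → (1ℚ ℚ.+ r₂ p) ℚ.* (1ℚ ℚ.+ r₂ p) ℚ.≤ 1ℚ
  κ₂²≤1 p = ≤-byDiff _ (0≤-* (0≤-+ (≤⇒0≤- (hi₂ p)) (0≤-+ {1ℚ} closed≤ 0≤ν)) (≤⇒0≤- (lo₂ p)))
      (solve 2 (λ v a → (con (+ 1) :+ a) :* (con (+ 1) :+ a) :+ (:- con (+ 1) :- v :- a :+ (con (+ 1) :+ v)) :* (a :- (:- con (+ 2))) := con (+ 1)) refl ν (r₂ p))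

  1≤κ₃ : ∀ p → 1ℚ ℚ.≤ 1ℚ ℚ.+ r₃ p
  1≤κ₃ p = ≤-byDiff (r₃ p) (lo₃ p) refl

  10r₃≤1 : ∀ p → q 10 ℚ.* r₃ p ℚ.≤ 1ℚ
  10r₃≤1 p = ℚP.≤-trans (ℚP.*-monoˡ-≤-nonNeg (q 10) {{ℚ.nonNegative (0≤q 10)}} (hi₃ p)) 10ν≤1

-- Descent by units

0≤-inverse : ∀ {a b} → 0ℚ ℚ.≤ a → a ℚ.* b ≡ 1ℚ → 0ℚ ℚ.≤ b
0≤-inverse {a} {b} 0≤a ab≡1 = [ id , (λ b≤0 → ⊥-elim (ℚ<⇒≱ (subst (λ v → ℚ.- v ℚ.< 0ℚ) (sym ab≡1) (ℚP.negative⁻¹ (ℚ.- 1ℚ)))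
      (subst (0ℚ ℚ.≤_) (solve 2 (λ p i → p :* (:- i) := :- (p :* i)) refl a b) (0≤-* 0≤a (0≤-neg b≤0))))) ]′ (ℚP.≤-total 0ℚ b)
  where open ℚS.Solver

-- The three elements will be η, ρ / η and 1 / ρ. The i-th of them is smaller than 1 in absolute
-- value at the two roots other than rᵢ, so multiplying by it shrinks two of the three conjugates.
module Descent (n : ℕ) (10≤n : 10 ℕ.≤ n) (E₁ E₂ E₃ : K) where

  open CubicField n
  open ℚS.Solver using (solve; _:*_; _:+_; _:-_; :-_; con; _:=_)

  private
    q : ℕ → ℚ
    q k = ℚS.fromℤ (+ k)

    c : ℚ
    c = nℚ n

    c≡int : c ≡ int (+ n)
    c≡int = sym (int≡ℤtoℚ (+ n))

    10≤c : q 10 ℚ.≤ c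
    10≤c = subst₂ ℚ._≤_ (sym (fromℕ≡ 10)) (sym c≡int) (int-mono-ℕ 10≤n)

    0≤q : ∀ k → 0ℚ ℚ.≤ q k
    0≤q k = subst (0ℚ ℚ.≤_) (sym (fromℕ≡ k)) (0≤int k)

    c≢0 : c ≢ 0ℚ
    c≢0 e = ℚ<⇒≱ {0ℚ} {q 10} (toWitness {a? = 0ℚ ℚP.<? q 10} tt) (subst (q 10 ℚ.≤_) e 10≤c)

    ν : ℚ
    ν = proj₁ (inverse c≢0)

    cν≡1 : c ℚ.* ν ≡ 1ℚ
    cν≡1 = proj₂ (inverse c≢0)

    0≤ν : 0ℚ ℚ.≤ ν
    0≤ν = 0≤-inverse (ℚP.≤-trans (0≤q 10) 10≤c) cν≡1

  open RootBox c ν cν≡1 0≤ν 10≤c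

  private
    ν≤1 : ν ℚ.≤ 1ℚ
    ν≤1 = ≤-byDiff _ (0≤-+ (0≤-* (≤⇒0≤- 10≤c) 0≤ν) (0≤-* (0≤q 9) 0≤ν)) (trans (solve 2 (λ c v → v :+ ((c :- con (+ 10)) :* v :+ con (+ 9) :* v) := c :* v) refl c ν) cν≡1)

  module AtRoot (r : Pt → ℚ) (bdd-r : Bdd r) (small-F : Small (λ p → f (r p))) where

    ξ : K → Pt → ℚ
    ξ x p = ev (r p) x

    bdd-ξ : ∀ x → Bdd (ξ x)
    bdd-ξ (x₀ , x₁ , x₂) = bdd-resp (λ p → sym (ev-coords (r p) x₀ x₁ x₂)) (bdd-+ (bdd-+ (bdd-const x₀) (bdd-* (bdd-const x₁) bdd-r)) (bdd-* (bdd-const x₂) (bdd-* bdd-r bdd-r)))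

    bdd-quot : ∀ x y → Bdd (λ p → quot (r p) x y)
    bdd-quot (x₀ , x₁ , x₂) (y₀ , y₁ , y₂) = bdd-resp (λ p → sym (quot-coords (r p) x₀ x₁ x₂ y₀ y₁ y₂))
      (bdd-+ (bdd-* (bdd-const (x₂ ℚ.* y₂)) (bdd-+ bdd-r (bdd-const (ℚ.- c)))) (bdd-const (x₁ ℚ.* y₂ ℚ.+ x₂ ℚ.* y₁)))

    ξ-mul : ∀ x y → ξ (x · y) ≈ (λ p → ξ x p ℚ.* ξ y p)
    ξ-mul x y = approx (small-resp (λ p → trans (solve 3 (λ a u v → :- (u :* v) := a :- (a :+ v :* u)) refl (ξ (x · y) p) (quot (r p) x y) (f (r p))) (cong (λ w → ξ (x · y) p ℚ.- w) (sym (ev-mul (r p) x y))))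
      (small-neg (small-* (bdd-quot x y) small-F)))

    ξ-square : ∀ x → ξ (x · x) ≈ (λ p → ξ x p ℚ.* ξ x p)
    ξ-square x = ξ-mul x x

    ξ-mul₃ : ∀ x y z → ξ (x · y · z) ≈ (λ p → ξ x p ℚ.* ξ y p ℚ.* ξ z p)
    ξ-mul₃ x y z = ≈-trans (ξ-mul (x · y) z) (≈-* (bdd-ξ (x · y)) (bdd-ξ z) (ξ-mul x y) ≈-refl)

    sq : K → Pt → ℚ
    sq x p = ξ x p ℚ.* ξ x p

    0≤sq : ∀ x p → 0ℚ ℚ.≤ sq x p
    0≤sq x p = 0≤-square (ξ x p)

    bdd-sq : ∀ x → Bdd (sq x)
    bdd-sq x = bdd-* (bdd-ξ x) (bdd-ξ x)

    sq-mul : ∀ e x → ξ ((e · x) · (e · x)) ≈ (λ p → sq e p ℚ.* sq x p)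
    sq-mul e x = ≈-trans (ξ-square (e · x)) (≈-trans (≈-* (bdd-ξ (e · x)) (bdd-* (bdd-ξ e) (bdd-ξ x)) (ξ-mul e x) (ξ-mul e x))
      (≡⇒≈ (λ p → solve 2 (λ a b → a :* b :* (a :* b) := a :* a :* (b :* b)) refl (ξ e p) (ξ x p))))

    ξ-κ : ∀ p → ξ κ p ≡ 1ℚ ℚ.+ r p
    ξ-κ p = trans (cong (ev (r p)) κ≡1+ρ) (trans (ev-add (r p) 1K ρ) (cong₂ ℚ._+_ (ev-ι (r p) 1ℚ) (ev-ρ (r p))))

    private
      square-≈ : ∀ {A B} → Bdd A → Bdd B → A ≈ B → (λ p → A p ℚ.* A p) ≈ (λ p → B p ℚ.* B p)
      square-≈ ba bb e = ≈-* ba bb e e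

      κ² : Pt → ℚ
      κ² p = (1ℚ ℚ.+ r p) ℚ.* (1ℚ ℚ.+ r p)

      bdd-κ : Bdd (λ p → 1ℚ ℚ.+ r p)
      bdd-κ = bdd-+ (bdd-const 1ℚ) bdd-r

      bdd-κ³ : Bdd (λ p → (1ℚ ℚ.+ r p) ℚ.* (1ℚ ℚ.+ r p) ℚ.* (1ℚ ℚ.+ r p))
      bdd-κ³ = bdd-* (bdd-* bdd-κ bdd-κ) bdd-κ

      ξ-κ³ : ξ (κ · κ · κ) ≈ (λ p → (1ℚ ℚ.+ r p) ℚ.* (1ℚ ℚ.+ r p) ℚ.* (1ℚ ℚ.+ r p))
      ξ-κ³ = ≈-trans (ξ-mul₃ κ κ κ) (≡⇒≈ (λ p → cong (λ k → k ℚ.* k ℚ.* k) (ξ-κ p)))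

      ξ-2 : ∀ y → ξ (ι (q 2) · y) ≈ (λ p → q 2 ℚ.* ξ y p)
      ξ-2 y = ≈-trans (ξ-mul (ι (q 2)) y) (≡⇒≈ (λ p → cong (ℚ._* ξ y p) (ev-ι (r p) (q 2))))

    E₁-square : ι (q 2) · E₁ ≡ κ · κ · κ → (λ p → q 4 ℚ.* sq E₁ p) ≈ (λ p → κ² p ℚ.* κ² p ℚ.* κ² p)
    E₁-square eq = ≈-trans (≡⇒≈ (λ p → solve 1 (λ a → con (+ 4) :* (a :* a) := con (+ 2) :* a :* (con (+ 2) :* a)) refl (ξ E₁ p)))
      (≈-trans (square-≈ (bdd-* (bdd-const (q 2)) (bdd-ξ E₁)) bdd-κ³ (≈-trans (≈-sym (ξ-2 E₁)) (≈-trans (≡⇒≈ (λ p → cong (ev (r p)) eq)) ξ-κ³)))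
        (≡⇒≈ (λ p → solve 1 (λ k → k :* k :* k :* (k :* k :* k) := k :* k :* (k :* k) :* (k :* k)) refl (1ℚ ℚ.+ r p))))

    E₂-square : E₂ · (κ · κ · κ) ≡ ι (q 2) · ρ → (λ p → sq E₂ p ℚ.* (κ² p ℚ.* κ² p ℚ.* κ² p)) ≈ (λ p → q 4 ℚ.* (r p ℚ.* r p))
    E₂-square eq = ≈-trans (≡⇒≈ (λ p → solve 2 (λ a k → a :* a :* (k :* k :* (k :* k) :* (k :* k)) := a :* (k :* k :* k) :* (a :* (k :* k :* k))) refl (ξ E₂ p) (1ℚ ℚ.+ r p)))
      (≈-trans (square-≈ (bdd-* (bdd-ξ E₂) bdd-κ³) (bdd-* (bdd-const (q 2)) bdd-r)
          (≈-trans (≈-sym (≈-trans (ξ-mul E₂ (κ · κ · κ)) (≈-* (bdd-ξ E₂) bdd-κ³ ≈-refl ξ-κ³)))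
            (≈-trans (≡⇒≈ (λ p → cong (ev (r p)) eq)) (≈-trans (ξ-2 ρ) (≡⇒≈ (λ p → cong (q 2 ℚ.*_) (ev-ρ (r p))))))))
        (≡⇒≈ (λ p → solve 1 (λ a → con (+ 2) :* a :* (con (+ 2) :* a) := con (+ 4) :* (a :* a)) refl (r p))))

    E₃-square : E₃ · ρ ≡ 1K → (λ p → sq E₃ p ℚ.* (r p ℚ.* r p)) ≈ (λ _ → 1ℚ)
    E₃-square eq = ≈-trans (≡⇒≈ (λ p → solve 2 (λ a k → a :* a :* (k :* k) := a :* k :* (a :* k)) refl (ξ E₃ p) (r p)))
      (≈-trans (square-≈ (bdd-* (bdd-ξ E₃) bdd-r) (bdd-const 1ℚ)
        (≈-trans (≈-sym (≈-trans (ξ-mul E₃ ρ) (≡⇒≈ (λ p → cong (ξ E₃ p ℚ.*_) (ev-ρ (r p)))))) (≡⇒≈ (λ p → trans (cong (ev (r p)) eq) (ev-ι (r p) 1ℚ)))))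
        (≡⇒≈ (λ p → refl)))

    -- The margin 1 + ν is dictated by 1 / ρ at r₂, where its absolute value is barely below 1. In
    -- the other five cases the margin is 2, which suffices by `contracts`.
    Contracts : K → Set
    Contracts e = Neg (λ p → (1ℚ ℚ.+ ν) ℚ.* sq e p ℚ.- 1ℚ)

    contracts : ∀ e → Neg (λ p → q 2 ℚ.* sq e p ℚ.- 1ℚ) → Contracts e
    contracts e = neg-≤ (λ p → ≤-byDiff _ (0≤-* (≤⇒0≤- ν≤1) (0≤sq e p)) (solve 2 (λ v a → (con (+ 1) :+ v) :* a :- con (+ 1) :+ (con (+ 1) :- v) :* a := con (+ 2) :* a :- con (+ 1)) refl ν (sq e p)))

  module R₁ = AtRoot r₁ bdd-r₁ small-F₁
  module R₂ = AtRoot r₂ bdd-r₂ small-F₂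
  module R₃ = AtRoot r₃ bdd-r₃ small-F₃

  ξ-sum : ∀ x → (λ p → R₁.ξ x p ℚ.+ R₂.ξ x p ℚ.+ R₃.ξ x p) ≈ (λ _ → tr x)
  ξ-sum (x₀ , x₁ , x₂) = approx (small-resp (λ p → trans (solve 7 (λ c x₀ x₁ x₂ a b d →
        x₁ :* (c :+ a :+ b :+ d) :+ x₂ :* (a :* a :+ b :* b :+ d :* d :- (c :* c :- con (+ 2) :* c))
        := x₀ :+ x₁ :* a :+ x₂ :* (a :* a) :+ (x₀ :+ x₁ :* b :+ x₂ :* (b :* b)) :+ (x₀ :+ x₁ :* d :+ x₂ :* (d :* d)) :- (con (+ 3) :* x₀ :- c :* x₁ :+ (c :* c :- con (+ 2) :* c) :* x₂)) refl c x₀ x₁ x₂ (r₁ p) (r₂ p) (r₃ p))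
      (sym (cong₂ ℚ._-_ (cong₂ ℚ._+_ (cong₂ ℚ._+_ (ev-coords (r₁ p) x₀ x₁ x₂) (ev-coords (r₂ p) x₀ x₁ x₂)) (ev-coords (r₃ p) x₀ x₁ x₂)) (tr-coords x₀ x₁ x₂))))
    (small-+ (small-* (bdd-const x₁) vieta₁) (small-* (bdd-const x₂) vieta₂)))

  ξ²-sum : ∀ x → (λ p → R₁.sq x p ℚ.+ R₂.sq x p ℚ.+ R₃.sq x p) ≈ (λ _ → tr (x · x))
  ξ²-sum x = ≈-trans (≈-+ (≈-+ (≈-sym (R₁.ξ-square x)) (≈-sym (R₂.ξ-square x))) (≈-sym (R₃.ξ-square x))) (ξ-sum (x · x))

  private
    ξ³-sum : ∀ x → (λ p → R₁.ξ x p ℚ.* R₁.ξ x p ℚ.* R₁.ξ x p ℚ.+ R₂.ξ x p ℚ.* R₂.ξ x p ℚ.* R₂.ξ x p ℚ.+ R₃.ξ x p ℚ.* R₃.ξ x p ℚ.* R₃.ξ x p) ≈ (λ _ → tr (x · x · x))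
    ξ³-sum x = ≈-trans (≈-+ (≈-+ (≈-sym (R₁.ξ-mul₃ x x x)) (≈-sym (R₂.ξ-mul₃ x x x))) (≈-sym (R₃.ξ-mul₃ x x x))) (ξ-sum (x · x · x))

  -- Newton's identity 6 e₃ = s₁³ - 3 s₁ s₂ + 2 s₃ reduces the product of the conjugates to power
  -- sums, which `ξ-sum` identifies with traces.
  ξ-product : ∀ x → (λ p → R₁.ξ x p ℚ.* R₂.ξ x p ℚ.* R₃.ξ x p) ≈ (λ _ → N x)
  ξ-product x = approx (small-÷ {λ _ → q 6} (λ _ → closed≤) (small-resp
      (λ p → trans (cong (λ w → (S₁ p ℚ.* S₁ p ℚ.* S₁ p ℚ.- q 3 ℚ.* (S₁ p ℚ.* S₂ p) ℚ.+ q 2 ℚ.* S₃ p) ℚ.- w) newton′)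
        (solve 4 (λ a b d N → let s₁ = a :+ b :+ d ; s₂ = a :* a :+ b :* b :+ d :* d ; s₃ = a :* a :* a :+ b :* b :* b :+ d :* d :* d in
           s₁ :* s₁ :* s₁ :- con (+ 3) :* (s₁ :* s₂) :+ con (+ 2) :* s₃ :- con (+ 6) :* N := con (+ 6) :* (a :* b :* d :- N)) refl (R₁.ξ x p) (R₂.ξ x p) (R₃.ξ x p) (N x)))
      (small (≈-+ (≈-+ (≈-* (bdd-* bS₁ bS₁) bT₁ (≈-* bS₁ bT₁ e₁ e₁) e₁) (≈-neg (≈-* (bdd-const (q 3)) (bdd-* bT₁ (bdd-const (tr (x · x)))) ≈-refl (≈-* bS₁ (bdd-const (tr (x · x))) e₁ (ξ²-sum x)))))
        (≈-* (bdd-const (q 2)) (bdd-const (tr (x · x · x))) ≈-refl (ξ³-sum x))))))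
    where
    S₁ S₂ S₃ : Pt → ℚ
    S₁ p = R₁.ξ x p ℚ.+ R₂.ξ x p ℚ.+ R₃.ξ x p
    S₂ p = R₁.sq x p ℚ.+ R₂.sq x p ℚ.+ R₃.sq x p
    S₃ p = R₁.ξ x p ℚ.* R₁.ξ x p ℚ.* R₁.ξ x p ℚ.+ R₂.ξ x p ℚ.* R₂.ξ x p ℚ.* R₂.ξ x p ℚ.+ R₃.ξ x p ℚ.* R₃.ξ x p ℚ.* R₃.ξ x p
    bS₁ : Bdd S₁
    bS₁ = bdd-+ (bdd-+ (R₁.bdd-ξ x) (R₂.bdd-ξ x)) (R₃.bdd-ξ x)
    bT₁ : Bdd (λ _ → tr x)
    bT₁ = bdd-const (tr x)
    e₁ : S₁ ≈ (λ _ → tr x)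
    e₁ = ξ-sum x
    newton′ : tr x ℚ.* tr x ℚ.* tr x ℚ.- q 3 ℚ.* (tr x ℚ.* tr (x · x)) ℚ.+ q 2 ℚ.* tr (x · x · x) ≡ q 6 ℚ.* N x
    newton′ = trans (solve 3 (λ a b d → a :* a :* a :- con (+ 3) :* (a :* b) :+ con (+ 2) :* d := (a :* a :* a :+ con (+ 2) :* d) :- con (+ 3) :* a :* b) refl (tr x) (tr (x · x)) (tr (x · x · x)))
      (trans (cong (λ w → w ℚ.- q 3 ℚ.* tr x ℚ.* tr (x · x)) (sym (newton x))) (solve 2 (λ a b → a :+ b :- b := a) refl (q 6 ℚ.* N x) (q 3 ℚ.* tr x ℚ.* tr (x · x))))

  private
    cancel-scale : ∀ k A → Neg (λ p → q (suc k) ℚ.* A p) → Neg A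
    cancel-scale k A = neg-÷ (λ _ → subst (1ℚ ℚ.≤_) (sym (ℚS.fromℕ-suc k)) (≤-byDiff (q k) (0≤q k) refl))

    1≤-* : ∀ {a b} → 1ℚ ℚ.≤ a → 1ℚ ℚ.≤ b → 1ℚ ℚ.≤ a ℚ.* b
    1≤-* {a} {b} p r = *-mono-≤ {1ℚ} {a} {1ℚ} {b} closed≤ p closed≤ r

    ≤-neg : ∀ {A B} → A ≈ B → ∀ {D} → (∀ p → D p ℚ.≤ A p ℚ.- B p) → Neg D
    ≤-neg e le = neg-≤ le (small⇒neg (small e))

    κ²₃ : Pt → ℚ
    κ²₃ p = (1ℚ ℚ.+ r₃ p) ℚ.* (1ℚ ℚ.+ r₃ p)

    1≤κ²₃ : ∀ p → 1ℚ ℚ.≤ κ²₃ p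
    1≤κ²₃ p = 1≤-* (1≤κ₃ p) (1≤κ₃ p)

    4κ²₃≤5 : ∀ p → q 4 ℚ.* κ²₃ p ℚ.≤ q 5
    4κ²₃≤5 p = ≤-byDiff _ (0≤-+ d (0≤-* (0≤-* (0≤q 2) (lo₃ p)) (0≤-+ d (0≤-* (0≤q 8) (lo₃ p)))))
      (solve 1 (λ r → let d = con (+ 1) :- con (+ 10) :* r in con (+ 4) :* ((con (+ 1) :+ r) :* (con (+ 1) :+ r)) :+ (d :+ con (+ 2) :* r :* (d :+ con (+ 8) :* r)) := con (+ 5)) refl (r₃ p))
      where d = ≤⇒0≤- (10r₃≤1 p)

    -- From 4 κ² ≤ 5 follows 64 κ⁶ ≤ 125 < 128.
    κ⁶₃≤2 : ∀ p → κ²₃ p ℚ.* κ²₃ p ℚ.* κ²₃ p ℚ.≤ q 2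
    κ⁶₃≤2 p = ℚP.*-cancelˡ-≤-pos (q 64) (≤-byDiff _ (0≤-+ (0≤-* (≤⇒0≤- (4κ²₃≤5 p)) (0≤-+ (0≤-+ (0≤q 25) (0≤-* (0≤q 20) w)) (0≤-* (0≤q 16) (0≤-* w w)))) (0≤q 3))
      (solve 1 (λ w → con (+ 64) :* (w :* w :* w) :+ ((con (+ 5) :- con (+ 4) :* w) :* (con (+ 25) :+ con (+ 20) :* w :+ con (+ 16) :* (w :* w)) :+ con (+ 3)) := con (+ 64) :* con (+ 2)) refl (κ²₃ p)))
      where w = ℚP.≤-trans (closed≤ {0ℚ} {1ℚ}) (1≤κ²₃ p)

    κ⁶₂≤2 : ∀ p → (1ℚ ℚ.+ r₂ p) ℚ.* (1ℚ ℚ.+ r₂ p) ℚ.* ((1ℚ ℚ.+ r₂ p) ℚ.* (1ℚ ℚ.+ r₂ p)) ℚ.* ((1ℚ ℚ.+ r₂ p) ℚ.* (1ℚ ℚ.+ r₂ p)) ℚ.≤ q 2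
    κ⁶₂≤2 p = ℚP.≤-trans (*-mono-≤ (0≤-* w w) (*-mono-≤ w (κ₂²≤1 p) w (κ₂²≤1 p)) w (κ₂²≤1 p)) closed≤
      where w = 0≤-square (1ℚ ℚ.+ r₂ p)

    halved : ∀ {S K⁶ : Pt → ℚ} → (λ p → q 4 ℚ.* S p) ≈ K⁶ → (∀ p → K⁶ p ℚ.≤ q 2) → Neg (λ p → q 2 ℚ.* S p ℚ.- 1ℚ)
    halved {S} {K⁶} e le = cancel-scale 1 (λ p → q 2 ℚ.* S p ℚ.- 1ℚ) (≤-neg e (λ p → ≤-byDiff _ (≤⇒0≤- (le p))
      (solve 2 (λ s k → con (+ 2) :* (con (+ 2) :* s :- con (+ 1)) :+ (con (+ 2) :- k) := con (+ 4) :* s :- k) refl (S p) (K⁶ p))))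

    -- Here X, Y, Z are the squared conjugates of x and A, B, D those of the multiplier. In the
    -- limit, (1 + ν) times the two contracted terms is at most Y + Z ≤ T, and the remaining term is
    -- at most (1 + ν) C X.
    isolate : ∀ (X Y Z A B D : Pt → ℚ) C T T′ → (∀ p → 0ℚ ℚ.≤ X p) → (∀ p → 0ℚ ℚ.≤ Y p) → (∀ p → 0ℚ ℚ.≤ Z p) → Bdd Y → Bdd Z → (∀ p → A p ℚ.≤ C) →
      Neg (λ p → (1ℚ ℚ.+ ν) ℚ.* B p ℚ.- 1ℚ) → Neg (λ p → (1ℚ ℚ.+ ν) ℚ.* D p ℚ.- 1ℚ) →
      (λ p → A p ℚ.* X p ℚ.+ B p ℚ.* Y p ℚ.+ D p ℚ.* Z p) ≈ (λ _ → T′) → (λ p → X p ℚ.+ Y p ℚ.+ Z p) ≈ (λ _ → T) →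
      Neg (λ p → (1ℚ ℚ.+ ν) ℚ.* T′ ℚ.- (1ℚ ℚ.+ ν) ℚ.* C ℚ.* X p ℚ.- T)
    isolate X Y Z A B D C T T′ 0≤X 0≤Y 0≤Z bY bZ A≤C cB cD eT′ eT =
      neg-≤ (λ p → ≤-byDiff _ (0≤-+ (0≤-* (0≤-* 0≤1+ν (≤⇒0≤- (A≤C p))) (0≤X p)) (0≤X p))
          (solve 10 (λ v C T T′ x y z a b d → (con (+ 1) :+ v) :* T′ :- (con (+ 1) :+ v) :* C :* x :- T :+ ((con (+ 1) :+ v) :* (C :- a) :* x :+ x)
            := (con (+ 1) :+ v) :* (T′ :- (a :* x :+ b :* y :+ d :* z)) :+ (x :+ y :+ z :- T) :+ (y :* ((con (+ 1) :+ v) :* b :- con (+ 1)) :+ z :* ((con (+ 1) :+ v) :* d :- con (+ 1))))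
            refl ν C T T′ (X p) (Y p) (Z p) (A p) (B p) (D p)))
        (neg-+ (neg-+ (small⇒neg (small-* (bdd-const (1ℚ ℚ.+ ν)) (small (≈-sym eT′)))) (small⇒neg (small eT))) (neg-+ (neg-* 0≤Y bY cB) (neg-* 0≤Z bZ cD)))
      where
      0≤1+ν : 0ℚ ℚ.≤ 1ℚ ℚ.+ ν
      0≤1+ν = 0≤-+ {1ℚ} closed≤ 0≤ν

  module Reduction (h₁ : ι (q 2) · E₁ ≡ κ · κ · κ) (h₂ : E₂ · (κ · κ · κ) ≡ ι (q 2) · ρ) (h₃ : E₃ · ρ ≡ 1K) where

    private
      E₁-at₂ : R₂.Contracts E₁
      E₁-at₂ = R₂.contracts E₁ (halved {R₂.sq E₁} (R₂.E₁-square h₁) κ⁶₂≤2)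

      E₁-at₃ : R₃.Contracts E₁
      E₁-at₃ = R₃.contracts E₁ (halved {R₃.sq E₁} (R₃.E₁-square h₁) κ⁶₃≤2)

      E₃-at₁ : R₁.Contracts E₃
      E₃-at₁ = R₁.contracts E₃ (≤-neg (R₁.E₃-square h₃) (λ p → ≤-byDiff _ (0≤-* (R₁.0≤sq E₃ p) (≤⇒0≤- (r₁²≥2 p)))
        (solve 2 (λ s r → con (+ 2) :* s :- con (+ 1) :+ s :* (r :- con (+ 2)) := s :* r :- con (+ 1)) refl (R₁.sq E₃ p) (r₁ p ℚ.* r₁ p))))

      E₃-at₂ : R₂.Contracts E₃
      E₃-at₂ = ≤-neg (R₂.E₃-square h₃) (λ p → ≤-byDiff _ (0≤-* (R₂.0≤sq E₃ p) (≤⇒0≤- (r₂²≥1+ν p)))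
        (solve 3 (λ v s r → (con (+ 1) :+ v) :* s :- con (+ 1) :+ s :* (r :- (con (+ 1) :+ v)) := s :* r :- con (+ 1)) refl ν (R₂.sq E₃ p) (r₂ p ℚ.* r₂ p)))

      -- In the limit E₂² κ⁶ = 4 ρ² ≤ 16 κ², and κ⁴ ≥ 32 because κ² ≥ 6; hence E₂² ≤ 1/2.
      E₂-at₁ : R₁.Contracts E₂
      E₂-at₁ = R₁.contracts E₂ (cancel-scale 15 (λ p → q 2 ℚ.* R₁.sq E₂ p ℚ.- 1ℚ) (neg-÷ {λ p → (1ℚ ℚ.+ r₁ p) ℚ.* (1ℚ ℚ.+ r₁ p)}
        (λ p → ℚP.≤-trans closed≤ (κ₁²≥49 p))
        (≤-neg (R₁.E₂-square h₂) (λ p → ≤-byDiff _ (0≤-+ (0≤-* (0≤-* (R₁.0≤sq E₂ p) (0≤-square (1ℚ ℚ.+ r₁ p))) (0≤-+ (0≤-+ (0≤-* (h p) (h p)) (0≤-* (0≤q 12) (h p))) (0≤q 4)))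
              (0≤-* (0≤q 4) (≤⇒0≤- (r₁²≤4κ₁² p))))
          (solve 3 (λ s k r → let h = k :- con (+ 6) in k :* (con (+ 16) :* (con (+ 2) :* s :- con (+ 1))) :+ (s :* k :* (h :* h :+ con (+ 12) :* h :+ con (+ 4)) :+ con (+ 4) :* (con (+ 4) :* k :- r))
             := s :* (k :* k :* k) :- con (+ 4) :* r) refl (R₁.sq E₂ p) ((1ℚ ℚ.+ r₁ p) ℚ.* (1ℚ ℚ.+ r₁ p)) (r₁ p ℚ.* r₁ p))))))
        where
        h : ∀ p → 0ℚ ℚ.≤ (1ℚ ℚ.+ r₁ p) ℚ.* (1ℚ ℚ.+ r₁ p) ℚ.- q 6
        h p = ≤⇒0≤- {q 6} (ℚP.≤-trans (closed≤ {q 6} {q 49}) (κ₁²≥49 p))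

      E₂-at₃ : R₃.Contracts E₂
      E₂-at₃ = R₃.contracts E₂ (neg-≤ (λ p → ≤-byDiff _ (0≤-+ (0≤-* (0≤-* (0≤q 2) (R₃.0≤sq E₂ p)) (≤⇒0≤- (1≤-* (1≤-* (1≤κ²₃ p) (1≤κ²₃ p)) (1≤κ²₃ p))))
              (0≤-+ (≤⇒0≤- (10r₃≤1 p)) (0≤-* (lo₃ p) (0≤-+ (≤⇒0≤- (10r₃≤1 p)) (0≤-+ (0≤q 9) (0≤-* (0≤q 2) (lo₃ p)))))))
          (solve 3 (λ s k r → let d = con (+ 1) :- con (+ 10) :* r in con (+ 2) :* s :- con (+ 1) :+ (con (+ 2) :* s :* (k :* k :* k :- con (+ 1)) :+ (d :+ r :* (d :+ (con (+ 9) :+ con (+ 2) :* r))))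
             := con (+ 2) :* (s :* (k :* k :* k) :- con (+ 4) :* (r :* r))) refl (R₃.sq E₂ p) (κ²₃ p) (r₃ p)))
        (small⇒neg (small-* (bdd-const (q 2)) (small (R₃.E₂-square h₂)))))

      upper : ∀ {A} ((B , _) : Bdd A) → ∀ p → A p ℚ.≤ B
      upper {A} (B , _ , le) p = ℚP.≤-trans (≤-abs (A p)) (le p)

      C : ℚ
      C = proj₁ (R₁.bdd-sq E₁) ℚ.+ proj₁ (R₂.bdd-sq E₂) ℚ.+ proj₁ (R₃.bdd-sq E₃)

      C₁ = proj₁ (proj₂ (R₁.bdd-sq E₁))
      C₂ = proj₁ (proj₂ (R₂.bdd-sq E₂))
      C₃ = proj₁ (proj₂ (R₃.bdd-sq E₃))

      E₁≤C : ∀ p → R₁.sq E₁ p ℚ.≤ C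
      E₁≤C p = ℚP.≤-trans (upper (R₁.bdd-sq E₁) p) (≤-byDiff _ (0≤-+ C₂ C₃) (sym (ℚP.+-assoc (proj₁ (R₁.bdd-sq E₁)) _ _)))

      E₂≤C : ∀ p → R₂.sq E₂ p ℚ.≤ C
      E₂≤C p = ℚP.≤-trans (upper (R₂.bdd-sq E₂) p) (≤-byDiff _ (0≤-+ C₁ C₃) (solve 3 (λ a b c → b :+ (a :+ c) := a :+ b :+ c) refl (proj₁ (R₁.bdd-sq E₁)) (proj₁ (R₂.bdd-sq E₂)) (proj₁ (R₃.bdd-sq E₃))))

      E₃≤C : ∀ p → R₃.sq E₃ p ℚ.≤ C
      E₃≤C p = ℚP.≤-trans (upper (R₃.bdd-sq E₃) p) (≤-byDiff _ (0≤-+ C₁ C₂) (solve 3 (λ a b c → c :+ (a :+ b) := a :+ b :+ c) refl (proj₁ (R₁.bdd-sq E₁)) (proj₁ (R₂.bdd-sq E₂)) (proj₁ (R₃.bdd-sq E₃))))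

      ν-sum : ∀ e x → (λ p → R₁.sq e p ℚ.* R₁.sq x p ℚ.+ R₂.sq e p ℚ.* R₂.sq x p ℚ.+ R₃.sq e p ℚ.* R₃.sq x p) ≈ (λ _ → tr ((e · x) · (e · x)))
      ν-sum e x = ≈-trans (≈-+ (≈-+ (≈-sym (R₁.sq-mul e x)) (≈-sym (R₂.sq-mul e x))) (≈-sym (R₃.sq-mul e x))) (ξ-sum ((e · x) · (e · x)))

      Bound : K → (Pt → ℚ) → K → Set
      Bound e X x = Neg (λ p → (1ℚ ℚ.+ ν) ℚ.* tr ((e · x) · (e · x)) ℚ.- (1ℚ ℚ.+ ν) ℚ.* C ℚ.* X p ℚ.- tr (x · x))

      bound₁ : ∀ x → Bound E₁ (R₁.sq x) x
      bound₁ x = isolate (R₁.sq x) (R₂.sq x) (R₃.sq x) (R₁.sq E₁) (R₂.sq E₁) (R₃.sq E₁) C (tr (x · x)) (tr ((E₁ · x) · (E₁ · x)))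
        (R₁.0≤sq x) (R₂.0≤sq x) (R₃.0≤sq x) (R₂.bdd-sq x) (R₃.bdd-sq x) E₁≤C E₁-at₂ E₁-at₃ (ν-sum E₁ x) (ξ²-sum x)

      bound₂ : ∀ x → Bound E₂ (R₂.sq x) x
      bound₂ x = isolate (R₂.sq x) (R₁.sq x) (R₃.sq x) (R₂.sq E₂) (R₁.sq E₂) (R₃.sq E₂) C (tr (x · x)) (tr ((E₂ · x) · (E₂ · x)))
        (R₂.0≤sq x) (R₁.0≤sq x) (R₃.0≤sq x) (R₁.bdd-sq x) (R₃.bdd-sq x) E₂≤C E₂-at₁ E₂-at₃
        (≈-trans (≡⇒≈ (λ p → cong (ℚ._+ R₃.sq E₂ p ℚ.* R₃.sq x p) (ℚP.+-comm (R₂.sq E₂ p ℚ.* R₂.sq x p) (R₁.sq E₂ p ℚ.* R₁.sq x p)))) (ν-sum E₂ x))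
        (≈-trans (≡⇒≈ (λ p → cong (ℚ._+ R₃.sq x p) (ℚP.+-comm (R₂.sq x p) (R₁.sq x p)))) (ξ²-sum x))

      bound₃ : ∀ x → Bound E₃ (R₃.sq x) x
      bound₃ x = isolate (R₃.sq x) (R₁.sq x) (R₂.sq x) (R₃.sq E₃) (R₁.sq E₃) (R₂.sq E₃) C (tr (x · x)) (tr ((E₃ · x) · (E₃ · x)))
        (R₃.0≤sq x) (R₁.0≤sq x) (R₂.0≤sq x) (R₁.bdd-sq x) (R₂.bdd-sq x) E₃≤C E₃-at₁ E₃-at₂
        (≈-trans (≡⇒≈ (λ p → trans (ℚP.+-assoc (R₃.sq E₃ p ℚ.* R₃.sq x p) _ _) (ℚP.+-comm (R₃.sq E₃ p ℚ.* R₃.sq x p) (R₁.sq E₃ p ℚ.* R₁.sq x p ℚ.+ R₂.sq E₃ p ℚ.* R₂.sq x p)))) (ν-sum E₃ x))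
        (≈-trans (≡⇒≈ (λ p → trans (ℚP.+-assoc (R₃.sq x p) _ _) (ℚP.+-comm (R₃.sq x p) (R₁.sq x p ℚ.+ R₂.sq x p)))) (ξ²-sum x))

      fine : ∀ B → 0ℚ ℚ.≤ B → ∃ λ p → B ℚ.* ε p ℚ.≤ 1ℚ
      fine B 0≤B = close (inverse {3B+3} (λ e → ℚ<⇒≱ {0ℚ} {q 3} (toWitness {a? = 0ℚ ℚP.<? q 3} tt) (subst (q 3 ℚ.≤_) e (≤-byDiff (q 3 ℚ.* B) (0≤-* (0≤q 3) 0≤B) (ℚP.+-comm (q 3) (q 3 ℚ.* B))))))
        where
        -- The summand 3 keeps this invertible when B = 0; δ is its inverse, so that B (3 δ) ≤ 1.
        3B+3 = q 3 ℚ.* B ℚ.+ q 3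
        close : (∃ λ δ → 3B+3 ℚ.* δ ≡ 1ℚ) → ∃ λ p → B ℚ.* ε p ℚ.≤ 1ℚ
        close (δ , e) = finish (near δ (ℚP.≰⇒> (λ δ≤0 → 0≢1 (trans (sym (ℚP.*-zeroʳ 3B+3)) (trans (cong (3B+3 ℚ.*_) (ℚP.≤-antisym 0≤δ δ≤0)) e)))))
          where
          0≢1 : 0ℚ ≢ 1ℚ
          0≢1 ()
          0≤δ : 0ℚ ℚ.≤ δ
          0≤δ = 0≤-inverse (0≤-+ (0≤-* (0≤q 3) 0≤B) (0≤q 3)) e
          finish : (∃ λ p → ε p ℚ.≤ δ ℚ.+ δ ℚ.+ δ) → ∃ λ p → B ℚ.* ε p ℚ.≤ 1ℚ
          finish (p , le) = p , ℚP.≤-trans (ℚP.*-monoˡ-≤-nonNeg B {{ℚ.nonNegative 0≤B}} le)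
            (≤-byDiff (q 3 ℚ.* δ) (0≤-* (0≤q 3) 0≤δ) (trans (solve 2 (λ B d → B :* (d :+ d :+ d) :+ con (+ 3) :* d := (con (+ 3) :* B :+ con (+ 3)) :* d) refl B δ) e))

    -- Chosen so that T = tr (x²) above it satisfies ν T ≥ 4 (1 + ν) C + 2. This beats the term (1 +
    -- ν) C X with X ≤ 4 and an approximation error of at most 1, and leaves a strict decrease.
    threshold : ℚ
    threshold = c ℚ.* (q 4 ℚ.* ((1ℚ ℚ.+ ν) ℚ.* C) ℚ.+ q 2)

    Decreases : K → K → Set
    Decreases e x = tr ((e · x) · (e · x)) ℚ.< tr (x · x)

    -- One conjugate of x is at most 2 in absolute value; the unit that contracts the other two decreases tr (x²).
    reduce : ∀ x → N x ≡ 1ℚ ⊎ N x ≡ ℚ.- 1ℚ → threshold ℚ.≤ tr (x · x) → Decreases E₁ x ⊎ Decreases E₂ x ⊎ Decreases E₃ x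
    reduce x Nx≡±1 large = atPoint (bound₁ x) (bound₂ x) (bound₃ x) (small (ξ-product x))
      where
      0≤C : 0ℚ ℚ.≤ C
      0≤C = 0≤-+ (0≤-+ C₁ C₂) C₃
      0≤1+ν : 0ℚ ℚ.≤ 1ℚ ℚ.+ ν
      0≤1+ν = 0≤-+ {1ℚ} closed≤ 0≤ν
      T = tr (x · x)
      νT : q 4 ℚ.* ((1ℚ ℚ.+ ν) ℚ.* C) ℚ.+ q 2 ℚ.≤ ν ℚ.* T
      νT = ℚP.≤-trans (ℚP.≤-reflexive (trans (trans (sym (ℚP.*-identityˡ _)) (cong (ℚ._* (q 4 ℚ.* ((1ℚ ℚ.+ ν) ℚ.* C) ℚ.+ q 2)) (sym cν≡1)))
        (solve 3 (λ c v w → c :* v :* w := v :* (c :* w)) refl c ν (q 4 ℚ.* ((1ℚ ℚ.+ ν) ℚ.* C) ℚ.+ q 2)))) (ℚP.*-monoˡ-≤-nonNeg ν {{ℚ.nonNegative 0≤ν}} large)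
      decrease : ∀ {e X} → (1ℚ ℚ.+ ν) ℚ.* tr ((e · x) · (e · x)) ℚ.- (1ℚ ℚ.+ ν) ℚ.* C ℚ.* X ℚ.- T ℚ.≤ 1ℚ → X ℚ.≤ q 4 → Decreases e x
      decrease {e} {X} le X≤4 = ℚP.≰⇒> (λ T≤T′ → ℚ<⇒≱ {0ℚ} {1ℚ} (toWitness {a? = 0ℚ ℚP.<? 1ℚ} tt)
        (≤-byDiff _ (0≤-+ (0≤-+ (0≤-+ (≤⇒0≤- le) (≤⇒0≤- νT)) (0≤-* (0≤-* 0≤1+ν 0≤C) (≤⇒0≤- X≤4))) (0≤-* 0≤1+ν (≤⇒0≤- T≤T′)))
          (solve 5 (λ v C T T′ X → con (+ 1) :+ (con (+ 1) :- ((con (+ 1) :+ v) :* T′ :- (con (+ 1) :+ v) :* C :* X :- T) :+ (v :* T :- (con (+ 4) :* ((con (+ 1) :+ v) :* C) :+ con (+ 2)))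
              :+ (con (+ 1) :+ v) :* C :* (con (+ 4) :- X) :+ (con (+ 1) :+ v) :* (T′ :- T)) := con (+ 0)) refl ν C T (tr ((e · x) · (e · x))) X)))
      atPoint : Bound E₁ (R₁.sq x) x → Bound E₂ (R₂.sq x) x → Bound E₃ (R₃.sq x) x → Small (λ p → R₁.ξ x p ℚ.* R₂.ξ x p ℚ.* R₃.ξ x p ℚ.- N x) → Decreases E₁ x ⊎ Decreases E₂ x ⊎ Decreases E₃ x
      -- One point is taken so close to the roots that all four errors are at most 1. The product of
      -- the conjugates of x is then within 1 of N x = ± 1, hence at most 2 in absolute value, and
      -- the three squares cannot all be at least 4.
      atPoint (B₁ , 0≤B₁ , le₁) (B₂ , 0≤B₂ , le₂) (B₃ , 0≤B₃ , le₃) (B₄ , 0≤B₄ , le₄) = choose (fine (B₁ ℚ.+ B₂ ℚ.+ B₃ ℚ.+ B₄) (0≤-+ (0≤-+ (0≤-+ 0≤B₁ 0≤B₂) 0≤B₃) 0≤B₄))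
        where
        choose : (∃ λ p → (B₁ ℚ.+ B₂ ℚ.+ B₃ ℚ.+ B₄) ℚ.* ε p ℚ.≤ 1ℚ) → Decreases E₁ x ⊎ Decreases E₂ x ⊎ Decreases E₃ x
        choose (p , le) = [ (λ s → inj₁ (decrease (part B₁ (0≤-+ (0≤-+ 0≤B₂ 0≤B₃) 0≤B₄) (solve 4 (λ a b c d → a :+ (b :+ c :+ d) := a :+ b :+ c :+ d) refl B₁ B₂ B₃ B₄) (le₁ p)) s))
            , (λ b₁ → [ (λ s → inj₂ (inj₁ (decrease (part B₂ (0≤-+ (0≤-+ 0≤B₁ 0≤B₃) 0≤B₄) (solve 4 (λ a b c d → b :+ (a :+ c :+ d) := a :+ b :+ c :+ d) refl B₁ B₂ B₃ B₄) (le₂ p)) s)))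
            , (λ b₂ → [ (λ s → inj₂ (inj₂ (decrease (part B₃ (0≤-+ (0≤-+ 0≤B₁ 0≤B₂) 0≤B₄) (solve 4 (λ a b c d → c :+ (a :+ b :+ d) := a :+ b :+ c :+ d) refl B₁ B₂ B₃ B₄) (le₃ p)) s)))
            , (λ b₃ → ⊥-elim (impossible b₁ b₂ b₃)) ]′ (ℚP.≤-total (R₃.sq x p) (q 4))) ]′ (ℚP.≤-total (R₂.sq x p) (q 4))) ]′ (ℚP.≤-total (R₁.sq x p) (q 4))
          where
          part : ∀ B {B′ a} → 0ℚ ℚ.≤ B′ → B ℚ.+ B′ ≡ B₁ ℚ.+ B₂ ℚ.+ B₃ ℚ.+ B₄ → a ℚ.≤ B ℚ.* ε p → a ℚ.≤ 1ℚ
          part B {B′} 0≤B′ eq a≤ = ℚP.≤-trans a≤ (ℚP.≤-trans (ℚP.*-monoʳ-≤-nonNeg (ε p) {{ℚ.nonNegative (0≤ε p)}} (≤-byDiff {B} B′ 0≤B′ eq)) le)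
          m = R₁.ξ x p ℚ.* R₂.ξ x p ℚ.* R₃.ξ x p
          ∣m-N∣≤1 : ℚ.∣ m ℚ.- N x ∣ ℚ.≤ 1ℚ
          ∣m-N∣≤1 = part B₄ (0≤-+ (0≤-+ 0≤B₁ 0≤B₂) 0≤B₃) (solve 4 (λ a b c d → d :+ (a :+ b :+ c) := a :+ b :+ c :+ d) refl B₁ B₂ B₃ B₄) (le₄ p)
          ∣N∣≤1 : ℚ.∣ N x ∣ ℚ.≤ 1ℚ
          ∣N∣≤1 = [ (λ e → subst (λ v → ℚ.∣ v ∣ ℚ.≤ 1ℚ) (sym e) closed≤) , (λ e → subst (λ v → ℚ.∣ v ∣ ℚ.≤ 1ℚ) (sym e) closed≤) ]′ Nx≡±1
          ∣m∣≤2 : ℚ.∣ m ∣ ℚ.≤ q 2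
          ∣m∣≤2 = ℚP.≤-trans (subst (λ v → ℚ.∣ v ∣ ℚ.≤ ℚ.∣ m ℚ.- N x ∣ ℚ.+ ℚ.∣ N x ∣) (solve 2 (λ m N → m :- N :+ N := m) refl m (N x)) (ℚP.∣p+q∣≤∣p∣+∣q∣ (m ℚ.- N x) (N x))) (ℚP.+-mono-≤ ∣m-N∣≤1 ∣N∣≤1)
          impossible : q 4 ℚ.≤ R₁.sq x p → q 4 ℚ.≤ R₂.sq x p → q 4 ℚ.≤ R₃.sq x p → ⊥
          impossible b₁ b₂ b₃ = ℚ<⇒≱ {q 4} {q 64} (toWitness {a? = q 4 ℚP.<? q 64} tt) (begin
            q 64                                          ≤⟨ *-mono-≤ {q 16} closed≤ (*-mono-≤ {q 4} closed≤ b₁ closed≤ b₂) closed≤ b₃ ⟩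
            R₁.sq x p ℚ.* R₂.sq x p ℚ.* R₃.sq x p         ≡⟨ solve 3 (λ a b d → a :* a :* (b :* b) :* (d :* d) := a :* b :* d :* (a :* b :* d)) refl (R₁.ξ x p) (R₂.ξ x p) (R₃.ξ x p) ⟩
            m ℚ.* m                                       ≤⟨ ≤-abs (m ℚ.* m) ⟩
            ℚ.∣ m ℚ.* m ∣                                 ≡⟨ ℚP.∣p*q∣≡∣p∣*∣q∣ m m ⟩
            ℚ.∣ m ∣ ℚ.* ℚ.∣ m ∣                           ≤⟨ *-mono-≤ (ℚP.0≤∣p∣ m) ∣m∣≤2 (ℚP.0≤∣p∣ m) ∣m∣≤2 ⟩
            q 4 ∎)
            where open ℚP.≤-Reasoning

-- Fields with n odd

even-cube : ∀ {a A} → IsInt a → IsInt A → a ℚ.* a ℚ.* a ≡ ℚS.fromℤ (+ 2) ℚ.* A → ∃ λ z → IsInt z × a ≡ ℚS.fromℤ (+ 2) ℚ.* z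
even-cube (u , refl) (v , refl) e = halve (ℤD.∣ᵤ⇒∣ {+ 2} {u} 2∣u)
  where
  uuu≡2v : u ℤ.* u ℤ.* u ≡ + 2 ℤ.* v
  uuu≡2v = int-injective (trans (trans (int-* (u ℤ.* u) u) (cong (ℚ._* int u) (int-* u u))) (trans e (trans (cong (ℚ._* int v) (fromℕ≡ 2)) (sym (int-* (+ 2) v)))))
  2∣uuu : 2 ℕD.∣ ℤ.∣ u ∣ ℕ.* ℤ.∣ u ∣ ℕ.* ℤ.∣ u ∣
  2∣uuu = ℕD.divides ℤ.∣ v ∣ (trans (trans (cong (ℕ._* ℤ.∣ u ∣) (sym (ℤP.abs-* u u))) (sym (ℤP.abs-* (u ℤ.* u) u))) (trans (cong ℤ.∣_∣ uuu≡2v) (trans (ℤP.abs-* (+ 2) v) (ℕP.*-comm 2 ℤ.∣ v ∣))))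
  2∣u : 2 ℕD.∣ ℤ.∣ u ∣
  2∣u = [ ∣-even-square ℤ.∣ u ∣ , id ]′ (Prim.euclidsLemma (ℤ.∣ u ∣ ℕ.* ℤ.∣ u ∣) ℤ.∣ u ∣ Prim.prime[2] 2∣uuu)
  halve : + 2 ℤD.∣ u → ∃ λ z → IsInt z × int u ≡ ℚS.fromℤ (+ 2) ℚ.* z
  halve (ℤD.divides k eq) = int k , isInt-int k , trans (cong int (trans eq (ℤP.*-comm k (+ 2)))) (trans (int-* (+ 2) k) (cong (ℚ._* int k) (sym (fromℕ≡ 2))))

-- Divisibility by 2ᵏ for the single exponent k = |u| already forces u = 0, because k < 2ᵏ.
infinitelyEven : ∀ {a} → IsInt a → (∀ k → ∃ λ b → IsInt b × a ≡ 2^ k ℚ.* b) → a ≡ 0ℚ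
infinitelyEven {a} (u , refl) h = from (h ℤ.∣ u ∣)
  where
  k = ℤ.∣ u ∣
  from : (∃ λ b → IsInt b × int u ≡ 2^ k ℚ.* b) → int u ≡ 0ℚ
  from (b , (v , refl) , e) = trans (cong int (ℤP.∣i∣≡0⇒i≡0 {u} (zero-or-large k ℤ.∣ v ∣ size))) int-0
    where
    size : k ≡ 2 ℕ.^ k ℕ.* ℤ.∣ v ∣
    size = trans (cong ℤ.∣_∣ (int-injective (trans e (trans (cong (ℚ._* int v) (2^≡ k)) (sym (int-* (+ (2 ℕ.^ k)) v)))))) (ℤP.abs-* (+ (2 ℕ.^ k)) v)
    zero-or-large : ∀ k w → k ≡ 2 ℕ.^ k ℕ.* w → k ≡ 0
    zero-or-large k zero e = trans e (ℕP.*-zeroʳ (2 ℕ.^ k))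
    zero-or-large k (suc w) e = ⊥-elim (ℕP.<⇒≱ (k<2+n^k 0 k) (ℕP.≤-trans (ℕP.m≤m*n (2 ℕ.^ k) (suc w)) (ℕP.≤-reflexive (sym e))))

module OddField (n m : ℕ) (10≤n : 10 ℕ.≤ n) (n≡ : n ≡ 1 ℕ.+ 2 ℕ.* m) where

  open CubicField n
  open KS.Solver using (solve; _:+_; _:*_; :-_; _:-_; con; _:=_)
  private
    module QR = ℚS.Solver

    q : ℕ → ℚ
    q k = ℚS.fromℤ (+ k)

    0≤q : ∀ k → 0ℚ ℚ.≤ q k
    0≤q k = subst (0ℚ ℚ.≤_) (sym (fromℕ≡ k)) (0≤int k)

    c : ℚ
    c = nℚ n

    int-c : IsInt c
    int-c = isInt-ℤtoℚ (+ n)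

    10≤c : q 10 ℚ.≤ c
    10≤c = subst₂ ℚ._≤_ (sym (fromℕ≡ 10)) (int≡ℤtoℚ (+ n)) (int-mono-ℕ 10≤n)

    int-q : ∀ k → IsInt (q k)
    int-q k = + k , fromℕ≡ k

    h : ℚ
    h = 1ℚ ℚ.- int (+ m)

    int-h : IsInt h
    int-h = isInt-+ isInt-1 (isInt-neg (isInt-int (+ m)))

    2h : q 2 ℚ.* h ≡ q 3 ℚ.- c
    2h = trans (QR.solve 1 (λ m → QR.con (+ 2) QR.:* (QR.con (+ 1) QR.:- m) QR.:= QR.con (+ 3) QR.:- (QR.con (+ 1) QR.:+ QR.con (+ 2) QR.:* m)) refl (int (+ m)))
      (cong (λ v → q 3 ℚ.- v) (sym c≡))
      where
      c≡ : c ≡ 1ℚ ℚ.+ q 2 ℚ.* int (+ m)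
      c≡ = trans (sym (int≡ℤtoℚ (+ n))) (trans (cong (λ k → int (+ k)) n≡) (trans (int-+ (+ 1) (+ (2 ℕ.* m))) (cong₂ ℚ._+_ int-1 (trans (cong int (ℤP.pos-* 2 m)) (trans (int-* (+ 2) (+ m)) (cong (ℚ._* int (+ m)) (sym (fromℕ≡ 2))))))))

  -- Half of κ³: the coordinate (3 - n) / 2 is an integer for odd n. It is a unit because N κ = 2
  -- and N 2 = 8.
  η : K
  η = 1ℚ , h , h

  lat-η : Lat η
  lat-η = isInt-1 , int-h , int-h

  η≡κ³ : ι (q 2) · η ≡ κ · κ · κ
  η≡κ³ = κ³≡ h 2h

  ι-cancel : ∀ {s x y} → s ≢ 0ℚ → ι s · x ≡ ι s · y → x ≡ y
  ι-cancel {s} {x} {y} s≢0 e = from (inverse s≢0)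
    where
    unscale : ∀ i → s ℚ.* i ≡ 1ℚ → ∀ x → x ≡ ι i · (ι s · x)
    unscale i si≡1 x = trans (solve 1 (λ x → x := con (+ 1) :* x) refl x) (trans (cong (λ u → ι u · x) (sym si≡1)) (trans (cong (_· x) (ι-mul s i)) (solve 3 (λ s i x → s :* i :* x := i :* (s :* x)) refl (ι s) (ι i) x)))
    from : (∃ λ i → s ℚ.* i ≡ 1ℚ) → x ≡ y
    from (i , si≡1) = trans (unscale i si≡1 x) (trans (cong (ι i ·_) e) (sym (unscale i si≡1 y)))

  N-η : N η ≡ 1ℚ
  N-η = *-cancelˡ {q 2 ℚ.* q 2 ℚ.* q 2} (λ ()) (begin
    q 2 ℚ.* q 2 ℚ.* q 2 ℚ.* N η  ≡⟨ cong (ℚ._* N η) (sym (N-ι (q 2))) ⟩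
    N (ι (q 2)) ℚ.* N η          ≡⟨ sym (N-mul (ι (q 2)) η) ⟩
    N (ι (q 2) · η)              ≡⟨ cong N η≡κ³ ⟩
    N (κ · κ · κ)                ≡⟨ trans (N-mul (κ · κ) κ) (cong (ℚ._* N κ) (N-mul κ κ)) ⟩
    N κ ℚ.* N κ ℚ.* N κ          ≡⟨ cong (λ v → v ℚ.* v ℚ.* v) N-κ ⟩
    q 2 ℚ.* q 2 ℚ.* q 2 ℚ.* 1ℚ ∎)
    where open ≡-Reasoning

  norm1⇒inverse : ∀ {x} → N x ≡ 1ℚ → x · x ♯ ≡ 1K
  norm1⇒inverse {x} e = trans (mul-♯ x) (cong ι e)

  private
    -- Division by κ leaves a rational integer a. In N (κ w + a) = 0 every term but a³ is even, so a
    -- is even, and 2 = κ θ makes it a multiple of κ as well.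
    κ-halves : ∀ {x} → Lat x → N x ≡ 0ℚ → ∃ λ y → Lat y × N y ≡ 0ℚ × x ≡ κ · y
    κ-halves {x@(x₀ , x₁ , x₂)} (i₀ , i₁ , i₂) Nx≡0 = from (even-cube int-a (isInt-neg (isInt-+ (isInt-+ (lat⇒intN lat-w) (isInt-* int-e int-a)) (isInt-* (isInt-* int-t int-a) int-a))) cube)
      where
      a s : ℚ
      a = x₀ ℚ.- x₁ ℚ.+ x₂
      s = x₁ ℚ.- x₂ ℚ.- x₂
      w : K
      w = s ℚ.+ x₂ , x₂ , 0ℚ
      int-a : IsInt a
      int-a = isInt-+ (isInt-+ i₀ (isInt-neg i₁)) i₂
      int-s : IsInt s
      int-s = isInt-+ (isInt-+ i₁ (isInt-neg i₂)) (isInt-neg i₂)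
      lat-w : Lat w
      lat-w = isInt-+ int-s i₂ , i₂ , isInt-0
      x≡ : x ≡ κ · w ⊕ ι a
      x≡ = trans (κ-division x₀ x₁ x₂) (cong (λ u → κ · (u , x₂ , 0ℚ) ⊕ ι a) (QR.solve 2 (λ x y → x QR.:- y QR.:= x QR.:- y QR.:- y QR.:+ y) refl x₁ x₂))
      t e : ℚ
      t = h ℚ.* s ℚ.+ (q 2 ℚ.* h ℚ.* h ℚ.- q 2 ℚ.* h) ℚ.* x₂
      e = h ℚ.* s ℚ.* s ℚ.+ (q 2 ℚ.* h ℚ.* h ℚ.- q 3) ℚ.* s ℚ.* x₂ ℚ.+ (q 2 ℚ.* h ℚ.* h ℚ.- q 4 ℚ.* h) ℚ.* x₂ ℚ.* x₂
      int-2h² : IsInt (q 2 ℚ.* h ℚ.* h)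
      int-2h² = isInt-* (isInt-* (int-q 2) int-h) int-h
      int-t : IsInt t
      int-t = isInt-+ (isInt-* int-h int-s) (isInt-* (isInt-+ int-2h² (isInt-neg (isInt-* (int-q 2) int-h))) i₂)
      int-e : IsInt e
      int-e = isInt-+ (isInt-+ (isInt-* (isInt-* int-h int-s) int-s) (isInt-* (isInt-* (isInt-+ int-2h² (isInt-neg (int-q 3))) int-s) i₂)) (isInt-* (isInt-* (isInt-+ int-2h² (isInt-neg (isInt-* (int-q 4) int-h))) i₂) i₂)
      t≡ : tr (κ · w) ≡ q 2 ℚ.* t
      t≡ = trans (tr-κ s x₂) (trans (cong (λ g → g ℚ.* s ℚ.+ (g ℚ.* g ℚ.- q 2 ℚ.* g) ℚ.* x₂) (sym 2h))
        (QR.solve 3 (λ h s t → QR.con (+ 2) QR.:* h QR.:* s QR.:+ (QR.con (+ 2) QR.:* h QR.:* (QR.con (+ 2) QR.:* h) QR.:- QR.con (+ 2) QR.:* (QR.con (+ 2) QR.:* h)) QR.:* t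
          QR.:= QR.con (+ 2) QR.:* (h QR.:* s QR.:+ (QR.con (+ 2) QR.:* h QR.:* h QR.:- QR.con (+ 2) QR.:* h) QR.:* t)) refl h s x₂))
      e≡ : e₂ (κ · w) ≡ q 2 ℚ.* e
      e≡ = trans (e₂-κ s x₂) (trans (cong (λ g → g ℚ.* s ℚ.* s ℚ.+ (g ℚ.* g ℚ.- q 6) ℚ.* s ℚ.* x₂ ℚ.+ (g ℚ.* g ℚ.- q 4 ℚ.* g) ℚ.* x₂ ℚ.* x₂) (sym 2h))
        (QR.solve 3 (λ h s t → let g = QR.con (+ 2) QR.:* h in g QR.:* s QR.:* s QR.:+ (g QR.:* g QR.:- QR.con (+ 6)) QR.:* s QR.:* t QR.:+ (g QR.:* g QR.:- QR.con (+ 4) QR.:* g) QR.:* t QR.:* t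
          QR.:= QR.con (+ 2) QR.:* (h QR.:* s QR.:* s QR.:+ (QR.con (+ 2) QR.:* h QR.:* h QR.:- QR.con (+ 3)) QR.:* s QR.:* t QR.:+ (QR.con (+ 2) QR.:* h QR.:* h QR.:- QR.con (+ 4) QR.:* h) QR.:* t QR.:* t)) refl h s x₂))
      N≡ : N x ≡ q 2 ℚ.* N w ℚ.+ q 2 ℚ.* e ℚ.* a ℚ.+ q 2 ℚ.* t ℚ.* a ℚ.* a ℚ.+ a ℚ.* a ℚ.* a
      N≡ = trans (cong N x≡) (trans (N-add-ι (κ · w) a) (cong₂ (λ u v → u ℚ.+ v ℚ.* a ℚ.* a ℚ.+ a ℚ.* a ℚ.* a)
        (cong₂ (λ u v → u ℚ.+ v ℚ.* a) (trans (N-mul κ w) (cong (ℚ._* N w) N-κ)) e≡) t≡))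
      cube : a ℚ.* a ℚ.* a ≡ q 2 ℚ.* (ℚ.- (N w ℚ.+ e ℚ.* a ℚ.+ t ℚ.* a ℚ.* a))
      cube = trans (QR.solve 4 (λ N e t a → a QR.:* a QR.:* a QR.:= (QR.con (+ 2) QR.:* N QR.:+ QR.con (+ 2) QR.:* e QR.:* a QR.:+ QR.con (+ 2) QR.:* t QR.:* a QR.:* a QR.:+ a QR.:* a QR.:* a)
           QR.:+ QR.con (+ 2) QR.:* (QR.:- (N QR.:+ e QR.:* a QR.:+ t QR.:* a QR.:* a))) refl (N w) e t a)
        (trans (cong (ℚ._+ q 2 ℚ.* (ℚ.- (N w ℚ.+ e ℚ.* a ℚ.+ t ℚ.* a ℚ.* a))) (trans (sym N≡) Nx≡0)) (ℚP.+-identityˡ _))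
      θ : K
      θ = 1ℚ , c ℚ.- 1ℚ , 1ℚ
      from : (∃ λ z → IsInt z × a ≡ q 2 ℚ.* z) → ∃ λ y → Lat y × N y ≡ 0ℚ × x ≡ κ · y
      from (z , iz , a≡) = y , lat-add {w} {θ · ι z} lat-w (lat-mul {θ} {ι z} (isInt-1 , isInt-+ int-c (isInt-neg isInt-1) , isInt-1) (lat-ι iz))
          , *-cancelˡ {q 2} (λ ()) (trans (cong (ℚ._* N y) (sym N-κ)) (trans (sym (N-mul κ y)) (trans (cong N (sym eq)) Nx≡0))) , eq
        where
        y = w ⊕ θ · ι z
        eq : x ≡ κ · y
        eq = trans x≡ (trans (cong (λ u → κ · w ⊕ u) (trans (cong ι a≡) (trans (ι-mul (q 2) z) (cong (_· ι z) (sym κ-cofactor))))) (solve 4 (λ k w t z → k :* w :+ k :* t :* z := k :* (w :+ t :* z)) refl κ w θ (ι z)))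

    halves : ∀ {x} → Lat x → N x ≡ 0ℚ → ∃ λ y → Lat y × N y ≡ 0ℚ × x ≡ ι (q 2) · y
    halves {x} l e = step₁ (κ-halves l e)
      where
      step₃ : ∀ {y y′} → x ≡ κ · y → y ≡ κ · y′ → (∃ λ y″ → Lat y″ × N y″ ≡ 0ℚ × y′ ≡ κ · y″) → ∃ λ y → Lat y × N y ≡ 0ℚ × x ≡ ι (q 2) · y
      step₃ {y} {y′} e₁ e₂ (y″ , l″ , n″ , e₃) = η · y″ , lat-mul {η} {y″} lat-η l″ , trans (N-mul η y″) (trans (cong (N η ℚ.*_) n″) (ℚP.*-zeroʳ (N η))) ,
        trans e₁ (trans (cong (κ ·_) (trans e₂ (cong (κ ·_) e₃))) (trans (solve 2 (λ k y → k :* (k :* (k :* y)) := k :* k :* k :* y) refl κ y″) (trans (cong (_· y″) (sym η≡κ³)) (solve 3 (λ a b y → a :* b :* y := a :* (b :* y)) refl (ι (q 2)) η y″))))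
      step₂ : ∀ {y} → x ≡ κ · y → (∃ λ y′ → Lat y′ × N y′ ≡ 0ℚ × y ≡ κ · y′) → ∃ λ y → Lat y × N y ≡ 0ℚ × x ≡ ι (q 2) · y
      step₂ e₁ (y′ , l′ , n′ , e₂) = step₃ e₁ e₂ (κ-halves l′ n′)
      step₁ : (∃ λ y → Lat y × N y ≡ 0ℚ × x ≡ κ · y) → ∃ λ y → Lat y × N y ≡ 0ℚ × x ≡ ι (q 2) · y
      step₁ (y , l′ , n′ , e₁) = step₂ e₁ (κ-halves l′ n′)

    halves^ : ∀ {x} k → Lat x → N x ≡ 0ℚ → ∃ λ y → Lat y × N y ≡ 0ℚ × x ≡ ι (2^ k) · y
    halves^ {x} zero l e = x , l , e , solve 1 (λ x → x := con (+ 1) :* x) refl x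
    halves^ {x} (suc k) l e = step (halves l e)
      where
      step′ : ∀ {y} → x ≡ ι (q 2) · y → (∃ λ y′ → Lat y′ × N y′ ≡ 0ℚ × y ≡ ι (2^ k) · y′) → ∃ λ y → Lat y × N y ≡ 0ℚ × x ≡ ι (2^ (suc k)) · y
      step′ e₁ (y′ , l′ , n′ , e₂) = y′ , l′ , n′ , trans e₁ (trans (cong (ι (q 2) ·_) e₂) (trans (solve 3 (λ a b y → a :* (b :* y) := a :* b :* y) refl (ι (q 2)) (ι (2^ k)) y′) (cong (_· y′) (sym (ι-mul (q 2) (2^ k))))))
      step : (∃ λ y → Lat y × N y ≡ 0ℚ × x ≡ ι (q 2) · y) → ∃ λ y → Lat y × N y ≡ 0ℚ × x ≡ ι (2^ (suc k)) · y
      step (y , l′ , n′ , e₁) = step′ e₁ (halves^ k l′ n′)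

    -- Infinite descent at 2: three divisions by κ amount to one by 2, up to the unit η, so a
    -- lattice vector of norm 0 is divisible by every power of 2. This is what makes K a field.
    lat-anisotropic : ∀ {x} → Lat x → N x ≡ 0ℚ → x ≡ 0K
    lat-anisotropic {x₀ , x₁ , x₂} l@(i₀ , i₁ , i₂) e = coordinates
        (infinitelyEven i₀ (λ k → let y , ly , _ , eq = halves^ k l e in proj₁ y , proj₁ ly , cong proj₁ (trans eq (sym (·K≡ι· (2^ k) y)))))
        (infinitelyEven i₁ (λ k → let y , ly , _ , eq = halves^ k l e in proj₁ (proj₂ y) , proj₁ (proj₂ ly) , cong (λ v → proj₁ (proj₂ v)) (trans eq (sym (·K≡ι· (2^ k) y)))))
        (infinitelyEven i₂ (λ k → let y , ly , _ , eq = halves^ k l e in proj₂ (proj₂ y) , proj₂ (proj₂ ly) , cong (λ v → proj₂ (proj₂ v)) (trans eq (sym (·K≡ι· (2^ k) y)))))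
      where
      coordinates : ∀ {a b d : ℚ} → a ≡ 0ℚ → b ≡ 0ℚ → d ≡ 0ℚ → (a , b , d) ≡ 0K
      coordinates refl refl refl = refl

  N≡0⇒≡0 : ∀ {x} → N x ≡ 0ℚ → x ≡ 0K
  N≡0⇒≡0 {x} e = from (lat-denominator x)
    where
    from : (∃ λ d → d ≢ 0ℚ × IsInt d × Lat (ι d · x)) → x ≡ 0K
    from (d , d≢0 , _ , l) = ι-cancel d≢0 (trans (lat-anisotropic l (trans (N-mul (ι d) x) (trans (cong (N (ι d) ℚ.*_) e) (ℚP.*-zeroʳ (N (ι d)))))) (solve 1 (λ d → con (+ 0) := d :* con (+ 0)) refl (ι d)))

  N-0 : N 0K ≡ 0ℚ
  N-0 = N-ι 0ℚ

  noZeroDivisors : ∀ {x y} → x · y ≡ 0K → x ≡ 0K ⊎ y ≡ 0K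
  noZeroDivisors {x} {y} e = decide (N x ℚP.≟ 0ℚ)
    where
    decide : Dec (N x ≡ 0ℚ) → x ≡ 0K ⊎ y ≡ 0K
    decide (yes Nx≡0) = inj₁ (N≡0⇒≡0 Nx≡0)
    decide (no Nx≢0) = inj₂ (N≡0⇒≡0 (*-cancelˡ Nx≢0 (trans (sym (N-mul x y)) (trans (cong N e) (trans N-0 (sym (ℚP.*-zeroʳ (N x))))))))

-- Multiplicative relations between units

square-bound : ∀ i {S} → i ℤ.* i ℤ.≤ + S → ℤ.∣ i ∣ ℕ.≤ S
square-bound i {S} le = ℕP.≤-trans (k≤k*k ℤ.∣ i ∣) (ℤP.drop‿+≤+ (subst (ℤ._≤ + S) (i*i≡ i) le))
  where
  k≤k*k : ∀ k → k ℕ.≤ k ℕ.* k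
  k≤k*k zero = ℕ.z≤n
  k≤k*k (suc k) = ℕP.m≤m*n (suc k) (suc k)
  i*i≡ : ∀ i → i ℤ.* i ≡ + (ℤ.∣ i ∣ ℕ.* ℤ.∣ i ∣)
  i*i≡ (+ k) = sym (ℤP.pos-* k k)
  i*i≡ -[1+ k ] = refl

module _ (S : ℕ) where

  private
    size : ℕ
    size = suc (S ℕ.+ S)

    shifted : ∀ i → ℤ.∣ i ∣ ℕ.≤ S → + ℤ.∣ i ℤ.+ + S ∣ ≡ i ℤ.+ + S
    shifted i le = ℤP.0≤i⇒+∣i∣≡i (ℤP.≤-trans (subst (ℤ._≤ i ℤ.+ ℤ.- i) (ℤP.+-inverseʳ i) ℤP.≤-refl) (ℤP.+-monoʳ-≤ i (ℤP.≤-trans (-i≤∣i∣ i) (ℤ.+≤+ le))))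
      where
      -i≤∣i∣ : ∀ i → ℤ.- i ℤ.≤ + ℤ.∣ i ∣
      -i≤∣i∣ (+ zero) = ℤP.≤-refl
      -i≤∣i∣ (+ suc k) = ℤ.-≤+
      -i≤∣i∣ -[1+ k ] = ℤP.≤-refl

    encode : ∀ i → ℤ.∣ i ∣ ℕ.≤ S → Fin size
    encode i le = Fin.fromℕ< {ℤ.∣ i ℤ.+ + S ∣} (ℕ.s≤s (ℕP.≤-trans (ℤP.∣i+j∣≤∣i∣+∣j∣ i (+ S)) (ℕP.+-monoˡ-≤ S le)))

    encode-injective : ∀ {i j} (p : ℤ.∣ i ∣ ℕ.≤ S) (r : ℤ.∣ j ∣ ℕ.≤ S) → encode i p ≡ encode j r → i ≡ j
    encode-injective {i} {j} p r e = ∸-cancel (trans (sym (shifted i p)) (trans (cong +_ (trans (sym (FinP.toℕ-fromℕ< _)) (trans (cong Fin.toℕ e) (FinP.toℕ-fromℕ< _)))) (shifted j r)))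
      where
      ∸-cancel : i ℤ.+ + S ≡ j ℤ.+ + S → i ≡ j
      ∸-cancel e = trans (add-sub i) (trans (cong (ℤ._- + S) e) (sym (add-sub j)))
        where
        add-sub : ∀ k → k ≡ k ℤ.+ + S ℤ.- + S
        add-sub k = ℤS.Solver.solve 2 (λ k s → k := k :+ s :- s) refl k (+ S)
          where open ℤS.Solver

  Box³ : Set
  Box³ = Σ (ℤ × ℤ × ℤ) λ { (i , j , k) → ℤ.∣ i ∣ ℕ.≤ S × ℤ.∣ j ∣ ℕ.≤ S × ℤ.∣ k ∣ ℕ.≤ S }

  box-pigeonhole : (F : ℕ → Box³) → ∃₂ λ a b → a ℕ.< b × proj₁ (F a) ≡ proj₁ (F b)
  box-pigeonhole F = from (FinP.pigeonhole (ℕP.n<1+n (size ℕ.* (size ℕ.* size))) (λ a → code (F (Fin.toℕ a))))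
    where
    code : Box³ → Fin (size ℕ.* (size ℕ.* size))
    code ((i , j , k) , p , r , s) = Fin.combine (encode i p) (Fin.combine (encode j r) (encode k s))
    code-injective : ∀ x y → code x ≡ code y → proj₁ x ≡ proj₁ y
    code-injective ((i , j , k) , p , r , s) ((i′ , j′ , k′) , p′ , r′ , s′) e =
      cong₂ _,_ (encode-injective p p′ (proj₁ e₁)) (cong₂ _,_ (encode-injective r r′ (proj₁ e₂)) (encode-injective s s′ (proj₂ e₂)))
      where
      e₁ = FinP.combine-injective (encode i p) _ (encode i′ p′) _ e
      e₂ = FinP.combine-injective (encode j r) (encode k s) (encode j′ r′) (encode k′ s′) (proj₂ e₁)
    from : (∃₂ λ i j → i Fin.< j × code (F (Fin.toℕ i)) ≡ code (F (Fin.toℕ j))) → ∃₂ λ a b → a ℕ.< b × proj₁ (F a) ≡ proj₁ (F b)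
    from (i , j , i<j , e) = Fin.toℕ i , Fin.toℕ j , i<j , code-injective (F (Fin.toℕ i)) (F (Fin.toℕ j)) e

-- Every unit is multiplicatively dependent on ρ and η

module UnitRank (n m : ℕ) (10≤n : 10 ℕ.≤ n) (n≡ : n ≡ 1 ℕ.+ 2 ℕ.* m) where

  open CubicField n
  open OddField n m 10≤n n≡
  open KS.Solver using (solve; _:+_; _:*_; :-_; _:-_; con; _:=_)
  private
    module QR = ℚS.Solver

    q : ℕ → ℚ
    q k = ℚS.fromℤ (+ k)

    0≤q : ∀ k → 0ℚ ℚ.≤ q k
    0≤q k = subst (0ℚ ℚ.≤_) (sym (fromℕ≡ k)) (0≤int k)

    int-q : ∀ k → IsInt (q k)
    int-q k = + k , fromℕ≡ k

    c : ℚ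
    c = nℚ n

    int-c : IsInt c
    int-c = isInt-ℤtoℚ (+ n)

    10≤c : q 10 ℚ.≤ c
    10≤c = subst₂ ℚ._≤_ (sym (fromℕ≡ 10)) (int≡ℤtoℚ (+ n)) (int-mono-ℕ 10≤n)

    0≤c-10 : 0ℚ ℚ.≤ c ℚ.- q 10
    0≤c-10 = ≤⇒0≤- 10≤c

    1≤α : 1ℚ ℚ.≤ α
    1≤α = ≤-byDiff _ (0≤-+ (0≤-* 0≤c-10 (0≤-+ (0≤-* (0≤q 2) 0≤c-10) (0≤q 34))) (0≤q 139))
      (QR.solve 1 (λ c → QR.con (+ 1) QR.:+ ((c QR.:- QR.con (+ 10)) QR.:* (QR.con (+ 2) QR.:* (c QR.:- QR.con (+ 10)) QR.:+ QR.con (+ 34)) QR.:+ QR.con (+ 139)) QR.:= QR.con (+ 2) QR.:* c QR.:* c QR.:- QR.con (+ 6) QR.:* c) refl c)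

    1≤D : 1ℚ ℚ.≤ D
    1≤D = ≤-byDiff _ (0≤-+ (0≤-* (0≤-+ (0≤-* 0≤c-10 (0≤-+ 0≤c-10 (0≤q 20))) (0≤q 72)) (0≤-+ (0≤-square c) (0≤q 10))) (0≤q 252))
      (QR.solve 1 (λ c → QR.con (+ 1) QR.:+ (((c QR.:- QR.con (+ 10)) QR.:* (c QR.:- QR.con (+ 10) QR.:+ QR.con (+ 20)) QR.:+ QR.con (+ 72)) QR.:* (c QR.:* c QR.:+ QR.con (+ 10)) QR.:+ QR.con (+ 252))
        QR.:= c QR.:* c QR.:* c QR.:* c QR.:- QR.con (+ 18) QR.:* c QR.:* c QR.:- QR.con (+ 27)) refl c)

    int-α : IsInt α
    int-α = isInt-+ (isInt-* (isInt-* (int-q 2) int-c) int-c) (isInt-neg (isInt-* (int-q 6) int-c))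

    int-β : IsInt β
    int-β = isInt-+ (isInt-+ (isInt-neg (isInt-* (isInt-* (isInt-* (int-q 2) int-c) int-c) int-c)) (isInt-* (isInt-* (int-q 7) int-c) int-c)) (int-q 9)

    0≤α : 0ℚ ℚ.≤ α
    0≤α = ℚP.≤-trans (closed≤ {0ℚ} {1ℚ}) 1≤α

    α≢0 : α ≢ 0ℚ
    α≢0 e = ℚ<⇒≱ {0ℚ} {1ℚ} (toWitness {a? = 0ℚ ℚP.<? 1ℚ} tt) (subst (1ℚ ℚ.≤_) e 1≤α)

    0≤3D : 0ℚ ℚ.≤ q 3 ℚ.* D
    0≤3D = 0≤-* (0≤q 3) (ℚP.≤-trans (closed≤ {0ℚ} {1ℚ}) 1≤D)

    linear : K → ℚ
    linear (_ , x₁ , x₂) = α ℚ.* x₁ ℚ.+ β ℚ.* x₂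

    last : K → ℚ
    last (_ , _ , x₂) = x₂

  -- `tr-form` diagonalises the form with coefficients α, 1 and 3 D, all positive for n ≥ 10: the
  -- algebraic shape of the fact that K is totally real.
  0≤tr-square : ∀ x → 0ℚ ℚ.≤ tr (x · x)
  0≤tr-square x@(x₀ , x₁ , x₂) = ℚP.*-cancelˡ-≤-pos (α ℚ.* q 3) {{ℚ.positive 0<3α}}
    (subst₂ ℚ._≤_ (sym (ℚP.*-zeroʳ (α ℚ.* q 3))) (trans (sym (tr-form x₀ x₁ x₂)) (sym (ℚP.*-assoc α (q 3) (tr (x · x)))))
      (0≤-+ (0≤-+ (0≤-* 0≤α (0≤-square (tr x))) (0≤-square (linear x))) (0≤-* 0≤3D (0≤-square x₂))))
    where
    0<3α : 0ℚ ℚ.< α ℚ.* q 3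
    0<3α = ℚP.<-≤-trans (toWitness {a? = 0ℚ ℚP.<? 1ℚ} tt) (*-mono-≤ {1ℚ} {α} {1ℚ} {q 3} closed≤ 1≤α closed≤ closed≤)

  private
    int-tr : ∀ {x} → Lat x → IsInt (tr x)
    int-tr {x} l = bd⇒int-tr (bd-lat l)

    int-square-bound : ∀ {a} S → IsInt a → a ℚ.* a ℚ.≤ int (+ S) → ∃ λ i → a ≡ int i × ℤ.∣ i ∣ ℕ.≤ S
    int-square-bound S (i , refl) le = i , refl , square-bound i (int-cancel-≤ (subst (ℚ._≤ int (+ S)) (sym (int-* i i)) le))

    -- A lattice vector of bounded trace form, coded by the three integers diagonalising the form.
    code : ∀ R S → α ℚ.* (q 3 ℚ.* R) ℚ.≤ int (+ S) → ∀ y → Lat y → tr (y · y) ℚ.≤ R →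
      Σ (Box³ S) λ { ((i , j , k) , _) → tr y ≡ int i × linear y ≡ int j × last y ≡ int k }
    code R S le y@(y₀ , y₁ , y₂) l@(_ , i₁ , i₂) small = collect
        (int-square-bound S (int-tr l) (ℚP.≤-trans (scaled 1≤α (0≤-square (tr y))) (ℚP.≤-trans (≤-byDiff _ (0≤-+ sq₂ sq₃) (sym (ℚP.+-assoc (α ℚ.* (tr y ℚ.* tr y)) _ _))) total)))
        (int-square-bound S (isInt-+ (isInt-* int-α i₁) (isInt-* int-β i₂)) (ℚP.≤-trans (≤-byDiff _ (0≤-+ sq₁ sq₃) (QR.solve 3 (λ a b c → b QR.:+ (a QR.:+ c) QR.:= a QR.:+ b QR.:+ c) refl (α ℚ.* (tr y ℚ.* tr y)) (linear y ℚ.* linear y) (q 3 ℚ.* D ℚ.* (y₂ ℚ.* y₂)))) total))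
        (int-square-bound S i₂ (ℚP.≤-trans (scaled 1≤3D (0≤-square y₂)) (ℚP.≤-trans (≤-byDiff _ (0≤-+ sq₁ sq₂) (ℚP.+-comm (q 3 ℚ.* D ℚ.* (y₂ ℚ.* y₂)) _)) total)))
      where
      sq₁ = 0≤-* 0≤α (0≤-square (tr y))
      sq₂ = 0≤-square (linear y)
      sq₃ = 0≤-* 0≤3D (0≤-square y₂)
      1≤3D : 1ℚ ℚ.≤ q 3 ℚ.* D
      1≤3D = *-mono-≤ {1ℚ} {q 3} {1ℚ} {D} closed≤ closed≤ closed≤ 1≤D
      scaled : ∀ {k a} → 1ℚ ℚ.≤ k → 0ℚ ℚ.≤ a → a ℚ.≤ k ℚ.* a
      scaled {k} {a} 1≤k 0≤a = subst (ℚ._≤ k ℚ.* a) (ℚP.*-identityˡ a) (ℚP.*-monoʳ-≤-nonNeg a {{ℚ.nonNegative 0≤a}} 1≤k)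
      total : α ℚ.* (tr y ℚ.* tr y) ℚ.+ linear y ℚ.* linear y ℚ.+ q 3 ℚ.* D ℚ.* (y₂ ℚ.* y₂) ℚ.≤ int (+ S)
      total = subst (ℚ._≤ int (+ S)) (tr-form y₀ y₁ y₂) (ℚP.≤-trans (ℚP.*-monoˡ-≤-nonNeg α {{ℚ.nonNegative 0≤α}} (ℚP.*-monoˡ-≤-nonNeg (q 3) {{ℚ.nonNegative (0≤q 3)}} small)) le)
      collect : (∃ λ i → tr y ≡ int i × ℤ.∣ i ∣ ℕ.≤ S) → (∃ λ i → linear y ≡ int i × ℤ.∣ i ∣ ℕ.≤ S) → (∃ λ i → y₂ ≡ int i × ℤ.∣ i ∣ ℕ.≤ S) →
        Σ (Box³ S) λ { ((i , j , k) , _) → tr y ≡ int i × linear y ≡ int j × last y ≡ int k }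
      collect (i , e , b) (i′ , e′ , b′) (i″ , e″ , b″) = ((i , i′ , i″) , b , b′ , b″) , e , e′ , e″

    determined : ∀ x y → tr x ≡ tr y → linear x ≡ linear y → last x ≡ last y → x ≡ y
    determined (x₀ , x₁ , x₂) (y₀ , y₁ , .x₂) t e refl = second (*-cancelˡ α≢0 (cancel e)) t
      where
      cancel : α ℚ.* x₁ ℚ.+ β ℚ.* x₂ ≡ α ℚ.* y₁ ℚ.+ β ℚ.* x₂ → α ℚ.* x₁ ≡ α ℚ.* y₁
      cancel e = trans (QR.solve 2 (λ a b → a QR.:= a QR.:+ b QR.:- b) refl (α ℚ.* x₁) (β ℚ.* x₂)) (trans (cong (ℚ._- β ℚ.* x₂) e) (QR.solve 2 (λ a b → a QR.:+ b QR.:- b QR.:= a) refl (α ℚ.* y₁) (β ℚ.* x₂)))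
      first : ∀ {x₁} → tr (x₀ , x₁ , x₂) ≡ tr (y₀ , x₁ , x₂) → x₀ ≡ y₀
      first {x₁} t = *-cancelˡ {q 3} (λ ()) (trans (isolate x₀) (trans (cong (λ v → v ℚ.+ c ℚ.* x₁ ℚ.- (c ℚ.* c ℚ.- q 2 ℚ.* c) ℚ.* x₂) t) (sym (isolate y₀))))
        where
        isolate : ∀ z → q 3 ℚ.* z ≡ tr (z , x₁ , x₂) ℚ.+ c ℚ.* x₁ ℚ.- (c ℚ.* c ℚ.- q 2 ℚ.* c) ℚ.* x₂
        isolate z = trans (QR.solve 4 (λ c z a b → QR.con (+ 3) QR.:* z QR.:= (QR.con (+ 3) QR.:* z QR.:- c QR.:* a QR.:+ (c QR.:* c QR.:- QR.con (+ 2) QR.:* c) QR.:* b) QR.:+ c QR.:* a QR.:- (c QR.:* c QR.:- QR.con (+ 2) QR.:* c) QR.:* b) refl c z x₁ x₂)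
          (cong (λ v → v ℚ.+ c ℚ.* x₁ ℚ.- (c ℚ.* c ℚ.- q 2 ℚ.* c) ℚ.* x₂) (sym (tr-coords z x₁ x₂)))
      second : ∀ {x₁ y₁} → x₁ ≡ y₁ → tr (x₀ , x₁ , x₂) ≡ tr (y₀ , y₁ , x₂) → (x₀ , x₁ , x₂) ≡ (y₀ , y₁ , x₂)
      second {x₁} refl t = cong (λ v → v , x₁ , x₂) (first t)

  -- The units ρ / η and 1 / ρ, since `_♯` inverts elements of norm 1.
  E₂ E₃ : K
  E₂ = ρ · η ♯
  E₃ = ρ ♯

  open Descent n 10≤n η E₂ E₃ using (module Reduction)

  private
    ρρ♯ : ρ · ρ ♯ ≡ 1K
    ρρ♯ = norm1⇒inverse N-ρ

    ηη♯ : η · η ♯ ≡ 1K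
    ηη♯ = norm1⇒inverse N-η

  open Reduction η≡κ³
    (trans (cong (ρ · η ♯ ·_) (sym η≡κ³)) (trans (solve 4 (λ r e f t → r :* f :* (t :* e) := e :* f :* (t :* r)) refl ρ η (η ♯) (ι (q 2))) (trans (cong (_· (ι (q 2) · ρ)) ηη♯) (solve 1 (λ x → con (+ 1) :* x := x) refl (ι (q 2) · ρ)))))
    (trans (solve 2 (λ a b → a :* b := b :* a) refl (ρ ♯) ρ) ρρ♯) public using (threshold; reduce; Decreases)

  -- Elements of the group generated by ρ and η, written without negative exponents.
  Generated : K → Set
  Generated u = ∃₂ λ b c → ∃₂ λ b′ c′ → u · (ρ ^ b · η ^ c) ≡ ρ ^ b′ · η ^ c′

  generated-1 : Generated 1K
  generated-1 = 0 , 0 , 0 , 0 , solve 0 (con (+ 1) :* (con (+ 1) :* con (+ 1)) := con (+ 1) :* con (+ 1)) refl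

  generated-mul : ∀ {u v} → Generated u → Generated v → Generated (u · v)
  generated-mul {u} {v} (b , c , b′ , c′ , e) (d , f , d′ , f′ , e′) = b ℕ.+ d , c ℕ.+ f , b′ ℕ.+ d′ , c′ ℕ.+ f′ , (begin
    u · v · (ρ ^ (b ℕ.+ d) · η ^ (c ℕ.+ f))                ≡⟨ cong₂ (λ x y → u · v · (x · y)) (^-homo-* ρ b d) (^-homo-* η c f) ⟩
    u · v · ((ρ ^ b · ρ ^ d) · (η ^ c · η ^ f))            ≡⟨ solve 6 (λ u v a b c d → u :* v :* (a :* b :* (c :* d)) := u :* (a :* c) :* (v :* (b :* d))) refl u v (ρ ^ b) (ρ ^ d) (η ^ c) (η ^ f) ⟩
    (u · (ρ ^ b · η ^ c)) · (v · (ρ ^ d · η ^ f))          ≡⟨ cong₂ _·_ e e′ ⟩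
    (ρ ^ b′ · η ^ c′) · (ρ ^ d′ · η ^ f′)                  ≡⟨ solve 4 (λ a b c d → a :* b :* (c :* d) := a :* c :* (b :* d)) refl (ρ ^ b′) (η ^ c′) (ρ ^ d′) (η ^ f′) ⟩
    (ρ ^ b′ · ρ ^ d′) · (η ^ c′ · η ^ f′)                  ≡⟨ sym (cong₂ _·_ (^-homo-* ρ b′ d′) (^-homo-* η c′ f′)) ⟩
    ρ ^ (b′ ℕ.+ d′) · η ^ (c′ ℕ.+ f′) ∎)
    where open ≡-Reasoning

  private
    generated-η : Generated η
    generated-η = 0 , 0 , 0 , 1 , solve 1 (λ e → e :* (con (+ 1) :* con (+ 1)) := con (+ 1) :* (e :* con (+ 1))) refl η

    generated-E₂ : Generated E₂
    generated-E₂ = 0 , 1 , 1 , 0 , trans (solve 3 (λ r e f → r :* f :* (con (+ 1) :* (e :* con (+ 1))) := r :* (e :* f)) refl ρ η (η ♯)) (trans (cong (ρ ·_) ηη♯) (solve 1 (λ r → r :* con (+ 1) := r :* con (+ 1) :* con (+ 1)) refl ρ))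

    generated-E₃ : Generated E₃
    generated-E₃ = 1 , 0 , 0 , 0 , trans (solve 2 (λ r f → f :* (r :* con (+ 1) :* con (+ 1)) := r :* f) refl ρ (ρ ♯)) (trans ρρ♯ (solve 0 (con (+ 1) := con (+ 1) :* con (+ 1)) refl))

    N-♯ : ∀ {x} → N x ≡ 1ℚ → N (x ♯) ≡ 1ℚ
    N-♯ {x} e = trans (sym (ℚP.*-identityˡ (N (x ♯)))) (trans (cong (ℚ._* N (x ♯)) (sym e)) (trans (sym (N-mul x (x ♯))) (trans (cong N (norm1⇒inverse e)) (N-ι 1ℚ))))

    N-E₂ : N E₂ ≡ 1ℚ
    N-E₂ = trans (N-mul ρ (η ♯)) (trans (cong₂ ℚ._*_ N-ρ (N-♯ N-η)) refl)

    -- A representative u · x of x modulo the group generated by ρ and η, of bounded trace form and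
    -- with the same denominator d: only finitely many such representatives exist.
    Reduced : ℚ → K → Set
    Reduced d x = ∃ λ u → Generated u × Lat (ι d · (u · x)) × tr ((u · x) · (u · x)) ℚ.≤ threshold

    tr-ιsq : ∀ d x → tr ((ι d · x) · (ι d · x)) ≡ d ℚ.* d ℚ.* tr (x · x)
    tr-ιsq d x = trans (cong tr (trans (solve 2 (λ d x → d :* x :* (d :* x) := d :* d :* (x :* x)) refl (ι d) x) (cong (_· (x · x)) (sym (ι-mul d d))))) (tr-ι· (d ℚ.* d) (x · x))

    -- Terminates because tr ((d x)²) is a nonnegative integer, bounded by k, and every
    -- multiplication by one of the three units decreases it strictly.
    reduceLoop : ∀ d → d ≢ 0ℚ → ∀ k x → Lat (ι d · x) → N x ≡ 1ℚ ⊎ N x ≡ ℚ.- 1ℚ → tr ((ι d · x) · (ι d · x)) ℚ.≤ int (+ k) → Reduced d x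
    reduceLoop d d≢0 k x l Nx bound = decide (ℚP.≤-total threshold (tr (x · x)))
      where
      0<dd : 0ℚ ℚ.< d ℚ.* d
      0<dd = ℚP.≰⇒> (λ le → *≢0 d≢0 d≢0 (ℚP.≤-antisym le (0≤-square d)))
      lower : ∀ {i j : ℚ} → IsInt i → 0ℚ ℚ.≤ i → i ℚ.< j → j ℚ.≤ int (+ k) → ∃ λ k′ → k ≡ suc k′ × i ℚ.≤ int (+ k′)
      lower (z , refl) 0≤i i<j j≤k = pred k z (int-cancel-≤ (subst (ℚ._≤ int z) (sym int-0) 0≤i)) (ℤP.≰⇒> (λ k≤z → ℚ<⇒≱ (ℚP.<-≤-trans i<j j≤k) (int-mono-≤ k≤z)))
        where
        pred : ∀ k z → + 0 ℤ.≤ z → z ℤ.< + k → ∃ λ k′ → k ≡ suc k′ × int z ℚ.≤ int (+ k′)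
        pred zero (+ a) _ (ℤ.+<+ ())
        pred (suc k) (+ a) _ (ℤ.+<+ lt) = k , refl , int-mono-ℕ (ℕP.≤-pred lt)
      step : ∀ e → Generated e → Lat e → N e ≡ 1ℚ → Decreases e x → Reduced d x
      step e ge le Ne dec = continue (lower (int-tr (lat-mul {ι d · (e · x)} {ι d · (e · x)} l′ l′)) (0≤tr-square (ι d · (e · x))) smaller bound)
        where
        l′ : Lat (ι d · (e · x))
        l′ = subst Lat (solve 3 (λ d e x → e :* (d :* x) := d :* (e :* x)) refl (ι d) e x) (lat-mul {e} {ι d · x} le l)
        smaller : tr ((ι d · (e · x)) · (ι d · (e · x))) ℚ.< tr ((ι d · x) · (ι d · x))
        smaller = subst₂ ℚ._<_ (sym (tr-ιsq d (e · x))) (sym (tr-ιsq d x)) (ℚP.*-monoʳ-<-pos (d ℚ.* d) {{ℚ.positive 0<dd}} dec)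
        Nex : N (e · x) ≡ 1ℚ ⊎ N (e · x) ≡ ℚ.- 1ℚ
        Nex = [ (λ p → inj₁ (trans Nex≡ p)) , (λ p → inj₂ (trans Nex≡ p)) ]′ Nx
          where
          Nex≡ : N (e · x) ≡ N x
          Nex≡ = trans (N-mul e x) (trans (cong (ℚ._* N x) Ne) (ℚP.*-identityˡ (N x)))
        finish : Reduced d (e · x) → Reduced d x
        finish (u , gu , lu , tu) = u · e , generated-mul gu ge , subst (λ y → Lat (ι d · y)) assoc lu , subst (λ y → tr (y · y) ℚ.≤ threshold) assoc tu
          where
          assoc : u · (e · x) ≡ u · e · x
          assoc = solve 3 (λ u e x → u :* (e :* x) := u :* e :* x) refl u e x
        continue : (∃ λ k′ → k ≡ suc k′ × tr ((ι d · (e · x)) · (ι d · (e · x))) ℚ.≤ int (+ k′)) → Reduced d x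
        continue (k′ , refl , b′) = finish (reduceLoop d d≢0 k′ (e · x) l′ Nex b′)
      decide : threshold ℚ.≤ tr (x · x) ⊎ tr (x · x) ℚ.≤ threshold → Reduced d x
      decide (inj₂ le) = 1K , generated-1 , subst (λ y → Lat (ι d · y)) one l , subst (λ y → tr (y · y) ℚ.≤ threshold) one le
        where
        one : x ≡ 1K · x
        one = solve 1 (λ x → x := con (+ 1) :* x) refl x
      decide (inj₁ le) = [ step η generated-η lat-η N-η , [ step E₂ generated-E₂ (lat-mul {ρ} {η ♯} lat-ρ (lat-♯ {η} lat-η)) N-E₂ , step E₃ generated-E₃ (lat-♯ {ρ} lat-ρ) (N-♯ N-ρ) ]′ ]′ (reduce x Nx le)

  cancelˡ : ∀ {x y z} → N x ≢ 0ℚ → x · y ≡ x · z → y ≡ z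
  cancelˡ {x} {y} {z} Nx≢0 e = ι-cancel Nx≢0 (trans (cong (_· y) (sym (mul-♯ x))) (trans (solve 3 (λ a b y → a :* b :* y := b :* (a :* y)) refl x (x ♯) y) (trans (cong (x ♯ ·_) e)
    (trans (solve 3 (λ a b y → b :* (a :* y) := a :* b :* y) refl x (x ♯) z) (cong (_· z) (mul-♯ x))))))

  Relation : K → ℕ → Set
  Relation w d = ∃₂ λ i j → ∃₂ λ i′ j′ → w ^ d · (ρ ^ i · η ^ j) ≡ ρ ^ i′ · η ^ j′

  -- All powers of w share the denominator δ, so their reduced representatives lie in a finite set
  -- and two of them coincide, u wᵃ = v wᵇ with a < b. Cancelling wᵃ puts w^(b-a) into the group
  -- generated by ρ and η.
  unit-relation : ∀ w → BD w → N w ≡ 1ℚ ⊎ N w ≡ ℚ.- 1ℚ → ∃ λ d → 1 ℕ.≤ d × Relation w d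
  unit-relation w (δ , δ≢0 , iδ , lw) Nw = collide (box-pigeonhole S (λ a → proj₁ (coded a)))
    where
    R : ℚ
    R = δ ℚ.* δ ℚ.* threshold
    S : ℕ
    S = proj₁ (upperInt (α ℚ.* (q 3 ℚ.* R)))
    N^ : ∀ a → N (w ^ a) ≡ 1ℚ ⊎ N (w ^ a) ≡ ℚ.- 1ℚ
    N^ zero = inj₁ (N-ι 1ℚ)
    N^ (suc a) = signs Nw (N^ a)
      where
      signs : N w ≡ 1ℚ ⊎ N w ≡ ℚ.- 1ℚ → N (w ^ a) ≡ 1ℚ ⊎ N (w ^ a) ≡ ℚ.- 1ℚ → N (w ^ suc a) ≡ 1ℚ ⊎ N (w ^ suc a) ≡ ℚ.- 1ℚ
      signs (inj₁ p) (inj₁ r) = inj₁ (trans (N-mul w (w ^ a)) (cong₂ ℚ._*_ p r))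
      signs (inj₁ p) (inj₂ r) = inj₂ (trans (N-mul w (w ^ a)) (cong₂ ℚ._*_ p r))
      signs (inj₂ p) (inj₁ r) = inj₂ (trans (N-mul w (w ^ a)) (cong₂ ℚ._*_ p r))
      signs (inj₂ p) (inj₂ r) = inj₁ (trans (N-mul w (w ^ a)) (cong₂ ℚ._*_ p r))
    reduced : ∀ a → Reduced δ (w ^ a)
    reduced a = reduceLoop δ δ≢0 (proj₁ (upperInt t)) (w ^ a) (lw a) (N^ a) (proj₂ (upperInt t))
      where
      t = tr ((ι δ · w ^ a) · (ι δ · w ^ a))
    Y : ℕ → K
    Y a = ι δ · (proj₁ (reduced a) · w ^ a)
    coded : ∀ a → Σ (Box³ S) λ { ((i , j , k) , _) → tr (Y a) ≡ int i × linear (Y a) ≡ int j × last (Y a) ≡ int k }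
    coded a = code R S (proj₂ (upperInt (α ℚ.* (q 3 ℚ.* R)))) (Y a) (proj₁ (proj₂ (proj₂ (reduced a))))
      (subst (ℚ._≤ R) (sym (tr-ιsq δ (proj₁ (reduced a) · w ^ a))) (ℚP.*-monoˡ-≤-nonNeg (δ ℚ.* δ) {{ℚ.nonNegative (0≤-square δ)}} (proj₂ (proj₂ (proj₂ (reduced a))))))
    collide : (∃₂ λ a b → a ℕ.< b × proj₁ (proj₁ (coded a)) ≡ proj₁ (proj₁ (coded b))) → ∃ λ d → 1 ℕ.≤ d × Relation w d
    collide (a , b , a<b , e) = b ℕ.∸ a , ℕP.m<n⇒0<n∸m a<b , relate (proj₁ (proj₂ (reduced a))) (proj₁ (proj₂ (reduced b)))
      where
      u v : K
      u = proj₁ (reduced a)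
      v = proj₁ (reduced b)
      ca = proj₂ (coded a)
      cb = proj₂ (coded b)
      Ya≡Yb : Y a ≡ Y b
      Ya≡Yb = determined (Y a) (Y b) (trans (proj₁ ca) (trans (cong (λ { (i , _ , _) → int i }) e) (sym (proj₁ cb))))
        (trans (proj₁ (proj₂ ca)) (trans (cong (λ { (_ , j , _) → int j }) e) (sym (proj₁ (proj₂ cb)))))
        (trans (proj₂ (proj₂ ca)) (trans (cong (λ { (_ , _ , k) → int k }) e) (sym (proj₂ (proj₂ cb)))))
      N≢0 : N (w ^ a) ≢ 0ℚ
      N≢0 e = [ (λ p → case (trans (sym p) e)) , (λ p → case′ (trans (sym p) e)) ]′ (N^ a)
        where
        case : 1ℚ ≢ 0ℚ
        case ()
        case′ : ℚ.- 1ℚ ≢ 0ℚ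
        case′ ()
      d = b ℕ.∸ a
      u≡vwᵈ : u ≡ v · w ^ d
      u≡vwᵈ = cancelˡ {w ^ a} N≢0 (trans (solve 2 (λ a u → a :* u := u :* a) refl (w ^ a) u) (trans (ι-cancel δ≢0 Ya≡Yb) (trans (cong (v ·_) (trans (cong (w ^_) (sym (ℕP.m+[n∸m]≡n (ℕP.<⇒≤ a<b)))) (^-homo-* w a d)))
        (solve 3 (λ v a d → v :* (a :* d) := a :* (v :* d)) refl v (w ^ a) (w ^ d)))))
      relate : Generated u → Generated v → Relation w d
      relate (i , j , i′ , j′ , eu) (k , l , k′ , l′ , ev) = i ℕ.+ k′ , j ℕ.+ l′ , i′ ℕ.+ k , j′ ℕ.+ l , (begin
        w ^ d · (ρ ^ (i ℕ.+ k′) · η ^ (j ℕ.+ l′))                ≡⟨ cong₂ (λ x y → w ^ d · (x · y)) (^-homo-* ρ i k′) (^-homo-* η j l′) ⟩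
        w ^ d · ((ρ ^ i · ρ ^ k′) · (η ^ j · η ^ l′))            ≡⟨ solve 5 (λ w a b c d → w :* (a :* b :* (c :* d)) := (b :* d) :* (w :* (a :* c))) refl (w ^ d) (ρ ^ i) (ρ ^ k′) (η ^ j) (η ^ l′) ⟩
        (ρ ^ k′ · η ^ l′) · (w ^ d · (ρ ^ i · η ^ j))            ≡⟨ cong (_· (w ^ d · (ρ ^ i · η ^ j))) (sym ev) ⟩
        (v · (ρ ^ k · η ^ l)) · (w ^ d · (ρ ^ i · η ^ j))        ≡⟨ solve 4 (λ v x w y → v :* x :* (w :* y) := (v :* w :* y) :* x) refl v (ρ ^ k · η ^ l) (w ^ d) (ρ ^ i · η ^ j) ⟩
        (v · w ^ d · (ρ ^ i · η ^ j)) · (ρ ^ k · η ^ l)          ≡⟨ cong (λ x → x · (ρ ^ i · η ^ j) · (ρ ^ k · η ^ l)) (sym u≡vwᵈ) ⟩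
        (u · (ρ ^ i · η ^ j)) · (ρ ^ k · η ^ l)                  ≡⟨ cong (_· (ρ ^ k · η ^ l)) eu ⟩
        (ρ ^ i′ · η ^ j′) · (ρ ^ k · η ^ l)                      ≡⟨ solve 4 (λ a b c d → a :* b :* (c :* d) := a :* c :* (b :* d)) refl (ρ ^ i′) (η ^ j′) (ρ ^ k) (η ^ l) ⟩
        (ρ ^ i′ · ρ ^ k) · (η ^ j′ · η ^ l)                      ≡⟨ sym (cong₂ _·_ (^-homo-* ρ i′ k) (^-homo-* η j′ l)) ⟩
        ρ ^ (i′ ℕ.+ k) · η ^ (j′ ℕ.+ l) ∎)
        where open ≡-Reasoning

prime-divisor : ∀ k → 2 ℕ.≤ k → ∃ λ p → Prim.Prime p × p ℕD.∣ k
prime-divisor k@(suc _) 2≤k = from (Fact.factorise k)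
  where
  from : Fact.PrimeFactorisation k → ∃ λ p → Prim.Prime p × p ℕD.∣ k
  from record { factors = List.[] ; isFactorisation = e } = ⊥-elim (ℕP.<⇒≱ 2≤k (ℕP.≤-reflexive e))
  from record { factors = p List.∷ ps ; isFactorisation = e ; factorsPrime = pp All.∷ _ } = p , pp , ℕD.divides (List.foldr ℕ._*_ 1 ps) (trans e (ℕP.*-comm p (List.foldr ℕ._*_ 1 ps)))

prime≥2 : ∀ {p} → Prim.Prime p → 2 ℕ.≤ p
prime≥2 {zero} pp = ⊥-elim (Prim.¬prime[0] pp)
prime≥2 {suc zero} pp = ⊥-elim (Prim.¬prime[1] pp)
prime≥2 {suc (suc p)} pp = ℕ.s≤s (ℕ.s≤s ℕ.z≤n)

prime-parity : ∀ {p} → Prim.Prime p → p ≡ 2 ⊎ (∃ λ k → p ≡ suc (2 ℕ.* k))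
prime-parity {p} pp = by-remainder (p ℕ.% 2) (ℕDM.m%n<n p 2) (ℕDM.m≡m%n+[m/n]*n p 2)
  where
  by-remainder : ∀ r → r ℕ.< 2 → p ≡ r ℕ.+ (p ℕ./ 2) ℕ.* 2 → p ≡ 2 ⊎ (∃ λ k → p ≡ suc (2 ℕ.* k))
  by-remainder zero _ e = inj₁ (sym ([ (λ ()) , id ]′ (Prim.prime⇒irreducible pp (ℕD.divides (p ℕ./ 2) e))))
  by-remainder (suc zero) _ e = inj₂ (p ℕ./ 2 , trans e (cong suc (ℕP.*-comm (p ℕ./ 2) 2)))
  by-remainder (suc (suc r)) (ℕ.s≤s (ℕ.s≤s ())) e

divideOutGCD : ∀ k r → 1 ℕ.≤ k → ∃₂ λ g k′ → ∃ λ r′ → Cop.Coprime k′ r′ × k′ ℕ.* g ≡ k × r′ ℕ.* g ≡ r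
divideOutGCD k r 1≤k = g , k ℕ./ g , r ℕ./ g , Cop.coprime-/gcd k r , ℕDM.m/n*n≡m (GCD.gcd[m,n]∣m k r) , ℕDM.m/n*n≡m (GCD.gcd[m,n]∣n k r)
  where
  g = GCD.gcd k r
  instance
    g≢0 : ℕ.NonZero g
    g≢0 = ℕ.≢-nonZero (GCD.gcd[m,n]≢0 k r (inj₁ (ℕP.<⇒≢ 1≤k ∘ sym)))

-- From dependence of units to p-th power relations

module PowerRelations (n m : ℕ) (10≤n : 10 ℕ.≤ n) (n≡ : n ≡ 1 ℕ.+ 2 ℕ.* m) where

  open CubicField n
  open OddField n m 10≤n n≡
  open UnitRank n m 10≤n n≡
  open KS.Solver using (solve; _:+_; _:*_; :-_; _:-_; con; _:=_)

  private
    module QR = ℚS.Solver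

    geometric : K → ℕ → K
    geometric z zero = 0K
    geometric z (suc k) = z ^ k ⊕ geometric z k

    geometric-sum : ∀ z k → (z ⊕ neg 1K) · geometric z k ≡ z ^ k ⊕ neg 1K
    geometric-sum z zero = solve 1 (λ z → (z :- con (+ 1)) :* con (+ 0) := con (+ 1) :- con (+ 1)) refl z
    geometric-sum z (suc k) = trans (solve 3 (λ z a g → (z :- con (+ 1)) :* (a :+ g) := (z :- con (+ 1)) :* a :+ (z :- con (+ 1)) :* g) refl z (z ^ k) (geometric z k))
      (trans (cong ((z ⊕ neg 1K) · z ^ k ⊕_) (geometric-sum z k)) (solve 2 (λ z a → (z :- con (+ 1)) :* a :+ (a :- con (+ 1)) := z :* a :- con (+ 1)) refl z (z ^ k)))

    3≤tr-geometric : ∀ {z θ} → z ≡ θ · θ → ∀ k → ℚS.fromℤ (+ 3) ℚ.≤ tr (geometric z (suc k))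
    3≤tr-geometric e zero = ℚP.≤-reflexive (sym (trans (cong tr (solve 0 (con (+ 1) :+ con (+ 0) := con (+ 1)) refl)) (tr-ι 1ℚ)))
    3≤tr-geometric {z} {θ} refl (suc k) = ℚP.≤-trans (3≤tr-geometric {θ = θ} refl k) (≤-byDiff (tr (z ^ suc k))
      (subst (λ y → 0ℚ ℚ.≤ tr y) (sym (^-distrib-* θ θ (suc k))) (0≤tr-square (θ ^ suc k)))
      (trans (ℚP.+-comm (tr (geometric z (suc k))) (tr (z ^ suc k))) (sym (tr-add (z ^ suc k) (geometric z (suc k))))))

    -≡0⇒≡K : ∀ {x y} → x ⊕ neg y ≡ 0K → x ≡ y
    -≡0⇒≡K {x} {y} e = trans (solve 2 (λ x y → x := x :- y :+ y) refl x y) (trans (cong (_⊕ y) e) (solve 1 (λ y → con (+ 0) :+ y := y) refl y))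

    -- An odd-order root of unity is a square, so the trace of the geometric sum of its powers is at least 3.
    odd-torsion : ∀ k {z} → z ^ suc (2 ℕ.* k) ≡ 1K → z ≡ 1K
    odd-torsion k {z} e = [ -≡0⇒≡K , (λ s≡0 → ⊥-elim (ℚ<⇒≱ {0ℚ} {ℚS.fromℤ (+ 3)} (toWitness {a? = 0ℚ ℚP.<? ℚS.fromℤ (+ 3)} tt)
        (subst (ℚS.fromℤ (+ 3) ℚ.≤_) (trans (cong tr s≡0) (tr-ι 0ℚ)) (3≤tr-geometric {θ = z ^ suc k} square (2 ℕ.* k))))) ]′
      (noZeroDivisors (trans (geometric-sum z (suc (2 ℕ.* k))) (trans (cong (_⊕ neg 1K) e) (solve 0 (con (+ 1) :- con (+ 1) := con (+ 0)) refl))))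
      where
      square : z ≡ z ^ suc k · z ^ suc k
      square = trans (solve 1 (λ z → z := z :* con (+ 1)) refl z) (trans (cong (z ·_) (sym e)) (trans (cong (λ j → z · (z · z ^ (k ℕ.+ j))) (ℕP.+-identityʳ k))
        (trans (cong (λ y → z · (z · y)) (^-homo-* z k k)) (solve 2 (λ z a → z :* (z :* (a :* a)) := z :* a :* (z :* a)) refl z (z ^ k)))))

  IsSign : K → Set
  IsSign s = s ≡ 1K ⊎ s ≡ neg 1K

  private
    neg-odd^ : ∀ k y → neg y ^ suc (2 ℕ.* k) ≡ neg (y ^ suc (2 ℕ.* k))
    neg-odd^ k y = trans (cong (neg y ·_) (trans (sym (^-assocʳ (neg y) 2 k)) (trans (cong (_^ k) (solve 1 (λ y → (:- y) :* ((:- y) :* con (+ 1)) := y :* (y :* con (+ 1))) refl y)) (^-assocʳ y 2 k))))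
      (solve 2 (λ y a → (:- y) :* a := :- (y :* a)) refl y (y ^ (2 ℕ.* k)))

    -- For p = 2 the value y² = - 1 is excluded by `0≤tr-square`; for odd p a sign change reduces
    -- the claim to `odd-torsion`.
    sign-root : ∀ {p} → Prim.Prime p → ∀ {s y} → IsSign s → y ^ p ≡ s → IsSign y
    sign-root {p} pp {s} {y} sgn e = [ two , odd ]′ (prime-parity pp)
      where
      two : p ≡ 2 → IsSign y
      two refl = [ (λ s≡1 → [ (λ d → inj₁ (-≡0⇒≡K d)) , (λ d → inj₂ (-≡0⇒≡K (trans (solve 1 (λ y → y :- (:- con (+ 1)) := y :+ con (+ 1)) refl y) d))) ]′
             (noZeroDivisors {y ⊕ neg 1K} {y ⊕ 1K} (trans (solve 1 (λ y → (y :- con (+ 1)) :* (y :+ con (+ 1)) := y :* (y :* con (+ 1)) :- con (+ 1)) refl y)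
               (trans (cong (_⊕ neg 1K) (trans e s≡1)) (solve 0 (con (+ 1) :- con (+ 1) := con (+ 0)) refl)))))
        , (λ s≡-1 → ⊥-elim (ℚ<⇒≱ {ℚS.fromℤ (+ 3) ℚ.* ℚ.- 1ℚ} {0ℚ} (toWitness {a? = ℚS.fromℤ (+ 3) ℚ.* ℚ.- 1ℚ ℚP.<? 0ℚ} tt)
             (subst (0ℚ ℚ.≤_) (trans (cong tr (trans (solve 1 (λ y → y :* y := y :* (y :* con (+ 1))) refl y) (trans e (trans s≡-1 (sym (ι-neg 1ℚ)))))) (tr-ι (ℚ.- 1ℚ))) (0≤tr-square y)))) ]′ sgn
      odd : (∃ λ k → p ≡ suc (2 ℕ.* k)) → IsSign y
      odd (k , refl) = [ (λ s≡1 → inj₁ (odd-torsion k (trans e s≡1)))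
        , (λ s≡-1 → inj₂ (trans (solve 1 (λ y → y := :- (:- y)) refl y) (cong neg (odd-torsion k (trans (neg-odd^ k y) (trans (cong neg (trans e s≡-1)) (solve 0 (:- (:- con (+ 1)) := con (+ 1)) refl))))))) ]′ sgn

    root-up-to-sign : ∀ {p} → Prim.Prime p → ∀ {s x v v⁻} → IsSign s → v · v⁻ ≡ 1K → x ^ p ≡ s · v ^ p → ∃ λ s′ → IsSign s′ × x ≡ s′ · v
    root-up-to-sign {p} pp {s} {x} {v} {v⁻} sgn inv e = x · v⁻ , sign-root pp sgn (trans (^-distrib-* x v⁻ p) (trans (cong (_· v⁻ ^ p) e)
        (trans (solve 3 (λ s a b → s :* a :* b := s :* (a :* b)) refl s (v ^ p) (v⁻ ^ p)) (trans (cong (s ·_) (trans (sym (^-distrib-* v v⁻ p)) (trans (cong (_^ p) inv) (1^ p)))) (solve 1 (λ s → s :* con (+ 1) := s) refl s)))))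
      , trans (solve 1 (λ x → x := x :* con (+ 1)) refl x) (trans (cong (x ·_) (sym inv)) (solve 3 (λ x a b → x :* (a :* b) := x :* b :* a) refl x v v⁻))

    SignedRelation : K → ℕ → Set
    SignedRelation w d = ∃₂ λ i j → ∃₂ λ i′ j′ → ∃ λ s → IsSign s × w ^ d · (ρ ^ i · η ^ j) ≡ s · (ρ ^ i′ · η ^ j′)

  -- ± p-th powers in the group generated by x, ρ and η that are not p-th powers for trivial reasons.
  Dependent : ℕ → K → Set
  Dependent p x = ∃₂ λ d i → ∃ λ j → ∃₂ λ s v → IsSign s × ¬ (p ℕD.∣ d × p ℕD.∣ i × p ℕD.∣ j) × x ^ d · (ρ ^ i · η ^ j) ≡ s · v ^ p

  private
    ρ^η^-invertible : ∀ i j → (ρ ^ i · η ^ j) · (ρ ^ i · η ^ j) ♯ ≡ 1K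
    ρ^η^-invertible i j = norm1⇒inverse (trans (N-mul (ρ ^ i) (η ^ j)) (cong₂ ℚ._*_ (trans (N-^ ρ i) (trans (cong (ℚS._^ i) N-ρ) (ℚS.1^ i))) (trans (N-^ η j) (trans (cong (ℚS._^ j) N-η) (ℚS.1^ j)))))

    -- Adding i′ (p - 1) and j′ (p - 1) to the exponents on the left turns the right-hand side into
    -- a p-th power. If p divides every exponent, a p-th root can be extracted up to sign, which
    -- replaces d by d / p.
    normalise : ∀ {p} → Prim.Prime p → ∀ {w} fuel d → d ℕ.≤ fuel → 1 ℕ.≤ d → SignedRelation w d → Dependent p w
    normalise pp zero zero _ () rel
    normalise {zero} pp = ⊥-elim (Prim.¬prime[0] pp)
    normalise {p@(suc p′)} pp {w} (suc fuel) d d≤ 1≤d (i , j , i′ , j′ , s , sgn , e) = decide (p ℕD.∣? d) (p ℕD.∣? I) (p ℕD.∣? J)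
      where
      I J : ℕ
      I = i ℕ.+ i′ ℕ.* p′
      J = j ℕ.+ j′ ℕ.* p′
      V : K
      V = ρ ^ i′ · η ^ j′
      e′ : w ^ d · (ρ ^ I · η ^ J) ≡ s · V ^ p
      e′ = begin
        w ^ d · (ρ ^ I · η ^ J)                                              ≡⟨ cong₂ (λ x y → w ^ d · (x · y)) (^-homo-* ρ i (i′ ℕ.* p′)) (^-homo-* η j (j′ ℕ.* p′)) ⟩
        w ^ d · ((ρ ^ i · ρ ^ (i′ ℕ.* p′)) · (η ^ j · η ^ (j′ ℕ.* p′)))      ≡⟨ cong₂ (λ x y → w ^ d · ((ρ ^ i · x) · (η ^ j · y))) (sym (^-assocʳ ρ i′ p′)) (sym (^-assocʳ η j′ p′)) ⟩
        w ^ d · ((ρ ^ i · (ρ ^ i′) ^ p′) · (η ^ j · (η ^ j′) ^ p′))          ≡⟨ solve 5 (λ w a b c d → w :* (a :* b :* (c :* d)) := w :* (a :* c) :* (b :* d)) refl (w ^ d) (ρ ^ i) ((ρ ^ i′) ^ p′) (η ^ j) ((η ^ j′) ^ p′) ⟩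
        w ^ d · (ρ ^ i · η ^ j) · ((ρ ^ i′) ^ p′ · (η ^ j′) ^ p′)            ≡⟨ cong₂ _·_ e (sym (^-distrib-* (ρ ^ i′) (η ^ j′) p′)) ⟩
        s · V · V ^ p′                                                       ≡⟨ solve 3 (λ s v a → s :* v :* a := s :* (v :* a)) refl s V (V ^ p′) ⟩
        s · V ^ p ∎
        where open ≡-Reasoning
      descend : p ℕD.∣ d → p ℕD.∣ I → p ℕD.∣ J → Dependent p w
      descend (ℕD.divides d′ d≡) (ℕD.divides I′ I≡) (ℕD.divides J′ J≡) = continue (root-up-to-sign pp sgn (ρ^η^-invertible i′ j′) (trans root e′))
        where
        root : (w ^ d′ · (ρ ^ I′ · η ^ J′)) ^ p ≡ w ^ d · (ρ ^ I · η ^ J)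
        root = trans (^-distrib-* (w ^ d′) (ρ ^ I′ · η ^ J′) p) (cong₂ _·_ (trans (^-assocʳ w d′ p) (cong (w ^_) (sym d≡)))
          (trans (^-distrib-* (ρ ^ I′) (η ^ J′) p) (cong₂ _·_ (trans (^-assocʳ ρ I′ p) (cong (ρ ^_) (sym I≡))) (trans (^-assocʳ η J′ p) (cong (η ^_) (sym J≡))))))
        1≤d′ : ∀ d′ → d ≡ d′ ℕ.* p → 1 ℕ.≤ d′
        1≤d′ zero d≡0 = subst (1 ℕ.≤_) d≡0 1≤d
        1≤d′ (suc _) _ = ℕ.s≤s ℕ.z≤n
        d′<d : d′ ℕ.< d
        d′<d = subst (d′ ℕ.<_) (sym d≡) (ℕP.m<m*n d′ p {{ℕ.>-nonZero (1≤d′ d′ d≡)}} (prime≥2 pp))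
        continue : (∃ λ s′ → IsSign s′ × w ^ d′ · (ρ ^ I′ · η ^ J′) ≡ s′ · V) → Dependent p w
        continue (s′ , sgn′ , eq) = normalise pp fuel d′ (ℕP.≤-pred (ℕP.≤-trans d′<d d≤)) (1≤d′ d′ d≡) (I′ , J′ , i′ , j′ , s′ , sgn′ , eq)
      decide : Dec (p ℕD.∣ d) → Dec (p ℕD.∣ I) → Dec (p ℕD.∣ J) → Dependent p w
      decide (yes a) (yes b) (yes c) = descend a b c
      decide (no a) _ _ = d , I , J , s , V , sgn , (λ t → a (proj₁ t)) , e′
      decide _ (no b) _ = d , I , J , s , V , sgn , (λ t → b (proj₁ (proj₂ t))) , e′
      decide _ _ (no c) = d , I , J , s , V , sgn , (λ t → c (proj₂ (proj₂ t))) , e′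

  unit-dependent : ∀ {p} → Prim.Prime p → ∀ {w} → BD w → N w ≡ 1ℚ ⊎ N w ≡ ℚ.- 1ℚ → Dependent p w
  unit-dependent pp {w} bw Nw = from (unit-relation w bw Nw)
    where
    from : (∃ λ d → 1 ℕ.≤ d × Relation w d) → Dependent _ w
    from (d , 1≤d , i , j , i′ , j′ , e) = normalise pp d d ℕP.≤-refl 1≤d (i , j , i′ , j′ , 1K , inj₁ refl , trans e (solve 1 (λ x → x := con (+ 1) :* x) refl (ρ ^ i′ · η ^ j′)))

  -- The relation for w is combined with the d-th power of α^k′ = w β^(r′ p), where β enters only
  -- through a p-th power. The new exponent k′ d of α is a multiple of p only if d is, because p ∤
  -- k′.
  power-dependent : ∀ {p} → Prim.Prime p → ∀ {α β w k′ r′} → BD w → N w ≡ 1ℚ ⊎ N w ≡ ℚ.- 1ℚ → α ^ k′ ≡ w · β ^ (r′ ℕ.* p) → ¬ p ℕD.∣ k′ → Dependent p α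
  power-dependent {p} pp {α} {β} {w} {k′} {r′} bw Nw eq p∤k′ = from (unit-dependent pp bw Nw)
    where
    from : Dependent p w → Dependent p α
    from (d , i , j , s , v , sgn , indep , e) = k′ ℕ.* d , i , j , s , v · β ^ (r′ ℕ.* d) , sgn ,
      (λ { (a , b , c) → [ p∤k′ , (λ p∣d → indep (p∣d , b , c)) ]′ (Prim.euclidsLemma k′ d pp a) }) , (begin
        α ^ (k′ ℕ.* d) · (ρ ^ i · η ^ j)                       ≡⟨ cong (_· (ρ ^ i · η ^ j)) (sym (^-assocʳ α k′ d)) ⟩
        (α ^ k′) ^ d · (ρ ^ i · η ^ j)                         ≡⟨ cong (λ x → x ^ d · (ρ ^ i · η ^ j)) eq ⟩
        (w · β ^ (r′ ℕ.* p)) ^ d · (ρ ^ i · η ^ j)             ≡⟨ cong (_· (ρ ^ i · η ^ j)) (^-distrib-* w (β ^ (r′ ℕ.* p)) d) ⟩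
        (w ^ d · (β ^ (r′ ℕ.* p)) ^ d) · (ρ ^ i · η ^ j)       ≡⟨ solve 3 (λ w b x → w :* b :* x := w :* x :* b) refl (w ^ d) ((β ^ (r′ ℕ.* p)) ^ d) (ρ ^ i · η ^ j) ⟩
        w ^ d · (ρ ^ i · η ^ j) · (β ^ (r′ ℕ.* p)) ^ d         ≡⟨ cong₂ _·_ e (trans (^-assocʳ β (r′ ℕ.* p) d) (trans (cong (β ^_) exponents) (sym (^-assocʳ β (r′ ℕ.* d) p)))) ⟩
        s · v ^ p · (β ^ (r′ ℕ.* d)) ^ p                       ≡⟨ solve 3 (λ s a b → s :* a :* b := s :* (a :* b)) refl s (v ^ p) ((β ^ (r′ ℕ.* d)) ^ p) ⟩
        s · (v ^ p · (β ^ (r′ ℕ.* d)) ^ p)                     ≡⟨ cong (s ·_) (sym (^-distrib-* v (β ^ (r′ ℕ.* d)) p)) ⟩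
        s · (v · β ^ (r′ ℕ.* d)) ^ p ∎)
      where
      open ≡-Reasoning
      exponents : r′ ℕ.* p ℕ.* d ≡ r′ ℕ.* d ℕ.* p
      exponents = trans (ℕP.*-assoc r′ p d) (trans (cong (r′ ℕ.*_) (ℕP.*-comm p d)) (sym (ℕP.*-assoc r′ d p)))

  -- If α^k and β^r are associated for some 0 < k < r, then α^{k/g} = w β^{r/g} with g = gcd(k , r) and w a unit.
  associated⇒dependent : ∀ {k r α β u v} → 1 ℕ.≤ k → k ℕ.< r → N α ≢ 0ℚ → IsIntegral n u → IsIntegral n v →
    α ^ k ≡ β ^ r · u → β ^ r ≡ α ^ k · v → ∃ λ p → Prim.Prime p × p ℕD.∣ r × Dependent p α
  associated⇒dependent {k} {r} {α} {β} {u} {v} 1≤k k<r Nα≢0 iu iv eu ev = byGCD (divideOutGCD k r 1≤k)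
    where
    Nαᵏ≢0 : N (α ^ k) ≢ 0ℚ
    Nαᵏ≢0 = nonzero^ k
      where
      nonzero^ : ∀ k → N (α ^ k) ≢ 0ℚ
      nonzero^ zero e = 1≢0 (trans (sym (N-ι 1ℚ)) e)
        where
        1≢0 : 1ℚ ≢ 0ℚ
        1≢0 ()
      nonzero^ (suc k) e = *≢0 Nα≢0 (nonzero^ k) (trans (sym (N-mul α (α ^ k))) e)
    uv≡1 : u · v ≡ 1K
    uv≡1 = cancelˡ {α ^ k} Nαᵏ≢0 (begin
      α ^ k · (u · v)    ≡⟨ solve 3 (λ a u v → a :* (u :* v) := a :* v :* u) refl (α ^ k) u v ⟩
      α ^ k · v · u      ≡⟨ cong (_· u) (sym ev) ⟩
      β ^ r · u          ≡⟨ sym eu ⟩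
      α ^ k              ≡⟨ solve 1 (λ a → a := a :* con (+ 1)) refl (α ^ k) ⟩
      α ^ k · 1K ∎)
      where open ≡-Reasoning
    invertible : ∀ {x} → N x ≢ 0ℚ → ∃ λ y → x · y ≡ 1K
    invertible {x} Nx≢0 = from (inverse Nx≢0)
      where
      from : (∃ λ i → N x ℚ.* i ≡ 1ℚ) → ∃ λ y → x · y ≡ 1K
      from (i , e) = x ♯ · ι i , trans (solve 3 (λ x y i → x :* (y :* i) := x :* y :* i) refl x (x ♯) (ι i)) (trans (cong (_· ι i) (mul-♯ x)) (trans (sym (ι-mul (N x) i)) (cong ι e)))
    Nβ≢0 : ∀ r → N (β ^ suc r) ≢ 0ℚ → N β ≢ 0ℚ
    Nβ≢0 r h e = h (trans (N-mul β (β ^ r)) (trans (cong (ℚ._* N (β ^ r)) e) (ℚP.*-zeroˡ (N (β ^ r)))))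
    Nβʳ≢0 : N (β ^ r) ≢ 0ℚ
    Nβʳ≢0 e = Nαᵏ≢0 (trans (cong N eu) (trans (N-mul (β ^ r) u) (trans (cong (ℚ._* N u) e) (ℚP.*-zeroˡ (N u)))))
    byGCD : (∃₂ λ g k′ → ∃ λ r′ → Cop.Coprime k′ r′ × k′ ℕ.* g ≡ k × r′ ℕ.* g ≡ r) → ∃ λ p → Prim.Prime p × p ℕD.∣ r × Dependent p α
    byGCD (zero , k′ , r′ , cop , ek , er) = ⊥-elim (ℕP.<⇒≱ (ℕP.≤-trans (ℕ.s≤s ℕ.z≤n) k<r) (ℕP.≤-reflexive (trans (sym er) (ℕP.*-zeroʳ r′))))
    byGCD (suc g′ , k′ , r′ , cop , ek , er) = withPrime (prime-divisor r′ 2≤r′) (invertible (Nα≢0)) (invertible Nβ)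
      where
      g = suc g′
      2≤r′ : 2 ℕ.≤ r′
      2≤r′ = big r′ k′ refl refl
        where
        big : ∀ a b → a ≡ r′ → b ≡ k′ → 2 ℕ.≤ a
        big zero b e _ = ⊥-elim (ℕP.<⇒≱ k<r (ℕP.≤-trans (ℕP.≤-reflexive (trans (sym er) (cong (ℕ._* g) (sym e)))) ℕ.z≤n))
        big (suc zero) zero _ e′ = ⊥-elim (ℕP.<⇒≱ 1≤k (ℕP.≤-reflexive (trans (sym ek) (cong (ℕ._* g) (sym e′)))))
        big (suc zero) (suc b) e e′ = ⊥-elim (ℕP.<⇒≱ k<r (ℕP.≤-trans (ℕP.≤-reflexive (trans (sym er) (cong (ℕ._* g) (sym e)))) (ℕP.≤-trans (ℕP.*-monoˡ-≤ g (ℕ.s≤s {0} {b} ℕ.z≤n)) (ℕP.≤-reflexive (trans (cong (ℕ._* g) e′) ek)))))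
        big (suc (suc a)) _ _ _ = ℕ.s≤s (ℕ.s≤s ℕ.z≤n)
      Nβ : N β ≢ 0ℚ
      Nβ = positive r refl
        where
        positive : ∀ s → s ≡ r → N β ≢ 0ℚ
        positive zero e = ⊥-elim (ℕP.<⇒≱ (ℕP.≤-trans (ℕ.s≤s ℕ.z≤n) k<r) (ℕP.≤-reflexive (sym e)))
        positive (suc s) refl = Nβ≢0 s Nβʳ≢0
      withPrime : (∃ λ p → Prim.Prime p × p ℕD.∣ r′) → (∃ λ a → α · a ≡ 1K) → (∃ λ b → β · b ≡ 1K) → ∃ λ p → Prim.Prime p × p ℕD.∣ r × Dependent p α
      withPrime (p , pp , p∣r′@(ℕD.divides r″ r′≡)) (a , αa≡1) (b , βb≡1) = p , pp , subst (p ℕD.∣_) er (ℕD.∣m⇒∣m*n g p∣r′) ,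
        -- Only the g-th power of w is known to be integral, namely u; `bd-root` carries integrality
        -- over to w, and likewise to its inverse.
        power-dependent pp {α} {β} {w} {k′} {r″} (bd-root g′ (subst BD (sym wᵍ≡u) (integral⇒bd iu)))
          (unit-norm (bd-root g′ (subst BD (sym wᵍ≡u) (integral⇒bd iu))) (bd-root g′ (subst BD (sym w⁻ᵍ≡v) (integral⇒bd iv))) ww⁻≡1)
          (trans (sym quotient) (cong (λ e → w · β ^ e) r′≡))
          (λ p∣k′ → ℕP.<⇒≢ (prime≥2 pp) (sym (cop (p∣k′ , p∣r′))))
        where
        w w⁻ : K
        w = α ^ k′ · b ^ r′
        w⁻ = β ^ r′ · a ^ k′
        inverse^ : ∀ {x y} k → x · y ≡ 1K → x ^ k · y ^ k ≡ 1K
        inverse^ {x} {y} k e = trans (sym (^-distrib-* x y k)) (trans (cong (_^ k) e) (1^ k))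
        quotient : w · β ^ r′ ≡ α ^ k′
        quotient = trans (solve 3 (λ x y z → x :* y :* z := x :* (z :* y)) refl (α ^ k′) (b ^ r′) (β ^ r′)) (trans (cong (α ^ k′ ·_) (inverse^ r′ βb≡1)) (solve 1 (λ x → x :* con (+ 1) := x) refl (α ^ k′)))
        product^ : ∀ x y i j → (x ^ i · y ^ j) ^ g ≡ x ^ (i ℕ.* g) · y ^ (j ℕ.* g)
        product^ x y i j = trans (^-distrib-* (x ^ i) (y ^ j) g) (cong₂ _·_ (^-assocʳ x i g) (^-assocʳ y j g))
        wᵍ≡u : w ^ g ≡ u
        wᵍ≡u = trans (product^ α b k′ r′) (trans (cong₂ (λ i j → α ^ i · b ^ j) ek er) (trans (cong (_· b ^ r) eu) (trans (solve 3 (λ x y z → x :* y :* z := x :* z :* y) refl (β ^ r) u (b ^ r)) (trans (cong (_· u) (inverse^ r βb≡1)) (solve 1 (λ x → con (+ 1) :* x := x) refl u)))))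
        w⁻ᵍ≡v : w⁻ ^ g ≡ v
        w⁻ᵍ≡v = trans (product^ β a r′ k′) (trans (cong₂ (λ i j → β ^ i · a ^ j) er ek) (trans (cong (_· a ^ k) ev) (trans (solve 3 (λ x y z → x :* y :* z := x :* z :* y) refl (α ^ k) v (a ^ k)) (trans (cong (_· v) (inverse^ k αa≡1)) (solve 1 (λ x → con (+ 1) :* x := x) refl v)))))
        ww⁻≡1 : w · w⁻ ≡ 1K
        ww⁻≡1 = trans (solve 4 (λ x y z t → x :* y :* (z :* t) := x :* t :* (z :* y)) refl (α ^ k′) (b ^ r′) (β ^ r′) (a ^ k′)) (trans (cong₂ _·_ (inverse^ k′ αa≡1) (inverse^ r′ βb≡1)) (solve 0 (con (+ 1) :* con (+ 1) := con (+ 1)) refl))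

-- Congruences and power residues

-- A missed value could be punched out, giving an injection of a finite set into a smaller one.
injective⇒surjective : ∀ {k} (h : Fin k → Fin k) → (∀ {i j} → h i ≡ h j → i ≡ j) → ∀ w → ¬ (∀ i → w ≢ h i)
injective⇒surjective {suc k} h inj w missed = FinP.<⇒notInjective {f = λ i → Fin.punchOut (missed i)} (ℕP.n<1+n k)
  (λ {i} {j} e → inj (FinP.punchOut-injective (missed i) (missed j) e))

module Congruence (q : ℕ) where

  open ℤS.Solver using (solve; _:*_; _:+_; _:-_; :-_; con; _:=_)
  open ℤS using (_^_; ^-homo-*; ^-assocʳ; ^-distrib-*; 1^) public

  infix 4 _≈_
  record _≈_ (x y : ℤ) : Set where
    constructor mod
    field divides : + q ℤD.∣ x ℤ.- y
  open _≈_ public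

  ≡⇒≈ : ∀ {x y} → x ≡ y → x ≈ y
  ≡⇒≈ {x} refl = mod (ℤD.divides (+ 0) (ℤP.+-inverseʳ x))

  ≈-refl : ∀ {x} → x ≈ x
  ≈-refl = ≡⇒≈ refl

  ≈-sym : ∀ {x y} → x ≈ y → y ≈ x
  ≈-sym {x} {y} (mod (ℤD.divides k e)) = mod (ℤD.divides (ℤ.- k) (trans (solve 2 (λ x y → y :- x := :- (x :- y)) refl x y) (trans (cong ℤ.-_ e) (solve 2 (λ k q → :- (k :* q) := (:- k) :* q) refl k (+ q)))))

  ≈-trans : ∀ {x y z} → x ≈ y → y ≈ z → x ≈ z
  ≈-trans {x} {y} {z} (mod (ℤD.divides k e)) (mod (ℤD.divides l e′)) = mod (ℤD.divides (k ℤ.+ l) (trans (solve 3 (λ x y z → x :- z := x :- y :+ (y :- z)) refl x y z) (trans (cong₂ ℤ._+_ e e′) (sym (ℤP.*-distribʳ-+ (+ q) k l)))))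

  ≈-+ : ∀ {x y z w} → x ≈ y → z ≈ w → x ℤ.+ z ≈ y ℤ.+ w
  ≈-+ {x} {y} {z} {w} (mod (ℤD.divides k e)) (mod (ℤD.divides l e′)) = mod (ℤD.divides (k ℤ.+ l) (trans (solve 4 (λ x y z w → x :+ z :- (y :+ w) := x :- y :+ (z :- w)) refl x y z w) (trans (cong₂ ℤ._+_ e e′) (sym (ℤP.*-distribʳ-+ (+ q) k l)))))

  ≈-* : ∀ {x y z w} → x ≈ y → z ≈ w → x ℤ.* z ≈ y ℤ.* w
  ≈-* {x} {y} {z} {w} (mod (ℤD.divides k e)) (mod (ℤD.divides l e′)) = mod (ℤD.divides (k ℤ.* z ℤ.+ y ℤ.* l) (trans (solve 4 (λ x y z w → x :* z :- y :* w := (x :- y) :* z :+ y :* (z :- w)) refl x y z w)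
    (trans (cong₂ (λ u v → u ℤ.* z ℤ.+ y ℤ.* v) e e′) (solve 5 (λ k q z y l → k :* q :* z :+ y :* (l :* q) := (k :* z :+ y :* l) :* q) refl k (+ q) z y l))))

  ≈-neg : ∀ {x y} → x ≈ y → ℤ.- x ≈ ℤ.- y
  ≈-neg {x} {y} e = ≈-trans (≡⇒≈ (solve 1 (λ x → :- x := con -[1+ 0 ] :* x) refl x)) (≈-trans (≈-* (≈-refl { -[1+ 0 ]}) e) (≡⇒≈ (solve 1 (λ x → con -[1+ 0 ] :* x := :- x) refl y)))

  ≈-^ : ∀ {x y} k → x ≈ y → x ^ k ≈ y ^ k
  ≈-^ zero e = ≈-refl
  ≈-^ (suc k) e = ≈-* e (≈-^ k e)

  Zero Unit : ℤ → Set
  Zero x = x ≈ + 0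
  Unit x = ¬ Zero x

  zero⇒∣ : ∀ {x} → Zero x → + q ℤD.∣ x
  zero⇒∣ {x} (mod d) = subst (+ q ℤD.∣_) (ℤP.+-identityʳ x) d

  ∣⇒zero : ∀ {x} → + q ℤD.∣ x → Zero x
  ∣⇒zero {x} d = mod (subst (+ q ℤD.∣_) (sym (ℤP.+-identityʳ x)) d)

  zero? : ∀ x → Dec (Zero x)
  zero? x = decide (+ q ℤD.∣? x)
    where
    decide : Dec (+ q ℤD.∣ x) → Dec (Zero x)
    decide (yes d) = yes (∣⇒zero d)
    decide (no ¬d) = no (λ z → ¬d (zero⇒∣ z))

  coprime⇒inv : ∀ {x} → Cop.Coprime ℤ.∣ x ∣ q → ∃ λ y → x ℤ.* y ≈ + 1
  coprime⇒inv {x} coprime = signed x (fromBézout (Cop.coprime-Bézout coprime))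
    where
    lift : ∀ (a b c d : ℕ) → 1 ℕ.+ a ℕ.* b ≡ c ℕ.* d → + 1 ℤ.+ + a ℤ.* + b ≡ + c ℤ.* + d
    lift a b c d e = trans (cong (λ v → + 1 ℤ.+ v) (sym (ℤP.pos-* a b))) (trans (cong +_ e) (ℤP.pos-* c d))
    fromBézout : GCD.Bézout.Identity 1 ℤ.∣ x ∣ q → ∃ λ y → + ℤ.∣ x ∣ ℤ.* y ≈ + 1
    fromBézout (GCD.Bézout.+- a b e) = + a , mod (ℤD.divides (+ b) (trans (cong (λ v → v ℤ.- + 1) (trans (ℤP.*-comm (+ ℤ.∣ x ∣) (+ a)) (sym (lift b q a ℤ.∣ x ∣ e)))) (solve 1 (λ v → con (+ 1) :+ v :- con (+ 1) := v) refl (+ b ℤ.* + q))))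
    fromBézout (GCD.Bézout.-+ a b e) = ℤ.- + a , mod (ℤD.divides (ℤ.- + b) (trans (solve 2 (λ x a → x :* (:- a) :- con (+ 1) := :- (con (+ 1) :+ a :* x)) refl (+ ℤ.∣ x ∣) (+ a)) (trans (cong ℤ.-_ (lift a ℤ.∣ x ∣ b q e)) (solve 2 (λ b q → :- (b :* q) := (:- b) :* q) refl (+ b) (+ q)))))
    signed : ∀ x → (∃ λ y → + ℤ.∣ x ∣ ℤ.* y ≈ + 1) → ∃ λ y → x ℤ.* y ≈ + 1
    signed (+ k) r = r
    signed -[1+ k ] (y , e) = ℤ.- y , ≈-trans (≡⇒≈ (solve 2 (λ x y → (:- x) :* (:- y) := x :* y) refl (+ suc k) y)) e

module Modular {q : ℕ} (prime-q : Prim.Prime q) where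

  open Congruence q public
  open ℤS.Solver using (solve; _:*_; _:+_; _:-_; :-_; con; _:=_)

  zero-* : ∀ {x y} → Zero (x ℤ.* y) → Zero x ⊎ Zero y
  zero-* {x} {y} z = [ (λ d → inj₁ (∣⇒zero (ℤD.∣ᵤ⇒∣ d))) , (λ d → inj₂ (∣⇒zero (ℤD.∣ᵤ⇒∣ d))) ]′
    (Prim.euclidsLemma ℤ.∣ x ∣ ℤ.∣ y ∣ prime-q (subst (q ℕD.∣_) (ℤP.abs-* x y) (ℤD.∣⇒∣ᵤ (zero⇒∣ z))))

  unit-* : ∀ {x y} → Unit x → Unit y → Unit (x ℤ.* y)
  unit-* ux uy z = [ ux , uy ]′ (zero-* z)

  unit-1 : Unit (+ 1)
  unit-1 z = ℕP.<⇒≢ (prime≥2 prime-q) (sym (ℕD.∣1⇒≡1 (ℤD.∣⇒∣ᵤ (zero⇒∣ z))))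

  unit-^ : ∀ {x} k → Unit x → Unit (x ^ k)
  unit-^ zero u = unit-1
  unit-^ (suc k) u = unit-* u (unit-^ k u)

  unit-resp : ∀ {x y} → x ≈ y → Unit x → Unit y
  unit-resp e u z = u (≈-trans e z)

  unit-neg : ∀ {x} → Unit x → Unit (ℤ.- x)
  unit-neg {x} u z = u (≈-trans (≡⇒≈ (solve 1 (λ x → x := :- (:- x)) refl x)) (≈-neg z))

  unit-left : ∀ {x y} → x ℤ.* y ≈ + 1 → Unit x
  unit-left {x} {y} e z = unit-1 (≈-trans (≈-sym e) (≈-trans (≈-* z (≈-refl {y})) (≡⇒≈ (ℤP.*-zeroˡ y))))

  unit-ℕ : ∀ k → ¬ (q ℕD.∣ k) → Unit (+ k)
  unit-ℕ k ¬d z = ¬d (ℤD.∣⇒∣ᵤ (zero⇒∣ z))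

  inv : ∀ {x} → Unit x → ∃ λ y → x ℤ.* y ≈ + 1
  inv {x} ux = coprime⇒inv {x} λ { {d} (d∣x , d∣q) → [ id , (λ d≡q → ⊥-elim (ux (∣⇒zero (ℤD.∣ᵤ⇒∣ (subst (ℕD._∣ ℤ.∣ x ∣) d≡q d∣x))))) ]′ (Prim.prime⇒irreducible prime-q d∣q) }

  cancel : ∀ {x y z} → Unit x → x ℤ.* y ≈ x ℤ.* z → y ≈ z
  cancel {x} {y} {z} ux e = from (inv ux)
    where
    from : (∃ λ i → x ℤ.* i ≈ + 1) → y ≈ z
    from (i , xi≈1) = ≈-trans (expand y) (≈-trans (≈-* (≈-refl {i}) e) (≈-sym (expand z)))
      where
      expand : ∀ y → y ≈ i ℤ.* (x ℤ.* y)
      expand y = ≈-trans (≡⇒≈ (sym (ℤP.*-identityˡ y))) (≈-trans (≈-* (≈-sym xi≈1) (≈-refl {y})) (≡⇒≈ (solve 3 (λ x i y → x :* i :* y := i :* (x :* y)) refl x i y)))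

  module PowerResidue {p : ℕ} (prime-p : Prim.Prime p) where

    Power : ℤ → Set
    Power x = ∃ λ h → h ^ p ≈ x

    power-resp : ∀ {x y} → x ≈ y → Power x → Power y
    power-resp e (h , e′) = h , ≈-trans e′ e

    power-* : ∀ {x y} → Power x → Power y → Power (x ℤ.* y)
    power-* (h , e) (k , e′) = h ℤ.* k , ≈-trans (≡⇒≈ (^-distrib-* h k p)) (≈-* e e′)

    power-p : ∀ x → Power (x ^ p)
    power-p x = x , ≈-refl

    power-1 : Power (+ 1)
    power-1 = + 1 , ≡⇒≈ (1^ p)

    power-^p* : ∀ x k → Power (x ^ (k ℕ.* p))
    power-^p* x k = x ^ k , ≡⇒≈ (^-assocʳ x k p)

    power-^ : ∀ {x} k → Power x → Power (x ^ k)
    power-^ zero _ = power-1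
    power-^ (suc k) px = power-* px (power-^ k px)

    unit-root : ∀ {h x} → h ^ p ≈ x → Unit x → Unit h
    unit-root {h} e ux zh = ux (≈-trans (≈-sym e) (≈-trans (≈-^ p zh) (≡⇒≈ (0^p p (prime≥2 prime-p)))))
      where
      0^p : ∀ k → 2 ℕ.≤ k → (+ 0) ^ k ≡ + 0
      0^p (suc k) _ = ℤP.*-zeroˡ ((+ 0) ^ k)

    power-cancel : ∀ {x y} → Unit x → Power x → Power (x ℤ.* y) → Power y
    power-cancel {x} {y} ux (h , e) (k , e′) = from (inv (unit-root e ux))
      where
      from : (∃ λ i → h ℤ.* i ≈ + 1) → Power y
      from (i , hi≈1) = k ℤ.* i , cancel ux (≈-trans (≡⇒≈ (trans (cong (x ℤ.*_) (^-distrib-* k i p)) (solve 3 (λ x k i → x :* (k :* i) := k :* (x :* i)) refl x (k ^ p) (i ^ p))))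
        (≈-trans (≈-* e′ (≈-trans (≈-* (≈-sym e) (≈-refl {i ^ p})) (≈-trans (≡⇒≈ (sym (^-distrib-* h i p))) (≈-trans (≈-^ p hi≈1) (≡⇒≈ (1^ p)))))) (≡⇒≈ (ℤP.*-identityʳ (x ℤ.* y)))))

    power-root : ∀ {x} k → ¬ p ℕD.∣ k → Unit x → Power (x ^ k) → Power x
    power-root {x} k p∤k ux pxᵏ = fromBézout (Cop.coprime-Bézout coprime)
      where
      coprime : Cop.Coprime k p
      coprime {d} (d∣k , d∣p) = [ id , (λ d≡p → ⊥-elim (p∤k (subst (ℕD._∣ k) d≡p d∣k))) ]′ (Prim.prime⇒irreducible prime-p d∣p)
      fromBézout : GCD.Bézout.Identity 1 k p → Power x
      fromBézout (GCD.Bézout.+- a b e) = power-cancel (unit-^ (b ℕ.* p) ux) (power-^p* x b)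
        (power-resp (≡⇒≈ (trans (^-assocʳ x k a) (trans (cong (x ^_) (trans (ℕP.*-comm k a) (sym e))) (ℤP.*-comm x (x ^ (b ℕ.* p)))))) (power-^ a pxᵏ))
      fromBézout (GCD.Bézout.-+ a b e) = power-cancel (unit-^ (a ℕ.* k) ux) (power-resp (≡⇒≈ (trans (^-assocʳ x k a) (cong (x ^_) (ℕP.*-comm k a)))) (power-^ a pxᵏ))
        (power-resp (≡⇒≈ (trans (cong (x ^_) (sym e)) (ℤP.*-comm x (x ^ (a ℕ.* k))))) (power-^p* x b))

    opaque
      residue : ∀ h → ∃ λ (i : Fin q) → + Fin.toℕ i ≈ h
      residue h = Fin.fromℕ< r<q , mod (ℤD.divides (ℤ.- (h ℤM./ℕ q)) (trans (cong (λ k → + k ℤ.- h) (FinP.toℕ-fromℕ< r<q)) (trans (cong (λ v → + (h ℤM.%ℕ q) ℤ.- v) (ℤM.a≡a%ℕn+[a/ℕn]*n h q))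
        (solve 3 (λ r d q → r :- (r :+ d :* q) := (:- d) :* q) refl (+ (h ℤM.%ℕ q)) (h ℤM./ℕ q) (+ q)))))
        where
        instance
          q≢0 : ℕ.NonZero q
          q≢0 = Prim.prime⇒nonZero prime-q
        r<q : h ℤM.%ℕ q ℕ.< q
        r<q = ℤM.n%ℕd<d h q

    power? : ∀ x → Dec (Power x)
    power? x = decide (FinP.any? (λ i → zero? ((+ Fin.toℕ i) ^ p ℤ.- x)))
      where
      decide : Dec (∃ λ (i : Fin q) → Zero ((+ Fin.toℕ i) ^ p ℤ.- x)) → Dec (Power x)
      decide (yes (i , z)) = yes (+ Fin.toℕ i , mod (zero⇒∣ z))
      decide (no ¬e) = no (λ { (h , e) → let i , i≈h = residue h in ¬e (i , ∣⇒zero (divides (≈-trans (≈-^ p i≈h) e))) })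

    -- If two distinct residues have the same p-th power then h ↦ hᵖ is not injective on ℤ/q, hence not surjective.
    nonresidue : ∀ {ζ} → ζ ^ p ≈ + 1 → ¬ ζ ≈ + 1 → ∃ λ g → ¬ Power g
    nonresidue {ζ} ζᵖ≈1 ζ≉1 = fromFin (FinP.¬∀⟶∃¬ q (λ i → Power (+ Fin.toℕ i)) (λ i → power? (+ Fin.toℕ i)) notAll)
      where
      fromFin : (∃ λ (i : Fin q) → ¬ Power (+ Fin.toℕ i)) → ∃ λ g → ¬ Power g
      fromFin (i , ¬P) = + Fin.toℕ i , ¬P
      notAll : ¬ (∀ (i : Fin q) → Power (+ Fin.toℕ i))
      notAll all = injective⇒surjective sec sec-injective w w-missed
        where
        val : Fin q → ℤ
        val i = + Fin.toℕ i
        val-injective : ∀ {i j} → val i ≈ val j → i ≡ j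
        val-injective {i} {j} (mod d) = FinP.toℕ-injective (close (ℤD.∣⇒∣ᵤ d))
          where
          close : q ℕD.∣ ℤ.∣ val i ℤ.- val j ∣ → Fin.toℕ i ≡ Fin.toℕ j
          close d′ = ℤP.+-injective (trans (solve 2 (λ x y → x := x :- y :+ y) refl (val i) (val j)) (trans (cong (ℤ._+ val j) (ℤP.∣i∣≡0⇒i≡0 {val i ℤ.- val j} (small ℤ.∣ val i ℤ.- val j ∣ d′ bound))) (ℤP.+-identityˡ (val j))))
            where
            bound : ℤ.∣ val i ℤ.- val j ∣ ℕ.< q
            bound = subst (ℕ._< q) (sym (trans (cong ℤ.∣_∣ (ℤP.m-n≡m⊖n (Fin.toℕ i) (Fin.toℕ j))) refl)) (ℕP.≤-<-trans (ℤP.∣m⊝n∣≤m⊔n (Fin.toℕ i) (Fin.toℕ j)) (ℕP.⊔-pres-<m (FinP.toℕ<n i) (FinP.toℕ<n j)))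
            small : ∀ k → q ℕD.∣ k → k ℕ.< q → k ≡ 0
            small zero _ _ = refl
            small (suc k) d lt = ⊥-elim (ℕP.<⇒≱ lt (ℕD.∣⇒≤ d))
        sec : Fin q → Fin q
        sec i = proj₁ (residue (proj₁ (all i)))
        sec-power : ∀ i → val (sec i) ^ p ≈ val i
        sec-power i = ≈-trans (≈-^ p (proj₂ (residue (proj₁ (all i))))) (proj₂ (all i))
        sec-injective : ∀ {i j} → sec i ≡ sec j → i ≡ j
        sec-injective {i} {j} e = val-injective (≈-trans (≈-sym (sec-power i)) (≈-trans (≡⇒≈ (cong (λ k → val k ^ p) e)) (sec-power j)))
        one : Fin q
        one = proj₁ (residue (+ 1))
        one≈1 : val one ≈ + 1
        one≈1 = proj₂ (residue (+ 1))
        missed : ∃ λ w → val w ^ p ≈ + 1 × sec one ≢ w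
        missed = decide (sec one FinP.≟ one)
          where
          decide : Dec (sec one ≡ one) → ∃ λ w → val w ^ p ≈ + 1 × sec one ≢ w
          decide (no ≢) = one , ≈-trans (≈-^ p one≈1) (≡⇒≈ (1^ p)) , ≢
          decide (yes e) = proj₁ (residue ζ) , ≈-trans (≈-^ p (proj₂ (residue ζ))) ζᵖ≈1 ,
            λ e′ → ζ≉1 (≈-trans (≈-sym (proj₂ (residue ζ))) (≈-trans (≡⇒≈ (cong val (trans (sym e′) e))) one≈1))
        w = proj₁ missed
        w-missed : ∀ i → w ≢ sec i
        w-missed i e = proj₂ (proj₂ missed) (trans (cong sec (val-injective (≈-trans one≈1 (≈-trans (≈-sym (proj₁ (proj₂ missed))) (≈-trans (≡⇒≈ (cong (λ k → val k ^ p) e)) (sec-power i)))))) (sym e))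

-- Roots modulo q at which ρ^b η^c is not a p-th power

module GoodRoots {q : ℕ} (prime-q : Prim.Prime q) {p : ℕ} (prime-p : Prim.Prime p) where

  open Modular prime-q
  open PowerResidue prime-p
  open ℤS.Solver using (solve; _:*_; _:+_; _:-_; :-_; con; _:=_)

  -- f_n has a simple root at a mod q, n = (1 - a³) / (a (a + 1)), unless this polynomial vanishes at a.
  ramification : ℤ → ℤ
  ramification a = a ℤ.* a ℤ.* a ℤ.* a ℤ.+ + 2 ℤ.* (a ℤ.* a ℤ.* a) ℤ.+ + 2 ℤ.* a ℤ.+ + 1

  cube : ℤ → ℤ
  cube a = a ℤ.* a ℤ.* a

  -- A prospective degree one prime above q, at which ρ reduces to a and η = κ³ / 2 to e.
  -- Invertibility of a (1 + a) allows n to be chosen with a as a root, and `simple` makes that root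
  -- simple.
  record Root (b c : ℕ) : Set where
    field
      a e : ℤ
      unit-a : Unit a
      unit-1+a : Unit (+ 1 ℤ.+ a)
      simple : Unit (ramification a)
      e-eq : + 2 ℤ.* e ≈ cube (+ 1 ℤ.+ a)
      nonpower : ¬ Power (a ^ b ℤ.* e ^ c)

  private
    zero-comb : ∀ u v {x y} → Zero x → Zero y → Zero (u ℤ.* x ℤ.+ v ℤ.* y)
    zero-comb u v zx zy = ≈-trans (≈-+ (≈-* (≈-refl {u}) zx) (≈-* (≈-refl {v}) zy)) (≡⇒≈ (solve 2 (λ u v → u :* con (+ 0) :+ v :* con (+ 0) := con (+ 0)) refl u v))

    zero-cancel : ∀ {x y} → Unit x → Zero (x ℤ.* y) → Zero y
    zero-cancel ux z = [ (λ zx → ⊥-elim (ux zx)) , id ]′ (zero-* z)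

    zero-≡ : ∀ {x y} → x ≡ y → Zero x → Zero y
    zero-≡ refl z = z

    nonpower⇒unit : ∀ {g} → ¬ Power g → Unit g
    nonpower⇒unit {g} ¬P zg = ¬P (+ 0 , ≈-trans (≡⇒≈ (0^ p (prime≥2 prime-p))) (≈-sym zg))
      where
      0^ : ∀ k → 2 ℕ.≤ k → (+ 0) ^ k ≡ + 0
      0^ (suc k) _ = ℤP.*-zeroˡ ((+ 0) ^ k)

    -- Up to the factor (g - 1)⁴ these are the values of `ramification` at the two roots 1 / (g - 1)
    -- and - g / (g - 1) used in `reflect`.
    A B : ℤ → ℤ
    A g = g ℤ.* g ℤ.* g ℤ.* g ℤ.- + 2 ℤ.* (g ℤ.* g ℤ.* g) ℤ.+ + 4 ℤ.* g ℤ.- + 2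
    B g = ℤ.- + 2 ℤ.* (g ℤ.* g ℤ.* g ℤ.* g) ℤ.+ + 4 ℤ.* (g ℤ.* g ℤ.* g) ℤ.- + 2 ℤ.* g ℤ.+ + 1

  module _ (unit-2 : Unit (+ 2)) (unit-259 : Unit (+ 259)) (power--1 : Power (ℤ.- + 1)) (p≢3 : p ≢ 3) {g₀ : ℤ} (g₀-nonpower : ¬ Power g₀) where

    private
      unit-4g : ∀ {g} → Unit g → Unit (+ 4 ℤ.* g)
      unit-4g ug = unit-* (unit-* unit-2 unit-2) ug

      neg-nonpower : ∀ {g} → ¬ Power g → ¬ Power (ℤ.- g)
      neg-nonpower {g} ¬P P = ¬P (power-resp (≡⇒≈ (solve 1 (λ g → :- con (+ 1) :* (:- g) := g) refl g)) (power-* power--1 P))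

      -- Since - 1 is a p-th power, g₀ and - g₀ are both non-powers, and it suffices that F does not
      -- vanish at both.
      sign-choice : (F : ℤ → ℤ) (bad : ∀ {g} → Unit g → Zero (F g) → Zero (F (ℤ.- g)) → ⊥) → ∃ λ g → ¬ Power g × Unit (F g)
      sign-choice F bad = decide (zero? (F g₀))
        where
        decide : Dec (Zero (F g₀)) → ∃ λ g → ¬ Power g × Unit (F g)
        decide (no u) = g₀ , g₀-nonpower , u
        decide (yes z) = ℤ.- g₀ , neg-nonpower g₀-nonpower , bad (nonpower⇒unit g₀-nonpower) z

      -- Vanishing at g and - g would, by the odd and even parts of the polynomial, give g² = - 1
      -- and g⁴ = - 1, hence 2 = 0.
      choice₁ : ∃ λ g → ¬ Power g × Unit (ramification g)
      choice₁ = sign-choice ramification (λ {g} ug z z′ →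
        let z₁ = zero-cancel (unit-4g ug) (zero-≡ (solve 1 (λ g → let P = λ a → a :* a :* a :* a :+ con (+ 2) :* (a :* a :* a) :+ con (+ 2) :* a :+ con (+ 1) in
                     con (+ 1) :* P g :+ con -[1+ 0 ] :* P (:- g) := con (+ 4) :* g :* (g :* g :+ con (+ 1))) refl g) (zero-comb (+ 1) -[1+ 0 ] z z′))
            z₂ = zero-cancel unit-2 (zero-≡ (solve 1 (λ g → let P = λ a → a :* a :* a :* a :+ con (+ 2) :* (a :* a :* a) :+ con (+ 2) :* a :+ con (+ 1) in
                     con (+ 1) :* P g :+ con (+ 1) :* P (:- g) := con (+ 2) :* (g :* g :* (g :* g) :+ con (+ 1))) refl g) (zero-comb (+ 1) (+ 1) z z′))
        in unit-2 (zero-≡ (solve 1 (λ g → (con (+ 1) :- g :* g) :* (g :* g :+ con (+ 1)) :+ con (+ 1) :* (g :* g :* (g :* g) :+ con (+ 1)) := con (+ 2)) refl g) (zero-comb (+ 1 ℤ.- g ℤ.* g) (+ 1) z₁ z₂)))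

      -- 259 is the resultant of A(X) and B(-X).
      resultant : ∀ g → Zero (A g) → Zero (B (ℤ.- g)) → ⊥
      resultant g z z′ = unit-259 (zero-≡ (solve 1 (λ g → (con (+ 14) :+ con (+ 260) :* g :+ con (+ 376) :* (g :* g) :+ con (+ 128) :* (g :* g :* g)) :* (g :* g :* g :* g :- con (+ 2) :* (g :* g :* g) :+ con (+ 4) :* g :- con (+ 2))
            :+ (con (+ 287) :- con (+ 110) :* g :- con (+ 68) :* (g :* g) :+ con (+ 64) :* (g :* g :* g)) :* (:- con (+ 2) :* ((:- g) :* (:- g) :* (:- g) :* (:- g)) :+ con (+ 4) :* ((:- g) :* (:- g) :* (:- g)) :- con (+ 2) :* (:- g) :+ con (+ 1))
            := con (+ 259)) refl g)
          (zero-comb (+ 14 ℤ.+ + 260 ℤ.* g ℤ.+ + 376 ℤ.* (g ℤ.* g) ℤ.+ + 128 ℤ.* (g ℤ.* g ℤ.* g)) (+ 287 ℤ.- + 110 ℤ.* g ℤ.- + 68 ℤ.* (g ℤ.* g) ℤ.+ + 64 ℤ.* (g ℤ.* g ℤ.* g)) z z′))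

      choice₂ : ∃ λ g → ¬ Power g × Unit (A g ℤ.* B g)
      choice₂ = sign-choice (λ g → A g ℤ.* B g) (λ {g} ug z z′ → bad ug (zero-* z) (zero-* z′))
        where
        bad : ∀ {g} → Unit g → Zero (A g) ⊎ Zero (B g) → Zero (A (ℤ.- g)) ⊎ Zero (B (ℤ.- g)) → ⊥
        bad {g} ug (inj₁ z) (inj₁ z′) =
          let z₁ = zero-cancel (unit-4g ug) (zero-≡ (solve 1 (λ g → let A = λ a → a :* a :* a :* a :- con (+ 2) :* (a :* a :* a) :+ con (+ 4) :* a :- con (+ 2) in
                       con (+ 1) :* A g :+ con -[1+ 0 ] :* A (:- g) := con (+ 4) :* g :* (con (+ 2) :- g :* g)) refl g) (zero-comb (+ 1) -[1+ 0 ] z z′))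
              z₂ = zero-cancel unit-2 (zero-≡ (solve 1 (λ g → let A = λ a → a :* a :* a :* a :- con (+ 2) :* (a :* a :* a) :+ con (+ 4) :* a :- con (+ 2) in
                       con (+ 1) :* A g :+ con (+ 1) :* A (:- g) := con (+ 2) :* (g :* g :* (g :* g) :- con (+ 2))) refl g) (zero-comb (+ 1) (+ 1) z z′))
          in unit-2 (zero-≡ (solve 1 (λ g → (g :* g :+ con (+ 2)) :* (con (+ 2) :- g :* g) :+ con (+ 1) :* (g :* g :* (g :* g) :- con (+ 2)) := con (+ 2)) refl g) (zero-comb (g ℤ.* g ℤ.+ + 2) (+ 1) z₁ z₂))
        bad {g} ug (inj₂ z) (inj₂ z′) =
          let z₁ = zero-cancel (unit-4g ug) (zero-≡ (solve 1 (λ g → let B = λ a → :- con (+ 2) :* (a :* a :* a :* a) :+ con (+ 4) :* (a :* a :* a) :- con (+ 2) :* a :+ con (+ 1) in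
                       con (+ 1) :* B g :+ con -[1+ 0 ] :* B (:- g) := con (+ 4) :* g :* (con (+ 2) :* (g :* g) :- con (+ 1))) refl g) (zero-comb (+ 1) -[1+ 0 ] z z′))
              z₂ = zero-comb (+ 1) (+ 1) z z′
          in unit-1 (zero-≡ (solve 1 (λ g → let B = λ a → :- con (+ 2) :* (a :* a :* a :* a) :+ con (+ 4) :* (a :* a :* a) :- con (+ 2) :* a :+ con (+ 1) in
                       (con (+ 2) :* (g :* g) :+ con (+ 1)) :* (con (+ 2) :* (g :* g) :- con (+ 1)) :+ con (+ 1) :* (con (+ 1) :* B g :+ con (+ 1) :* B (:- g)) := con (+ 1)) refl g) (zero-comb (+ 2 ℤ.* (g ℤ.* g) ℤ.+ + 1) (+ 1) z₁ z₂))
        bad {g} ug (inj₁ z) (inj₂ z′) = resultant g z z′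
        bad {g} ug (inj₂ z) (inj₁ z′) = resultant (ℤ.- g) z′ (subst (λ h → Zero (B h)) (solve 1 (λ g → g := :- (:- g)) refl g) z)

      H : ℤ
      H = proj₁ (inv unit-2)

      2H≈1 : + 2 ℤ.* H ≈ + 1
      2H≈1 = proj₂ (inv unit-2)

      half-cube : ℤ → ℤ
      half-cube a = cube (+ 1 ℤ.+ a) ℤ.* H

      half-cube-eq : ∀ a → + 2 ℤ.* half-cube a ≈ cube (+ 1 ℤ.+ a)
      half-cube-eq a = ≈-trans (≡⇒≈ (solve 2 (λ k H → con (+ 2) :* (k :* H) := con (+ 2) :* H :* k) refl (cube (+ 1 ℤ.+ a)) H)) (≈-trans (≈-* 2H≈1 (≈-refl {cube (+ 1 ℤ.+ a)})) (≡⇒≈ (ℤP.*-identityˡ (cube (+ 1 ℤ.+ a)))))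

      unit-H : Unit H
      unit-H = unit-left {H} {+ 2} (≈-trans (≡⇒≈ (ℤP.*-comm H (+ 2))) 2H≈1)

      unit-half-cube : ∀ a → Unit (+ 1 ℤ.+ a) → Unit (half-cube a)
      unit-half-cube a u = unit-* (unit-* (unit-* u u) u) unit-H

      twoRoots : ∀ b c {a a′} → Unit a → Unit (+ 1 ℤ.+ a) → Unit (ramification a) → Unit a′ → Unit (+ 1 ℤ.+ a′) → Unit (ramification a′) →
        (Power (a ^ b ℤ.* half-cube a ^ c) → Power (a′ ^ b ℤ.* half-cube a′ ^ c) → ⊥) → Root b c
      twoRoots b c {a} {a′} ua u1a sa ua′ u1a′ sa′ not-both = decide (power? (a ^ b ℤ.* half-cube a ^ c))
        where
        decide : Dec (Power (a ^ b ℤ.* half-cube a ^ c)) → Root b c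
        decide (no ¬P) = record { a = a ; e = half-cube a ; unit-a = ua ; unit-1+a = u1a ; simple = sa ; e-eq = half-cube-eq a ; nonpower = ¬P }
        decide (yes P) = record { a = a′ ; e = half-cube a′ ; unit-a = ua′ ; unit-1+a = u1a′ ; simple = sa′ ; e-eq = half-cube-eq a′ ; nonpower = not-both P }

      inverse^ : ∀ {x y} k → x ℤ.* y ≈ + 1 → x ^ k ℤ.* y ^ k ≈ + 1
      inverse^ {x} {y} k e = ≈-trans (≡⇒≈ (sym (^-distrib-* x y k))) (≈-trans (≈-^ k e) (≡⇒≈ (1^ k)))

      -- The roots g and 1 / g.
      invert : ∀ b c → ¬ p ℕD.∣ b ℕ.+ (b ℕ.+ 3 ℕ.* c) → Root b c
      invert b c p∤ = from choice₁
        where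
        from : (∃ λ g → ¬ Power g × Unit (ramification g)) → Root b c
        from (g , ¬Pg , sg) = with-inverse (inv ug)
          where
          ug : Unit g
          ug = nonpower⇒unit ¬Pg
          u1g : Unit (+ 1 ℤ.+ g)
          u1g z = ¬Pg (power-resp (≈-trans (≡⇒≈ (solve 1 (λ g → :- con (+ 1) := g :- (con (+ 1) :+ g)) refl g)) (≈-trans (≈-+ (≈-refl {g}) (≈-neg z)) (≡⇒≈ (ℤP.+-identityʳ g)))) power--1)
          with-inverse : (∃ λ i → g ℤ.* i ≈ + 1) → Root b c
          with-inverse (i , gi≈1) = twoRoots b c ug u1g sg ui u1i si not-both
            where
            ui : Unit i
            ui = unit-left {i} {g} (≈-trans (≡⇒≈ (ℤP.*-comm i g)) gi≈1)
            1+i≈ : + 1 ℤ.+ i ≈ i ℤ.* (+ 1 ℤ.+ g)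
            1+i≈ = ≈-trans (≈-+ (≈-sym gi≈1) (≈-refl {i})) (≡⇒≈ (solve 2 (λ g i → g :* i :+ i := i :* (con (+ 1) :+ g)) refl g i))
            u1i : Unit (+ 1 ℤ.+ i)
            u1i = unit-resp (≈-sym 1+i≈) (unit-* ui u1g)
            si : Unit (ramification i)
            si zi = sg (≈-trans (≈-sym palindrome) (≈-trans (≈-* (≈-refl {g ℤ.* g ℤ.* g ℤ.* g}) zi) (≡⇒≈ (ℤP.*-zeroʳ (g ℤ.* g ℤ.* g ℤ.* g)))))
              where
              palindrome : g ℤ.* g ℤ.* g ℤ.* g ℤ.* ramification i ≈ ramification g
              palindrome = ≈-trans (≡⇒≈ (solve 2 (λ g i → g :* g :* g :* g :* (i :* i :* i :* i :+ con (+ 2) :* (i :* i :* i) :+ con (+ 2) :* i :+ con (+ 1))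
                  := let u = g :* i in u :* u :* u :* u :+ con (+ 2) :* (u :* u :* u :* g) :+ con (+ 2) :* (u :* (g :* g :* g)) :+ g :* g :* g :* g) refl g i))
                (≈-trans (≈-+ (≈-+ (≈-+ (≈-* (≈-* (≈-* gi≈1 gi≈1) gi≈1) gi≈1) (≈-* (≈-refl {+ 2}) (≈-* (≈-* (≈-* gi≈1 gi≈1) gi≈1) (≈-refl {g})))) (≈-* (≈-refl {+ 2}) (≈-* gi≈1 (≈-refl {g ℤ.* g ℤ.* g})))) (≈-refl {g ℤ.* g ℤ.* g ℤ.* g}))
                (≡⇒≈ (solve 1 (λ g → con (+ 1) :+ con (+ 2) :* (con (+ 1) :* g) :+ con (+ 2) :* (con (+ 1) :* (g :* g :* g)) :+ g :* g :* g :* g := g :* g :* g :* g :+ con (+ 2) :* (g :* g :* g) :+ con (+ 2) :* g :+ con (+ 1)) refl g)))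
            e : ℤ
            e = half-cube g
            e′≈ : half-cube i ≈ i ^ 3 ℤ.* e
            e′≈ = ≈-trans (≈-* (≈-* (≈-* 1+i≈ 1+i≈) 1+i≈) (≈-refl {H})) (≡⇒≈ (solve 3 (λ i k H → i :* k :* (i :* k) :* (i :* k) :* H := i :* (i :* (i :* con (+ 1))) :* (k :* k :* k :* H)) refl i (+ 1 ℤ.+ g) H))
            x₁ x₂ : ℤ
            x₁ = g ^ b ℤ.* e ^ c
            x₂ = i ^ b ℤ.* half-cube i ^ c
            ratio : x₂ ℤ.* g ^ (b ℕ.+ (b ℕ.+ 3 ℕ.* c)) ≈ x₁
            ratio = ≈-trans (≈-* (≈-* (≈-refl {i ^ b}) (≈-trans (≈-^ c e′≈) (≡⇒≈ (trans (^-distrib-* (i ^ 3) e c) (cong (ℤ._* e ^ c) (^-assocʳ i 3 c)))))) (≡⇒≈ (trans (^-homo-* g b (b ℕ.+ 3 ℕ.* c)) (cong (g ^ b ℤ.*_) (^-homo-* g b (3 ℕ.* c))))))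
              (≈-trans (≡⇒≈ (solve 5 (λ ib i3 e gb g3 → ib :* (i3 :* e) :* (gb :* (gb :* g3)) := (gb :* ib) :* (g3 :* i3) :* (gb :* e)) refl (i ^ b) (i ^ (3 ℕ.* c)) (e ^ c) (g ^ b) (g ^ (3 ℕ.* c))))
              (≈-trans (≈-* (≈-* (inverse^ b gi≈1) (inverse^ (3 ℕ.* c) gi≈1)) (≈-refl {x₁})) (≡⇒≈ (solve 1 (λ x → con (+ 1) :* con (+ 1) :* x := x) refl x₁))))
            not-both : Power x₁ → Power x₂ → ⊥
            not-both P₁ P₂ = ¬Pg (power-root (b ℕ.+ (b ℕ.+ 3 ℕ.* c)) p∤ ug (power-cancel (unit-* (unit-^ b ui) (unit-^ c (unit-half-cube i u1i))) P₂ (power-resp (≈-sym ratio) P₁)))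

      -- The roots 1 / (g - 1) and - g / (g - 1), whose sum is -1.
      reflect : ∀ b c p′ → p ≡ suc p′ → ¬ p ℕD.∣ b ℕ.+ 3 ℕ.* c ℕ.* p′ → Root b c
      reflect b c p′ p≡ p∤ = from choice₂
        where
        from : (∃ λ g → ¬ Power g × Unit (A g ℤ.* B g)) → Root b c
        from (g , ¬Pg , uAB) = with-inverse (inv uw)
          where
          w : ℤ
          w = g ℤ.- + 1
          uw : Unit w
          uw z = ¬Pg (power-resp (≈-trans (≡⇒≈ (ℤP.+-comm (+ 0) (+ 1))) (≈-trans (≈-+ (≈-refl {+ 1}) (≈-sym z)) (≡⇒≈ (solve 1 (λ g → con (+ 1) :+ (g :- con (+ 1)) := g) refl g)))) power-1)
          ug : Unit g
          ug = nonpower⇒unit ¬Pg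
          uA : Unit (A g)
          uA z = uAB (≈-trans (≈-* z (≈-refl {B g})) (≡⇒≈ (ℤP.*-zeroˡ (B g))))
          uB : Unit (B g)
          uB z = uAB (≈-trans (≈-* (≈-refl {A g}) z) (≡⇒≈ (ℤP.*-zeroʳ (A g))))
          with-inverse : (∃ λ v → w ℤ.* v ≈ + 1) → Root b c
          with-inverse (v , wv≈1) = twoRoots b c uv u1v sv ua′ u1a′ sa′ not-both
            where
            uv : Unit v
            uv = unit-left {v} {w} (≈-trans (≡⇒≈ (ℤP.*-comm v w)) wv≈1)
            1+v≈ : + 1 ℤ.+ v ≈ v ℤ.* g
            1+v≈ = ≈-trans (≈-+ (≈-sym wv≈1) (≈-refl {v})) (≡⇒≈ (solve 2 (λ g v → (g :- con (+ 1)) :* v :+ v := v :* g) refl g v))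
            u1v : Unit (+ 1 ℤ.+ v)
            u1v = unit-resp (≈-sym 1+v≈) (unit-* uv ug)
            a′ : ℤ
            a′ = ℤ.- (+ 1 ℤ.+ v)
            ua′ : Unit a′
            ua′ = unit-neg u1v
            1+a′≡ : + 1 ℤ.+ a′ ≡ ℤ.- v
            1+a′≡ = solve 1 (λ v → con (+ 1) :+ (:- (con (+ 1) :+ v)) := :- v) refl v
            u1a′ : Unit (+ 1 ℤ.+ a′)
            u1a′ = unit-resp (≡⇒≈ (sym 1+a′≡)) (unit-neg uv)
            w⁴ : ℤ
            w⁴ = w ℤ.* w ℤ.* w ℤ.* w
            sv : Unit (ramification v)
            sv z = uA (≈-trans (≈-sym homogeneous) (≈-trans (≈-* (≈-refl {w⁴}) z) (≡⇒≈ (ℤP.*-zeroʳ w⁴))))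
              where
              homogeneous : w⁴ ℤ.* ramification v ≈ A g
              homogeneous = ≈-trans (≡⇒≈ (solve 2 (λ w v → w :* w :* w :* w :* (v :* v :* v :* v :+ con (+ 2) :* (v :* v :* v) :+ con (+ 2) :* v :+ con (+ 1))
                  := let u = w :* v in u :* u :* u :* u :+ con (+ 2) :* (u :* u :* u :* w) :+ con (+ 2) :* (u :* (w :* w :* w)) :+ w :* w :* w :* w) refl w v))
                (≈-trans (≈-+ (≈-+ (≈-+ (≈-* (≈-* (≈-* wv≈1 wv≈1) wv≈1) wv≈1) (≈-* (≈-refl {+ 2}) (≈-* (≈-* (≈-* wv≈1 wv≈1) wv≈1) (≈-refl {w})))) (≈-* (≈-refl {+ 2}) (≈-* wv≈1 (≈-refl {w ℤ.* w ℤ.* w})))) (≈-refl {w⁴}))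
                (≡⇒≈ (solve 1 (λ g → let w = g :- con (+ 1) in con (+ 1) :+ con (+ 2) :* (con (+ 1) :* w) :+ con (+ 2) :* (con (+ 1) :* (w :* w :* w)) :+ w :* w :* w :* w := g :* g :* g :* g :- con (+ 2) :* (g :* g :* g) :+ con (+ 4) :* g :- con (+ 2)) refl g)))
            sa′ : Unit (ramification a′)
            sa′ z = uB (≈-trans (≈-sym homogeneous) (≈-trans (≈-* (≈-refl {w⁴}) z) (≡⇒≈ (ℤP.*-zeroʳ w⁴))))
              where
              wa′≈ : w ℤ.* a′ ≈ ℤ.- g
              wa′≈ = ≈-trans (≡⇒≈ (solve 2 (λ w v → w :* (:- (con (+ 1) :+ v)) := :- (w :* v :+ w)) refl w v)) (≈-trans (≈-neg (≈-+ wv≈1 (≈-refl {w}))) (≡⇒≈ (solve 1 (λ g → :- (con (+ 1) :+ (g :- con (+ 1))) := :- g) refl g)))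
              homogeneous : w⁴ ℤ.* ramification a′ ≈ B g
              homogeneous = ≈-trans (≡⇒≈ (solve 2 (λ w v → w :* w :* w :* w :* (v :* v :* v :* v :+ con (+ 2) :* (v :* v :* v) :+ con (+ 2) :* v :+ con (+ 1))
                  := let u = w :* v in u :* u :* u :* u :+ con (+ 2) :* (u :* u :* u :* w) :+ con (+ 2) :* (u :* (w :* w :* w)) :+ w :* w :* w :* w) refl w a′))
                (≈-trans (≈-+ (≈-+ (≈-+ (≈-* (≈-* (≈-* wa′≈ wa′≈) wa′≈) wa′≈) (≈-* (≈-refl {+ 2}) (≈-* (≈-* (≈-* wa′≈ wa′≈) wa′≈) (≈-refl {w})))) (≈-* (≈-refl {+ 2}) (≈-* wa′≈ (≈-refl {w ℤ.* w ℤ.* w})))) (≈-refl {w⁴}))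
                (≡⇒≈ (solve 1 (λ g → let w = g :- con (+ 1) ; h = :- g in h :* h :* h :* h :+ con (+ 2) :* (h :* h :* h :* w) :+ con (+ 2) :* (h :* (w :* w :* w)) :+ w :* w :* w :* w := :- con (+ 2) :* (g :* g :* g :* g) :+ con (+ 4) :* (g :* g :* g) :- con (+ 2) :* g :+ con (+ 1)) refl g)))
            k Y x₁ x₂ : ℤ
            k = v ^ 3 ℤ.* H
            Y = v ^ b ℤ.* k ^ c
            x₁ = v ^ b ℤ.* half-cube v ^ c
            x₂ = a′ ^ b ℤ.* half-cube a′ ^ c
            x₁≈ : x₁ ≈ Y ℤ.* g ^ (3 ℕ.* c)
            x₁≈ = ≈-trans (≈-* (≈-refl {v ^ b}) (≈-trans (≈-^ c (≈-trans (≈-* (≈-* (≈-* 1+v≈ 1+v≈) 1+v≈) (≈-refl {H})) (≡⇒≈ (solve 3 (λ v g H → v :* g :* (v :* g) :* (v :* g) :* H := v :* (v :* (v :* con (+ 1))) :* H :* (g :* (g :* (g :* con (+ 1))))) refl v g H))))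
                (≡⇒≈ (trans (^-distrib-* k (g ^ 3) c) (cong (k ^ c ℤ.*_) (^-assocʳ g 3 c)))))) (≡⇒≈ (sym (ℤP.*-assoc (v ^ b) (k ^ c) (g ^ (3 ℕ.* c)))))
            -1ᶻ : ℤ
            -1ᶻ = ℤ.- + 1
            x₂≈ : x₂ ≈ (-1ᶻ ^ b ℤ.* -1ᶻ ^ c) ℤ.* (Y ℤ.* g ^ b)
            x₂≈ = ≈-trans (≈-* (≈-trans (≈-^ b (≈-trans (≈-neg 1+v≈) (≡⇒≈ (solve 2 (λ v g → :- (v :* g) := (:- con (+ 1)) :* (v :* g)) refl v g)))) (≡⇒≈ (trans (^-distrib-* -1ᶻ (v ℤ.* g) b) (cong (-1ᶻ ^ b ℤ.*_) (^-distrib-* v g b)))))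
                (≈-trans (≈-^ c (≡⇒≈ (trans (cong (λ u → cube u ℤ.* H) 1+a′≡) (solve 2 (λ v H → (:- v) :* (:- v) :* (:- v) :* H := (:- con (+ 1)) :* (v :* (v :* (v :* con (+ 1))) :* H)) refl v H)))) (≡⇒≈ (^-distrib-* -1ᶻ k c))))
              (≡⇒≈ (solve 5 (λ s v g t k → s :* (v :* g) :* (t :* k) := s :* t :* (v :* k :* g)) refl (-1ᶻ ^ b) (v ^ b) (g ^ b) (-1ᶻ ^ c) (k ^ c)))
            unit--1 : Unit -1ᶻ
            unit--1 = unit-neg unit-1
            not-both : Power x₁ → Power x₂ → ⊥
            not-both P₁ P₂ = ¬Pg (power-root (b ℕ.+ 3 ℕ.* c ℕ.* p′) p∤ ug (power-cancel (unit-* (unit-^ b uv) (unit-^ c (unit-half-cube v u1v))) P₁ (power-resp (≈-sym ratio) (power-* Yg^b (power-^p* g (3 ℕ.* c))))))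
              where
              Yg^b : Power (Y ℤ.* g ^ b)
              Yg^b = power-cancel (unit-* (unit-^ b unit--1) (unit-^ c unit--1)) (power-* (power-^ b power--1) (power-^ c power--1)) (power-resp x₂≈ P₂)
              ratio : x₁ ℤ.* g ^ (b ℕ.+ 3 ℕ.* c ℕ.* p′) ≈ Y ℤ.* g ^ b ℤ.* g ^ (3 ℕ.* c ℕ.* p)
              ratio = ≈-trans (≈-* x₁≈ (≡⇒≈ (^-homo-* g b (3 ℕ.* c ℕ.* p′)))) (≡⇒≈ (trans (solve 4 (λ Y a b d → Y :* a :* (b :* d) := Y :* b :* (a :* d)) refl Y (g ^ (3 ℕ.* c)) (g ^ b) (g ^ (3 ℕ.* c ℕ.* p′)))
                (cong (Y ℤ.* g ^ b ℤ.*_) (trans (sym (^-homo-* g (3 ℕ.* c) (3 ℕ.* c ℕ.* p′))) (cong (g ^_) (trans (sym (ℕP.*-suc (3 ℕ.* c) p′)) (cong (3 ℕ.* c ℕ.*_) (sym p≡))))))))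

    -- Comparing the two roots of `invert` changes ρ^b η^c by g to the power 2 b + 3 c, and
    -- comparing those of `reflect` by b - 3 c up to sign; p′ = p - 1 stands for - 1 modulo p. If p
    -- divided both numbers it would divide 9 c, hence c and then b, as p ≠ 3. So in at least one
    -- pair one root yields a non-power.
    goodRoot : ∀ b c → ¬ (p ℕD.∣ b × p ℕD.∣ c) → Root b c
    goodRoot b c indep = bySuc p refl
      where
      bySuc : ∀ k → p ≡ k → Root b c
      bySuc zero e = ⊥-elim (Prim.¬prime[0] (subst Prim.Prime e prime-p))
      bySuc (suc p′) e = decide (p ℕD.∣? b ℕ.+ (b ℕ.+ 3 ℕ.* c)) (p ℕD.∣? b ℕ.+ 3 ℕ.* c ℕ.* p′)
        where
        decide : Dec (p ℕD.∣ b ℕ.+ (b ℕ.+ 3 ℕ.* c)) → Dec (p ℕD.∣ b ℕ.+ 3 ℕ.* c ℕ.* p′) → Root b c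
        decide (no ∤) _ = invert b c ∤
        decide (yes _) (no ∤) = reflect b c p′ e ∤
        decide (yes d₁) (yes d₂) = ⊥-elim (indep (p∣b , p∣c))
          where
          open import Data.Nat.Solver using (module +-*-Solver)
          open +-*-Solver using () renaming (solve to solveℕ; _:+_ to _⊞_; _:*_ to _⊠_; con to conℕ; _:=_ to _≐_)
          combination : 2 ℕ.* (b ℕ.+ 3 ℕ.* c ℕ.* p′) ℕ.+ 9 ℕ.* c ≡ (b ℕ.+ (b ℕ.+ 3 ℕ.* c)) ℕ.+ 6 ℕ.* c ℕ.* p
          combination = trans (solveℕ 3 (λ b c p → conℕ 2 ⊠ (b ⊞ conℕ 3 ⊠ c ⊠ p) ⊞ conℕ 9 ⊠ c ≐ (b ⊞ (b ⊞ conℕ 3 ⊠ c)) ⊞ conℕ 6 ⊠ c ⊠ (conℕ 1 ⊞ p)) refl b c p′) (cong (λ k → (b ℕ.+ (b ℕ.+ 3 ℕ.* c)) ℕ.+ 6 ℕ.* c ℕ.* k) (sym e))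
          p∤3 : ¬ p ℕD.∣ 3
          p∤3 d = [ (λ p≡1 → Prim.¬prime[1] (subst Prim.Prime p≡1 prime-p)) , p≢3 ]′ (Prim.prime⇒irreducible {3} (toWitness {a? = Prim.prime? 3} tt) d)
          p∣9c : p ℕD.∣ 3 ℕ.* 3 ℕ.* c
          p∣9c = ℕD.∣m+n∣m⇒∣n (subst (p ℕD.∣_) (sym combination) (ℕD.∣m∣n⇒∣m+n d₁ (ℕD.n∣m*n (6 ℕ.* c)))) (ℕD.∣n⇒∣m*n 2 d₂)
          p∣c : p ℕD.∣ c
          p∣c = [ (λ p∣9 → ⊥-elim ([ p∤3 , p∤3 ]′ (Prim.euclidsLemma 3 3 prime-p p∣9))) , id ]′ (Prim.euclidsLemma (3 ℕ.* 3) c prime-p p∣9c)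
          p∣b : p ℕD.∣ b
          p∣b = ℕD.∣m+n∣m⇒∣n (subst (p ℕD.∣_) (ℕP.+-comm b (3 ℕ.* c ℕ.* p′)) d₂) (ℕD.∣m⇒∣m*n p′ (ℕD.∣n⇒∣m*n 3 p∣c))

-- Local conditions

-- The prime q is kept away from M, so that conditions at q are independent of earlier ones. The
-- number y will serve as residue of Z at q, so that z = Zʳ ≡ - 1.
record Place (r : ℕ) {p : ℕ} (prime-p : Prim.Prime p) (b c M : ℕ) : Set where
  field
    {q} : ℕ
    prime-q : Prim.Prime q
    q∤M : ¬ q ℕD.∣ M
  open Modular prime-q public
  open PowerResidue prime-p public
  open GoodRoots prime-q prime-p public
  field
    unit-2 : Unit (+ 2)
    y : ℤ
    y^r≈-1 : y ^ r ≈ ℤ.- + 1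
    power--1 : Power (ℤ.- + 1)
    root : Root b c

-- (1 + y V_k) (1 + y) = 1 + y^{2k+1} for y = 1 + y′
private
  V : ℕ → ℕ → ℕ
  V y′ zero = 0
  V y′ (suc k) = y′ ℕ.+ suc y′ ℕ.* suc y′ ℕ.* V y′ k

  V-identity : ∀ y′ k → (1 ℕ.+ suc y′ ℕ.* V y′ k) ℕ.* (1 ℕ.+ suc y′) ≡ 1 ℕ.+ suc y′ ℕ.^ suc (2 ℕ.* k)
  V-identity y′ zero = solve 1 (λ y → (con 1 :+ (con 1 :+ y) :* con 0) :* (con 1 :+ (con 1 :+ y)) := con 1 :+ (con 1 :+ y) :* con 1) refl y′
    where
    open import Data.Nat.Solver using (module +-*-Solver)
    open +-*-Solver
  V-identity y′ (suc k) = ℕP.+-cancelʳ-≡ (suc y′ ℕ.* suc y′ ℕ.+ suc y′ ℕ.* suc y′ ℕ.* suc y′) _ _ (begin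
    (1 ℕ.+ y ℕ.* (y′ ℕ.+ y ℕ.* y ℕ.* V y′ k)) ℕ.* (1 ℕ.+ y) ℕ.+ (y ℕ.* y ℕ.+ y ℕ.* y ℕ.* y)
      ≡⟨ solve 2 (λ y′ v → let y = con 1 :+ y′ in (con 1 :+ y :* (y′ :+ y :* y :* v)) :* (con 1 :+ y) :+ (y :* y :+ y :* y :* y)
           := (con 1 :+ y :* v) :* (con 1 :+ y) :* (y :* y) :+ (con 1 :+ y :* y :* y)) refl y′ (V y′ k) ⟩
    (1 ℕ.+ y ℕ.* V y′ k) ℕ.* (1 ℕ.+ y) ℕ.* (y ℕ.* y) ℕ.+ (1 ℕ.+ y ℕ.* y ℕ.* y)
      ≡⟨ cong (λ e → e ℕ.* (y ℕ.* y) ℕ.+ (1 ℕ.+ y ℕ.* y ℕ.* y)) (V-identity y′ k) ⟩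
    (1 ℕ.+ y ℕ.^ suc (2 ℕ.* k)) ℕ.* (y ℕ.* y) ℕ.+ (1 ℕ.+ y ℕ.* y ℕ.* y)
      ≡⟨ solve 2 (λ y p → (con 1 :+ p) :* (y :* y) :+ (con 1 :+ y :* y :* y) := con 1 :+ y :* (y :* p) :+ (y :* y :+ y :* y :* y)) refl y (y ℕ.^ suc (2 ℕ.* k)) ⟩
    1 ℕ.+ y ℕ.* (y ℕ.* y ℕ.^ suc (2 ℕ.* k)) ℕ.+ (y ℕ.* y ℕ.+ y ℕ.* y ℕ.* y)
      ≡⟨ cong (λ e → 1 ℕ.+ y ℕ.^ suc e ℕ.+ (y ℕ.* y ℕ.+ y ℕ.* y ℕ.* y)) (sym (ℕP.*-suc 2 k)) ⟩
    1 ℕ.+ y ℕ.^ suc (2 ℕ.* suc k) ℕ.+ (y ℕ.* y ℕ.+ y ℕ.* y ℕ.* y) ∎)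
    where
    y = suc y′
    open import Data.Nat.Solver using (module +-*-Solver)
    open +-*-Solver
    open ≡-Reasoning

pos-^ : ∀ k j → + (k ℕ.^ j) ≡ (+ k) ℤS.^ j
pos-^ k zero = refl
pos-^ k (suc j) = trans (ℤP.pos-* k (k ℕ.^ j)) (cong (+ k ℤ.*_) (pos-^ k j))

private
  -- A prime factor of E = 1 + y V′, together with the reason why y^p ≡ -1 and why -y (or -1, if p = 2) is a non-trivial p-th root of 1.
  record Factor {p : ℕ} (prime-p : Prim.Prime p) (y : ℕ) : Set where
    field
      V′ : ℕ
      V′≥1 : 1 ℕ.≤ V′
      roots : ∀ {q} (prime-q : Prim.Prime q) → let open Modular prime-q in Zero (+ (1 ℕ.+ y ℕ.* V′)) → Unit (+ 2) → Unit (+ p) →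
        (+ y) ^ p ≈ ℤ.- + 1 × ∃ λ ζ → ζ ^ p ≈ + 1 × ¬ ζ ≈ + 1

  factor : ∀ {p} (prime-p : Prim.Prime p) y → 2 ℕ.≤ y → Factor prime-p y
  factor {p} pp zero ()
  factor {p} pp y@(suc y′) (ℕ.s≤s 1≤y′) = byParity (prime-parity pp)
    where
    open ℤS.Solver using (solve; _:*_; _:+_; _:-_; :-_; con; _:=_)
    byParity : p ≡ 2 ⊎ (∃ λ k → p ≡ suc (2 ℕ.* k)) → Factor pp y
    byParity (inj₁ refl) = record { V′ = y ; V′≥1 = ℕ.s≤s ℕ.z≤n ; roots = roots }
      where
      roots : ∀ {q} (prime-q : Prim.Prime q) → let open Modular prime-q in Zero (+ (1 ℕ.+ y ℕ.* y)) → Unit (+ 2) → Unit (+ 2) →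
        (+ y) ^ 2 ≈ ℤ.- + 1 × ∃ λ ζ → ζ ^ 2 ≈ + 1 × ¬ ζ ≈ + 1
      roots prime-q z u2 _ = ≈-trans (≡⇒≈ (solve 1 (λ y → y :* (y :* con (+ 1)) := con (+ 1) :+ y :* y :+ :- con (+ 1)) refl (+ y)))
            (≈-trans (≈-+ (≈-trans (≡⇒≈ (cong (λ v → + 1 ℤ.+ v) (sym (ℤP.pos-* y y)))) z) (≈-refl {ℤ.- + 1})) (≡⇒≈ (ℤP.+-identityˡ (ℤ.- + 1)))) ,
          ℤ.- + 1 , ≈-refl , λ e → u2 (≈-trans (≡⇒≈ refl) (≈-trans (≈-+ (≈-sym e) (≈-refl {+ 1})) (≡⇒≈ refl)))
        where open Modular prime-q
    byParity (inj₂ (k , refl)) = record { V′ = V y′ k ; V′≥1 = V≥1 k refl ; roots = roots }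
      where
      V≥1 : ∀ j → j ≡ k → 1 ℕ.≤ V y′ j
      V≥1 zero refl = ⊥-elim (Prim.¬prime[1] pp)
      V≥1 (suc j) _ = ℕP.≤-trans 1≤y′ (ℕP.m≤m+n y′ _)
      roots : ∀ {q} (prime-q : Prim.Prime q) → let open Modular prime-q in Zero (+ (1 ℕ.+ y ℕ.* V y′ k)) → Unit (+ 2) → Unit (+ suc (2 ℕ.* k)) →
        (+ y) ^ suc (2 ℕ.* k) ≈ ℤ.- + 1 × ∃ λ ζ → ζ ^ suc (2 ℕ.* k) ≈ + 1 × ¬ ζ ≈ + 1
      roots prime-q z u2 up = y^p≈-1 , ℤ.- + y , ζ^p≈1 , ζ≉1
        where
        open Modular prime-q
        Y : ℤ
        Y = + y
        W : ℕ → ℤ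
        W j = + (1 ℕ.+ y ℕ.* V y′ j)
        y^p≈-1 : Y ^ suc (2 ℕ.* k) ≈ ℤ.- + 1
        y^p≈-1 = ≈-trans (≡⇒≈ (trans (solve 1 (λ a → a := con (+ 1) :+ a :+ :- con (+ 1)) refl (Y ^ suc (2 ℕ.* k))) (cong (λ v → v ℤ.+ ℤ.- + 1) identity)))
            (≈-trans (≈-+ (≈-trans (≈-* z (≈-refl {+ (1 ℕ.+ y)})) (≡⇒≈ (ℤP.*-zeroˡ (+ (1 ℕ.+ y))))) (≈-refl {ℤ.- + 1})) (≡⇒≈ (ℤP.+-identityˡ (ℤ.- + 1))))
          where
          identity : + 1 ℤ.+ Y ^ suc (2 ℕ.* k) ≡ W k ℤ.* + (1 ℕ.+ y)
          identity = trans (cong (λ v → + 1 ℤ.+ v) (sym (pos-^ y (suc (2 ℕ.* k))))) (trans (cong +_ (sym (V-identity y′ k))) (ℤP.pos-* (1 ℕ.+ y ℕ.* V y′ k) (1 ℕ.+ y)))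
        ζ^p≈1 : (ℤ.- Y) ^ suc (2 ℕ.* k) ≈ + 1
        ζ^p≈1 = ≈-trans (≡⇒≈ (trans (cong (ℤ.- Y ℤ.*_) (trans (sym (^-assocʳ (ℤ.- Y) 2 k)) (trans (cong (_^ k) (solve 1 (λ y → (:- y) :* ((:- y) :* con (+ 1)) := y :* (y :* con (+ 1))) refl Y)) (^-assocʳ Y 2 k))))
            (solve 2 (λ y a → (:- y) :* a := :- (y :* a)) refl Y (Y ^ (2 ℕ.* k))))) (≈-neg y^p≈-1)
        ζ≉1 : ¬ ℤ.- Y ≈ + 1
        ζ≉1 e = up (≈-trans (≈-sym (W≈ k)) z)
          where
          Y≈-1 : Y ≈ ℤ.- + 1
          Y≈-1 = ≈-trans (≡⇒≈ (solve 1 (λ y → y := :- (:- y)) refl Y)) (≈-neg e)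
          -- W k is the alternating sum 1 - y + y² - ... of p terms, which becomes p when y ≡ - 1.
          -- As q divides W k but not p, this excludes - y ≡ 1.
          W≈ : ∀ j → W j ≈ + suc (2 ℕ.* j)
          W≈ zero = ≡⇒≈ (cong (λ v → + (1 ℕ.+ v)) (ℕP.*-zeroʳ y))
          W≈ (suc j) = ≈-trans (≡⇒≈ (trans expand (solve 2 (λ t v → let Y = con (+ 1) :+ t in con (+ 1) :+ Y :* (t :+ Y :* Y :* v) := Y :* Y :* (con (+ 1) :+ Y :* v) :- Y :+ con (+ 1)) refl (+ y′) (+ V y′ j))))
              (≈-trans (≈-+ (≈-+ (≈-* (≈-* Y≈-1 Y≈-1) (≈-trans (≡⇒≈ (sym expand′)) (W≈ j))) (≈-neg Y≈-1)) (≈-refl {+ 1}))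
                (≡⇒≈ (trans (solve 1 (λ a → (:- con (+ 1)) :* (:- con (+ 1)) :* a :- (:- con (+ 1)) :+ con (+ 1) := con (+ 2) :+ a) refl (+ suc (2 ℕ.* j))) (cong (λ v → + suc v) (sym (ℕP.*-suc 2 j))))))
            where
            expand′ : W j ≡ + 1 ℤ.+ Y ℤ.* + V y′ j
            expand′ = cong (λ v → + 1 ℤ.+ v) (ℤP.pos-* y (V y′ j))
            expand : W (suc j) ≡ + 1 ℤ.+ Y ℤ.* (+ y′ ℤ.+ Y ℤ.* Y ℤ.* + V y′ j)
            expand = cong (λ v → + 1 ℤ.+ v) (trans (ℤP.pos-* y (V y′ (suc j))) (cong (λ v → Y ℤ.* (+ y′ ℤ.+ v)) (trans (ℤP.pos-* (y ℕ.* y) (V y′ j)) (cong (ℤ._* + V y′ j) (ℤP.pos-* y y)))))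

-- Euclid's argument: y = x^r′ is a multiple of 2 · 259 · p · M, so no prime factor of E ≡ 1 modulo
-- y divides any of these numbers. Modulo such a prime yᵖ ≡ - 1, which says x^(r′ p) ≡ - 1. The
-- factor 259 is there for `resultant`.
place : ∀ {p} (prime-p : Prim.Prime p) → p ≢ 3 → ∀ r′ M → 1 ℕ.≤ r′ → 1 ℕ.≤ M → ∀ b c → ¬ (p ℕD.∣ b × p ℕD.∣ c) → Place (r′ ℕ.* p) prime-p b c M
place {p} prime-p p≢3 r′ M 1≤r′ 1≤M b c indep = fromFactor (factor prime-p y 2≤y)
  where
  x y : ℕ
  x = 2 ℕ.* (259 ℕ.* (p ℕ.* M))
  y = x ℕ.^ r′
  x∣y : x ℕD.∣ y
  x∣y = divides-power r′ 1≤r′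
    where
    divides-power : ∀ k → 1 ℕ.≤ k → x ℕD.∣ x ℕ.^ k
    divides-power (suc k) _ = ℕD.m∣m*n (x ℕ.^ k)
  1≤x : 1 ℕ.≤ x
  1≤x = ℕP.*-mono-≤ {1} {2} (ℕ.s≤s ℕ.z≤n) (ℕP.*-mono-≤ {1} {259} (ℕ.s≤s ℕ.z≤n) (ℕP.*-mono-≤ {1} {p} (ℕP.≤-trans (ℕ.s≤s ℕ.z≤n) (prime≥2 prime-p)) 1≤M))
  2≤y : 2 ℕ.≤ y
  2≤y = ℕP.≤-trans (ℕD.∣⇒≤ {{ℕ.>-nonZero 1≤x}} (ℕD.m∣m*n (259 ℕ.* (p ℕ.* M)))) (ℕD.∣⇒≤ {{ℕ.>-nonZero (ℕP.m^n>0 x {{ℕ.>-nonZero 1≤x}} r′)}} x∣y)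
  fromFactor : Factor prime-p y → Place (r′ ℕ.* p) prime-p b c M
  fromFactor F = fromPrime (prime-divisor E (ℕ.s≤s (ℕP.≤-trans V′≥1 (ℕP.m≤n*m V′ y {{ℕ.>-nonZero (ℕP.≤-trans (ℕ.s≤s ℕ.z≤n) 2≤y)}}))))
    where
    open Factor F
    E : ℕ
    E = 1 ℕ.+ y ℕ.* V′
    fromPrime : (∃ λ q → Prim.Prime q × q ℕD.∣ E) → Place (r′ ℕ.* p) prime-p b c M
    fromPrime (q , prime-q , q∣E) = build (roots prime-q zero-E unit-2 (unit-ℕ p (λ d → q∤x (ℕD.∣n⇒∣m*n 2 (ℕD.∣n⇒∣m*n 259 (ℕD.∣m⇒∣m*n M d))))))
      where
      open Modular prime-q
      q∤x : ¬ q ℕD.∣ x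
      q∤x d = ℕP.<⇒≢ (prime≥2 prime-q) (sym (ℕD.∣1⇒≡1 (ℕD.∣m+n∣m⇒∣n {q} {y ℕ.* V′} (subst (q ℕD.∣_) (ℕP.+-comm 1 (y ℕ.* V′)) q∣E) (ℕD.∣m⇒∣m*n V′ (ℕD.∣-trans d x∣y)))))
      unit-2 : Unit (+ 2)
      unit-2 = unit-ℕ 2 (λ d → q∤x (ℕD.∣m⇒∣m*n (259 ℕ.* (p ℕ.* M)) d))
      zero-E : Zero (+ E)
      zero-E = ∣⇒zero (ℤD.∣ᵤ⇒∣ q∣E)
      build : ((+ y) ^ p ≈ ℤ.- + 1 × ∃ λ ζ → ζ ^ p ≈ + 1 × ¬ ζ ≈ + 1) → Place (r′ ℕ.* p) prime-p b c M
      build (y^p , ζ , ζ^p , ζ≉1) = record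
        { prime-q = prime-q
        ; q∤M = λ d → q∤x (ℕD.∣n⇒∣m*n 2 (ℕD.∣n⇒∣m*n 259 (ℕD.∣n⇒∣m*n p d)))
        ; unit-2 = unit-2
        ; y = + x
        ; y^r≈-1 = ≈-trans (≡⇒≈ (trans (sym (^-assocʳ (+ x) r′ p)) (cong (_^ p) (sym (pos-^ x r′))))) y^p
        ; power--1 = power--1
        ; root = goodRoot unit-2 unit-259 power--1 p≢3 (proj₂ (nonresidue ζ^p ζ≉1)) b c indep
        }
        where
        open PowerResidue prime-p
        open GoodRoots prime-q prime-p
        power--1 : Power (ℤ.- + 1)
        power--1 = + y , y^p
        unit-259 : Unit (+ 259)
        unit-259 = unit-ℕ 259 (λ d → q∤x (ℕD.∣n⇒∣m*n 2 (ℕD.∣m⇒∣m*n (p ℕ.* M) d)))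

-- Reduction of a p-th power relation at a degree one prime

module LocalObstruction (n m : ℕ) (10≤n : 10 ℕ.≤ n) (n≡ : n ≡ 1 ℕ.+ 2 ℕ.* m) where

  open CubicField n hiding (α; f; f′; _^_; ^-homo-*; ^-assocʳ; ^-distrib-*; 1^)
  open OddField n m 10≤n n≡
  open PowerRelations n m 10≤n n≡
  private
    module K = KS.Solver
    module QR = ℚS.Solver

  fℤ : ℤ → ℤ
  fℤ a = a ℤ.* a ℤ.* a ℤ.+ + n ℤ.* a ℤ.* a ℤ.+ + n ℤ.* a ℤ.- + 1

  private
    c : ℚ
    c = nℚ n

    c≡ : c ≡ int (+ n)
    c≡ = sym (int≡ℤtoℚ (+ n))

    int-c : IsInt c
    int-c = + n , c≡

    f-int : ∀ a → CubicField.f n (int a) ≡ int (fℤ a)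
    f-int a = sym (begin
      int (fℤ a)
        ≡⟨ trans (int-+ _ _) (cong₂ ℚ._+_ (trans (int-+ _ _) (cong₂ ℚ._+_ (trans (int-+ _ _) (cong₂ ℚ._+_ (trans (int-* (a ℤ.* a) a) (cong (ℚ._* int a) (int-* a a)))
             (trans (int-* (+ n ℤ.* a) a) (cong (ℚ._* int a) (int-* (+ n) a))))) (int-* (+ n) a))) (trans (int-neg (+ 1)) (cong ℚ.-_ int-1))) ⟩
      int a ℚ.* int a ℚ.* int a ℚ.+ int (+ n) ℚ.* int a ℚ.* int a ℚ.+ int (+ n) ℚ.* int a ℚ.+ ℚ.- 1ℚ
        ≡⟨ cong (λ k → int a ℚ.* int a ℚ.* int a ℚ.+ k ℚ.* int a ℚ.* int a ℚ.+ k ℚ.* int a ℚ.+ ℚ.- 1ℚ) (sym c≡) ⟩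
      CubicField.f n (int a) ∎)
      where open ≡-Reasoning

    f′ℤ : ℤ → ℤ
    f′ℤ a = + 3 ℤ.* a ℤ.* a ℤ.+ + 2 ℤ.* + n ℤ.* a ℤ.+ + n

    f′-int : ∀ a → CubicField.f′ n (int a) ≡ int (f′ℤ a)
    f′-int a = sym (trans (trans (int-+ _ (+ n)) (cong₂ ℚ._+_ (trans (int-+ _ _) (cong₂ ℚ._+_ (trans (int-* (+ 3 ℤ.* a) a) (cong (ℚ._* int a) (trans (int-* (+ 3) a) (cong (ℚ._* int a) (sym (fromℕ≡ 3))))))
        (trans (int-* (+ 2 ℤ.* + n) a) (cong (ℚ._* int a) (trans (int-* (+ 2) (+ n)) (cong₂ ℚ._*_ (sym (fromℕ≡ 2)) (sym c≡))))))) (sym c≡))) refl)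

  module AtRoot {q p : ℕ} (prime-q : Prim.Prime q) (prime-p : Prim.Prime p) where
    open Modular prime-q
    open PowerResidue prime-p
    open GoodRoots prime-q prime-p

    module _ {a : ℤ} (root : Zero (fℤ a)) (unit-a : Unit a) (unit-1+a : Unit (+ 1 ℤ.+ a)) (simple : Unit (ramification a)) where

      private
        t : ℚ
        t = int a

        ev-isInt : ∀ {x} → Lat x → IsInt (ev t x)
        ev-isInt {x₀ , x₁ , x₂} (i₀ , i₁ , i₂) = subst IsInt (sym (ev-coords t x₀ x₁ x₂)) (isInt-+ (isInt-+ i₀ (isInt-* i₁ (isInt-int a))) (isInt-* i₂ (isInt-* (isInt-int a) (isInt-int a))))

        opaque
          red : ∀ {x} → Lat x → ℤ
          red l = proj₁ (ev-isInt l)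

          ev≡red : ∀ {x} (l : Lat x) → ev t x ≡ int (red l)
          ev≡red l = proj₂ (ev-isInt l)

        red-≡ : ∀ {x y} (l : Lat x) (l′ : Lat y) → x ≡ y → red l ≡ red l′
        red-≡ l l′ e = int-injective (trans (sym (ev≡red l)) (trans (cong (ev t) e) (ev≡red l′)))

        red-int : ∀ {x k} (l : Lat x) → ev t x ≡ int k → red l ≡ k
        red-int l e = int-injective (trans (sym (ev≡red l)) e)

        quot-isInt : ∀ {x y} → Lat x → Lat y → IsInt (quot t x y)
        quot-isInt {x₀ , x₁ , x₂} {y₀ , y₁ , y₂} (i₀ , i₁ , i₂) (j₀ , j₁ , j₂) = subst IsInt (sym (quot-coords t x₀ x₁ x₂ y₀ y₁ y₂))
          (isInt-+ (isInt-* (isInt-* i₂ j₂) (isInt-+ (isInt-int a) (isInt-neg int-c))) (isInt-+ (isInt-* i₁ j₂) (isInt-* i₂ j₁)))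

        red-mul : ∀ {x y} (lx : Lat x) (ly : Lat y) (l : Lat (x · y)) → red l ≈ red lx ℤ.* red ly
        red-mul {x} {y} lx ly l = from (quot-isInt lx ly)
          where
          from : IsInt (quot t x y) → red l ≈ red lx ℤ.* red ly
          from (k , e) = ≈-sym (≈-trans (≡⇒≈ (int-injective (trans (int-* (red lx) (red ly)) (trans (cong₂ ℚ._*_ (sym (ev≡red lx)) (sym (ev≡red ly))) (trans (ev-mul t x y)
              (trans (cong₂ (λ u v → u ℚ.+ v) (ev≡red l) (cong₂ ℚ._*_ (f-int a) e)) (trans (cong (λ v → int (red l) ℚ.+ v) (sym (int-* (fℤ a) k))) (sym (int-+ (red l) (fℤ a ℤ.* k))))))))))
            (≈-trans (≈-+ (≈-refl {red l}) (≈-* root (≈-refl {k}))) (≡⇒≈ (solve 2 (λ x k → x :+ con (+ 0) :* k := x) refl (red l) k))))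
            where open ℤS.Solver

        red-1 : red lat-1 ≡ + 1
        red-1 = red-int lat-1 (trans (ev-ι t 1ℚ) (sym int-1))

        red-^ : ∀ {x} k (lx : Lat x) (l : Lat (x KS.^ k)) → red l ≈ red lx ^ k
        red-^ zero lx l = ≡⇒≈ (trans (red-≡ l lat-1 refl) red-1)
        red-^ {x} (suc k) lx l = ≈-trans (red-mul lx (lat-^ k lx) l) (≈-* (≈-refl {red lx}) (red-^ k lx (lat-^ k lx)))

        red-ι : ∀ k (l : Lat (ι (int k))) → red l ≡ k
        red-ι k l = red-int l (ev-ι t (int k))

        Θ : K
        Θ = cofactor t

        lat-Θ : Lat Θ
        lat-Θ = isInt-+ (isInt-+ (isInt-* (isInt-int a) (isInt-int a)) (isInt-* int-c (isInt-int a))) int-c , isInt-+ int-c (isInt-int a) , isInt-1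

        -- The cofactor evaluates to f′ a at the root, and a (1 + a) f′ a ≡ `ramification a` there.
        unit-Θ : Unit (red lat-Θ)
        unit-Θ z = simple (≈-trans (≈-sym derivative) (≈-trans (≈-* (≈-refl {a ℤ.* (+ 1 ℤ.+ a)}) (≈-trans (≡⇒≈ (sym (red-int lat-Θ (trans (ev-cofactor t) (f′-int a))))) z)) (≡⇒≈ (ℤP.*-zeroʳ (a ℤ.* (+ 1 ℤ.+ a))))))
          where
          derivative : a ℤ.* (+ 1 ℤ.+ a) ℤ.* f′ℤ a ≈ ramification a
          derivative = ≈-trans (≡⇒≈ (solve 2 (λ n a → a :* (con (+ 1) :+ a) :* (con (+ 3) :* a :* a :+ con (+ 2) :* n :* a :+ n)
              := (con (+ 2) :* a :+ con (+ 1)) :* (a :* a :* a :+ n :* a :* a :+ n :* a :- con (+ 1)) :+ (a :* a :* a :* a :+ con (+ 2) :* (a :* a :* a) :+ con (+ 2) :* a :+ con (+ 1))) refl (+ n) a))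
            (≈-trans (≈-+ (≈-* (≈-refl {+ 2 ℤ.* a ℤ.+ + 1}) root) (≈-refl {ramification a})) (≡⇒≈ (solve 2 (λ u v → u :* con (+ 0) :+ v := v) refl (+ 2 ℤ.* a ℤ.+ + 1) (ramification a))))
            where open ℤS.Solver

        Q : ℚ
        Q = int (+ q)

        Q≢0 : Q ≢ 0ℚ
        Q≢0 = int≢0 (λ e → ℕP.<⇒≢ (ℕP.≤-trans (ℕ.s≤s ℕ.z≤n) (prime≥2 prime-q)) (sym (ℤP.+-injective e)))

        -- If x vanishes at the root a modulo q then Θ x is divisible by q.
        Θ-divides : ∀ {x} (l : Lat x) → Zero (red l) → ∃ λ x′ → Lat x′ × Θ · x ≡ ι Q · x′
        Θ-divides {x@(x₀ , x₁ , x₂)} l@(i₀ , i₁ , i₂) z = from (zero⇒∣ z) (zero⇒∣ root)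
          where
          w : K
          w = x₁ ℚ.+ x₂ ℚ.* t , x₂ , 0ℚ
          lat-w : Lat w
          lat-w = isInt-+ i₁ (isInt-* i₂ (isInt-int a)) , i₂ , isInt-0
          scaled : ∀ {k j v} → j ≡ k ℤ.* + q → v ≡ int j → ι v ≡ ι Q · ι (int k)
          scaled {k} {j} {v} e e′ = trans (cong ι (trans e′ (trans (cong int e) (trans (int-* k (+ q)) (ℚP.*-comm (int k) Q))))) (ι-mul Q (int k))
          from : + q ℤD.∣ red l → + q ℤD.∣ fℤ a → ∃ λ x′ → Lat x′ × Θ · x ≡ ι Q · x′
          from (ℤD.divides k e) (ℤD.divides j e′) = ι (int k) · Θ ⊕ neg (ι (int j) · w) ,
            lat-add {ι (int k) · Θ} {neg (ι (int j) · w)} (lat-mul {ι (int k)} {Θ} (lat-ι (isInt-int k)) lat-Θ) (lat-neg {ι (int j) · w} (lat-mul {ι (int j)} {w} (lat-ι (isInt-int j)) lat-w)) ,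
            trans (cofactor-mul t x₀ x₁ x₂) (trans (cong₂ (λ u v → u · Θ ⊕ neg (v · w)) (scaled e (ev≡red l)) (scaled e′ (f-int a)))
              (K.solve 5 (λ Q k T j w → Q K.:* k K.:* T K.:+ K.:- (Q K.:* j K.:* w) K.:= Q K.:* (k K.:* T K.:+ K.:- (j K.:* w))) refl (ι Q) (ι (int k)) Θ (ι (int j)) w))

        sign-lat : ∀ {s} → IsSign s → Lat s
        sign-lat (inj₁ refl) = lat-1
        sign-lat (inj₂ refl) = lat-neg {1K} lat-1

        red-sign : ∀ {s} (sgn : IsSign s) → red (sign-lat sgn) ≈ + 1 ⊎ red (sign-lat sgn) ≈ ℤ.- + 1
        red-sign (inj₁ refl) = inj₁ (≡⇒≈ red-1)
        red-sign (inj₂ refl) = inj₂ (≡⇒≈ (red-int (lat-neg {1K} lat-1) (trans (cong (ev t) (sym (ι-neg 1ℚ))) (trans (ev-ι t (ℚ.- 1ℚ)) (trans (cong ℚ.-_ (sym int-1)) (sym (int-neg (+ 1))))))))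

        unit-sign : ∀ {s} (sgn : IsSign s) → Unit (red (sign-lat sgn))
        unit-sign sgn = [ (λ e → unit-resp (≈-sym e) unit-1) , (λ e → unit-resp (≈-sym e) (unit-neg unit-1)) ]′ (red-sign sgn)

      -- Denominators divisible by q are removed one factor at a time, at the cost of a power of Θ.
      reduce-denominator : ∀ fuel M → ℤ.∣ M ∣ ℕ.≤ fuel → M ≢ + 0 → ∀ k {s X G} (sgn : IsSign s) → Lat X → (lG : Lat G) →
        s · X KS.^ p ≡ ι (int M) KS.^ p · ((Θ KS.^ k) KS.^ p · G) → ∃₂ λ h u → Unit u × red (sign-lat sgn) ℤ.* h ^ p ≈ u ^ p ℤ.* red lG
      reduce-denominator zero (+ zero) _ M≢0 = ⊥-elim (M≢0 refl)
      reduce-denominator zero (+ suc _) ()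
      reduce-denominator zero -[1+ _ ] ()
      reduce-denominator (suc fuel) M M≤ M≢0 k {s} {X} {G} sgn lX lG e = decide (zero? M)
        where
        lΘᵏ : Lat (Θ KS.^ k)
        lΘᵏ = lat-^ k lat-Θ
        lM : Lat (ι (int M))
        lM = lat-ι (isInt-int M)
        reduced : red (sign-lat sgn) ℤ.* red lX ^ p ≈ M ^ p ℤ.* ((red lat-Θ ^ k) ^ p ℤ.* red lG)
        reduced = ≈-trans (≈-sym (≈-trans (red-mul (sign-lat sgn) (lat-^ p lX) lhs) (≈-* (≈-refl {red (sign-lat sgn)}) (red-^ p lX (lat-^ p lX)))))
          (≈-trans (≡⇒≈ (red-≡ lhs rhs e)) (≈-trans (red-mul (lat-^ p lM) r₂ rhs) (≈-* (≈-trans (red-^ p lM (lat-^ p lM)) (≈-^ p (≡⇒≈ (red-ι M lM))))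
            (≈-trans (red-mul (lat-^ p lΘᵏ) lG r₂) (≈-* (≈-trans (red-^ p lΘᵏ (lat-^ p lΘᵏ)) (≈-^ p (red-^ k lat-Θ lΘᵏ))) (≈-refl {red lG}))))))
          where
          lhs : Lat (s · X KS.^ p)
          lhs = lat-mul {s} {X KS.^ p} (sign-lat sgn) (lat-^ p lX)
          r₂ : Lat ((Θ KS.^ k) KS.^ p · G)
          r₂ = lat-mul {(Θ KS.^ k) KS.^ p} {G} (lat-^ p lΘᵏ) lG
          rhs : Lat (ι (int M) KS.^ p · ((Θ KS.^ k) KS.^ p · G))
          rhs = lat-mul {ι (int M) KS.^ p} {(Θ KS.^ k) KS.^ p · G} (lat-^ p lM) r₂
        decide : Dec (Zero M) → ∃₂ λ h u → Unit u × red (sign-lat sgn) ℤ.* h ^ p ≈ u ^ p ℤ.* red lG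
        decide (no uM) = red lX , M ℤ.* red lat-Θ ^ k , unit-* uM (unit-^ k unit-Θ) ,
          ≈-trans reduced (≡⇒≈ (trans (sym (ℤP.*-assoc (M ^ p) ((red lat-Θ ^ k) ^ p) (red lG))) (cong (ℤ._* red lG) (sym (^-distrib-* M (red lat-Θ ^ k) p)))))
        decide (yes zM) = descend (zero⇒∣ zM) (Θ-divides lX zero-X)
          where
          0^p : (+ 0) ^ p ≡ + 0
          0^p = byPrime p (prime≥2 prime-p)
            where
            byPrime : ∀ j → 2 ℕ.≤ j → (+ 0) ^ j ≡ + 0
            byPrime (suc j) _ = ℤP.*-zeroˡ ((+ 0) ^ j)
          zero-X : Zero (red lX)
          zero-X = root-zero p (zero-right (≈-trans reduced (≈-trans (≈-* (≈-trans (≈-^ p zM) (≡⇒≈ 0^p)) (≈-refl {(red lat-Θ ^ k) ^ p ℤ.* red lG})) (≡⇒≈ (ℤP.*-zeroˡ ((red lat-Θ ^ k) ^ p ℤ.* red lG))))))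
            where
            zero-right : Zero (red (sign-lat sgn) ℤ.* red lX ^ p) → Zero (red lX ^ p)
            zero-right z = [ (λ z′ → ⊥-elim (unit-sign sgn z′)) , id ]′ (zero-* z)
            root-zero : ∀ j → Zero (red lX ^ j) → Zero (red lX)
            root-zero zero z = ⊥-elim (unit-1 z)
            root-zero (suc j) z = [ id , root-zero j ]′ (zero-* z)
          descend : + q ℤD.∣ M → (∃ λ x′ → Lat x′ × Θ · X ≡ ι Q · x′) → ∃₂ λ h u → Unit u × red (sign-lat sgn) ℤ.* h ^ p ≈ u ^ p ℤ.* red lG
          descend (ℤD.divides M′ M≡) (X′ , lX′ , ΘX≡) = reduce-denominator fuel M′ M′≤ M′≢0 (suc k) sgn lX′ lG (cancel-Q (begin
              ι Q KS.^ p · (s · X′ KS.^ p)                                          ≡⟨ K.solve 3 (λ a s b → a K.:* (s K.:* b) K.:= s K.:* (a K.:* b)) refl (ι Q KS.^ p) s (X′ KS.^ p) ⟩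
              s · (ι Q KS.^ p · X′ KS.^ p)                                          ≡⟨ cong (s ·_) (sym (KS.^-distrib-* (ι Q) X′ p)) ⟩
              s · (ι Q · X′) KS.^ p                                                 ≡⟨ cong (λ v → s · v KS.^ p) (sym ΘX≡) ⟩
              s · (Θ · X) KS.^ p                                                    ≡⟨ cong (s ·_) (KS.^-distrib-* Θ X p) ⟩
              s · (Θ KS.^ p · X KS.^ p)                                             ≡⟨ K.solve 3 (λ a s b → s K.:* (a K.:* b) K.:= a K.:* (s K.:* b)) refl (Θ KS.^ p) s (X KS.^ p) ⟩
              Θ KS.^ p · (s · X KS.^ p)                                             ≡⟨ cong (Θ KS.^ p ·_) e ⟩
              Θ KS.^ p · (ι (int M) KS.^ p · ((Θ KS.^ k) KS.^ p · G))               ≡⟨ cong (λ v → Θ KS.^ p · (v · ((Θ KS.^ k) KS.^ p · G))) (trans (cong (KS._^ p) (trans (cong ι (trans (cong int (trans M≡ (ℤP.*-comm M′ (+ q)))) (int-* (+ q) M′))) (ι-mul Q (int M′)))) (KS.^-distrib-* (ι Q) (ι (int M′)) p)) ⟩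
              Θ KS.^ p · ((ι Q KS.^ p · ι (int M′) KS.^ p) · ((Θ KS.^ k) KS.^ p · G)) ≡⟨ K.solve 5 (λ a b c d g → a K.:* (b K.:* c K.:* (d K.:* g)) K.:= b K.:* (c K.:* (a K.:* d K.:* g))) refl (Θ KS.^ p) (ι Q KS.^ p) (ι (int M′) KS.^ p) ((Θ KS.^ k) KS.^ p) G ⟩
              ι Q KS.^ p · (ι (int M′) KS.^ p · ((Θ KS.^ p · (Θ KS.^ k) KS.^ p) · G)) ≡⟨ cong (λ v → ι Q KS.^ p · (ι (int M′) KS.^ p · (v · G))) (sym (KS.^-distrib-* Θ (Θ KS.^ k) p)) ⟩
              ι Q KS.^ p · (ι (int M′) KS.^ p · ((Θ KS.^ suc k) KS.^ p · G)) ∎))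
            where
            open ≡-Reasoning
            M′≢0 : M′ ≢ + 0
            M′≢0 e = M≢0 (trans M≡ (trans (cong (ℤ._* + q) e) (ℤP.*-zeroˡ (+ q))))
            M′≤ : ℤ.∣ M′ ∣ ℕ.≤ fuel
            M′≤ = ℕP.≤-pred (ℕP.≤-trans (subst (ℤ.∣ M′ ∣ ℕ.<_) (trans (sym (ℤP.abs-* M′ (+ q))) (cong ℤ.∣_∣ (sym M≡))) (ℕP.m<m*n ℤ.∣ M′ ∣ q {{ℕ.≢-nonZero (λ e → M′≢0 (ℤP.∣i∣≡0⇒i≡0 e))}} (prime≥2 prime-q))) M≤)
            cancel-Q : ∀ {x y} → ι Q KS.^ p · x ≡ ι Q KS.^ p · y → x ≡ y
            cancel-Q = cancel-power p
              where
              cancel-power : ∀ j {x y} → ι Q KS.^ j · x ≡ ι Q KS.^ j · y → x ≡ y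
              cancel-power zero {x} {y} e = trans (K.solve 1 (λ x → x K.:= K.con (+ 1) K.:* x) refl x) (trans e (K.solve 1 (λ x → K.con (+ 1) K.:* x K.:= x) refl y))
              cancel-power (suc j) {x} {y} e = cancel-power j (ι-cancel Q≢0 (trans (K.solve 3 (λ a b x → a K.:* (b K.:* x) K.:= a K.:* b K.:* x) refl (ι Q) (ι Q KS.^ j) x) (trans e (K.solve 3 (λ a b x → a K.:* b K.:* x K.:= a K.:* (b K.:* x)) refl (ι Q) (ι Q KS.^ j) y))))

      -- The element v need not be integral, let alone integral at q. After `reduce-denominator` the
      -- relation reduces to ± hᵖ ≡ uᵖ A^d a^i e^j with u a unit, and the sign is itself a p-th
      -- power.
      dependent⇒power : ∀ {x A} → Lat x → ev t x ≡ int A → Power (ℤ.- + 1) → ∀ {d i j s v} → IsSign s → x KS.^ d · (ρ KS.^ i · η KS.^ j) ≡ s · v KS.^ p →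
        ∀ {e} → + 2 ℤ.* e ≈ cube (+ 1 ℤ.+ a) → Unit (+ 2) → Power (A ^ d ℤ.* (a ^ i ℤ.* e ^ j))
      dependent⇒power {x} {A} lx evx power--1 {d} {i} {j} {s} {v} sgn eq {e} 2e≈ unit-2 = from (lat-denominator v)
        where
        lG : Lat (x KS.^ d · (ρ KS.^ i · η KS.^ j))
        lG = lat-mul {x KS.^ d} {ρ KS.^ i · η KS.^ j} (lat-^ d lx) (lat-mul {ρ KS.^ i} {η KS.^ j} (lat-^ i lat-ρ) (lat-^ j lat-η))
        red-η : red lat-η ≈ e
        red-η = cancel unit-2 (≈-trans (≈-trans (≈-* (≡⇒≈ (sym (red-int l2 (trans (ev-ι t (ℚS.fromℤ (+ 2))) (fromℕ≡ 2))))) (≈-refl {red lat-η})) (≈-sym (red-mul l2 lat-η l2η)))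
            (≈-trans (≡⇒≈ (red-≡ l2η lκ³ η≡κ³)) (≈-trans (red-mul (lat-mul {κ} {κ} lκ lκ) lκ lκ³) (≈-trans (≈-* (red-mul lκ lκ (lat-mul {κ} {κ} lκ lκ)) (≈-refl {red lκ})) (≈-trans (≡⇒≈ (cong cube redκ)) (≈-sym 2e≈))))))
          where
          l2 : Lat (ι (ℚS.fromℤ (+ 2)))
          l2 = lat-ι (+ 2 , fromℕ≡ 2)
          l2η : Lat (ι (ℚS.fromℤ (+ 2)) · η)
          l2η = lat-mul {ι (ℚS.fromℤ (+ 2))} {η} l2 lat-η
          lκ : Lat κ
          lκ = isInt-1 , isInt-1 , isInt-0
          lκ³ : Lat (κ · κ · κ)
          lκ³ = lat-mul {κ · κ} {κ} (lat-mul {κ} {κ} lκ lκ) lκ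
          redκ : red lκ ≡ + 1 ℤ.+ a
          redκ = red-int lκ (trans (cong (ev t) κ≡1+ρ) (trans (ev-add t 1K ρ) (trans (cong₂ ℚ._+_ (trans (ev-ι t 1ℚ) (sym int-1)) (ev-ρ t)) (sym (int-+ (+ 1) a)))))
        red-G : red lG ≈ A ^ d ℤ.* (a ^ i ℤ.* e ^ j)
        red-G = ≈-trans (red-mul (lat-^ d lx) lρη lG) (≈-* (≈-trans (red-^ d lx (lat-^ d lx)) (≈-^ d (≡⇒≈ (red-int lx evx))))
            (≈-trans (red-mul (lat-^ i lat-ρ) (lat-^ j lat-η) lρη) (≈-* (≈-trans (red-^ i lat-ρ (lat-^ i lat-ρ)) (≈-^ i (≡⇒≈ (red-int lat-ρ (ev-ρ t))))) (≈-trans (red-^ j lat-η (lat-^ j lat-η)) (≈-^ j red-η)))))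
          where
          lρη : Lat (ρ KS.^ i · η KS.^ j)
          lρη = lat-mul {ρ KS.^ i} {η KS.^ j} (lat-^ i lat-ρ) (lat-^ j lat-η)
        from : (∃ λ m → m ≢ 0ℚ × IsInt m × Lat (ι m · v)) → Power (A ^ d ℤ.* (a ^ i ℤ.* e ^ j))
        from (m , m≢0 , (M , refl) , lX) = power-resp red-G (conclude (reduce-denominator ℤ.∣ M ∣ M ℕP.≤-refl (λ e → m≢0 (trans (cong int e) int-0)) 0 sgn lX lG scaled))
          where
          scaled : s · (ι (int M) · v) KS.^ p ≡ ι (int M) KS.^ p · ((Θ KS.^ 0) KS.^ p · (x KS.^ d · (ρ KS.^ i · η KS.^ j)))
          scaled = trans (cong (s ·_) (KS.^-distrib-* (ι (int M)) v p)) (trans (K.solve 3 (λ s a b → s K.:* (a K.:* b) K.:= a K.:* (K.con (+ 1) K.:* (s K.:* b))) refl s (ι (int M) KS.^ p) (v KS.^ p))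
            (cong₂ (λ u w → ι (int M) KS.^ p · (u · w)) (sym (KS.1^ p)) (sym eq)))
          conclude : (∃₂ λ h u → Unit u × red (sign-lat sgn) ℤ.* h ^ p ≈ u ^ p ℤ.* red lG) → Power (red lG)
          conclude (h , u , uu , e) = power-cancel (unit-^ p uu) (power-p u) (power-resp e (power-* power-sign (power-p h)))
            where
            power-sign : Power (red (sign-lat sgn))
            power-sign = [ (λ e → power-resp (≈-sym e) power-1) , (λ e → power-resp (≈-sym e) power--1) ]′ (red-sign sgn)

  -- α = z + (z + 1) ρ reduces to ρ modulo divisors of z and to -1 modulo divisors of z + 1.
  generator : ℕ → K
  generator z = int (+ z) , int (+ suc z) , 0ℚ

  module _ (z : ℕ) {p r : ℕ} (prime-p : Prim.Prime p) where

    Splits : ∀ {b c M} → Place r prime-p b c M → Set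
    Splits P = Zero (fℤ (Root.a root)) where open Place P

    private
      lat-generator : Lat (generator z)
      lat-generator = isInt-int _ , isInt-int _ , isInt-0

      ev-generator : ∀ a → ev (int a) (generator z) ≡ int (+ z ℤ.+ + suc z ℤ.* a)
      ev-generator a = trans (ev-coords (int a) (int (+ z)) (int (+ suc z)) 0ℚ) (trans (QR.solve 3 (λ z w a → z QR.:+ w QR.:* a QR.:+ QR.con (+ 0) QR.:* (a QR.:* a) QR.:= z QR.:+ w QR.:* a) refl (int (+ z)) (int (+ suc z)) (int a))
        (trans (cong (λ v → int (+ z) ℚ.+ v) (sym (int-* (+ suc z) a))) (sym (int-+ (+ z) (+ suc z ℤ.* a)))))

      power-at : ∀ {b c M} (P : Place r prime-p b c M) → Splits P → let open Place P in let open Root root in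
        ∀ {d i j s v} → IsSign s → generator z KS.^ d · (ρ KS.^ i · η KS.^ j) ≡ s · v KS.^ p → Power ((+ z ℤ.+ + suc z ℤ.* a) ^ d ℤ.* (a ^ i ℤ.* e ^ j))
      power-at P split {d} {i} {j} {s} {v} sgn eq = AtRoot.dependent⇒power prime-q prime-p split unit-a unit-1+a simple lat-generator (ev-generator a) power--1 {d} {i} {j} {s} {v} sgn eq e-eq unit-2
        where
        open Place P
        open Root root

      -- At a prime dividing z + 1 the element α is - 1, a p-th power, so α^d drops out and the
      -- exponents i, j matter only modulo p. This leaves finitely many places to prescribe. Writing
      -- p as `suc (ℕ.pred p)` exhibits the divisor as nonzero.
      typeII : ∀ {M} i j → (P : Place r prime-p (i ℕ.% suc (ℕ.pred p)) (j ℕ.% suc (ℕ.pred p)) M) → Splits P → Place.q P ℕD.∣ suc z →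
        ∀ {d s v} → IsSign s → generator z KS.^ d · (ρ KS.^ i · η KS.^ j) ≡ s · v KS.^ p → ⊥
      typeII i j P split q∣1+z {d} {s} {v} sgn eq = nonpower (power-cancel (unit-* (unit-^ (i′ ℕ.* p) unit-a) (unit-^ (j′ ℕ.* p) unit-e)) (power-* (power-^p* a i′) (power-^p* e j′))
          (power-resp regroup (power-cancel (unit-^ d (unit-resp (≈-sym A≈-1) (unit-neg unit-1))) (power-^ d (power-resp (≈-sym A≈-1) power--1)) (power-at P split {d} {i} {j} {s} {v} sgn eq))))
        where
        open Place P
        open Root root
        p⁺ i′ j′ : ℕ
        p⁺ = suc (ℕ.pred p)
        i′ = i ℕ./ p⁺
        j′ = j ℕ./ p⁺
        p⁺≡p : p⁺ ≡ p
        p⁺≡p = ℕP.suc-pred p {{Prim.prime⇒nonZero prime-p}}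
        A≈-1 : + z ℤ.+ + suc z ℤ.* a ≈ ℤ.- + 1
        A≈-1 = ≈-trans (≡⇒≈ (solve 2 (λ z a → z :+ (con (+ 1) :+ z) :* a := (con (+ 1) :+ z) :* (con (+ 1) :+ a) :+ :- con (+ 1)) refl (+ z) a))
          (≈-trans (≈-+ (≈-* (∣⇒zero {+ suc z} (ℤD.∣ᵤ⇒∣ q∣1+z)) (≈-refl {+ 1 ℤ.+ a})) (≈-refl {ℤ.- + 1})) (≡⇒≈ (solve 1 (λ a → con (+ 0) :* a :+ :- con (+ 1) := :- con (+ 1)) refl (+ 1 ℤ.+ a))))
          where open ℤS.Solver
        unit-e : Unit e
        unit-e ze = unit-* (unit-* unit-1+a unit-1+a) unit-1+a (≈-trans (≈-sym e-eq) (≈-* (≈-refl {+ 2}) ze))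
        split-exponent : ∀ x k → x ^ k ≡ x ^ ((k ℕ./ p⁺) ℕ.* p) ℤ.* x ^ (k ℕ.% p⁺)
        split-exponent x k = trans (cong (x ^_) (trans (ℕDM.m≡m%n+[m/n]*n k p⁺) (trans (ℕP.+-comm (k ℕ.% p⁺) _) (cong (λ u → (k ℕ./ p⁺) ℕ.* u ℕ.+ k ℕ.% p⁺) p⁺≡p)))) (^-homo-* x ((k ℕ./ p⁺) ℕ.* p) (k ℕ.% p⁺))
        regroup : a ^ i ℤ.* e ^ j ≈ (a ^ (i′ ℕ.* p) ℤ.* e ^ (j′ ℕ.* p)) ℤ.* (a ^ (i ℕ.% p⁺) ℤ.* e ^ (j ℕ.% p⁺))
        regroup = ≡⇒≈ (trans (cong₂ ℤ._*_ (split-exponent a i) (split-exponent e j)) (solve 4 (λ x y u v → x :* y :* (u :* v) := x :* u :* (y :* v)) refl (a ^ (i′ ℕ.* p)) (a ^ (i ℕ.% p⁺)) (e ^ (j′ ℕ.* p)) (e ^ (j ℕ.% p⁺))))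
          where open ℤS.Solver

      -- At a prime dividing z the element α reduces to the root a. When p divides i and j the
      -- relation makes a^d a p-th power, hence a itself because p ∤ d, against the choice of the
      -- place for (b , c) = (1 , 0).
      typeI : ∀ {M} → (P : Place r prime-p 1 0 M) → Splits P → Place.q P ℕD.∣ z →
        ∀ {d i j s v} → ¬ p ℕD.∣ d → p ℕD.∣ i → p ℕD.∣ j → IsSign s → generator z KS.^ d · (ρ KS.^ i · η KS.^ j) ≡ s · v KS.^ p → ⊥
      typeI P split q∣z {d} {i} {j} {s} {v} p∤d (ℕD.divides i′ refl) (ℕD.divides j′ refl) sgn eq = nonpower (power-resp (≡⇒≈ (solve 1 (λ a → a := a :* con (+ 1) :* con (+ 1)) refl a))
          (power-root d p∤d unit-a (power-cancel (unit-* (unit-^ (i′ ℕ.* p) unit-a) (unit-^ (j′ ℕ.* p) unit-e)) (power-* (power-^p* a i′) (power-^p* e j′))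
            (power-resp (≈-trans (≈-* (≈-^ d A≈a) (≈-refl {a ^ (i′ ℕ.* p) ℤ.* e ^ (j′ ℕ.* p)})) (≡⇒≈ (ℤP.*-comm (a ^ d) (a ^ (i′ ℕ.* p) ℤ.* e ^ (j′ ℕ.* p))))) (power-at P split {d} {i′ ℕ.* p} {j′ ℕ.* p} {s} {v} sgn eq)))))
        where
        open Place P
        open Root root
        open ℤS.Solver
        A≈a : + z ℤ.+ + suc z ℤ.* a ≈ a
        A≈a = ≈-trans (≡⇒≈ (solve 2 (λ z a → z :+ (con (+ 1) :+ z) :* a := z :* (con (+ 1) :+ a) :+ a) refl (+ z) a))
          (≈-trans (≈-+ (≈-* (∣⇒zero {+ z} (ℤD.∣ᵤ⇒∣ q∣z)) (≈-refl {+ 1 ℤ.+ a})) (≈-refl {a})) (≡⇒≈ (solve 2 (λ b a → con (+ 0) :* b :+ a := a) refl (+ 1 ℤ.+ a) a)))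
        unit-e : Unit e
        unit-e ze = unit-* (unit-* unit-1+a unit-1+a) unit-1+a (≈-trans (≈-sym e-eq) (≈-* (≈-refl {+ 2}) ze))

    independent : ∀ {M} (P₁ : Place r prime-p 1 0 M) → Splits P₁ → Place.q P₁ ℕD.∣ z →
      (∀ b c → b ℕ.< p → c ℕ.< p → ¬ (p ℕD.∣ b × p ℕD.∣ c) → ∃ λ M → Σ (Place r prime-p b c M) λ P → Splits P × Place.q P ℕD.∣ suc z) →
      ¬ Dependent p (generator z)
    independent P₁ split₁ q∣z places (d , i , j , s , v , sgn , indep , eq) = decide (p ℕD.∣? i) (p ℕD.∣? j)
      where
      p⁺ : ℕ
      p⁺ = suc (ℕ.pred p)
      p⁺≡p : p⁺ ≡ p
      p⁺≡p = ℕP.suc-pred p {{Prim.prime⇒nonZero prime-p}}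
      rem<p : ∀ k → k ℕ.% p⁺ ℕ.< p
      rem<p k = subst (k ℕ.% p⁺ ℕ.<_) p⁺≡p (ℕDM.m%n<n k p⁺)
      from-rem : ∀ k → p ℕD.∣ k ℕ.% p⁺ → p ℕD.∣ k
      from-rem k dv = subst (p ℕD.∣_) (sym (ℕDM.m≡m%n+[m/n]*n k p⁺)) (ℕD.∣m∣n⇒∣m+n dv (subst (ℕD._∣ (k ℕ./ p⁺) ℕ.* p⁺) p⁺≡p (ℕD.n∣m*n (k ℕ./ p⁺))))
      second : ¬ (p ℕD.∣ i × p ℕD.∣ j) → ⊥
      second ∤ = use (places (i ℕ.% p⁺) (j ℕ.% p⁺) (rem<p i) (rem<p j) (λ { (di , dj) → ∤ (from-rem i di , from-rem j dj) }))
        where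
        use : (∃ λ M → Σ (Place r prime-p (i ℕ.% p⁺) (j ℕ.% p⁺) M) λ P → Splits P × Place.q P ℕD.∣ suc z) → ⊥
        use (M , P , split , q∣) = typeII i j P split q∣ {d} {s} {v} sgn eq
      decide : Dec (p ℕD.∣ i) → Dec (p ℕD.∣ j) → ⊥
      decide (yes di) (yes dj) = typeI P₁ split₁ q∣z {d} {i} {j} {s} {v} (λ dd → indep (dd , di , dj)) di dj sgn eq
      decide (no ∤i) _ = second (λ t → ∤i (proj₁ t))
      decide _ (no ∤j) = second (λ t → ∤j (proj₂ t))

-- A class of order r

-- At c = z (z + 1) this is the Δ of `linear-resultant`. Up to terms divisible by α it equals z α ♯,
-- so it lies in the ideal generated by α and α ♯.
resultant : ℤ → ℤ
resultant c = + 2 ℤ.* c ℤ.* c ℤ.- + 2 ℤ.* c ℤ.- + 1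

module ClassOfOrder (n m : ℕ) (10≤n : 10 ℕ.≤ n) (n≡ : n ≡ 1 ℕ.+ 2 ℕ.* m) (z r : ℕ) (t s : ℤ)
  (norm : + z ℤ.* + z ℤ.* + z ℤ.+ + suc z ℤ.* + suc z ℤ.* + suc z ℤ.+ + n ℤ.* (+ z ℤ.* + suc z) ≡ t ℤS.^ r)
  (norm≡1 : t ℤS.^ r ≡ + 1 ℤ.+ resultant (+ z ℤ.* + suc z) ℤ.* s) where

  open CubicField n hiding (_^_; ^-homo-*; ^-assocʳ; ^-distrib-*; 1^; α)
  open PowerRelations n m 10≤n n≡
  open LocalObstruction n m 10≤n n≡ using (generator)
  open Ideals n

  private
    Z W T : ℚ
    Z = int (+ z)
    W = 1ℚ ℚ.+ Z
    T = int t

    a : K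
    a = generator z

    W≡ : int (+ suc z) ≡ W
    W≡ = trans (int-+ (+ 1) (+ z)) (cong (ℚ._+ Z) int-1)

    lat-a : Lat a
    lat-a = isInt-int (+ z) , isInt-int (+ suc z) , isInt-0

    N-a : N a ≡ T ℚS.^ r
    N-a = trans (N-linear Z (int (+ suc z))) (trans (trans (cong (λ w → Z ℚ.* Z ℚ.* Z ℚ.+ w ℚ.* w ℚ.* w ℚ.+ nℚ n ℚ.* Z ℚ.* (w ℚ.* w) ℚ.- nℚ n ℚ.* (Z ℚ.* Z) ℚ.* w) W≡)
      (trans (QR.solve 2 (λ n z → let w = QR.con (+ 1) QR.:+ z in z QR.:* z QR.:* z QR.:+ w QR.:* w QR.:* w QR.:+ n QR.:* z QR.:* (w QR.:* w) QR.:- n QR.:* (z QR.:* z) QR.:* w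
          QR.:= z QR.:* z QR.:* z QR.:+ w QR.:* w QR.:* w QR.:+ n QR.:* (z QR.:* w)) refl (nℚ n) Z)
        (cong₂ (λ c w → Z ℚ.* Z ℚ.* Z ℚ.+ w ℚ.* w ℚ.* w ℚ.+ c ℚ.* (Z ℚ.* w)) (sym (int≡ℤtoℚ (+ n))) (sym W≡))))
      (trans (sym expand) (trans (cong int norm) (int-^ t r))))
      where
      module QR = ℚS.Solver
      expand : int (+ z ℤ.* + z ℤ.* + z ℤ.+ + suc z ℤ.* + suc z ℤ.* + suc z ℤ.+ + n ℤ.* (+ z ℤ.* + suc z)) ≡
        Z ℚ.* Z ℚ.* Z ℚ.+ int (+ suc z) ℚ.* int (+ suc z) ℚ.* int (+ suc z) ℚ.+ int (+ n) ℚ.* (Z ℚ.* int (+ suc z))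
      expand = trans (int-+ (+ z ℤ.* + z ℤ.* + z ℤ.+ + suc z ℤ.* + suc z ℤ.* + suc z) (+ n ℤ.* (+ z ℤ.* + suc z))) (cong₂ ℚ._+_ (trans (int-+ (+ z ℤ.* + z ℤ.* + z) _) (cong₂ ℚ._+_ (cubed (+ z)) (cubed (+ suc z)))) (trans (int-* (+ n) (+ z ℤ.* + suc z)) (cong (int (+ n) ℚ.*_) (int-* (+ z) (+ suc z)))))
        where
        cubed : ∀ u → int (u ℤ.* u ℤ.* u) ≡ int u ℚ.* int u ℚ.* int u
        cubed u = trans (int-* (u ℤ.* u) u) (cong (ℚ._* int u) (int-* u u))

    Δ : ℚ
    Δ = ℚS.fromℤ (+ 2) ℚ.* (Z ℚ.* W) ℚ.* (Z ℚ.* W) ℚ.- ℚS.fromℤ (+ 2) ℚ.* (Z ℚ.* W) ℚ.- 1ℚ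

    Δ≡ : int (resultant (+ z ℤ.* + suc z)) ≡ Δ
    Δ≡ = trans (expand (+ z ℤ.* + suc z)) (cong (λ c → ℚS.fromℤ (+ 2) ℚ.* c ℚ.* c ℚ.- ℚS.fromℤ (+ 2) ℚ.* c ℚ.- 1ℚ) (trans (int-* (+ z) (+ suc z)) (cong (Z ℚ.*_) W≡)))
      where
      expand : ∀ c → int (resultant c) ≡ ℚS.fromℤ (+ 2) ℚ.* int c ℚ.* int c ℚ.- ℚS.fromℤ (+ 2) ℚ.* int c ℚ.- 1ℚ
      expand c = trans (int-+ (+ 2 ℤ.* c ℤ.* c ℤ.- + 2 ℤ.* c) (ℤ.- + 1)) (cong₂ ℚ._+_ (trans (int-+ (+ 2 ℤ.* c ℤ.* c) (ℤ.- (+ 2 ℤ.* c))) (cong₂ ℚ._+_ (trans (int-* (+ 2 ℤ.* c) c) (cong (ℚ._* int c) double)) (trans (int-neg (+ 2 ℤ.* c)) (cong ℚ.-_ double)))) (trans (int-neg (+ 1)) (cong ℚ.-_ int-1)))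
        where
        double : int (+ 2 ℤ.* c) ≡ ℚS.fromℤ (+ 2) ℚ.* int c
        double = trans (int-* (+ 2) c) (cong (ℚ._* int c) (sym (fromℕ≡ 2)))

    one : 1ℚ ≡ N a ℚ.- Δ ℚ.* int s
    one = trans (trans (QR.solve 1 (λ x → QR.con (+ 1) QR.:= QR.con (+ 1) QR.:+ x QR.:- x) refl (Δ ℚ.* int s)) (cong (ℚ._- Δ ℚ.* int s)
        (trans (cong₂ ℚ._+_ (sym int-1) (trans (cong (ℚ._* int s) (sym Δ≡)) (sym (int-* (resultant (+ z ℤ.* + suc z)) s)))) (trans (sym (int-+ (+ 1) (resultant (+ z ℤ.* + suc z) ℤ.* s))) (cong int (sym norm≡1))))))
      (cong (ℚ._- Δ ℚ.* int s) (trans (int-^ t r) (sym N-a)))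
      where module QR = ℚS.Solver

    -- Write 1 = tʳ - Δ s. Here tʳ = α · α ♯, and Δ is a combination of α and α ♯ by
    -- `linear-resultant`.
    comaximal : ∃₂ λ u v → IsIntegral n u × IsIntegral n v × 1K ≡ u · a ⊕ v · a ♯
    comaximal = u , v , integral-add (int-integral S-int (integral-mul (lat-integral (lat-ι isInt-Z)) (lat-integral lat-g))) (lat-integral lat-0) ,
        integral-add (lat-integral lat-a) (integral-mul (lat-integral (lat-neg (lat-ι (isInt-int s)))) (integral-add (lat-integral (lat-ι isInt-Z)) (integral-mul (lat-integral (lat-ι (isInt-+ isInt-Z (isInt-neg isInt-1)))) (lat-integral lat-a)))) ,
        identity
      where
      open KS.Solver
      isInt-Z : IsInt Z
      isInt-Z = isInt-int (+ z)
      isInt-W : IsInt W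
      isInt-W = subst IsInt W≡ (isInt-int (+ suc z))
      g u v : K
      g = nℚ n ℚ.* W ℚ.- ℚS.fromℤ (+ 2) ℚ.* Z , W , 0ℚ
      u = ι (int s) · (ι Z · g) ⊕ 0K
      v = a ⊕ neg (ι (int s)) · (ι Z ⊕ ι (Z ℚ.- 1ℚ) · a)
      lat-g : Lat g
      lat-g = isInt-+ (isInt-* (isInt-ℤtoℚ (+ n)) isInt-W) (isInt-neg (isInt-* (+ 2 , fromℕ≡ 2) isInt-Z)) , isInt-W , isInt-0
      S-int : IsInt (int s)
      S-int = isInt-int s
      int-integral : ∀ {q x} → IsInt q → IsIntegral n x → IsIntegral n (ι q · x)
      int-integral i ix = integral-mul (lat-integral (lat-ι i)) ix
      linear : ι Δ ⊕ ι Z · (a · g) ≡ ι Z · a ♯ ⊕ ι (Z ℚ.- 1ℚ) · (a · a ♯)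
      linear = subst (λ w → ι Δ ⊕ ι Z · ((Z , w , 0ℚ) · g) ≡ ι Z · (Z , w , 0ℚ) ♯ ⊕ ι (Z ℚ.- 1ℚ) · ((Z , w , 0ℚ) · (Z , w , 0ℚ) ♯)) (sym W≡) (linear-resultant Z)
      identity : 1K ≡ u · a ⊕ v · a ♯
      identity = trans (trans (cong ι one) (trans (ι-add (N a) (ℚ.- (Δ ℚ.* int s))) (cong₂ _⊕_ (sym (mul-♯ a)) (trans (ι-neg (Δ ℚ.* int s)) (cong neg (trans (ι-mul Δ (int s)) (cong (_· ι (int s)) isolate)))))))
        (solve 6 (λ a b s z z₁ g → a :* b :+ :- ((z :* b :+ z₁ :* (a :* b) :- z :* (a :* g)) :* s) := (s :* (z :* g) :+ con (+ 0)) :* a :+ (a :+ (:- s) :* (z :+ z₁ :* a)) :* b) refl a (a ♯) (ι (int s)) (ι Z) (ι (Z ℚ.- 1ℚ)) g)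
        where
        isolate : ι Δ ≡ ι Z · a ♯ ⊕ ι (Z ℚ.- 1ℚ) · (a · a ♯) ⊕ neg (ι Z · (a · g))
        isolate = trans (solve 2 (λ d x → d := d :+ x :- x) refl (ι Δ) (ι Z · (a · g))) (cong (_⊕ neg (ι Z · (a · g))) linear)

  class-of-order : 1 ℕ.≤ r → t ≢ + 0 → (∀ {p} → Prim.Prime p → p ℕD.∣ r → ¬ Dependent p a) → HasClassOfOrder n r
  class-of-order 1≤r t≢0 independent = J , J-isIdeal T≢0 , generator⇒principal {r} {a} (lat-integral lat-a) J^r-divides a∈J^r , not-principal
    where
    open RootIdeal a T r lat-a (isInt-int t) N-a comaximal
    open Powers J-isModule
    T≢0 : T ≢ 0ℚ
    T≢0 = int≢0 t≢0
    power≢0 : ∀ k → T ℚS.^ k ≢ 0ℚ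
    power≢0 zero ()
    power≢0 (suc k) = *≢0 T≢0 (power≢0 k)
    a∈J^r : IdealPow n J r a
    a∈J^r = α∈J^r (ℕ.pred r) (sym (ℕP.suc-pred r {{ℕ.>-nonZero 1≤r}}))
    not-principal : ∀ k → 1 ℕ.≤ k → k ℕ.< r → ¬ IsPrincipal n (IdealPow n J k)
    not-principal k 1≤k k<r P = fromUnits (associated {k} {r} {a} {proj₁ P} (J^r-divides , a∈J^r) (principal⇒generator {k} P))
      where
      fromUnits : (∃₂ λ u v → IsIntegral n u × IsIntegral n v × a KS.^ k ≡ proj₁ P KS.^ r · u × proj₁ P KS.^ r ≡ a KS.^ k · v) → ⊥
      fromUnits (u , v , iu , iv , eu , ev) = fromDependence (associated⇒dependent 1≤k k<r (λ e → power≢0 r (trans (sym N-a) e)) iu iv eu ev)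
        where
        fromDependence : (∃ λ p → Prim.Prime p × p ℕD.∣ r × Dependent p a) → ⊥
        fromDependence (p , prime-p , p∣r , dep) = independent prime-p p∣r dep

-- Discriminants and isomorphisms

discriminant : ℤ → ℤ
discriminant x = x ℤ.* x ℤ.* x ℤ.* x ℤ.- + 18 ℤ.* x ℤ.* x ℤ.- + 27

D≡discriminant : ∀ n → CubicField.D n ≡ int (discriminant (+ n))
D≡discriminant n = trans (cong (λ c → RawCubic.D ℚ._+_ ℚ._*_ ℚ.-_ 0ℚ 1ℚ c) (sym (int≡ℤtoℚ (+ n))))
  (trans (solve 1 (λ n → let two = con (+ 1) :+ con (+ 1); three = con (+ 1) :+ two in
      n :* n :* n :* n :- two :* three :* three :* n :* n :- three :* three :* three := n :* n :* n :* n :- con (+ 18) :* n :* n :- con (+ 27)) refl (int (+ n)))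
    (sym expand))
  where
  open ℚS.Solver
  expand : int (discriminant (+ n)) ≡ int (+ n) ℚ.* int (+ n) ℚ.* int (+ n) ℚ.* int (+ n) ℚ.- ℚS.fromℤ (+ 18) ℚ.* int (+ n) ℚ.* int (+ n) ℚ.- ℚS.fromℤ (+ 27)
  expand = trans (int-+ (x ℤ.* x ℤ.* x ℤ.* x ℤ.- + 18 ℤ.* x ℤ.* x) (ℤ.- + 27)) (cong₂ ℚ._+_ (trans (int-+ (x ℤ.* x ℤ.* x ℤ.* x) (ℤ.- (+ 18 ℤ.* x ℤ.* x))) (cong₂ ℚ._+_ fourth (trans (int-neg (+ 18 ℤ.* x ℤ.* x)) (cong ℚ.-_ (trans (int-* (+ 18 ℤ.* x) x) (cong (ℚ._* int x) (trans (int-* (+ 18) x) (cong (ℚ._* int x) (sym (fromℕ≡ 18))))))))))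
      (trans (int-neg (+ 27)) (cong ℚ.-_ (sym (fromℕ≡ 27)))))
    where
    x : ℤ
    x = + n
    fourth : int (x ℤ.* x ℤ.* x ℤ.* x) ≡ int x ℚ.* int x ℚ.* int x ℚ.* int x
    fourth = trans (int-* (x ℤ.* x ℤ.* x) x) (cong (ℚ._* int x) (trans (int-* (x ℤ.* x) x) (cong (ℚ._* int x) (int-* x x))))

module Isomorphism {n m : ℕ} (iso : FieldIso n m) where

  open FieldIso iso
  private
    module A = CubicField n
    module B = CubicField m
    open B using (_·_; _⊕_; neg; ι)

    to-⊕ : ∀ x y → to (x A.⊕ y) ≡ to x ⊕ to y
    to-⊕ x y = trans (cong to (sym (A.+K≡⊕ x y))) (trans (to-+ x y) (B.+K≡⊕ (to x) (to y)))

    to-· : ∀ x y → to (x A.· y) ≡ to x · to y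
    to-· x y = trans (cong to (sym (A.mulK≡· x y))) (trans (to-* x y) (B.mulK≡· (to x) (to y)))

    to-0 : to 0K ≡ 0K
    to-0 = trans (solve 1 (λ a → a := a :+ a :- a) refl (to 0K)) (trans (cong (_⊕ neg (to 0K)) (trans (sym (to-⊕ 0K 0K)) (cong to (A.KS.Solver.solve 0 (A.KS.Solver.con (+ 0) A.KS.Solver.:+ A.KS.Solver.con (+ 0) A.KS.Solver.:= A.KS.Solver.con (+ 0)) refl))))
        (solve 1 (λ a → a :- a := con (+ 0)) refl (to 0K)))
      where open B.KS.Solver

    FixedBy : ℚ → Set
    FixedBy q = to (ι q) ≡ ι q

    fixed-+ : ∀ {p q} → FixedBy p → FixedBy q → FixedBy (p ℚ.+ q)
    fixed-+ {p} {q} a b = trans (cong to (A.ι-add p q)) (trans (to-⊕ (ι p) (ι q)) (trans (cong₂ _⊕_ a b) (sym (B.ι-add p q))))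

    fixed-neg : ∀ {p} → FixedBy p → FixedBy (ℚ.- p)
    fixed-neg {p} a = trans (trans (solve 2 (λ u v → u := u :+ v :- v) refl (to (ι (ℚ.- p))) (to (ι p))) (cong (_⊕ neg (to (ι p))) (trans (sym (to-⊕ (ι (ℚ.- p)) (ι p))) (trans (cong to (trans (sym (A.ι-add (ℚ.- p) p)) (cong ι (ℚP.+-inverseˡ p)))) to-0))))
        (trans (cong (λ v → 0K ⊕ neg v) a) (trans (solve 1 (λ v → con (+ 0) :- v := :- v) refl (ι p)) (sym (B.ι-neg p))))
      where open B.KS.Solver

    fixed-ℕ : ∀ k → FixedBy (int (+ k))
    fixed-ℕ zero = subst FixedBy (sym int-0) to-0
    fixed-ℕ (suc k) = subst FixedBy (sym (trans (int-+ (+ 1) (+ k)) (cong (ℚ._+ int (+ k)) int-1))) (fixed-+ {1ℚ} {int (+ k)} to-1 (fixed-ℕ k))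

    fixed-ℤ : ∀ z → FixedBy (int z)
    fixed-ℤ (+ k) = fixed-ℕ k
    fixed-ℤ -[1+ k ] = subst FixedBy (sym (int-neg (+ suc k))) (fixed-neg {int (+ suc k)} (fixed-ℕ (suc k)))

    fixed : ∀ q → FixedBy q
    fixed q = fromDenominator (denominator q)
      where
      open B.KS.Solver
      fromDenominator : (Σ ℕ λ d → int (+ suc d) ℚ.* q ≡ int (ℚ.numerator q)) → FixedBy q
      fromDenominator (d , eq) = fromInverse (inverse {s} (int≢0 (λ ())))
        where
        s : ℚ
        s = int (+ suc d)
        scaled : ι s · to (ι q) ≡ ι s · ι q
        scaled = trans (cong (_· to (ι q)) (sym (fixed-ℕ (suc d)))) (trans (sym (to-· (ι s) (ι q))) (trans (cong to (trans (sym (A.ι-mul s q)) (cong ι eq))) (trans (fixed-ℤ (ℚ.numerator q)) (trans (cong ι (sym eq)) (B.ι-mul s q)))))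
        fromInverse : (∃ λ b → s ℚ.* b ≡ 1ℚ) → FixedBy q
        fromInverse (b , sb≡1) = trans (unscale (to (ι q))) (trans (cong (ι b ·_) scaled) (sym (unscale (ι q))))
          where
          unscale : ∀ x → x ≡ ι b · (ι s · x)
          unscale x = trans (solve 1 (λ x → x := con (+ 1) :* x) refl x) (trans (cong (_· x) (trans (cong ι (sym sb≡1)) (B.ι-mul s b))) (solve 3 (λ s b x → s :* b :* x := b :* (s :* x)) refl (ι s) (ι b) x))

    θ : K
    θ = to A.ρ

    c T S M : ℚ
    c = nℚ n
    T = B.tr θ
    S = B.e₂ θ
    M = B.N θ

    θ-root : θ · θ · θ ⊕ (ι c · (θ · θ) ⊕ ι c · θ) ≡ 1K
    θ-root = trans (sym (trans (to-⊕ _ _) (cong₂ _⊕_ (trans (to-· _ _) (cong (_· θ) (to-· _ _))) (trans (to-⊕ _ _) (cong₂ _⊕_ (trans (to-· _ _) (cong₂ _·_ (fixed c) (to-· _ _))) (trans (to-· _ _) (cong (_· θ) (fixed c))))))))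
      (trans (cong to A.ρ-root) to-1)

    -- The image θ of ρ satisfies two monic cubics over ℚ, namely f_n and its own characteristic
    -- polynomial in K_m. This is their difference.
    relation : ι (M ℚ.- 1ℚ) ⊕ (ι (c ℚ.- S) · θ ⊕ ι (c ℚ.+ T) · (θ · θ)) ≡ 0K
    relation = trans (cong₂ _⊕_ (trans (B.ι-add M (ℚ.- 1ℚ)) (cong (ι M ⊕_) (B.ι-neg 1ℚ))) (cong₂ _⊕_ (cong (_· θ) (trans (B.ι-add c (ℚ.- S)) (cong (ι c ⊕_) (B.ι-neg S)))) (cong (_· (θ · θ)) (B.ι-add c T))))
      (trans (solve 5 (λ M c S T θ → M :- con (+ 1) :+ ((c :- S) :* θ :+ (c :+ T) :* (θ :* θ)) :=
          (T :* (θ :* θ) :+ M) :- (θ :* θ :* θ :+ S :* θ) :+ (θ :* θ :* θ :+ (c :* (θ :* θ) :+ c :* θ) :- con (+ 1))) refl (ι M) (ι c) (ι S) (ι T) θ)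
        (trans (cong₂ (λ x y → x ⊕ neg (θ · θ · θ ⊕ ι S · θ) ⊕ (y ⊕ neg 1K)) (sym (B.cayley-hamilton θ)) θ-root)
          (solve 1 (λ a → a :- a :+ (con (+ 1) :- con (+ 1)) := con (+ 0)) refl (θ · θ · θ ⊕ ι S · θ))))
      where open B.KS.Solver

    -- Pulled back to K_n, the quadratic relation becomes a coordinate vector in the basis 1, ρ, ρ²,
    -- so it vanishes identically: the characteristic polynomial of θ is f_n.
    coefficients : (M ℚ.- 1ℚ , c ℚ.- S , c ℚ.+ T) ≡ 0K
    coefficients = trans (sym (from∘to _)) (trans (cong from (trans image (trans relation (sym to-0)))) (from∘to 0K))
      where
      image : to (M ℚ.- 1ℚ , c ℚ.- S , c ℚ.+ T) ≡ ι (M ℚ.- 1ℚ) ⊕ (ι (c ℚ.- S) · θ ⊕ ι (c ℚ.+ T) · (θ · θ))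
      image = trans (cong to (A.basis-expansion (M ℚ.- 1ℚ) (c ℚ.- S) (c ℚ.+ T)))
        (trans (to-⊕ _ _) (cong₂ _⊕_ (fixed _) (trans (to-⊕ _ _) (cong₂ _⊕_ (trans (to-· _ _) (cong (_· θ) (fixed _))) (trans (to-· _ _) (cong₂ _·_ (fixed _) (to-· _ _)))))))

  -- The discriminant of the characteristic polynomial of θ is computed twice: as the discriminant
  -- of f_n, and by the index form of K_m.
  D-square : ∃ λ k → A.D ≡ k ℚ.* k ℚ.* B.D
  D-square = fromDisc (B.disc θ)
    where
    open ℚS.Solver
    disc : ℚ → ℚ → ℚ → ℚ
    disc = RawCubic.disc ℚ._+_ ℚ._*_ ℚ.-_ 0ℚ 1ℚ
    M≡ : M ≡ 1ℚ
    M≡ = -≡0⇒≡ (cong proj₁ coefficients)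
    S≡ : S ≡ c
    S≡ = sym (-≡0⇒≡ (cong (λ x → proj₁ (proj₂ x)) coefficients))
    T≡ : T ≡ ℚ.- c
    T≡ = trans (solve 2 (λ T c → T := c :+ T :- c) refl T c) (trans (cong (ℚ._- c) (cong (λ x → proj₂ (proj₂ x)) coefficients)) (solve 1 (λ c → con (+ 0) :- c := :- c) refl c))
    disc≡D : disc (ℚ.- c) c 1ℚ ≡ A.D
    disc≡D = solve 1 (λ n → let one = con (+ 1); two = one :+ one; three = one :+ two in
      (:- n) :* (:- n) :* n :* n :- two :* two :* n :* n :* n :- two :* two :* (:- n) :* (:- n) :* (:- n) :* one :- three :* three :* three :* one :* one :+ two :* three :* three :* (:- n) :* n :* one
      := n :* n :* n :* n :- two :* three :* three :* n :* n :- three :* three :* three) refl c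
    fromDisc : (∃ λ k → disc T S M ≡ k ℚ.* k ℚ.* B.D) → ∃ λ k → A.D ≡ k ℚ.* k ℚ.* B.D
    fromDisc (k , eq) = k , trans (sym disc≡D) (trans (sym (trans (cong (λ T → disc T S M) T≡) (trans (cong (λ S → disc (ℚ.- c) S M) S≡) (cong (disc (ℚ.- c) c) M≡)))) eq)

-- Separating discriminants by their square classes

sqrt-isInt : ∀ x → IsInt (x ℚ.* x) → IsInt x
sqrt-isInt x int-xx = fromDenominator (clearDenominator x)
  where
  fromDenominator : (∃ λ m → m ≢ 0ℚ × IsInt m × IsInt (m ℚ.* x)) → IsInt x
  fromDenominator (m , m≢0 , im , imx) = boundedPowers⇒int x m m≢0 im (λ k → proj₁ (both k))
    where
    open ℚS.Solver
    both : ∀ k → IsInt (m ℚ.* x ℚS.^ k) × IsInt (m ℚ.* x ℚS.^ suc k)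
    both zero = subst IsInt (sym (ℚP.*-identityʳ m)) im , subst IsInt (cong (m ℚ.*_) (sym (ℚP.*-identityʳ x))) imx
    both (suc k) = proj₂ (both k) , subst IsInt (solve 3 (λ m x a → m :* a :* (x :* x) := m :* (x :* (x :* a))) refl m x (x ℚS.^ k)) (isInt-* (proj₁ (both k)) int-xx)

primes⇒coprime : ∀ {a b} → a ≢ 0 → (∀ {p} → Prim.Prime p → p ℕD.∣ a → p ℕD.∣ b → ⊥) → Cop.Coprime a b
primes⇒coprime {a} a≢0 h {0} (d∣a , _) = ⊥-elim (a≢0 (ℕD.0∣⇒≡0 d∣a))
primes⇒coprime a≢0 h {1} _ = refl
primes⇒coprime a≢0 h {suc (suc d)} (d∣a , d∣b) = fromPrime (prime-divisor (suc (suc d)) (ℕ.s≤s (ℕ.s≤s ℕ.z≤n)))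
  where
  fromPrime : (∃ λ p → Prim.Prime p × p ℕD.∣ suc (suc d)) → suc (suc d) ≡ 1
  fromPrime (p , prime-p , p∣d) = ⊥-elim (h prime-p (ℕD.∣-trans p∣d d∣a) (ℕD.∣-trans p∣d d∣b))

-- With g = gcd (a , x), a = a′ g and x = x′ g one gets a′ b = x′² g. Then a′ ∣ g because a′ is
-- prime to x′, and g ∣ a′ because g is prime to b.
coprime-square : ∀ {a b x} → 1 ℕ.≤ a → Cop.Coprime a b → a ℕ.* b ≡ x ℕ.* x → ∃ λ g → a ≡ g ℕ.* g
coprime-square {a} {b} {x} 1≤a cop ab≡xx = from (divideOutGCD a x 1≤a)
  where
  open import Data.Nat.Solver using (module +-*-Solver)
  open +-*-Solver
  from : (∃₂ λ g a′ → ∃ λ x′ → Cop.Coprime a′ x′ × a′ ℕ.* g ≡ a × x′ ℕ.* g ≡ x) → ∃ λ g → a ≡ g ℕ.* g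
  from (zero , a′ , x′ , _ , a′g≡a , _) = ⊥-elim (ℕP.<⇒≢ 1≤a (trans (sym (ℕP.*-zeroʳ a′)) a′g≡a))
  from (g@(suc _) , a′ , x′ , cop′ , refl , refl) = g , cong (ℕ._* g) (ℕD.∣-antisym a′∣g g∣a′)
    where
    reduced : a′ ℕ.* b ≡ x′ ℕ.* (x′ ℕ.* g)
    reduced = ℕP.*-cancelˡ-≡ _ _ g (trans (solve 3 (λ g a b → g :* (a :* b) := a :* g :* b) refl g a′ b) (trans ab≡xx (solve 2 (λ x g → x :* g :* (x :* g) := g :* (x :* (x :* g))) refl x′ g)))
    a′∣g : a′ ℕD.∣ g
    a′∣g = Cop.coprime-divisor cop′ (Cop.coprime-divisor cop′ (subst (a′ ℕD.∣_) reduced (ℕD.m∣m*n b)))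
    g∣a′ : g ℕD.∣ a′
    g∣a′ = Cop.coprime-divisor {g} {b} (λ { (d∣g , d∣b) → cop (ℕD.∣n⇒∣m*n a′ d∣g , d∣b) }) (subst (g ℕD.∣_) (trans (trans (ℕP.*-assoc x′ x′ g) (sym reduced)) (ℕP.*-comm a′ b)) (ℕD.n∣m*n (x′ ℕ.* x′)))

no-square-between : ∀ {a g} → a ℕ.* a ℕ.< g ℕ.* g → g ℕ.* g ℕ.< suc a ℕ.* suc a → ⊥
no-square-between {a} {g} lower upper = ℕP.<⇒≱ (root-< {a} {g} lower) (ℕP.≤-pred (root-< {g} {suc a} upper))
  where
  root-< : ∀ {u v} → u ℕ.* u ℕ.< v ℕ.* v → u ℕ.< v
  root-< {u} {v} h = ℕP.≰⇒> λ v≤u → ℕP.<⇒≱ h (ℕP.*-mono-≤ v≤u v≤u)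

-- Prescribing n modulo Q², and not just Q, makes Q a unitary divisor of D n; the factor 3 passes on
-- to n the property of x of being prime to 3. The centre x² makes Q = (x⁴ - 9)² - 108 a near miss
-- of a square, hence not a square.
Congruent : ℕ → ℕ → Set
Congruent x n = let N = + x ℤ.* + x; Q = discriminant N in ∃ λ k → + n ≡ N ℤ.+ + 3 ℤ.* (Q ℤ.* Q) ℤ.* k

prime-3 : Prim.Prime 3
prime-3 = toWitness {a? = Prim.prime? 3} tt

Unit₃ : ℤ → Set
Unit₃ = Modular.Unit prime-3

unit₃-discriminant : ∀ {x n} → Unit₃ (+ x) → Congruent x n → Unit₃ (discriminant (+ n))
unit₃-discriminant {x} {n} ux (k , n≡) = unit-resp (≈-sym fourth) (unit-* (unit-* (unit-* un un) un) un)
  where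
  open Modular prime-3
  open import Data.Integer.Solver using (module +-*-Solver)
  open +-*-Solver
  N : ℤ
  N = + x ℤ.* + x
  un : Unit (+ n)
  un = unit-resp (record { divides = ℤD.divides (ℤ.- (discriminant N ℤ.* discriminant N ℤ.* k)) (trans (cong (λ v → N ℤ.- v) n≡)
      (solve 3 (λ N q k → N :- (N :+ con (+ 3) :* (q :* q) :* k) := :- (q :* q :* k) :* con (+ 3)) refl N (discriminant N) k)) }) (unit-* ux ux)
  fourth : discriminant (+ n) ≈ + n ℤ.* + n ℤ.* + n ℤ.* + n
  fourth = record { divides = ℤD.divides (ℤ.- (+ 6 ℤ.* + n ℤ.* + n) ℤ.- + 9) (solve 1 (λ x → x :* x :* x :* x :- con (+ 18) :* x :* x :- con (+ 27) :- x :* x :* x :* x := (:- (con (+ 6) :* x :* x) :- con (+ 9)) :* con (+ 3)) refl (+ n)) }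

-- Here a = x⁴ - 10 and x⁴ = 64 + b. From Q = (x⁴ - 9)² - 108 one sees a² < Q < (a + 1)², and 64 is
-- the least value of x⁴ allowed by the lower inequality.
discriminant-x² : ∀ {x} → 10 ℕ.≤ x → ∃₂ λ a b → a ≡ 54 ℕ.+ b × discriminant (+ x ℤ.* + x) ≡ + (a ℕ.* a ℕ.+ (2 ℕ.* b ℕ.+ 1))
discriminant-x² {x} 10≤x = from (ℕP.m≤n⇒∃[o]m+o≡n {64} (ℕP.≤-trans (toWitness {a? = 64 ℕP.≤? 100} tt) (ℕP.≤-trans 100≤ (ℕP.m≤m*n (x ℕ.* x) (x ℕ.* x) {{ℕ.>-nonZero (ℕP.≤-trans (ℕ.s≤s ℕ.z≤n) 100≤)}}))))
  where
  open import Data.Integer.Solver using (module +-*-Solver)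
  open +-*-Solver
  100≤ : 100 ℕ.≤ x ℕ.* x
  100≤ = ℕP.*-mono-≤ 10≤x 10≤x
  from : (∃ λ b → 64 ℕ.+ b ≡ x ℕ.* x ℕ.* (x ℕ.* x)) → ∃₂ λ a b → a ≡ 54 ℕ.+ b × discriminant (+ x ℤ.* + x) ≡ + (a ℕ.* a ℕ.+ (2 ℕ.* b ℕ.+ 1))
  from (b , b≡) = 54 ℕ.+ b , b , refl , trans (trans (solve 1 (λ x → (x :* x) :* (x :* x) :* (x :* x) :* (x :* x) :- con (+ 18) :* (x :* x) :* (x :* x) :- con (+ 27)
        := (x :* x :* (x :* x)) :* (x :* x :* (x :* x)) :- con (+ 18) :* (x :* x :* (x :* x)) :- con (+ 27)) refl (+ x))
      (trans (cong (λ u → u ℤ.* u ℤ.- + 18 ℤ.* u ℤ.- + 27) (trans (sym fourth) (ℤP.pos-+ 64 b)))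
        (solve 1 (λ b → (con (+ 64) :+ b) :* (con (+ 64) :+ b) :- con (+ 18) :* (con (+ 64) :+ b) :- con (+ 27) := (con (+ 54) :+ b) :* (con (+ 54) :+ b) :+ (con (+ 2) :* b :+ con (+ 1))) refl (+ b))))
    (sym (trans (ℤP.pos-+ ((54 ℕ.+ b) ℕ.* (54 ℕ.+ b)) (2 ℕ.* b ℕ.+ 1)) (cong₂ ℤ._+_ (trans (ℤP.pos-* (54 ℕ.+ b) (54 ℕ.+ b)) (cong (λ v → v ℤ.* v) (ℤP.pos-+ 54 b))) (trans (ℤP.pos-+ (2 ℕ.* b) 1) (cong (ℤ._+ + 1) (ℤP.pos-* 2 b))))))
    where
    fourth : + (64 ℕ.+ b) ≡ + x ℤ.* + x ℤ.* (+ x ℤ.* + x)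
    fourth = trans (cong +_ b≡) (trans (ℤP.pos-* (x ℕ.* x) (x ℕ.* x)) (cong (λ v → v ℤ.* v) (ℤP.pos-* x x)))

-- The discriminant is -27 modulo x.
common-prime : ∀ {x p} → Prim.Prime p → p ℕD.∣ x → p ℕD.∣ ℤ.∣ discriminant (+ x ℤ.* + x) ∣ → p ≡ 3
common-prime {x} {p} prime-p p∣x p∣Q = at-3 (Prim.prime⇒irreducible prime-3 p∣3)
  where
  open Modular prime-p
  open import Data.Integer.Solver using (module +-*-Solver)
  open +-*-Solver
  u : ℤ
  u = + x ℤ.* + x ℤ.* + x ℤ.* + x ℤ.* + x ℤ.* + x ℤ.* + x ℤ.- + 18 ℤ.* + x ℤ.* + x ℤ.* + x
  zero-27 : Zero (+ 27)
  zero-27 = ≈-trans (≡⇒≈ (solve 1 (λ x → con (+ 27) := (x :* x :* x :* x :* x :* x :* x :- con (+ 18) :* x :* x :* x) :* x :- ((x :* x) :* (x :* x) :* (x :* x) :* (x :* x) :- con (+ 18) :* (x :* x) :* (x :* x) :- con (+ 27))) refl (+ x)))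
    (≈-trans (≈-+ (≈-* (≈-refl {u}) (∣⇒zero {+ x} (ℤD.∣ᵤ⇒∣ p∣x))) (≈-neg (∣⇒zero {discriminant (+ x ℤ.* + x)} (ℤD.∣ᵤ⇒∣ p∣Q)))) (≡⇒≈ (solve 1 (λ v → v :* con (+ 0) :- con (+ 0) := con (+ 0)) refl u)))
  p∣3 : p ℕD.∣ 3
  p∣3 = [ id , (λ d → [ id , id ]′ (Prim.euclidsLemma 3 3 prime-p d)) ]′ (Prim.euclidsLemma 3 9 prime-p (ℤD.∣⇒∣ᵤ (zero⇒∣ zero-27)))
  at-3 : p ≡ 1 ⊎ p ≡ 3 → p ≡ 3
  at-3 (inj₁ refl) = ⊥-elim (Prim.¬prime[1] prime-p)
  at-3 (inj₂ p≡3) = p≡3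

-- The discriminant of x² lies strictly between two consecutive squares, and it is a unitary divisor of the discriminant of any n congruent to x²
-- modulo its square.
not-square : ∀ {x n n′} → 10 ℕ.≤ x → Congruent x n → ℤ.∣ discriminant (+ n′) ∣ ℕD.∣ x → Unit₃ (discriminant (+ n′)) → ∀ X → discriminant (+ n) ℤ.* discriminant (+ n′) ≢ X ℤ.* X
not-square {x} {n} {n′} 10≤x (k , n≡) D′∣x unit-D′ X DD′≡XX = fromRoots (discriminant-x² 10≤x)
  where
  open import Data.Integer.Solver using (module +-*-Solver)
  open +-*-Solver
  N Q D′ h w : ℤ
  N = + x ℤ.* + x
  Q = discriminant N
  D′ = discriminant (+ n′)
  h = + 3 ℤ.* (Q ℤ.* Q) ℤ.* k
  -- Obtained by expanding the discriminant at N with the increment h = 3 Q² k; splitting off one of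
  -- the two factors Q leaves D n = Q (1 + Q w).
  w = + 3 ℤ.* k ℤ.* (+ 4 ℤ.* N ℤ.* N ℤ.* N ℤ.+ + 6 ℤ.* N ℤ.* N ℤ.* h ℤ.+ + 4 ℤ.* N ℤ.* h ℤ.* h ℤ.+ h ℤ.* h ℤ.* h ℤ.- + 36 ℤ.* N ℤ.- + 18 ℤ.* h)
  D≡ : discriminant (+ n) ≡ Q ℤ.* (+ 1 ℤ.+ Q ℤ.* w)
  D≡ = trans (cong discriminant n≡) (trans (taylor N h) (factor-Q Q k _))
    where
    taylor : ∀ N h → discriminant (N ℤ.+ h) ≡ discriminant N ℤ.+ h ℤ.* (+ 4 ℤ.* N ℤ.* N ℤ.* N ℤ.+ + 6 ℤ.* N ℤ.* N ℤ.* h ℤ.+ + 4 ℤ.* N ℤ.* h ℤ.* h ℤ.+ h ℤ.* h ℤ.* h ℤ.- + 36 ℤ.* N ℤ.- + 18 ℤ.* h)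
    taylor = solve 2 (λ N h → let disc = λ x → x :* x :* x :* x :- con (+ 18) :* x :* x :- con (+ 27) in
      disc (N :+ h) := disc N :+ h :* (con (+ 4) :* N :* N :* N :+ con (+ 6) :* N :* N :* h :+ con (+ 4) :* N :* h :* h :+ h :* h :* h :- con (+ 36) :* N :- con (+ 18) :* h)) refl
    factor-Q : ∀ Q k e → Q ℤ.+ + 3 ℤ.* (Q ℤ.* Q) ℤ.* k ℤ.* e ≡ Q ℤ.* (+ 1 ℤ.+ Q ℤ.* (+ 3 ℤ.* k ℤ.* e))
    factor-Q = solve 3 (λ Q k e → Q :+ con (+ 3) :* (Q :* Q) :* k :* e := Q :* (con (+ 1) :+ Q :* (con (+ 3) :* k :* e))) refl
  E : ℤ
  E = (+ 1 ℤ.+ Q ℤ.* w) ℤ.* D′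
  product : ℤ.∣ Q ∣ ℕ.* ℤ.∣ E ∣ ≡ ℤ.∣ X ∣ ℕ.* ℤ.∣ X ∣
  product = trans (sym (ℤP.abs-* Q E)) (trans (cong ℤ.∣_∣ (trans (sym (ℤP.*-assoc Q (+ 1 ℤ.+ Q ℤ.* w) D′)) (trans (cong (ℤ._* D′) (sym D≡)) DD′≡XX))) (ℤP.abs-* X X))
  disjoint : ∀ {p} → Prim.Prime p → p ℕD.∣ ℤ.∣ Q ∣ → p ℕD.∣ ℤ.∣ E ∣ → ⊥
  disjoint {p} prime-p p∣Q p∣E = cases (zero-* {+ 1 ℤ.+ Q ℤ.* w} {D′} (∣⇒zero {E} (ℤD.∣ᵤ⇒∣ p∣E)))
    where
    open Modular prime-p
    zero-Q : Zero Q
    zero-Q = ∣⇒zero {Q} (ℤD.∣ᵤ⇒∣ p∣Q)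
    cases : Zero (+ 1 ℤ.+ Q ℤ.* w) ⊎ Zero D′ → ⊥
    cases (inj₁ z) = unit-1 (≈-trans (≈-sym (≈-trans (≈-+ (≈-refl {+ 1}) (≈-* zero-Q (≈-refl {w}))) (≡⇒≈ (solve 1 (λ w → con (+ 1) :+ con (+ 0) :* w := con (+ 1)) refl w)))) z)
    -- Here p divides D′ and hence x, but also D (x²), so p = 3; and D′ is prime to 3.
    cases (inj₂ z) = at-3 (common-prime prime-p (ℕD.∣-trans p∣D′ D′∣x) p∣Q)
      where
      p∣D′ : p ℕD.∣ ℤ.∣ D′ ∣
      p∣D′ = ℤD.∣⇒∣ᵤ (zero⇒∣ z)
      at-3 : p ≡ 3 → ⊥
      at-3 refl = unit-D′ (Modular.∣⇒zero prime-3 {D′} (ℤD.∣ᵤ⇒∣ p∣D′))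
  fromRoots : (∃₂ λ a b → a ≡ 54 ℕ.+ b × Q ≡ + (a ℕ.* a ℕ.+ (2 ℕ.* b ℕ.+ 1))) → ⊥
  fromRoots (a , b , a≡ , Q≡) = fromSquare (coprime-square {x = ℤ.∣ X ∣} 1≤Q (primes⇒coprime (λ e → ℕP.<⇒≢ 1≤Q (sym e)) disjoint) product)
    where
    ∣Q∣≡ : ℤ.∣ Q ∣ ≡ a ℕ.* a ℕ.+ (2 ℕ.* b ℕ.+ 1)
    ∣Q∣≡ = cong ℤ.∣_∣ Q≡
    below : a ℕ.* a ℕ.< a ℕ.* a ℕ.+ (2 ℕ.* b ℕ.+ 1)
    below = ℕP.m<m+n (a ℕ.* a) (subst (0 ℕ.<_) (ℕP.+-comm 1 (2 ℕ.* b)) (ℕ.s≤s ℕ.z≤n))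
    above : a ℕ.* a ℕ.+ (2 ℕ.* b ℕ.+ 1) ℕ.< suc a ℕ.* suc a
    above = subst (a ℕ.* a ℕ.+ (2 ℕ.* b ℕ.+ 1) ℕ.<_) (NS.solve 1 (λ a → a NS.:* a NS.:+ (NS.con 2 NS.:* a NS.:+ NS.con 1) NS.:= (NS.con 1 NS.:+ a) NS.:* (NS.con 1 NS.:+ a)) refl a)
        (ℕP.+-monoʳ-< (a ℕ.* a) (ℕP.+-monoˡ-< 1 (ℕP.*-monoʳ-< 2 (subst (b ℕ.<_) (sym a≡) (ℕP.m<n+m b {54} (ℕ.s≤s ℕ.z≤n))))))
      where
      import Data.Nat.Solver as NatSolver
      module NS = NatSolver.+-*-Solver
    1≤Q : 1 ℕ.≤ ℤ.∣ Q ∣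
    1≤Q = subst (1 ℕ.≤_) (sym ∣Q∣≡) (ℕP.≤-trans (ℕ.s≤s ℕ.z≤n) below)
    fromSquare : (∃ λ g → ℤ.∣ Q ∣ ≡ g ℕ.* g) → ⊥
    fromSquare (g , Q≡gg) = no-square-between {a} {g} (subst (a ℕ.* a ℕ.<_) gg≡ below) (subst (ℕ._< suc a ℕ.* suc a) gg≡ above)
      where
      gg≡ : a ℕ.* a ℕ.+ (2 ℕ.* b ℕ.+ 1) ≡ g ℕ.* g
      gg≡ = trans (sym ∣Q∣≡) Q≡gg

-- Infinitely many pairwise non-isomorphic fields

module Sequence (P : ℕ → Set₁) (s : ℕ) (1≤s : 1 ℕ.≤ s) (unit-s : Unit₃ (+ s))
  (select : ∀ B → 1 ℕ.≤ B → Unit₃ (+ B) → ∃ λ n → P n × Congruent (10 ℕ.* (s ℕ.* B)) n) where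

  private
    open Modular prime-3 using (unit-*; unit-1; unit-resp; ≡⇒≈; unit-ℕ; unit-left; ∣⇒zero)

    -- B accumulates the discriminants of the fields already chosen, so that x = 10 s B is divisible
    -- by each of them, as `not-square` requires. The factor 10 makes x even and at least 10 without
    -- introducing the prime 3.
    record Product : Set where
      field
        B : ℕ
        1≤B : 1 ℕ.≤ B
        unit-B : Unit₃ (+ B)

      n : ℕ
      n = proj₁ (select B 1≤B unit-B)

      x : ℕ
      x = 10 ℕ.* (s ℕ.* B)

      10≤x : 10 ℕ.≤ x
      10≤x = ℕP.*-monoʳ-≤ 10 (ℕP.*-mono-≤ 1≤s 1≤B)

      congruent : Congruent x n
      congruent = proj₂ (proj₂ (select B 1≤B unit-B))

      unit-D : Unit₃ (discriminant (+ n))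
      unit-D = unit₃-discriminant {x} {n} (unit-resp (≡⇒≈ (sym (trans (ℤP.pos-* 10 (s ℕ.* B)) (cong (+ 10 ℤ.*_) (ℤP.pos-* s B))))) (unit-* (unit-ℕ 10 10≢0) (unit-* unit-s unit-B))) congruent
        where
        10≢0 : ¬ 3 ℕD.∣ 10
        10≢0 d = ℕP.<⇒≱ {1} {3} (ℕ.s≤s (ℕ.s≤s ℕ.z≤n)) (ℕD.∣⇒≤ {1} {3} (ℕD.∣m+n∣m⇒∣n {3} {9} {1} d (ℕD.divides 3 refl)))

    open Product

    next : Product → Product
    next S = record
      { B = B S ℕ.* ℤ.∣ discriminant (+ n S) ∣
      ; 1≤B = ℕP.*-mono-≤ (1≤B S) (ℕP.n≢0⇒n>0 (λ e → unit-D S (≡⇒≈ (ℤP.∣i∣≡0⇒i≡0 {discriminant (+ n S)} e))))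
      ; unit-B = unit-resp (≡⇒≈ (sym (ℤP.pos-* (B S) ℤ.∣ discriminant (+ n S) ∣))) (unit-* (unit-B S) (λ z → unit-D S (∣⇒zero {discriminant (+ n S)} (ℤD.∣ᵤ⇒∣ (ℤD.∣⇒∣ᵤ (Modular.zero⇒∣ prime-3 z))))))
      }

    at : ℕ → Product
    at zero = record { B = 1 ; 1≤B = ℕP.≤-refl ; unit-B = unit-1 }
    at (suc i) = next (at i)

    D∣B : ∀ {i j} → j ℕ.<′ i → ℤ.∣ discriminant (+ n (at j)) ∣ ℕD.∣ B (at i)
    D∣B {j = j} ℕ.<′-base = ℕD.n∣m*n (B (at j))
    D∣B {suc i} (ℕ.≤′-step j<i) = ℕD.∣m⇒∣m*n ℤ.∣ discriminant (+ n (at i)) ∣ (D∣B j<i)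

    separate : ∀ {i j} → j ℕ.< i → ∀ q → CubicField.D (n (at i)) ℚ.* CubicField.D (n (at j)) ≢ q ℚ.* q
    separate {i} {j} j<i q eq = fromInteger (sqrt-isInt q (discriminant (+ nᵢ) ℤ.* discriminant (+ nⱼ) , trans (sym eq) integral))
      where
      nᵢ nⱼ : ℕ
      nᵢ = n (at i)
      nⱼ = n (at j)
      integral : CubicField.D nᵢ ℚ.* CubicField.D nⱼ ≡ int (discriminant (+ nᵢ) ℤ.* discriminant (+ nⱼ))
      integral = trans (cong₂ ℚ._*_ (D≡discriminant nᵢ) (D≡discriminant nⱼ)) (sym (int-* _ _))
      fromInteger : IsInt q → ⊥
      fromInteger (X , q≡) = not-square {x (at i)} {nᵢ} {nⱼ} (10≤x (at i)) (congruent (at i)) (ℕD.∣n⇒∣m*n 10 (ℕD.∣n⇒∣m*n s (D∣B (ℕP.<⇒<′ j<i)))) (unit-D (at j)) X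
        (int-injective (trans (sym integral) (trans eq (trans (cong₂ ℚ._*_ q≡ q≡) (sym (int-* X X))))))

  sequence : Σ (ℕ → ℕ) λ g → (∀ i → P (g i)) × (∀ i j → i ≢ j → ¬ FieldIso (g i) (g j))
  sequence = (λ i → n (at i)) , (λ i → proj₁ (proj₂ (select (B (at i)) (1≤B (at i)) (unit-B (at i))))) , distinct
    where
    open ℚS.Solver
    distinct : ∀ i j → i ≢ j → ¬ FieldIso (n (at i)) (n (at j))
    distinct i j i≢j iso = fromSquare (Isomorphism.D-square iso)
      where
      D₁ D₂ : ℚ
      D₁ = CubicField.D (n (at i))
      D₂ = CubicField.D (n (at j))
      fromSquare : (∃ λ k → D₁ ≡ k ℚ.* k ℚ.* D₂) → ⊥
      fromSquare (k , eq) = compare (ℕP.<-cmp i j)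
        where
        product : D₁ ℚ.* D₂ ≡ k ℚ.* D₂ ℚ.* (k ℚ.* D₂)
        product = trans (cong (ℚ._* D₂) eq) (solve 2 (λ k d → k :* k :* d :* d := k :* d :* (k :* d)) refl k D₂)
        compare : Tri (i ℕ.< j) (i ≡ j) (j ℕ.< i) → ⊥
        compare (tri< i<j _ _) = separate i<j (k ℚ.* D₂) (trans (ℚP.*-comm D₂ D₁) product)
        compare (tri≈ _ i≡j _) = i≢j i≡j
        compare (tri> _ _ j<i) = separate j<i (k ℚ.* D₂) product

-- Systems of congruences for n and z

restrict : ∀ {m m′ x y} → m ℕD.∣ m′ → Congruence._≈_ m′ x y → Congruence._≈_ m x y
restrict m∣m′ (Congruence.mod d) = Congruence.mod (ℤD.∣-trans (ℤD.∣ᵤ⇒∣ m∣m′) d)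

coprime-* : ∀ {a b k} → Cop.Coprime a b → a ℕD.∣ k → b ℕD.∣ k → a ℕ.* b ℕD.∣ k
coprime-* {a} {b} cop (ℕD.divides k refl) b∣ = subst (ℕD._∣ k ℕ.* a) (ℕP.*-comm b a) (ℕD.*-monoˡ-∣ a (Cop.coprime-divisor {b} {a} (Cop.sym cop) (subst (b ℕD.∣_) (ℕP.*-comm k a) b∣)))

glue : ∀ {a b x y} → Cop.Coprime a b → Congruence._≈_ a x y → Congruence._≈_ b x y → Congruence._≈_ (a ℕ.* b) x y
glue cop (Congruence.mod d) (Congruence.mod d′) = Congruence.mod (ℤD.∣ᵤ⇒∣ (coprime-* cop (ℤD.∣⇒∣ᵤ d) (ℤD.∣⇒∣ᵤ d′)))

crt : ∀ {a b} → Cop.Coprime a b → ∀ x y → ∃ λ z → Congruence._≈_ a z x × Congruence._≈_ b z y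
crt {a} {b} cop x y = from (Congruence.coprime⇒inv b {+ a} cop)
  where
  open ℤS.Solver using (solve; _:*_; _:+_; _:-_; :-_; con; _:=_)
  from : (∃ λ i → Congruence._≈_ b (+ a ℤ.* i) (+ 1)) → ∃ λ z → Congruence._≈_ a z x × Congruence._≈_ b z y
  from (i , ai≈1) = x ℤ.+ + a ℤ.* i ℤ.* (y ℤ.- x) ,
    Congruence.mod (ℤD.divides (i ℤ.* (y ℤ.- x)) (solve 4 (λ x y a i → x :+ a :* i :* (y :- x) :- x := i :* (y :- x) :* a) refl x y (+ a) i)) ,
    ≈-trans (≈-+ (≈-refl {x}) (≈-* ai≈1 (≈-refl {y ℤ.- x}))) (≡⇒≈ (solve 2 (λ x y → x :+ con (+ 1) :* (y :- x) := y) refl x y))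
    where open Congruence b

cubic : ℤ → ℤ → ℤ
cubic ν a = a ℤ.* a ℤ.* a ℤ.+ ν ℤ.* a ℤ.* a ℤ.+ ν ℤ.* a ℤ.- + 1

-- Prescribing finitely many places simultaneously

module Places (r : ℕ) (1≤r : 1 ℕ.≤ r) (3∤r : ¬ 3 ℕD.∣ r) where

  open ℤS using (_^_)
  open ℤS.Solver using (solve; _:*_; _:+_; _:-_; :-_; con; _:=_)

  -- The value of z (z + 1) at z = ζʳ. It has to vanish modulo Q, since n can be prescribed only
  -- modulo divisors of z (z + 1).
  root : ℤ → ℤ
  root ζ = ζ ^ r ℤ.* (ζ ^ r ℤ.+ + 1)

  -- Congruence conditions n ≡ ν, Z ≡ ζ modulo Q, where z = Zʳ is to satisfy Q ∣ z (z + 1).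
  record System : Set where
    field
      Q : ℕ
      1≤Q : 1 ℕ.≤ Q
      ν ζ : ℤ
      disjoint : ∀ {p} → Prim.Prime p → p ℕD.∣ Q → ¬ p ℕD.∣ 6 ℕ.* r
      zero-root : Congruence.Zero Q (root ζ)

  open System

  record _⊑_ (S S′ : System) : Set where
    field
      Q∣Q′ : Q S ℕD.∣ Q S′
      ν≈ : Congruence._≈_ (Q S) (ν S′) (ν S)
      ζ≈ : Congruence._≈_ (Q S) (ζ S′) (ζ S)

  open _⊑_

  ⊑-refl : ∀ {S} → S ⊑ S
  ⊑-refl {S} = record { Q∣Q′ = ℕD.∣-refl ; ν≈ = Congruence.≈-refl (Q S) ; ζ≈ = Congruence.≈-refl (Q S) }

  ⊑-trans : ∀ {S S′ S″} → S ⊑ S′ → S′ ⊑ S″ → S ⊑ S″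
  ⊑-trans {S} a b = record
    { Q∣Q′ = ℕD.∣-trans (Q∣Q′ a) (Q∣Q′ b)
    ; ν≈ = Congruence.≈-trans (Q S) (restrict (Q∣Q′ a) (ν≈ b)) (ν≈ a)
    ; ζ≈ = Congruence.≈-trans (Q S) (restrict (Q∣Q′ a) (ζ≈ b)) (ζ≈ a)
    }

  -- Conditions that persist under refinement and can be reached from every system. They are closed
  -- under finite conjunctions, so any finite list of places can be imposed one after another.
  record Attainable (X : System → Set) : Set where
    field
      monotone : ∀ {S S′} → S ⊑ S′ → X S → X S′
      attain : ∀ S → ∃ λ S′ → S ⊑ S′ × X S′

  open Attainable

  attainable-× : ∀ {X Y} → Attainable X → Attainable Y → Attainable (λ S → X S × Y S)
  attainable-× {X} {Y} aX aY = record
    { monotone = λ { S⊑S′ (x , y) → monotone aX S⊑S′ x , monotone aY S⊑S′ y }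
    ; attain = λ S → first (attain aX S)
    }
    where
    first : ∀ {S} → (∃ λ S′ → S ⊑ S′ × X S′) → ∃ λ S′ → S ⊑ S′ × X S′ × Y S′
    first {S} (S′ , S⊑S′ , x) = second (attain aY S′)
      where
      second : (∃ λ S″ → S′ ⊑ S″ × Y S″) → ∃ λ S″ → S ⊑ S″ × X S″ × Y S″
      second (S″ , S′⊑S″ , y) = S″ , ⊑-trans S⊑S′ S′⊑S″ , monotone aX S′⊑S″ x , y

  attainable-⇒ : ∀ {A : Set} {X : System → Set} → Dec A → (A → Attainable X) → Attainable (λ S → A → X S)
  attainable-⇒ {A} {X} A? aX = record { monotone = λ S⊑S′ f a → monotone (aX a) S⊑S′ (f a) ; attain = λ S → decide S A? }
    where
    decide : ∀ S → Dec A → ∃ λ S′ → S ⊑ S′ × (A → X S′)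
    decide S (no ¬a) = S , ⊑-refl , λ a → ⊥-elim (¬a a)
    decide S (yes a) = weaken (attain (aX a) S)
      where
      weaken : (∃ λ S′ → S ⊑ S′ × X S′) → ∃ λ S′ → S ⊑ S′ × (A → X S′)
      weaken (S′ , S⊑S′ , x) = S′ , S⊑S′ , λ _ → x

  attainable-∃ : ∀ {A : Set} {X : A → System → Set} → A → (∀ a → Attainable (X a)) → Attainable (λ S → ∃ λ a → X a S)
  attainable-∃ {A} {X} a aX = record { monotone = λ { S⊑S′ (a , x) → a , monotone (aX a) S⊑S′ x } ; attain = λ S → weaken (attain (aX a) S) }
    where
    weaken : ∀ {S} → (∃ λ S′ → S ⊑ S′ × X a S′) → ∃ λ S′ → S ⊑ S′ × ∃ λ a → X a S′
    weaken (S′ , S⊑S′ , x) = S′ , S⊑S′ , a , x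

  attainable-∀< : ∀ {X : ℕ → System → Set} → (∀ k → Attainable (X k)) → ∀ K → Attainable (λ S → ∀ k → k ℕ.< K → X k S)
  attainable-∀< {X} aX K = record { monotone = λ S⊑S′ f k k<K → monotone (aX k) S⊑S′ (f k k<K) ; attain = upTo K }
    where
    upTo : ∀ K S → ∃ λ S′ → S ⊑ S′ × (∀ k → k ℕ.< K → X k S′)
    upTo zero S = S , ⊑-refl , λ k ()
    upTo (suc K) S = first (upTo K S)
      where
      first : (∃ λ S′ → S ⊑ S′ × (∀ k → k ℕ.< K → X k S′)) → ∃ λ S′ → S ⊑ S′ × (∀ k → k ℕ.< suc K → X k S′)
      first (S′ , S⊑S′ , below) = second (attain (aX K) S′)
        where
        second : (∃ λ S″ → S′ ⊑ S″ × X K S″) → ∃ λ S″ → S ⊑ S″ × (∀ k → k ℕ.< suc K → X k S″)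
        second (S″ , S′⊑S″ , x) = S″ , ⊑-trans S⊑S′ S′⊑S″ , λ k k<1+K → [ (λ k<K → monotone (aX k) S′⊑S″ (below k k<K)) , (λ k≡K → subst (λ k → X k S″) (sym k≡K) x) ]′ (ℕP.m≤n⇒m<n∨m≡n (ℕP.≤-pred k<1+K))

  module _ {p : ℕ} {prime-p : Prim.Prime p} {b c M : ℕ} (P : Place r prime-p b c M) where

    open Place P renaming (root to place-root)
    open Root place-root

    record Realizes (y′ : ℤ) (S : System) : Set where
      field
        q∣Q : q ℕD.∣ Q S
        splits : Zero (cubic (ν S) a)
        ζ≈y′ : ζ S ≈ y′

    cubic-resp : ∀ {ν ν′} → ν ≈ ν′ → cubic ν a ≈ cubic ν′ a
    cubic-resp e = ≈-+ (≈-+ (≈-+ (≈-refl {a ℤ.* a ℤ.* a}) (≈-* (≈-* e (≈-refl {a})) (≈-refl {a}))) (≈-* e (≈-refl {a}))) (≈-refl {ℤ.- + 1})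

    private
      -- The cubic is affine in ν with slope a (a + 1), a unit modulo q.
      splitting : ∃ λ ν → Zero (cubic ν a)
      splitting = from (inv {a ℤ.* (+ 1 ℤ.+ a)} (unit-* unit-a unit-1+a))
        where
        from : (∃ λ i → a ℤ.* (+ 1 ℤ.+ a) ℤ.* i ≈ + 1) → ∃ λ ν → Zero (cubic ν a)
        from (i , e) = (+ 1 ℤ.- a ℤ.* a ℤ.* a) ℤ.* i , ≈-trans (≡⇒≈ (solve 2 (λ a i → let ν = (con (+ 1) :- a :* a :* a) :* i in
            a :* a :* a :+ ν :* a :* a :+ ν :* a :- con (+ 1) := (con (+ 1) :- a :* a :* a) :* (a :* (con (+ 1) :+ a) :* i) :- (con (+ 1) :- a :* a :* a)) refl a i))
          (≈-trans (≈-+ (≈-* (≈-refl {+ 1 ℤ.- a ℤ.* a ℤ.* a}) e) (≈-refl {ℤ.- (+ 1 ℤ.- a ℤ.* a ℤ.* a)})) (≡⇒≈ (solve 1 (λ u → u :* con (+ 1) :- u := con (+ 0)) refl (+ 1 ℤ.- a ℤ.* a ℤ.* a))))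

    -- Taking M = 6 r Q makes q a new prime: it is coprime to Q, so the residues of n and Z can be
    -- glued, and it does not divide 6 r, as `disjoint` demands of the larger modulus.
    adjoin : ∀ y′ → Zero (root y′) → ∀ S → M ≡ 6 ℕ.* r ℕ.* Q S → ∃ λ S′ → S ⊑ S′ × Realizes y′ S′
    adjoin y′ root-y′ S refl = fromCrt splitting
      where
      cop : Cop.Coprime (Q S) q
      cop = Cop.sym (primes⇒coprime {q} (λ e → ℕP.<⇒≢ (ℕP.≤-trans (ℕ.s≤s ℕ.z≤n) (prime≥2 prime-q)) (sym e)) only-q)
        where
        only-q : ∀ {l} → Prim.Prime l → l ℕD.∣ q → l ℕD.∣ Q S → ⊥
        only-q {l} prime-l l∣q l∣Q = [ (λ { refl → Prim.¬prime[1] prime-l }) , (λ { refl → q∤M (ℕD.∣n⇒∣m*n (6 ℕ.* r) l∣Q) }) ]′ (Prim.prime⇒irreducible prime-q l∣q)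
      fromCrt : (∃ λ ν → Zero (cubic ν a)) → ∃ λ S′ → S ⊑ S′ × Realizes y′ S′
      fromCrt (ν₁ , split₁) = build (crt cop (ν S) ν₁) (crt cop (ζ S) y′)
        where
        build : (∃ λ ν′ → Congruence._≈_ (Q S) ν′ (ν S) × ν′ ≈ ν₁) → (∃ λ ζ′ → Congruence._≈_ (Q S) ζ′ (ζ S) × ζ′ ≈ y′) → ∃ λ S′ → S ⊑ S′ × Realizes y′ S′
        build (ν′ , ν≈ , ν≈₁) (ζ′ , ζ≈ , ζ≈₁) =
          record
            { Q = Q S ℕ.* q
            ; 1≤Q = ℕP.*-mono-≤ (1≤Q S) (ℕP.≤-trans (ℕ.s≤s ℕ.z≤n) (prime≥2 prime-q))
            ; ν = ν′
            ; ζ = ζ′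
            ; disjoint = λ prime-l l∣ l∣6r → [ (λ l∣Q → disjoint S prime-l l∣Q l∣6r) , (λ l∣q → avoid prime-l l∣q l∣6r) ]′ (Prim.euclidsLemma (Q S) q prime-l l∣)
            ; zero-root = glue cop (root-resp (Q S) ζ≈ (zero-root S)) (root-resp q ζ≈₁ root-y′)
            } ,
          record { Q∣Q′ = ℕD.m∣m*n q ; ν≈ = ν≈ ; ζ≈ = ζ≈ } ,
          record { q∣Q = ℕD.n∣m*n (Q S) ; splits = ≈-trans (cubic-resp ν≈₁) split₁ ; ζ≈y′ = ζ≈₁ }
          where
          root-resp : ∀ m {x y} → Congruence._≈_ m x y → Congruence.Zero m (root y) → Congruence.Zero m (root x)
          root-resp m {x} {y} e z = M.≈-trans (M.≈-* (M.≈-^ r e) (M.≈-+ (M.≈-^ r e) (M.≈-refl {+ 1}))) z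
            where module M = Congruence m
          avoid : ∀ {l} → Prim.Prime l → l ℕD.∣ q → ¬ l ℕD.∣ 6 ℕ.* r
          avoid prime-l l∣q l∣6r = [ (λ { refl → Prim.¬prime[1] prime-l }) , (λ { refl → q∤M (ℕD.∣m⇒∣m*n (Q S) l∣6r) }) ]′ (Prim.prime⇒irreducible prime-q l∣q)

    realizes-monotone : ∀ {y′ S S′} → S ⊑ S′ → Realizes y′ S → Realizes y′ S′
    realizes-monotone S⊑S′ R = record
      { q∣Q = ℕD.∣-trans q∣Q (Q∣Q′ S⊑S′)
      ; splits = ≈-trans (cubic-resp (restrict q∣Q (ν≈ S⊑S′))) splits
      ; ζ≈y′ = ≈-trans (restrict q∣Q (ζ≈ S⊑S′)) ζ≈y′
      }
      where open Realizes R

  RealizedPlace : ∀ {p} (prime-p : Prim.Prime p) (b c : ℕ) → (∀ {M} → Place r prime-p b c M → ℤ) → System → Set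
  RealizedPlace prime-p b c y′ S = ∃ λ M → Σ (Place r prime-p b c M) λ P → Realizes P (y′ P) S

  attainable-place : ∀ {p} (prime-p : Prim.Prime p) → p ℕD.∣ r → ∀ b c → ¬ (p ℕD.∣ b × p ℕD.∣ c) → (y′ : ∀ {M} → Place r prime-p b c M → ℤ) →
    (∀ {M} (P : Place r prime-p b c M) → Place.Zero P (root (y′ P))) → Attainable (RealizedPlace prime-p b c y′)
  attainable-place {p} prime-p p∣r b c indep y′ root-y′ = record
    { monotone = λ { S⊑S′ (M , P , R) → M , P , realizes-monotone P S⊑S′ R }
    ; attain = λ S → weaken (adjoin (new S p∣r) (y′ (new S p∣r)) (root-y′ (new S p∣r)) S refl)
    }
    where
    weaken : ∀ {S M} {P : Place r prime-p b c M} → (∃ λ S′ → S ⊑ S′ × Realizes P (y′ P) S′) → ∃ λ S′ → S ⊑ S′ × RealizedPlace prime-p b c y′ S′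
    weaken {S} {M} {P} (S′ , S⊑S′ , R) = S′ , S⊑S′ , M , P , R
    new : ∀ S → p ℕD.∣ r → Place r prime-p b c (6 ℕ.* r ℕ.* Q S)
    new S (ℕD.divides r′ r≡) = subst (λ k → Place k prime-p b c (6 ℕ.* r ℕ.* Q S)) (sym r≡)
      (place prime-p (λ { refl → 3∤r p∣r }) r′ (6 ℕ.* r ℕ.* Q S) (ℕP.n≢0⇒n>0 (λ { refl → ℕP.<⇒≢ 1≤r (sym r≡) })) (ℕP.*-mono-≤ {1} {6 ℕ.* r} (ℕP.*-mono-≤ {1} {6} (ℕ.s≤s ℕ.z≤n) 1≤r) (1≤Q S)) b c indep)

  -- The residue 0 of Z at a place means q ∣ z, and the residue y means q ∣ z + 1. The primality
  -- proof is packaged again because places are indexed by it, while `attainable-⇒` produces only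
  -- non-dependent implications.
  Sufficient : ℕ → System → Set
  Sufficient p S = Prim.Prime p → p ℕD.∣ r → ∃ λ (prime-p : Prim.Prime p) →
    RealizedPlace prime-p 1 0 (λ _ → + 0) S ×
    (∀ b → b ℕ.< p → ∀ c → c ℕ.< p → ¬ (p ℕD.∣ b × p ℕD.∣ c) → RealizedPlace prime-p b c Place.y S)

  sufficient : ∃ λ S → ∀ p → p ℕ.< suc r → Sufficient p S
  sufficient = forget (attain (attainable-∀< {Sufficient} at-p (suc r)) trivial)
    where
    forget : ∀ {S} → (∃ λ S′ → S ⊑ S′ × (∀ p → p ℕ.< suc r → Sufficient p S′)) → ∃ λ S → ∀ p → p ℕ.< suc r → Sufficient p S
    forget (S , _ , R) = S , R
    trivial : System
    trivial = record { Q = 1 ; 1≤Q = ℕP.≤-refl ; ν = + 0 ; ζ = + 0 ; disjoint = λ prime-p p∣1 _ → ℕP.<⇒≢ (prime≥2 prime-p) (sym (ℕD.∣1⇒≡1 p∣1)) ; zero-root = Congruence.∣⇒zero 1 {root (+ 0)} (ℤD.∣ᵤ⇒∣ (ℕD.1∣ ℤ.∣ root (+ 0) ∣)) }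
    0^r≡0 : ∀ k → 1 ℕ.≤ k → (+ 0) ^ k ≡ + 0
    0^r≡0 (suc k) _ = refl
    ¬both? : ∀ p b c → Dec (¬ (p ℕD.∣ b × p ℕD.∣ c))
    ¬both? p b c = ¬? ((p ℕD.∣? b) ×-dec (p ℕD.∣? c))
    at-p : ∀ p → Attainable (Sufficient p)
    at-p p = attainable-⇒ (Prim.prime? p) λ prime-p → attainable-⇒ (p ℕD.∣? r) λ p∣r → attainable-∃ prime-p λ prime-p → attainable-×
      (attainable-place prime-p p∣r 1 0 (λ { (p∣1 , _) → ℕP.<⇒≢ (prime≥2 prime-p) (sym (ℕD.∣1⇒≡1 p∣1)) }) (λ _ → + 0) (λ P → Place.≡⇒≈ P (trans (cong (λ v → v ℤ.* (v ℤ.+ + 1)) (0^r≡0 r 1≤r)) refl)))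
      (attainable-∀< (λ b → attainable-∀< (λ c → attainable-⇒ (¬both? p b c) λ indep → attainable-place prime-p p∣r b c indep Place.y root-y) p) p)
      where
      root-y : ∀ {prime-p : Prim.Prime p} {b c M} (P : Place r prime-p b c M) → Place.Zero P (root (Place.y P))
      root-y P = ≈-trans (≈-* (≈-refl {y ^ r}) (≈-trans (≈-+ y^r≈-1 (≈-refl {+ 1})) (≡⇒≈ refl))) (≡⇒≈ (ℤP.*-zeroʳ (y ^ r)))
        where open Place P hiding (_^_)

-- Construction of n

positive-residue : ∀ {m} → 1 ℕ.≤ m → ∀ b x → ∃ λ k → b ℕ.≤ k × Congruence._≈_ m (+ k) x
positive-residue {m@(suc _)} _ b x = x ℤM.%ℕ m ℕ.+ b ℕ.* m , ℕP.≤-trans (ℕP.m≤m*n b m) (ℕP.m≤n+m (b ℕ.* m) (x ℤM.%ℕ m)) ,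
  Congruence.mod (ℤD.divides (+ b ℤ.- x ℤM./ℕ m) (trans (cong₂ ℤ._-_ (trans (ℤP.pos-+ (x ℤM.%ℕ m) (b ℕ.* m)) (cong (λ v → + (x ℤM.%ℕ m) ℤ.+ v) (ℤP.pos-* b m))) (ℤM.a≡a%ℕn+[a/ℕn]*n x m))
    (solve 4 (λ r b m q → r :+ b :* m :- (r :+ q :* m) := (b :- q) :* m) refl (+ (x ℤM.%ℕ m)) (+ b) (+ m) (x ℤM./ℕ m))))
  where open ℤS.Solver using (solve; _:*_; _:+_; _:-_; _:=_)

odd⇒ : ∀ {n} → 1 ℕ.≤ n → Congruence._≈_ 2 (+ n) (+ 1) → ∃ λ m → n ≡ 1 ℕ.+ 2 ℕ.* m
odd⇒ {suc n} _ (Congruence.mod d) = half (ℤD.∣⇒∣ᵤ d)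
  where
  half : 2 ℕD.∣ ℤ.∣ + suc n ℤ.- + 1 ∣ → ∃ λ m → suc n ≡ 1 ℕ.+ 2 ℕ.* m
  half (ℕD.divides m e) = m , cong suc (trans e (ℕP.*-comm m 2))

^-expansion : ∀ k a h → ∃ λ w → (a ℤ.+ h) ℤS.^ suc k ≡ a ℤS.^ suc k ℤ.+ h ℤ.* (+ suc k ℤ.* a ℤS.^ k ℤ.+ h ℤ.* w)
^-expansion zero a h = + 0 , solve 2 (λ a h → (a :+ h) :* con (+ 1) := a :* con (+ 1) :+ h :* (con (+ 1) :* con (+ 1) :+ h :* con (+ 0))) refl a h
  where open ℤS.Solver
^-expansion (suc k) a h = step (^-expansion k a h)
  where
  open ℤS.Solver
  open ℤS using (_^_)
  step : (∃ λ w → (a ℤ.+ h) ^ suc k ≡ a ^ suc k ℤ.+ h ℤ.* (+ suc k ℤ.* a ^ k ℤ.+ h ℤ.* w)) → ∃ λ w → (a ℤ.+ h) ^ suc (suc k) ≡ a ^ suc (suc k) ℤ.+ h ℤ.* (+ suc (suc k) ℤ.* a ^ suc k ℤ.+ h ℤ.* w)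
  step (w , e) = + suc k ℤ.* a ^ k ℤ.+ (a ℤ.+ h) ℤ.* w , trans (cong ((a ℤ.+ h) ℤ.*_) e)
    (solve 5 (λ a h p s w → (a :+ h) :* (a :* p :+ h :* (s :* p :+ h :* w)) := a :* (a :* p) :+ h :* ((con (+ 1) :+ s) :* (a :* p) :+ h :* (s :* p :+ (a :+ h) :* w))) refl a h (a ^ k) (+ suc k) w)

-- Solutions (n , t) of z³ + (z + 1)³ + n z (z + 1) = tʳ with z = Zʳ: t must be 1 modulo z and may be taken to be Z modulo z + 1.
-- Requiring moreover t ≡ 1 modulo Δ = resultant c leaves n an affine function of the parameter v modulo c = z (z + 1).
module NormEquation (k Z₁ : ℕ) where

  open ℤS using (_^_)
  open import Data.Integer.Solver using (module +-*-Solver)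
  open +-*-Solver

  r Z z : ℕ
  r = suc k
  Z = suc Z₁
  z = Z ℕ.^ r

  c Δ e : ℤ
  c = + z ℤ.* + suc z
  Δ = resultant c
  e = + z ℤ.* + z ℤ.* + z ℤ.+ + suc z ℤ.* + suc z ℤ.* + suc z

  -- Modulo z and modulo Δ this is 1. Modulo z + 1 one has z (z + 2) ≡ - 1 and Δ ≡ - 1, so it is 1 +
  -- Z₁ = Z. The factor 2 before c Δ v serves the parity of n.
  T : ℤ → ℤ
  T v = + 1 ℤ.+ + z ℤ.* (+ z ℤ.+ + 2) ℤ.* + Z₁ ℤ.* Δ ℤ.+ + 2 ℤ.* c ℤ.* Δ ℤ.* v

  1≤z : 1 ℕ.≤ z
  1≤z = ℕP.m^n>0 Z r

  c≡ : + (z ℕ.* suc z) ≡ c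
  c≡ = ℤP.pos-* z (suc z)

  z≡ : + z ≡ (+ Z) ^ r
  z≡ = pos-^ Z r

  -- Modulo z both sides are 1. Modulo z + 1 the left side is Zʳ = z ≡ - 1 and the right side z³ ≡ -
  -- 1.
  T^r≈e : ∀ v → Congruence._≈_ (z ℕ.* suc z) (T v ^ r) e
  T^r≈e v = glue coprime at-z at-1+z
    where
    coprime : Cop.Coprime z (suc z)
    coprime {d} (d∣z , d∣1+z) = ℕD.∣1⇒≡1 (ℕD.∣m+n∣m⇒∣n {d} {z} (subst (d ℕD.∣_) (ℕP.+-comm 1 z) d∣1+z) d∣z)
    at-z : Congruence._≈_ z (T v ^ r) e
    at-z = ≈-trans (≈-^ r T≈1) (≈-trans (≡⇒≈ (ℤS.1^ r)) 1≈e)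
      where
      open Congruence z
      T≈1 : T v ≈ + 1
      T≈1 = mod (ℤD.divides ((+ z ℤ.+ + 2) ℤ.* + Z₁ ℤ.* Δ ℤ.+ + 2 ℤ.* + suc z ℤ.* Δ ℤ.* v)
        (solve 5 (λ z w Z₁ Δ v → con (+ 1) :+ z :* (z :+ con (+ 2)) :* Z₁ :* Δ :+ con (+ 2) :* (z :* w) :* Δ :* v :- con (+ 1) := ((z :+ con (+ 2)) :* Z₁ :* Δ :+ con (+ 2) :* w :* Δ :* v) :* z) refl (+ z) (+ suc z) (+ Z₁) Δ v))
      1≈e : + 1 ≈ e
      1≈e = mod (ℤD.divides (ℤ.- (+ 2 ℤ.* + z ℤ.* + z ℤ.+ + 3 ℤ.* + z ℤ.+ + 3)) (solve 1 (λ z → let w = con (+ 1) :+ z in con (+ 1) :- (z :* z :* z :+ w :* w :* w) := (:- (con (+ 2) :* z :* z :+ con (+ 3) :* z :+ con (+ 3))) :* z) refl (+ z)))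
    at-1+z : Congruence._≈_ (suc z) (T v ^ r) e
    at-1+z = ≈-trans (≈-^ r T≈Z) (≈-trans (≡⇒≈ (sym z≡)) z≈e)
      where
      open Congruence (suc z)
      T≈Z : T v ≈ + Z
      T≈Z = mod (ℤD.divides (+ Z₁ ℤ.* (+ suc z ℤ.* Δ ℤ.- + 2 ℤ.* c ℤ.* + z ℤ.+ + 2 ℤ.* + z) ℤ.+ + 2 ℤ.* + z ℤ.* Δ ℤ.* v)
        (solve 3 (λ z Z₁ v → let w = con (+ 1) :+ z; c = z :* w; Δ = con (+ 2) :* c :* c :- con (+ 2) :* c :- con (+ 1) in
          con (+ 1) :+ z :* (z :+ con (+ 2)) :* Z₁ :* Δ :+ con (+ 2) :* c :* Δ :* v :- (con (+ 1) :+ Z₁) := (Z₁ :* (w :* Δ :- con (+ 2) :* c :* z :+ con (+ 2) :* z) :+ con (+ 2) :* z :* Δ :* v) :* w) refl (+ z) (+ Z₁) v))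
      z≈e : + z ≈ e
      z≈e = mod (ℤD.divides (ℤ.- (+ z ℤ.* (+ z ℤ.- + 1) ℤ.+ + suc z ℤ.* + suc z)) (solve 1 (λ z → let w = con (+ 1) :+ z in z :- (z :* z :* z :+ w :* w :* w) := (:- (z :* (z :- con (+ 1)) :+ w :* w)) :* w) refl (+ z)))

  private
    solution : ∀ v → ∃ λ n → e ℤ.+ n ℤ.* c ≡ T v ^ r
    solution v = from (T^r≈e v)
      where
      from : Congruence._≈_ (z ℕ.* suc z) (T v ^ r) e → ∃ λ n → e ℤ.+ n ℤ.* c ≡ T v ^ r
      from (Congruence.mod (ℤD.divides n eq)) = n , trans (cong (λ u → e ℤ.+ u) (trans (cong (n ℤ.*_) (sym c≡)) (sym eq))) (solve 2 (λ e t → e :+ (t :- e) := t) refl e (T v ^ r))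

  opaque
    n : ℤ → ℤ
    n v = proj₁ (solution v)

    norm : ∀ v → e ℤ.+ n v ℤ.* c ≡ T v ^ r
    norm v = proj₂ (solution v)

  private
    instance
      nonZero-c : ℤ.NonZero c
      nonZero-c = ℤ.≢-nonZero (λ e → ℕP.<⇒≢ (ℕP.*-mono-≤ 1≤z (ℕ.s≤s (ℕ.z≤n {z}))) (sym (ℤP.+-injective (trans c≡ e))))

      nonZero-z : ℤ.NonZero (+ z)
      nonZero-z = ℤ.≢-nonZero (λ e → ℕP.<⇒≢ 1≤z (sym (ℤP.+-injective e)))

  norm≡1 : ∀ v → ∃ λ s → T v ^ r ≡ + 1 ℤ.+ Δ ℤ.* s
  norm≡1 v = power r
    where
    g : ℤ
    g = + z ℤ.* (+ z ℤ.+ + 2) ℤ.* + Z₁ ℤ.+ + 2 ℤ.* c ℤ.* v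
    power : ∀ j → ∃ λ s → T v ^ j ≡ + 1 ℤ.+ Δ ℤ.* s
    power zero = + 0 , solve 1 (λ Δ → con (+ 1) := con (+ 1) :+ Δ :* con (+ 0)) refl Δ
    power (suc j) = step (power j)
      where
      step : (∃ λ s → T v ^ j ≡ + 1 ℤ.+ Δ ℤ.* s) → ∃ λ s → T v ^ suc j ≡ + 1 ℤ.+ Δ ℤ.* s
      step (s , eq) = s ℤ.+ g ℤ.* (+ 1 ℤ.+ Δ ℤ.* s) , trans (cong (T v ℤ.*_) eq) (solve 6 (λ z Z₁ c Δ v s → (con (+ 1) :+ z :* (z :+ con (+ 2)) :* Z₁ :* Δ :+ con (+ 2) :* c :* Δ :* v) :* (con (+ 1) :+ Δ :* s)
        := con (+ 1) :+ Δ :* (s :+ (z :* (z :+ con (+ 2)) :* Z₁ :+ con (+ 2) :* c :* v) :* (con (+ 1) :+ Δ :* s))) refl (+ z) (+ Z₁) c Δ v s)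

  -- For even z one has T v ≡ 1 modulo 2 z. Dividing the norm equation by z gives (z + 1) n = 2 s -
  -- (2 z² + 3 z + 3), which is odd, and z + 1 is odd.
  odd : ∀ y → + z ≡ + 2 ℤ.* y → ∀ v → Congruence._≈_ 2 (n v) (+ 1)
  odd y z≡2y v = from (power r)
    where
    g : ℤ
    g = (y ℤ.+ + 1) ℤ.* + Z₁ ℤ.* Δ ℤ.+ + suc z ℤ.* Δ ℤ.* v
    T≡ : T v ≡ + 1 ℤ.+ + 2 ℤ.* + z ℤ.* g
    T≡ = trans (cong (λ u → + 1 ℤ.+ + z ℤ.* (u ℤ.+ + 2) ℤ.* + Z₁ ℤ.* Δ ℤ.+ + 2 ℤ.* c ℤ.* Δ ℤ.* v) z≡2y)
      (solve 6 (λ z y w Z₁ Δ v → con (+ 1) :+ z :* (con (+ 2) :* y :+ con (+ 2)) :* Z₁ :* Δ :+ con (+ 2) :* (z :* w) :* Δ :* v := con (+ 1) :+ con (+ 2) :* z :* ((y :+ con (+ 1)) :* Z₁ :* Δ :+ w :* Δ :* v)) refl (+ z) y (+ suc z) (+ Z₁) Δ v)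
    power : ∀ j → ∃ λ s → T v ^ j ≡ + 1 ℤ.+ + 2 ℤ.* + z ℤ.* s
    power zero = + 0 , solve 1 (λ z → con (+ 1) := con (+ 1) :+ con (+ 2) :* z :* con (+ 0)) refl (+ z)
    power (suc j) = step (power j)
      where
      step : (∃ λ s → T v ^ j ≡ + 1 ℤ.+ + 2 ℤ.* + z ℤ.* s) → ∃ λ s → T v ^ suc j ≡ + 1 ℤ.+ + 2 ℤ.* + z ℤ.* s
      step (s , eq) = s ℤ.+ g ℤ.* (+ 1 ℤ.+ + 2 ℤ.* + z ℤ.* s) , trans (cong₂ ℤ._*_ T≡ eq) (solve 3 (λ z g s → (con (+ 1) :+ con (+ 2) :* z :* g) :* (con (+ 1) :+ con (+ 2) :* z :* s) := con (+ 1) :+ con (+ 2) :* z :* (s :+ g :* (con (+ 1) :+ con (+ 2) :* z :* s))) refl (+ z) g s)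
    from : (∃ λ s → T v ^ r ≡ + 1 ℤ.+ + 2 ℤ.* + z ℤ.* s) → Congruence._≈_ 2 (n v) (+ 1)
    from (s , eq) = Congruence.mod (ℤD.divides (s ℤ.- + z ℤ.* + z ℤ.- + z ℤ.- y ℤ.- + 2 ℤ.- y ℤ.* n v)
      (trans (solve 3 (λ n z y → n :- con (+ 1) := (con (+ 1) :+ z) :* n :- z :* n :- con (+ 1)) refl (n v) (+ z) y)
      (trans (cong₂ (λ a b → a ℤ.- b ℤ.* n v ℤ.- + 1) reduced z≡2y)
      (trans (solve 4 (λ s z y n → con (+ 2) :* s :- con (+ 2) :* z :* z :- con (+ 3) :* z :- con (+ 3) :- con (+ 2) :* y :* n :- con (+ 1) := (s :- z :* z :- z :- con (+ 2) :- y :* n) :* con (+ 2) :- z) refl s (+ z) y (n v))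
      (trans (cong (λ u → (s ℤ.- + z ℤ.* + z ℤ.- + z ℤ.- + 2 ℤ.- y ℤ.* n v) ℤ.* + 2 ℤ.- u) z≡2y)
        (solve 4 (λ s z y n → (s :- z :* z :- z :- con (+ 2) :- y :* n) :* con (+ 2) :- con (+ 2) :* y := (s :- z :* z :- z :- y :- con (+ 2) :- y :* n) :* con (+ 2)) refl s (+ z) y (n v)))))))
      where
      reduced : + suc z ℤ.* n v ≡ + 2 ℤ.* s ℤ.- + 2 ℤ.* + z ℤ.* + z ℤ.- + 3 ℤ.* + z ℤ.- + 3
      reduced = ℤP.*-cancelˡ-≡ (+ z) _ _ (trans (solve 2 (λ z n → let w = con (+ 1) :+ z in z :* (w :* n) := (z :* z :* z :+ w :* w :* w) :+ n :* (z :* w) :- (z :* z :* z :+ w :* w :* w)) refl (+ z) (n v))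
        (trans (cong (ℤ._- e) (trans (norm v) eq))
          (solve 2 (λ z s → let w = con (+ 1) :+ z in con (+ 1) :+ con (+ 2) :* z :* s :- (z :* z :* z :+ w :* w :* w) := z :* (con (+ 2) :* s :- con (+ 2) :* z :* z :- con (+ 3) :* z :- con (+ 3))) refl (+ z) s)))

  -- Expanding (t₀ + 2 c Δ v)ʳ to first order and dividing by c gives n v = n 0 + 2 Δ v (r t₀^(r-1)
  -- + 2 c Δ v w), where Δ ≡ - 1 modulo c.
  affine : ∀ v → Congruence._≈_ (z ℕ.* suc z) (n v) (n (+ 0) ℤ.- + 2 ℤ.* + r ℤ.* T (+ 0) ^ k ℤ.* v)
  affine v = from (^-expansion k (T (+ 0)) (+ 2 ℤ.* c ℤ.* Δ ℤ.* v))
    where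
    t₀ : ℤ
    t₀ = T (+ 0)
    from : (∃ λ w → (t₀ ℤ.+ + 2 ℤ.* c ℤ.* Δ ℤ.* v) ^ r ≡ t₀ ^ r ℤ.+ + 2 ℤ.* c ℤ.* Δ ℤ.* v ℤ.* (+ r ℤ.* t₀ ^ k ℤ.+ + 2 ℤ.* c ℤ.* Δ ℤ.* v ℤ.* w)) →
      Congruence._≈_ (z ℕ.* suc z) (n v) (n (+ 0) ℤ.- + 2 ℤ.* + r ℤ.* t₀ ^ k ℤ.* v)
    from (w , eq) = Congruence.mod (ℤD.divides (+ 4 ℤ.* Δ ℤ.* Δ ℤ.* v ℤ.* v ℤ.* w ℤ.+ (+ 2 ℤ.* c ℤ.- + 2) ℤ.* (+ 2 ℤ.* + r ℤ.* t₀ ^ k ℤ.* v))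
      (trans (trans (cong (ℤ._- (n (+ 0) ℤ.- + 2 ℤ.* + r ℤ.* t₀ ^ k ℤ.* v)) difference)
          (solve 6 (λ n₀ c v w r p → let Δ = con (+ 2) :* c :* c :- con (+ 2) :* c :- con (+ 1) in
            n₀ :+ con (+ 2) :* Δ :* v :* (r :* p :+ con (+ 2) :* c :* Δ :* v :* w) :- (n₀ :- con (+ 2) :* r :* p :* v)
            := (con (+ 4) :* Δ :* Δ :* v :* v :* w :+ (con (+ 2) :* c :- con (+ 2)) :* (con (+ 2) :* r :* p :* v)) :* c) refl (n (+ 0)) c v w (+ r) (t₀ ^ k)))
        (cong ((+ 4 ℤ.* Δ ℤ.* Δ ℤ.* v ℤ.* v ℤ.* w ℤ.+ (+ 2 ℤ.* c ℤ.- + 2) ℤ.* (+ 2 ℤ.* + r ℤ.* t₀ ^ k ℤ.* v)) ℤ.*_) (sym c≡))))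
      where
      T≡ : T v ≡ t₀ ℤ.+ + 2 ℤ.* c ℤ.* Δ ℤ.* v
      T≡ = solve 3 (λ a b v → con (+ 1) :+ a :+ b :* v := con (+ 1) :+ a :+ b :* con (+ 0) :+ b :* v) refl (+ z ℤ.* (+ z ℤ.+ + 2) ℤ.* + Z₁ ℤ.* Δ) (+ 2 ℤ.* c ℤ.* Δ) v
      difference : n v ≡ n (+ 0) ℤ.+ + 2 ℤ.* Δ ℤ.* v ℤ.* (+ r ℤ.* t₀ ^ k ℤ.+ + 2 ℤ.* c ℤ.* Δ ℤ.* v ℤ.* w)
      difference = ℤP.*-cancelˡ-≡ c _ _ (trans (solve 3 (λ e n c → c :* n := e :+ n :* c :- e) refl e (n v) c)
        (trans (cong (ℤ._- e) (trans (norm v) (trans (cong (_^ r) T≡) (trans eq (cong (ℤ._+ + 2 ℤ.* c ℤ.* Δ ℤ.* v ℤ.* (+ r ℤ.* t₀ ^ k ℤ.+ + 2 ℤ.* c ℤ.* Δ ℤ.* v ℤ.* w)) (sym (norm (+ 0))))))))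
          (solve 6 (λ e n₀ c Δ v x → e :+ n₀ :* c :+ con (+ 2) :* c :* Δ :* v :* x :- e := c :* (n₀ :+ con (+ 2) :* Δ :* v :* x)) refl e (n (+ 0)) c Δ v (+ r ℤ.* t₀ ^ k ℤ.+ + 2 ℤ.* c ℤ.* Δ ℤ.* v ℤ.* w))))

  -- t₀ʳ ≡ e and e² ≡ 1 modulo c, so the slope -2 r t₀ʳ⁻¹ is invertible modulo any divisor of c prime to 2 r.
  solvable : ∀ {L} → L ℕD.∣ z ℕ.* suc z → Cop.Coprime (2 ℕ.* r) L → ∀ τ → ∃ λ v₁ → ∀ v → Congruence._≈_ L v v₁ → Congruence._≈_ L (n v) τ
  solvable {L} L∣c cop τ = from (coprime⇒inv {+ (2 ℕ.* r)} cop)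
    where
    open Congruence L hiding (_^_)
    t₀ : ℤ
    t₀ = T (+ 0)
    from : (∃ λ i → + (2 ℕ.* r) ℤ.* i ≈ + 1) → ∃ λ v₁ → ∀ v → v ≈ v₁ → n v ≈ τ
    from (i , ri≈1) = v₁ , λ v v≈v₁ → ≈-trans (restrict L∣c (affine v)) (≈-trans (≈-+ (≈-refl {n₀}) (≈-neg (≈-* (≈-refl {+ 2 ℤ.* + r ℤ.* t₀ ^ k}) v≈v₁)))
        (≈-trans (≡⇒≈ (solve 7 (λ n₀ τ r p t e i → n₀ :- con (+ 2) :* r :* p :* (:- ((τ :- n₀) :* t :* e :* i)) := n₀ :+ (τ :- n₀) :* (con (+ 2) :* r :* i) :* ((t :* p) :* e)) refl n₀ τ (+ r) (t₀ ^ k) t₀ e i))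
          (≈-trans (≈-+ (≈-refl {n₀}) (≈-* (≈-* (≈-refl {τ ℤ.- n₀}) (≈-trans (≡⇒≈ (cong (ℤ._* i) (sym (ℤP.pos-* 2 r)))) ri≈1)) (≈-trans (≈-* (restrict L∣c (T^r≈e (+ 0))) (≈-refl {e})) (restrict L∣c ee≈1))))
            (≡⇒≈ (solve 2 (λ n₀ τ → n₀ :+ (τ :- n₀) :* con (+ 1) :* con (+ 1) := τ) refl n₀ τ)))))
      where
      n₀ v₁ : ℤ
      n₀ = n (+ 0)
      v₁ = ℤ.- ((τ ℤ.- n₀) ℤ.* t₀ ℤ.* e ℤ.* i)
      ee≈1 : Congruence._≈_ (z ℕ.* suc z) (e ℤ.* e) (+ 1)
      ee≈1 = Congruence.mod (ℤD.divides (+ 4 ℤ.* c ℤ.* c ℤ.+ + 9 ℤ.* c ℤ.+ + 6)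
        (trans (solve 1 (λ z → let w = con (+ 1) :+ z; c = z :* w; e = z :* z :* z :+ w :* w :* w in e :* e :- con (+ 1) := (con (+ 4) :* c :* c :+ con (+ 9) :* c :+ con (+ 6)) :* c) refl (+ z)) (cong ((+ 4 ℤ.* c ℤ.* c ℤ.+ + 9 ℤ.* c ℤ.+ + 6) ℤ.*_) (sym c≡))))

  private
    cℕ eℕ : ℕ
    cℕ = z ℕ.* suc z
    eℕ = z ℕ.* z ℕ.* z ℕ.+ suc z ℕ.* suc z ℕ.* suc z

    e≡ : + eℕ ≡ e
    e≡ = cong₂ ℤ._+_ (cubed z) (cubed (suc z))
      where
      cubed : ∀ u → + (u ℕ.* u ℕ.* u) ≡ + u ℤ.* + u ℤ.* + u
      cubed u = trans (ℤP.pos-* (u ℕ.* u) u) (cong (ℤ._* + u) (ℤP.pos-* u u))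

  bound : ℕ
  bound = eℕ ℕ.+ 10 ℕ.* cℕ

  -- T v ≥ v and n c = (T v)ʳ - e, so v ≥ e + 10 c forces n ≥ 10.
  large : ∀ v → bound ℕ.≤ v → ∃ λ n′ → n (+ v) ≡ + n′ × 10 ℕ.≤ n′ × T (+ v) ≢ + 0
  large v b≤v = fromΔ (ℕP.m≤n⇒∃[o]m+o≡n {2} (ℕP.*-mono-≤ 1≤z (ℕ.s≤s 1≤z)))
    where
    fromΔ : (∃ λ c′ → 2 ℕ.+ c′ ≡ cℕ) → ∃ λ n′ → n (+ v) ≡ + n′ × 10 ℕ.≤ n′ × T (+ v) ≢ + 0
    fromΔ (c′ , c′≡) = nonNegative (n (+ v)) (ℤP.*-cancelˡ-≤-pos (+ 10) (n (+ v)) c {{positive-c}} 10c≤) T≢0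
      where
      Δℕ Tℕ : ℕ
      Δℕ = 2 ℕ.* c′ ℕ.* c′ ℕ.+ 6 ℕ.* c′ ℕ.+ 3
      Tℕ = suc (z ℕ.* (z ℕ.+ 2) ℕ.* Z₁ ℕ.* Δℕ ℕ.+ 2 ℕ.* cℕ ℕ.* Δℕ ℕ.* v)
      -- Substituting c = 2 + c′ gives Δ positive coefficients, so that T v is visibly a positive
      -- natural number.
      Δ≡ : + Δℕ ≡ Δ
      Δ≡ = trans (trans (ℤP.pos-+ (2 ℕ.* c′ ℕ.* c′ ℕ.+ 6 ℕ.* c′) 3) (cong (ℤ._+ + 3) (trans (ℤP.pos-+ (2 ℕ.* c′ ℕ.* c′) (6 ℕ.* c′)) (cong₂ ℤ._+_ (trans (ℤP.pos-* (2 ℕ.* c′) c′) (cong (ℤ._* + c′) (ℤP.pos-* 2 c′))) (ℤP.pos-* 6 c′)))))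
        (trans (solve 1 (λ c′ → con (+ 2) :* c′ :* c′ :+ con (+ 6) :* c′ :+ con (+ 3) := con (+ 2) :* (con (+ 2) :+ c′) :* (con (+ 2) :+ c′) :- con (+ 2) :* (con (+ 2) :+ c′) :- con (+ 1)) refl (+ c′))
          (cong resultant (trans (sym (ℤP.pos-+ 2 c′)) (trans (cong +_ c′≡) c≡))))
      T≡ : + Tℕ ≡ T (+ v)
      T≡ = trans (cong (λ u → + 1 ℤ.+ u) (ℤP.pos-+ (z ℕ.* (z ℕ.+ 2) ℕ.* Z₁ ℕ.* Δℕ) (2 ℕ.* cℕ ℕ.* Δℕ ℕ.* v)))
        (trans (cong₂ (λ a b → + 1 ℤ.+ (a ℤ.+ b))
            (trans (ℤP.pos-* (z ℕ.* (z ℕ.+ 2) ℕ.* Z₁) Δℕ) (cong₂ ℤ._*_ (trans (ℤP.pos-* (z ℕ.* (z ℕ.+ 2)) Z₁) (cong (ℤ._* + Z₁) (ℤP.pos-* z (z ℕ.+ 2)))) Δ≡))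
            (trans (ℤP.pos-* (2 ℕ.* cℕ ℕ.* Δℕ) v) (cong (ℤ._* + v) (trans (ℤP.pos-* (2 ℕ.* cℕ) Δℕ) (cong₂ ℤ._*_ (trans (ℤP.pos-* 2 cℕ) (cong (+ 2 ℤ.*_) c≡)) Δ≡)))))
          (sym (ℤP.+-assoc (+ 1) (+ z ℤ.* (+ z ℤ.+ + 2) ℤ.* + Z₁ ℤ.* Δ) (+ 2 ℤ.* c ℤ.* Δ ℤ.* + v))))
      T≢0 : T (+ v) ≢ + 0
      T≢0 e = absurd (trans T≡ e)
        where
        absurd : + Tℕ ≢ + 0
        absurd ()
      positive-c : ℤ.Positive c
      positive-c = subst ℤ.Positive (trans (cong +_ c′≡) c≡) _
      v≤T : v ℕ.≤ Tℕ
      v≤T = ℕP.m≤n⇒m≤1+n (ℕP.≤-trans (ℕP.m≤n*m v (2 ℕ.* cℕ ℕ.* Δℕ) {{ℕ.>-nonZero (ℕP.*-mono-≤ (ℕP.*-mono-≤ {1} {2} (ℕ.s≤s ℕ.z≤n) (ℕP.*-mono-≤ 1≤z (ℕ.s≤s (ℕ.z≤n {z})))) (ℕP.≤-trans (ℕ.s≤s ℕ.z≤n) (ℕP.m≤n+m 3 (2 ℕ.* c′ ℕ.* c′ ℕ.+ 6 ℕ.* c′))))}}) (ℕP.m≤n+m (2 ℕ.* cℕ ℕ.* Δℕ ℕ.* v) (z ℕ.* (z ℕ.+ 2) ℕ.* Z₁ ℕ.* Δℕ)))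
      bound≤ : bound ℕ.≤ Tℕ ℕ.^ r
      bound≤ = ℕP.≤-trans b≤v (ℕP.≤-trans v≤T (ℕP.m≤m*n Tℕ (Tℕ ℕ.^ k) {{ℕ.>-nonZero (ℕP.m^n>0 Tℕ k)}}))
      10c≤ : c ℤ.* + 10 ℤ.≤ c ℤ.* n (+ v)
      10c≤ = subst₂ ℤ._≤_
        (trans (cong (ℤ._- e) (trans (ℤP.pos-+ eℕ (10 ℕ.* cℕ)) (cong₂ ℤ._+_ e≡ (trans (ℤP.pos-* 10 cℕ) (cong (+ 10 ℤ.*_) c≡))))) (solve 2 (λ e c → e :+ con (+ 10) :* c :- e := c :* con (+ 10)) refl e c))
        (trans (cong (ℤ._- e) (trans (pos-^ Tℕ r) (trans (cong (_^ r) T≡) (sym (norm (+ v)))))) (solve 3 (λ e c n → e :+ n :* c :- e := c :* n) refl e c (n (+ v))))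
        (ℤP.+-monoˡ-≤ (ℤ.- e) (ℤ.+≤+ bound≤))
      nonNegative : ∀ x → + 10 ℤ.≤ x → T (+ v) ≢ + 0 → ∃ λ n′ → x ≡ + n′ × 10 ℕ.≤ n′ × T (+ v) ≢ + 0
      nonNegative (+ n′) (ℤ.+≤+ 10≤n′) T≢0 = n′ , refl , 10≤n′ , T≢0

-- Satisfying all conditions on n at once

module Selection (k : ℕ) (3∤r : ¬ 3 ℕD.∣ suc k) where

  open ℤS using (_^_)
  open Places (suc k) (ℕ.s≤s ℕ.z≤n) 3∤r

  private
    r : ℕ
    r = suc k

    Selected : ℕ → Set₁
    Selected n = InFamily n × HasClassOfOrder n r

    cast : ∀ {a b : ℤ} m → a ≡ b → Congruence._≈_ m a b
    cast m = Congruence.≡⇒≈ m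

  module _ (S : System) (enough : ∀ p → p ℕ.< suc r → Sufficient p S) where

    open System S

    private
      s : ℕ
      s = r ℕ.* Q

      1≤s : 1 ℕ.≤ s
      1≤s = ℕP.*-mono-≤ {1} {r} (ℕ.s≤s ℕ.z≤n) 1≤Q

      3∤Q : ¬ 3 ℕD.∣ Q
      3∤Q d = disjoint prime-3 d (ℕD.∣m⇒∣m*n r (ℕD.divides 2 refl))

      unit-s : Unit₃ (+ s)
      unit-s = unit-ℕ s (λ d → [ 3∤r , 3∤Q ]′ (Prim.euclidsLemma r Q prime-3 d))
        where open Modular prime-3

      module Choice (B : ℕ) (1≤B : 1 ℕ.≤ B) (unit-B : Unit₃ (+ B)) where

        x q₀ M₀ : ℕ
        x = 10 ℕ.* (s ℕ.* B)
        q₀ = ℤ.∣ discriminant (+ x ℤ.* + x) ∣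
        M₀ = 3 ℕ.* (q₀ ℕ.* q₀)

        2∣x : 2 ℕD.∣ x
        2∣x = ℕD.∣m⇒∣m*n (s ℕ.* B) (ℕD.divides 5 refl)

        r∣x : r ℕD.∣ x
        r∣x = ℕD.∣n⇒∣m*n 10 (ℕD.∣m⇒∣m*n B (ℕD.m∣m*n Q))

        Q∣x : Q ℕD.∣ x
        Q∣x = ℕD.∣n⇒∣m*n 10 (ℕD.∣m⇒∣m*n B (ℕD.n∣m*n r))

        1≤q₀ : 1 ℕ.≤ q₀
        1≤q₀ = from (discriminant-x² {x} (ℕP.*-monoʳ-≤ 10 (ℕP.*-mono-≤ 1≤s 1≤B)))
          where
          from : (∃₂ λ a b → a ≡ 54 ℕ.+ b × discriminant (+ x ℤ.* + x) ≡ + (a ℕ.* a ℕ.+ (2 ℕ.* b ℕ.+ 1))) → 1 ℕ.≤ q₀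
          from (a , b , _ , eq) = subst (1 ℕ.≤_) (sym (cong ℤ.∣_∣ eq)) (ℕP.≤-trans (ℕP.m≤n+m 1 (2 ℕ.* b)) (ℕP.m≤n+m (2 ℕ.* b ℕ.+ 1) (a ℕ.* a)))

        1≤M₀ : 1 ℕ.≤ M₀
        1≤M₀ = ℕP.*-mono-≤ {1} {3} (ℕ.s≤s ℕ.z≤n) (ℕP.*-mono-≤ 1≤q₀ 1≤q₀)

        private
          split-M₀ : ∀ {p} → Prim.Prime p → p ℕD.∣ M₀ → p ≡ 3 ⊎ p ℕD.∣ q₀
          split-M₀ {p} prime-p d = [ (λ p∣3 → [ (λ { refl → ⊥-elim (Prim.¬prime[1] prime-p) }) , inj₁ ]′ (Prim.prime⇒irreducible prime-3 p∣3)) ,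
            (λ e → [ inj₂ , inj₂ ]′ (Prim.euclidsLemma q₀ q₀ prime-p e)) ]′ (Prim.euclidsLemma 3 (q₀ ℕ.* q₀) prime-p d)

          -- The number x is a multiple of 2, r and Q, so by `common-prime` the modulus M₀ can share
          -- with them no prime but 3. This is why s = r Q is put into every x.
          M₀≡3 : ∀ {p} → Prim.Prime p → p ℕD.∣ x → p ℕD.∣ M₀ → p ≡ 3
          M₀≡3 prime-p p∣x d = [ id , common-prime prime-p p∣x ]′ (split-M₀ prime-p d)

        coprime-M₀ : Cop.Coprime (2 ℕ.* M₀) Q
        coprime-M₀ = primes⇒coprime (λ e → ℕP.<⇒≢ (ℕP.*-mono-≤ {1} {2} (ℕ.s≤s ℕ.z≤n) 1≤M₀) (sym e)) λ {p} prime-p p∣2M₀ p∣Q → disjoint prime-p p∣Q (ℕD.∣m⇒∣m*n r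
          ([ (λ p∣2 → ℕD.∣m⇒∣m*n 3 p∣2) , (λ p∣M₀ → ℕD.∣n⇒∣m*n 2 (subst (p ℕD.∣_) (M₀≡3 prime-p (ℕD.∣-trans p∣Q Q∣x) p∣M₀) ℕD.∣-refl)) ]′ (Prim.euclidsLemma 2 M₀ prime-p p∣2M₀)))

        coprime-M₀Q : Cop.Coprime M₀ Q
        coprime-M₀Q (d∣M₀ , d∣Q) = coprime-M₀ (ℕD.∣n⇒∣m*n 2 d∣M₀ , d∣Q)

        -- The slope of n in the parameter v is - 2 r times a unit, so it must be invertible modulo
        -- M₀ Q. A common prime with M₀ could only be 3, which does not divide 2 r, and Q is prime
        -- to 6 r.
        coprime-2r : Cop.Coprime (2 ℕ.* r) (M₀ ℕ.* Q)
        coprime-2r = primes⇒coprime (λ ()) λ {p} prime-p p∣2r p∣ → [ (λ p∣M₀ → at-3 prime-p p∣2r (M₀≡3 prime-p (p∣x prime-p p∣2r) p∣M₀)) ,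
            (λ p∣Q → disjoint prime-p p∣Q (subst (p ℕD.∣_) (sym (ℕP.*-assoc 3 2 r)) (ℕD.∣n⇒∣m*n 3 p∣2r))) ]′ (Prim.euclidsLemma M₀ Q prime-p p∣)
          where
          p∣x : ∀ {p} → Prim.Prime p → p ℕD.∣ 2 ℕ.* r → p ℕD.∣ x
          p∣x prime-p d = [ (λ e → ℕD.∣-trans e 2∣x) , (λ e → ℕD.∣-trans e r∣x) ]′ (Prim.euclidsLemma 2 r prime-p d)
          at-3 : ∀ {p} → Prim.Prime p → p ℕD.∣ 2 ℕ.* r → p ≡ 3 → ⊥
          at-3 prime-p d refl = [ (λ e → ℕP.<⇒≱ {2} {3} (ℕP.n<1+n 2) (ℕD.∣⇒≤ e)) , 3∤r ]′ (Prim.euclidsLemma 2 r prime-p d)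

        -- The first congruence puts M₀ into z and makes z even; the second makes Q divide z (z +
        -- 1). So n can be prescribed modulo M₀ Q and is automatically odd.
        module WithRoot (Z₁ : ℕ) (Z≈0 : Congruence.Zero (2 ℕ.* M₀) (+ suc Z₁)) (Z≈ζ : Congruence._≈_ Q (+ suc Z₁) ζ) where

          open NormEquation k Z₁ hiding (r)

          2M₀∣z : 2 ℕ.* M₀ ℕD.∣ z
          2M₀∣z = ℕD.∣m⇒∣m*n (Z ℕ.^ k) (ℤD.∣⇒∣ᵤ (Congruence.zero⇒∣ (2 ℕ.* M₀) Z≈0))

          z≈ζ^r : Congruence._≈_ Q (+ z) (ζ ^ r)
          z≈ζ^r = ≈-trans (cast Q z≡) (≈-^ r Z≈ζ)
            where open Congruence Q hiding (_^_)

          L∣c : M₀ ℕ.* Q ℕD.∣ z ℕ.* suc z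
          L∣c = coprime-* coprime-M₀Q (ℕD.∣m⇒∣m*n (suc z) (ℕD.∣-trans (ℕD.n∣m*n 2) 2M₀∣z)) (ℤD.∣⇒∣ᵤ (zero⇒∣ Q∣c))
            where
            open Congruence Q hiding (_^_)
            Q∣c : Zero (+ (z ℕ.* suc z))
            Q∣c = ≈-trans (cast Q (trans c≡ (cong (+ z ℤ.*_) (ℤP.+-comm (+ 1) (+ z))))) (≈-trans (≈-* z≈ζ^r (≈-+ z≈ζ^r (≈-refl {+ 1}))) zero-root)

          half-z : ∃ λ y → + z ≡ + 2 ℤ.* y
          half-z = from (ℕD.∣-trans (ℕD.m∣m*n M₀) 2M₀∣z)
            where
            from : 2 ℕD.∣ z → ∃ λ y → + z ≡ + 2 ℤ.* y
            from (ℕD.divides y e) = + y , trans (cong +_ (trans e (ℕP.*-comm y 2))) (ℤP.pos-* 2 y)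

          module WithParameter (v n′ m : ℕ) (n≡n′ : n (+ v) ≡ + n′) (10≤n′ : 10 ℕ.≤ n′) (n′≡ : n′ ≡ 1 ℕ.+ 2 ℕ.* m) (T≢0 : T (+ v) ≢ + 0)
            (n≈ν : Congruence._≈_ Q (+ n′) ν) where

            independent-at : ∀ {p} → Prim.Prime p → p ℕD.∣ r → ¬ PowerRelations.Dependent n′ m 10≤n′ n′≡ p (LocalObstruction.generator n′ m 10≤n′ n′≡ z)
            independent-at {p} prime-p p∣r = from (enough p (ℕ.s≤s (ℕD.∣⇒≤ p∣r)) prime-p p∣r)
              where
              open LocalObstruction n′ m 10≤n′ n′≡
              from : (∃ λ (prime-p : Prim.Prime p) → RealizedPlace prime-p 1 0 (λ _ → + 0) S × (∀ b → b ℕ.< p → ∀ c → c ℕ.< p → ¬ (p ℕD.∣ b × p ℕD.∣ c) → RealizedPlace prime-p b c Place.y S)) →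
                ¬ PowerRelations.Dependent n′ m 10≤n′ n′≡ p (generator z)
              from (prime-p , (M , P , R) , typeII) = independent z prime-p P (splits-at P R) q∣z λ b c b<p c<p indep → second (typeII b b<p c c<p indep)
                where
                splits-at : ∀ {b c M y′} (P : Place r prime-p b c M) → Realizes P y′ S → Splits z prime-p P
                splits-at P R = Place.≈-trans P (cubic-resp P (restrict (Realizes.q∣Q R) n≈ν)) (Realizes.splits R)
                z≈ : ∀ {b c M y′} (P : Place r prime-p b c M) → Realizes P y′ S → Place._≈_ P (+ z) (y′ ^ r)
                z≈ P R = Place.≈-trans P (restrict (Realizes.q∣Q R) z≈ζ^r) (Place.≈-^ P r (Realizes.ζ≈y′ R))
                q∣z : Place.q P ℕD.∣ z
                q∣z = ℤD.∣⇒∣ᵤ (Place.zero⇒∣ P {+ z} (z≈ P R))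
                second : ∀ {b c} → RealizedPlace prime-p b c Place.y S → ∃ λ M → Σ (Place r prime-p b c M) λ P → Splits z prime-p P × Place.q P ℕD.∣ suc z
                second (M , P , R) = M , P , splits-at P R , ℤD.∣⇒∣ᵤ (zero⇒∣ {+ suc z} (≈-+ (≈-refl {+ 1}) (≈-trans (z≈ P R) y^r≈-1)))
                  where open Place P hiding (_^_)

            selected : Selected n′
            selected = (trans (cong (ℕ._% 2) (trans n′≡ (cong (1 ℕ.+_) (ℕP.*-comm 2 m)))) (ℕDM.[m+kn]%n≡m%n 1 m 2) , ℕP.≤-trans (ℕP.m≤n+m 5 5) 10≤n′) , from (norm≡1 (+ v))
              where
              from : (∃ λ s → T (+ v) ^ r ≡ + 1 ℤ.+ Δ ℤ.* s) → HasClassOfOrder n′ r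
              from (s , eq) = class-of-order (ℕ.s≤s ℕ.z≤n) T≢0 independent-at
                where open ClassOfOrder n′ m 10≤n′ n′≡ z r (T (+ v)) s (trans (cong (λ u → e ℤ.+ u ℤ.* c) (sym n≡n′)) (norm (+ v))) eq

            congruent : Congruence._≈_ M₀ (+ n′) (+ x ℤ.* + x) → Congruent x n′
            congruent (Congruence.mod (ℤD.divides j eq)) = j , trans (solve 2 (λ n N → n := N :+ (n :- N)) refl (+ n′) (+ x ℤ.* + x))
                (cong (λ u → + x ℤ.* + x ℤ.+ u) (trans eq (trans (ℤP.*-comm j (+ M₀)) (cong (ℤ._* j) M₀≡))))
              where
              open ℤS.Solver
              Qd : ℤ
              Qd = discriminant (+ x ℤ.* + x)
              abs-square : ∀ i → + ℤ.∣ i ∣ ℤ.* + ℤ.∣ i ∣ ≡ i ℤ.* i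
              abs-square (+ _) = refl
              abs-square -[1+ _ ] = refl
              M₀≡ : + M₀ ≡ + 3 ℤ.* (Qd ℤ.* Qd)
              M₀≡ = trans (ℤP.pos-* 3 (q₀ ℕ.* q₀)) (cong (+ 3 ℤ.*_) (trans (ℤP.pos-* q₀ q₀) (abs-square Qd)))

          -- The target class of n is x² modulo M₀, for the discriminant, and ν modulo Q, for the
          -- places. It determines a class of v modulo M₀ Q, in which v is taken large enough that n
          -- ≥ 10.
          choose : ∃ λ n → Selected n × Congruent x n
          choose = fromTarget (crt coprime-M₀Q (+ x ℤ.* + x) ν)
            where
            L : ℕ
            L = M₀ ℕ.* Q
            fromTarget : (∃ λ τ → Congruence._≈_ M₀ τ (+ x ℤ.* + x) × Congruence._≈_ Q τ ν) → ∃ λ n → Selected n × Congruent x n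
            fromTarget (τ , τ≈N , τ≈ν) = fromSlope (solvable L∣c coprime-2r τ)
              where
              fromSlope : (∃ λ v₁ → ∀ v → Congruence._≈_ L v v₁ → Congruence._≈_ L (n v) τ) → ∃ λ n → Selected n × Congruent x n
              fromSlope (v₁ , solves) = fromParameter (positive-residue {L} (ℕP.*-mono-≤ 1≤M₀ 1≤Q) bound v₁)
                where
                fromParameter : (∃ λ v → bound ℕ.≤ v × Congruence._≈_ L (+ v) v₁) → ∃ λ n → Selected n × Congruent x n
                fromParameter (v , bound≤v , v≈) = fromNatural (large v bound≤v)
                  where
                  fromNatural : (∃ λ n′ → n (+ v) ≡ + n′ × 10 ℕ.≤ n′ × T (+ v) ≢ + 0) → ∃ λ n → Selected n × Congruent x n
                  fromNatural (n′ , n≡n′ , 10≤n′ , T≢0) = fromOdd (odd⇒ {n′} (ℕP.≤-trans (ℕ.s≤s ℕ.z≤n) 10≤n′) (subst (λ u → Congruence._≈_ 2 u (+ 1)) n≡n′ (odd (proj₁ half-z) (proj₂ half-z) (+ v))))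
                    where
                    n≈τ : Congruence._≈_ L (+ n′) τ
                    n≈τ = subst (λ u → Congruence._≈_ L u τ) n≡n′ (solves (+ v) v≈)
                    fromOdd : (∃ λ m → n′ ≡ 1 ℕ.+ 2 ℕ.* m) → ∃ λ n → Selected n × Congruent x n
                    fromOdd (m , n′≡) = n′ , selected , congruent (Congruence.≈-trans M₀ (restrict (ℕD.m∣m*n Q) n≈τ) τ≈N)
                      where open WithParameter v n′ m n≡n′ 10≤n′ n′≡ T≢0 (Congruence.≈-trans Q (restrict (ℕD.n∣m*n M₀) n≈τ) τ≈ν)

        select : ∃ λ n → Selected n × Congruent x n
        select = fromResidue (crt coprime-M₀ (+ 0) ζ)
          where
          fromResidue : (∃ λ ζ′ → Congruence.Zero (2 ℕ.* M₀) ζ′ × Congruence._≈_ Q ζ′ ζ) → ∃ λ n → Selected n × Congruent x n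
          fromResidue (ζ′ , ζ′≈0 , ζ′≈ζ) = fromNatural (positive-residue {2 ℕ.* M₀ ℕ.* Q} (ℕP.*-mono-≤ (ℕP.*-mono-≤ {1} {2} (ℕ.s≤s ℕ.z≤n) 1≤M₀) 1≤Q) 1 ζ′)
            where
            fromNatural : (∃ λ Z → 1 ℕ.≤ Z × Congruence._≈_ (2 ℕ.* M₀ ℕ.* Q) (+ Z) ζ′) → ∃ λ n → Selected n × Congruent x n
            fromNatural (suc Z₁ , _ , Z≈ζ′) = WithRoot.choose Z₁ (Congruence.≈-trans (2 ℕ.* M₀) (restrict (ℕD.m∣m*n Q) Z≈ζ′) ζ′≈0) (Congruence.≈-trans Q (restrict (ℕD.n∣m*n (2 ℕ.* M₀)) Z≈ζ′) ζ′≈ζ)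

    family : Σ (ℕ → ℕ) λ g → (∀ i → Selected (g i)) × (∀ i j → i ≢ j → ¬ FieldIso (g i) (g j))
    family = Sequence.sequence Selected s 1≤s unit-s Choice.select

theorem4p1 : (r : ℕ) → 1 ≤ r → r % 3 ≢ 0 →
    Σ (ℕ → ℕ) λ g →
    (∀ i → InFamily (g i) × HasClassOfOrder (g i) r)
    × (∀ i j → i ≢ j → ¬ FieldIso (g i) (g j))
theorem4p1 (suc k) 1≤r r%3≢0 = family (proj₁ sufficient) (proj₂ sufficient)
  where
  3∤r : ¬ 3 ℕD.∣ suc k
  3∤r d = r%3≢0 (ℕD.n∣m⇒m%n≡0 (suc k) 3 d)
  open Places (suc k) (ℕ.s≤s ℕ.z≤n) 3∤r using (sufficient)
  open Selection k 3∤r using (family)
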